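{- For any positive integers $\ell$ and $k$, the $k$-Schur functions $\{s^{(k)}_\mu(x;t)\}_{\mu\in\mathrm{Par}^k_\ell}$ form a basis of the $\mathbb Q(t)$-vector space $\Lambda^k_\ell=\mathrm{Span}_{\mathbb Q(t)}\{H_\mu(x;t):\mu\in\mathrm{Par}^k_\ell\}\subset\Lambda$.
   Context: $\Lambda$ is the ring of symmetric functions over $\mathbb Q(t)$. $\mathrm{Par}^k_\ell=\{\mu\in\mathbb Z^\ell:k\ge\mu_1\ge\dots\ge\mu_\ell\ge0\}$; $\mathrm{Par}^k$ is the set of partitions with largest part $\le k$; partitions are identified with themselves padded by zeros. $H_\mu(x;t)$ is the modified Hall–Littlewood polynomial (denoted $Q'_\mu(x;t)$ by Macdonald); equivalently, with $s_\gamma=\det(h_{\gamma_i+j-i})_{1\le i,j\le\ell}$ for $\gamma\in\mathbb Z^\ell$, $H_\mu=\prod_{1\le i<j\le\ell}(1-tR_{ij})^{ -1}s_\mu$, meaning: expand $\prod_{i<j}(1-tz_i/z_j)^{ -1}z^\mu$ as a power series in $t$ and apply coefficientwise the linear map $z^\beta\mapsto s_\beta$. Hook length of a box (English notation): number of boxes below it in its column plus those weakly to its right in its row. A $(k+1)$-core is a partition with no box of hook length $k+1$; $\mathfrak p(\kappa)$ has $r$-th part equal to the number of boxes in row $r$ of $\kappa$ with hook length $\le k$, a bijection from $(k+1)$-cores to $\mathrm{Par}^k$. A strong cover $\tau\Rightarrow\kappa$: $(k+1)$-cores with $\tau\subset\kappa$, $|\mathfrak p(\tau)|+1=|\mathfrak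 p(\kappa)|$; a strong marked cover $\tau\xRightarrow{r}\kappa$ adds a positive integer $r$ equal to the smallest row index of some connected component of $\kappa/\tau$; its spin is $c(h-1)+N$ with $c$ the number of components, $h$ the common number of rows of each component, $N$ the number of components entirely in rows $>r$. For $\eta\in\mathbb Z^\infty_{\ge0}$, $m=|\eta|<\infty$, a strong marked tableau of weight $\eta$ is a chain $\kappa^{(0)}\xRightarrow{r_1}\cdots\xRightarrow{r_m}\kappa^{(m)}$ with $r_{v_i+1}\ge\dots\ge r_{v_i+\eta_i}$ for all $i$ ($v_i=\eta_1+\dots+\eta_{i-1}$), spin = sum of spins; $\mathrm{SMT}^k_\eta(\mu)$ consists of those with $\mathfrak p(\kappa^{(m)})=\mu$. The $k$-Schur function is $s^{(k)}_\mu(x;t)=\sum_{\eta,\,|\eta|=|\mu|}\sum_{T\in\mathrm{SMT}^k_\eta(\mu)}t^{\mathrm{spin}(T)}x^\eta$. -}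

module Defs where

open import Data.Nat as ℕ using (ℕ; zero; suc; _+_; _∸_; _≤ᵇ_; _<ᵇ_; _≡ᵇ_)
open import Data.Integer as ℤ using (ℤ; +_; -[1+_])
open import Data.Bool using (Bool; true; false; _∧_; _∨_; not; if_then_else_; T)
open import Data.List using (List; []; _∷_; _++_; map; concatMap; filter; length; foldr; upTo; drop; zipWith; null)
open import Data.Nat.ListAction using (sum)
open import Data.Bool.ListAction using (any; all)
open import Data.List.Membership.Propositional using (_∈_)
open import Data.List.Relation.Unary.All using (All)
open import Data.List.Relation.Unary.Any using (Any)
open import Data.Product using (_×_; _,_; Σ; ∃; proj₁; proj₂)
open import Relation.Binary.PropositionalEquality using (_≡_)
open import Relation.Nullary using (¬_)

at : List ℕ → ℕ → ℕ
at []       _       = 0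
at (x ∷ _)  zero    = x
at (_ ∷ xs) (suc i) = at xs i

atℤ : List ℤ → ℕ → ℤ
atℤ []       _       = + 0
atℤ (x ∷ _)  zero    = x
atℤ (_ ∷ xs) (suc i) = atℤ xs i

sumℤ : List ℤ → ℤ
sumℤ = foldr ℤ._+_ (+ 0)

countB : {A : Set} → (A → Bool) → List A → ℕ
countB p []       = 0
countB p (x ∷ xs) = if p x then suc (countB p xs) else countB p xs

-- Elements of Λ with integer coefficients, truncated to finitely many
-- variables only through the exponent vector: an element F is its
-- coefficient function  η ↦ [x^η] F  where  x^η = x₁^η₀ x₂^η₁ ⋯
-- (η a finite list; trailing zeros are irrelevant for all objects below).

SF : Set
SF = List ℕ → ℤ

below : List ℕ → List (List ℕ)
below []       = [] ∷ []
below (a ∷ as) = concatMap (λ b → map (b ∷_) (below as)) (upTo (suc a))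

_⊕_ : SF → SF → SF
(F ⊕ G) η = F η ℤ.+ G η

_⊛_ : SF → SF → SF
(F ⊛ G) η = sumℤ (map (λ β → F β ℤ.* G (zipWith _∸_ η β)) (below η))

zeroSF : SF
zeroSF _ = + 0

oneSF : SF
oneSF η = if sum η ≡ᵇ 0 then + 1 else + 0

hSF : ℤ → SF
hSF (+ a)    η = if sum η ≡ᵇ a then + 1 else + 0
hSF -[1+ _ ] η = + 0

det : ℕ → (ℕ → ℕ → SF) → SF
det zero    M = oneSF
det (suc n) M = foldr _⊕_ zeroSF (map term (upTo (suc n)))
  where
  sgn : ℕ → ℤ
  sgn j = if (j ℕ.% 2) ≡ᵇ 0 then + 1 else ℤ.- (+ 1)
  minor : ℕ → ℕ → ℕ → SF
  minor j i j' = M (suc i) (if j' <ᵇ j then j' else suc j')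
  term : ℕ → SF
  term j η = sgn j ℤ.* (M 0 j ⊛ det n (minor j)) η

sγ : ℕ → List ℤ → SF
sγ ℓ γ = det ℓ (λ i j → hSF (atℤ γ i ℤ.+ (+ j) ℤ.- (+ i)))

-- Series in t with coefficients in Λ (integer coefficients):
-- Ser-coefficient  (η , n) ↦ [x^η t^n]

Ser : Set
Ser = List ℕ → ℕ → ℤ

pairsLt : ℕ → List (ℕ × ℕ)
pairsLt ℓ = concatMap (λ j → map (λ i → i , j) (upTo j)) (upTo ℓ)

comps : ℕ → ℕ → List (List ℕ)
comps n zero    = if n ≡ᵇ 0 then [] ∷ [] else []
comps n (suc p) = concatMap (λ a → map (a ∷_) (comps (n ∸ a) p)) (upTo (suc n))

raise : ℕ × ℕ → ℕ → List ℤ → List ℤ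
raise (i , j) m γ = go 0 γ
  where
  go : ℕ → List ℤ → List ℤ
  go _ []       = []
  go r (x ∷ xs) =
    (if r ≡ᵇ i then x ℤ.+ (+ m) else if r ≡ᵇ j then x ℤ.- (+ m) else x) ∷ go (suc r) xs

raiseAll : List (ℕ × ℕ) → List ℕ → List ℤ → List ℤ
raiseAll (p ∷ ps) (m ∷ ms) γ = raiseAll ps ms (raise p m γ)
raiseAll _        _        γ = γ

HL : List ℕ → Ser
HL μ η n =
  sumℤ (map (λ m → sγ ℓ (raiseAll ps m (map +_ μ)) η) (comps n (length ps)))
  where
  ℓ  = length μ
  ps = pairsLt ℓ

isPartition : List ℕ → Bool
isPartition []           = true
isPartition (x ∷ [])     = 1 ≤ᵇ x
isPartition (x ∷ y ∷ xs) = (y ≤ᵇ x) ∧ isPartition (y ∷ xs)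

-- rows and columns are 0-indexed internally (row r here is row r+1 in the paper)
-- hook length of box (r , c) of λ: boxes below in its column + boxes weakly right in its row
hook : List ℕ → ℕ → ℕ → ℕ
hook λ' r c = countB (λ x → c <ᵇ x) (drop (suc r) λ') + (at λ' r ∸ c)

boxesRow : List ℕ → ℕ → List ℕ
boxesRow λ' r = upTo (at λ' r)

isCore : ℕ → List ℕ → Bool
isCore k λ' =
  all (λ r → all (λ c → not (hook λ' r c ≡ᵇ suc k)) (boxesRow λ' r)) (upTo (length λ'))

𝔭 : ℕ → List ℕ → List ℕ
𝔭 k κ = map (λ r → countB (λ c → hook κ r c ≤ᵇ k) (boxesRow κ r)) (upTo (length κ))

eqPad : List ℕ → List ℕ → Bool
eqPad []       []       = true
eqPad []       (y ∷ ys) = (y ≡ᵇ 0) ∧ eqPad [] ys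
eqPad (x ∷ xs) []       = (x ≡ᵇ 0) ∧ eqPad xs []
eqPad (x ∷ xs) (y ∷ ys) = (x ≡ᵇ y) ∧ eqPad xs ys

subBelow : ℕ → List ℕ → List (List ℕ)
subBelow b []       = [] ∷ []
subBelow b (a ∷ as) =
  concatMap (λ x → map (x ∷_) (subBelow x as)) (upTo (suc (ℕ._⊓_ a b)))

stripZeros : List ℕ → List ℕ
stripZeros = filter (λ x → 1 ℕ.≤? x)

subPartitions : List ℕ → List (List ℕ)
subPartitions κ = map stripZeros (subBelow (sum κ) κ)

Box : Set
Box = ℕ × ℕ

skewBoxes : List ℕ → List ℕ → List Box
skewBoxes κ τ =
  concatMap (λ r → map (λ c → r , c) (filter (λ c → at τ r ℕ.≤? c) (upTo (at κ r))))
            (upTo (length κ))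

dist1 : ℕ → ℕ → Bool
dist1 a b = (suc a ≡ᵇ b) ∨ (suc b ≡ᵇ a)

adjacent : Box → Box → Bool
adjacent (r , c) (r' , c') = ((r ≡ᵇ r') ∧ dist1 c c') ∨ ((c ≡ᵇ c') ∧ dist1 r r')

filterB : {A : Set} → (A → Bool) → List A → List A
filterB p []       = []
filterB p (x ∷ xs) = if p x then x ∷ filterB p xs else filterB p xs

-- grow the component C by absorbing boxes of `rest` adjacent to it
-- (fuel: length rest + 1 suffices, since each non-final round absorbs a box)
close : ℕ → List Box → List Box → List Box × List Box
close zero    C rest = C , rest
close (suc f) C rest =
  if null adj then (C , rest) else close f (C ++ adj) (filterB (λ b → not (touches b)) rest)
  where
  touches : Box → Bool
  touches b = any (adjacent b) C
  adj = filterB touches rest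

-- connected components (fuel: number of boxes suffices)
componentsF : ℕ → List Box → List (List Box)
componentsF zero    _        = []
componentsF (suc f) []       = []
componentsF (suc f) (b ∷ bs) with close (suc (length bs)) (b ∷ []) bs
... | C , rest = C ∷ componentsF f rest

components : List Box → List (List Box)
components bs = componentsF (length bs) bs

topRow : List Box → ℕ
topRow C = foldr (λ b m → ℕ._⊓_ (proj₁ b) m) (foldr (λ b m → ℕ._⊔_ (proj₁ b) m) 0 C) C

bottomRow : List Box → ℕ
bottomRow C = foldr (λ b m → ℕ._⊔_ (proj₁ b) m) 0 C

-- number of rows occupied by a (connected) component
numRows : List Box → ℕ
numRows C = suc (bottomRow C ∸ topRow C)

contained : List ℕ → List ℕ → Bool
contained τ κ = all (λ r → at τ r ≤ᵇ at κ r) (upTo (length τ))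

strongCover : ℕ → List ℕ → List ℕ → Bool
strongCover k τ κ =
  isCore k τ ∧ isCore k κ ∧ contained τ κ ∧ (suc (sum (𝔭 k τ)) ≡ᵇ sum (𝔭 k κ))

-- spin of the marked cover τ ⇒ʳ κ (r is the paper's 1-indexed row) :
-- c (h − 1) + N, where c = #components, h = #rows of a component (taken to
-- be the marked one; all components have the same number of rows),
-- N = #components lying entirely in rows > r
markedComp : ℕ → List (List Box) → List Box
markedComp r []       = []
markedComp r (C ∷ Cs) = if suc (topRow C) ≡ᵇ r then C else markedComp r Cs

spin : List ℕ → List ℕ → ℕ → ℕ
spin τ κ r =
  length Cs ℕ.* (numRows (markedComp r Cs) ∸ 1) + countB (λ C → r <ᵇ suc (topRow C)) Cs
  where Cs = components (skewBoxes κ τ)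

-- admissible markings: smallest (1-indexed) row index of some component
markings : List ℕ → List ℕ → List ℕ
markings τ κ = map (λ C → suc (topRow C)) (components (skewBoxes κ τ))

coversInto : ℕ → List ℕ → List (List ℕ × ℕ × ℕ)
coversInto k κ =
  concatMap (λ τ → map (λ r → τ , r , spin τ κ r) (markings τ κ))
            (filterB (λ τ → strongCover k τ κ) (subPartitions κ))

-- all chains κ⁽⁰⁾ ⇒^{r₁} ⋯ ⇒^{r_m} κ⁽ᵐ⁾ = κ of length m, recorded as
-- (list of markings r₁ … r_m , total spin); one entry per chain
chains : ℕ → ℕ → List ℕ → List (List ℕ × ℕ)
chains k zero    κ = ([] , 0) ∷ []
chains k (suc m) κ =
  concatMap (λ { (τ , r , s) → map (λ { (rs , s') → (rs ++ (r ∷ []) , s' + s) }) (chains k m τ) })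
            (coversInto k κ)

decreasing : List ℕ → Bool
decreasing []           = true
decreasing (x ∷ [])     = true
decreasing (x ∷ y ∷ xs) = (y ≤ᵇ x) ∧ decreasing (y ∷ xs)

take' : ℕ → List ℕ → List ℕ
take' zero    _        = []
take' (suc n) []       = []
take' (suc n) (x ∷ xs) = x ∷ take' n xs

weightOK : List ℕ → List ℕ → Bool
weightOK []       rs = null rs
weightOK (e ∷ es) rs = (e ≤ᵇ length rs) ∧ decreasing (take' e rs) ∧ weightOK es (drop e rs)

-- k-Schur function s^(k)_μ, computed from the (k+1)-core κ with 𝔭 κ = μ:
-- [x^η t^n] s^(k)_μ = #{T ∈ SMT^k_η(μ) : spin T = n}
kSchur : ℕ → List ℕ → List ℕ → Ser
kSchur k μ κ η n =
  + countB (λ { (rs , s) → weightOK η rs ∧ (s ≡ᵇ n) }) (chains k (sum μ) κ)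

IsCoreOf : ℕ → List ℕ → List ℕ → Set
IsCoreOf k κ μ = T (isPartition κ ∧ isCore k κ ∧ eqPad (𝔭 k κ) μ)

parBounded : ℕ → ℕ → List (List ℕ)
parBounded b zero    = [] ∷ []
parBounded b (suc ℓ) = concatMap (λ a → map (a ∷_) (parBounded a ℓ)) (upTo (suc b))

Par : ℕ → ℕ → List (List ℕ)
Par k ℓ = parBounded k ℓ

-- Linear algebra over ℚ(t) = Frac ℤ[t]
-- Polynomials in t with integer coefficients (constant term first).

Poly : Set
Poly = List ℤ

NonZeroPoly : Poly → Set
NonZeroPoly p = Any (λ a → ¬ a ≡ + 0) p

ZeroPoly : Poly → Set
ZeroPoly p = All (λ a → a ≡ + 0) p

_·_ : Poly → Ser → Ser
(p · F) η n = sumℤ (map (λ i → atℤ p i ℤ.* F η (n ∸ i)) (upTo (suc n)))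

linComb : List (List ℕ) → (List ℕ → Poly) → (List ℕ → Ser) → Ser
linComb P c F η n = sumℤ (map (λ μ → (c μ · F μ) η n) P)

-- g lies in the ℚ(t)-span of {F_μ : μ ∈ P}: after clearing denominators,
-- d g = Σ c_μ F_μ for some nonzero d ∈ ℤ[t] and c_μ ∈ ℤ[t]
InSpan : List (List ℕ) → (List ℕ → Ser) → Ser → Set
InSpan P F g =
  Σ Poly λ d → NonZeroPoly d × Σ (List ℕ → Poly) λ c → ∀ η n → (d · g) η n ≡ linComb P c F η n

-- {F_μ : μ ∈ P} linearly independent over ℚ(t) (equivalently over ℤ[t])
LinIndep : List (List ℕ) → (List ℕ → Ser) → Set
LinIndep P F =
  ∀ (c : List ℕ → Poly) → (∀ η n → linComb P c F η n ≡ + 0) → ∀ μ → μ ∈ P → ZeroPoly (c μ)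

IsBasisOfSpan : List (List ℕ) → (List ℕ → Ser) → (List ℕ → Ser) → Set
IsBasisOfSpan P S G =
  (∀ μ → μ ∈ P → InSpan P G (S μ)) × (∀ ν → ν ∈ P → InSpan P S (G ν)) × LinIndep P S

{-# OPTIONS --safe #-}
-- The k-Schur function of a core κ is the Catalan function of the root ideal Ψ read off from κ.
-- Expanding one raising operator at a time along a bounce path, the mirror symmetry of Schur
-- functions cancels every term except those of the strong marked covers of κ; hence both
-- families satisfy the same recursion in the last variable.  The Catalan functions lie in the
-- span of the H_μ with at most ℓ rows by straightening, a dominance-triangular relation then
-- inverts the transition, and at t = 0 independence is that of the Schur functions, whose
-- degree in the last variable is μ₁.
module Submission where

-- A single function d on rows ties the objects together. In a (k+1)-core the bead of row d i lies k
-- + 1 positions below the bead of row i; row i of the bounded partition is then k + 1 + i - d i,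
-- and d i is also the first column of row i in the root ideal. Lowering part j and deleting the
-- first root of row j is thus the one change of d j into d j + 1, which is what lets the expansion
-- of a Catalan function close up. The functions d met on the way need not come from cores: two
-- neighbouring values coincide, and the mirror symmetry either kills such a term or trades it, for
-- a factor t, for a collision elsewhere. Following these trades until the collision disappears
-- rebuilds the ribbons of a cover, and the accumulated power of t, with the steps along the bounce
-- path, is its spin. The laborious converse is that every strong cover arises in this way: a
-- smaller core inside κ is shown to fit below some bead move, and a comparison of sizes leaves no
-- room between. Antisymmetry of Schur functions is obtained from integer determinants by adjoining
-- variables one by one.

open import Defs
open import Data.Nat
open import Data.Nat.Properties
open import Data.Nat.ListAction using (sum)
open import Data.Bool using (Bool; true; false; _∧_; _∨_; not; if_then_else_; T)
open import Data.Bool.ListAction using (any; all)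
open import Data.Bool.Properties using (T-∧; T-≡)
open import Data.Integer as ℤ using (ℤ; +_; -[1+_])
import Data.Integer.Properties as ℤP
open import Data.List using (List; []; _∷_; _++_; map; concatMap; filter; length; foldr; upTo; drop; zipWith; null; applyUpTo)
open import Data.List.Properties using (map-++; ++-assoc; length-++; ++-identityʳ; map-∘; map-cong; length-map)
open import Data.List.Membership.Propositional using (_∈_; _∉_)
open import Data.List.Membership.Propositional.Properties using (∈-++⁺ˡ; ∈-++⁺ʳ; ∈-++⁻; ∈-map⁺; ∈-map⁻; ∈-filter⁺; ∈-filter⁻; ∈-upTo⁺; ∈-upTo⁻; ∈-concatMap⁺; ∈-concatMap⁻)
open import Data.List.Relation.Unary.Any using (Any; here; there)
open import Data.List.Relation.Unary.All as All using (All; []; _∷_)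
open import Data.List.Relation.Unary.AllPairs using ([]; _∷_)
open import Data.List.Relation.Unary.Unique.Propositional using (Unique)
import Data.List.Relation.Unary.Unique.Propositional.Properties as UniqueP
open import Data.List.Membership.Propositional.Properties.WithK using (unique∧set⇒bag)
open import Data.List.Relation.Binary.BagAndSetEquality using (∼bag⇒↭)
open import Data.List.Reverse using (Reverse; []; _∶_∶ʳ_; reverseView)
open import Function.Bundles using (mk⇔)
open import Data.List.Relation.Binary.Permutation.Propositional using (_↭_; prep; swap; ↭-sym; ↭-trans; ↭-refl)
open import Data.Product using (_×_; _,_; Σ; ∃; proj₁; proj₂; ∃-syntax)
open import Data.Sum using (_⊎_; inj₁; inj₂)
open import Data.Empty as ⊥ using (⊥)
open import Data.Unit using (⊤; tt)
open import Function using (_∘_; case_of_)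
open import Function.Bundles using (Equivalence)
open import Relation.Nullary using (¬_; Dec; yes; no; does)
open import Relation.Binary.Definitions using (tri<; tri≈; tri>)
open import Relation.Binary.PropositionalEquality as ≡ using (_≡_; _≢_; refl; subst₂; _≗_; module ≡-Reasoning)
open import Data.Nat.Tactic.RingSolver using (solve-∀)
import Data.Integer.Tactic.RingSolver as ℤR
open import Data.List.Relation.Unary.AllPairs using (AllPairs)
open import Data.Maybe using (Maybe; just; nothing) renaming (map to mapᵐ)
open import Data.Sum using ([_,_])
open import Data.List using (reverse)
open import Data.List.Properties using (reverse-++; reverse-involutive; unfold-reverse)
open import Data.List.Relation.Binary.Permutation.Propositional.Properties using (++-comm)

-- Instances at level zero, to keep elaboration small.
sym : {A : Set} {x y : A} → x ≡ y → y ≡ x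
sym = ≡.sym

trans : {A : Set} {x y z : A} → x ≡ y → y ≡ z → x ≡ z
trans = ≡.trans

cong : {A B : Set} (f : A → B) {x y : A} → x ≡ y → f x ≡ f y
cong = ≡.cong

cong₂ : {A B C : Set} (f : A → B → C) {x y : A} {u v : B} → x ≡ y → u ≡ v → f x u ≡ f y v
cong₂ = ≡.cong₂

subst : {A : Set} (P : A → Set) {x y : A} → x ≡ y → P x → P y
subst = ≡.subst

⊥-elim : {A : Set} → ⊥ → A
⊥-elim = ⊥.⊥-elim

-- Linear arithmetic over ℕ: a Farkas combination of the given facts is checked
-- coefficientwise, the variables being nonnegative.
module Linear where

  data Ex : Set where
    # $ : ℕ → Ex
    _⊹_ : Ex → Ex → Ex

  infixl 7 _⊹_

  var : List ℕ → ℕ → ℕ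
  var []      _       = 0
  var (x ∷ ρ) zero    = x
  var (x ∷ ρ) (suc i) = var ρ i

  ⟦_⟧ : Ex → List ℕ → ℕ
  ⟦ # c ⟧ ρ   = c
  ⟦ $ i ⟧ ρ   = var ρ i
  ⟦ a ⊹ b ⟧ ρ = ⟦ a ⟧ ρ + ⟦ b ⟧ ρ

  dot : List ℕ → List ℕ → ℕ
  dot []       _       = 0
  dot (c ∷ cs) []      = 0
  dot (c ∷ cs) (x ∷ ρ) = c * x + dot cs ρ

  LF : Set
  LF = ℕ × List ℕ

  ev : LF → List ℕ → ℕ
  ev (c , cs) ρ = c + dot cs ρ

  addL : List ℕ → List ℕ → List ℕ
  addL []       ds       = ds
  addL (c ∷ cs) []       = c ∷ cs
  addL (c ∷ cs) (d ∷ ds) = c + d ∷ addL cs ds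

  mulL : ℕ → List ℕ → List ℕ
  mulL m []       = []
  mulL m (c ∷ cs) = m * c ∷ mulL m cs

  unit : ℕ → List ℕ
  unit zero    = 1 ∷ []
  unit (suc i) = 0 ∷ unit i

  _⊞_ : LF → LF → LF
  (c , cs) ⊞ (d , ds) = c + d , addL cs ds

  nf : Ex → LF
  nf (# c)   = c , []
  nf ($ i)   = 0 , unit i
  nf (a ⊹ b) = nf a ⊞ nf b

  dot-add : ∀ cs ds ρ → dot (addL cs ds) ρ ≡ dot cs ρ + dot ds ρ
  dot-add []       ds       ρ       = refl
  dot-add (c ∷ cs) []       ρ       = sym (+-identityʳ _)
  dot-add (c ∷ cs) (d ∷ ds) []      = refl
  dot-add (c ∷ cs) (d ∷ ds) (x ∷ ρ) =
    trans (cong (λ w → (c + d) * x + w) (dot-add cs ds ρ)) (lem c d x (dot cs ρ) (dot ds ρ))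
    where
    lem : ∀ c d x p q → (c + d) * x + (p + q) ≡ (c * x + p) + (d * x + q)
    lem = solve-∀

  dot-mul : ∀ m cs ρ → dot (mulL m cs) ρ ≡ m * dot cs ρ
  dot-mul m []       ρ       = sym (*-zeroʳ m)
  dot-mul m (c ∷ cs) []      = sym (*-zeroʳ m)
  dot-mul m (c ∷ cs) (x ∷ ρ) =
    trans (cong (λ w → m * c * x + w) (dot-mul m cs ρ)) (lem m c x (dot cs ρ))
    where
    lem : ∀ m c x p → m * c * x + m * p ≡ m * (c * x + p)
    lem = solve-∀

  dot-unit : ∀ i ρ → dot (unit i) ρ ≡ var ρ i
  dot-unit zero    []      = refl
  dot-unit zero    (x ∷ ρ) = trans (+-identityʳ _) (+-identityʳ _)
  dot-unit (suc i) []      = refl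
  dot-unit (suc i) (x ∷ ρ) = dot-unit i ρ

  ev-add : ∀ p q ρ → ev (p ⊞ q) ρ ≡ ev p ρ + ev q ρ
  ev-add (c , cs) (d , ds) ρ = trans (cong (λ w → c + d + w) (dot-add cs ds ρ)) (lem c d _ _)
    where
    lem : ∀ c d p q → c + d + (p + q) ≡ (c + p) + (d + q)
    lem = solve-∀

  nf-ok : ∀ e ρ → ev (nf e) ρ ≡ ⟦ e ⟧ ρ
  nf-ok (# c)   ρ = +-identityʳ c
  nf-ok ($ i)   ρ = dot-unit i ρ
  nf-ok (a ⊹ b) ρ = trans (ev-add (nf a) (nf b) ρ) (cong₂ _+_ (nf-ok a ρ) (nf-ok b ρ))

  record Fact (ρ : List ℕ) : Set where
    constructor fact
    field
      mult    : ℕ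
      lhs rhs : Ex
      holds   : ⟦ lhs ⟧ ρ ≤ ⟦ rhs ⟧ ρ

  infix  6   _⊴_∋_ _≐_∋_
  infixr 5.5 _⊠_

  _⊴_∋_ : ∀ {ρ} x y → ⟦ x ⟧ ρ ≤ ⟦ y ⟧ ρ → Fact ρ
  x ⊴ y ∋ p = fact 1 x y p

  _≐_∋_ : ∀ {ρ} x y → ⟦ x ⟧ ρ ≡ ⟦ y ⟧ ρ → Fact ρ
  x ≐ y ∋ p = fact 1 x y (≤-reflexive p)

  _⊠_ : ∀ {ρ} → ℕ → Fact ρ → Fact ρ
  m ⊠ fact _ x y p = fact m x y p

  scale : ℕ → LF → LF
  scale m (c , cs) = m * c , mulL m cs

  lhsΣ rhsΣ : ∀ {ρ} → List (Fact ρ) → LF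
  lhsΣ []                     = 0 , []
  lhsΣ (fact m a b _ ∷ fs) = scale m (nf a) ⊞ lhsΣ fs
  rhsΣ []                     = 0 , []
  rhsΣ (fact m a b _ ∷ fs) = scale m (nf b) ⊞ rhsΣ fs

  ev-scale : ∀ m p ρ → ev (scale m p) ρ ≡ m * ev p ρ
  ev-scale m (c , cs) ρ = trans (cong (λ w → m * c + w) (dot-mul m cs ρ)) (sym (*-distribˡ-+ m c _))

  sum-ok : ∀ {ρ} (fs : List (Fact ρ)) → ev (lhsΣ fs) ρ ≤ ev (rhsΣ fs) ρ
  sum-ok []                     = ≤-refl
  sum-ok {ρ} (fact m a b p ∷ fs) =
    subst₂ _≤_ (sym (eq a (lhsΣ fs))) (sym (eq b (rhsΣ fs)))
      (+-mono-≤ (*-monoʳ-≤ m p) (sum-ok fs))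
    where
    eq : ∀ e q → ev (scale m (nf e) ⊞ q) ρ ≡ m * ⟦ e ⟧ ρ + ev q ρ
    eq e q = trans (ev-add (scale m (nf e)) q ρ)
               (cong (_+ ev q ρ) (trans (ev-scale m (nf e) ρ) (cong (m *_) (nf-ok e ρ))))

  leL : List ℕ → List ℕ → Bool
  leL []       _        = true
  leL (c ∷ cs) []       = (c ≤ᵇ 0) ∧ leL cs []
  leL (c ∷ cs) (d ∷ ds) = (c ≤ᵇ d) ∧ leL cs ds

  dot-zero : ∀ cs ρ → T (leL cs []) → dot cs ρ ≤ 0
  dot-zero []       ρ       t = z≤n
  dot-zero (c ∷ cs) []      t = z≤n
  dot-zero (c ∷ cs) (x ∷ ρ) t with Equivalence.to T-∧ t
  ... | p , q with n≤0⇒n≡0 (≤ᵇ⇒≤ c 0 p)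
  ... | refl = dot-zero cs ρ q

  dot-mono : ∀ cs ds ρ → T (leL cs ds) → dot cs ρ ≤ dot ds ρ
  dot-mono []       ds       ρ       t = z≤n
  dot-mono (c ∷ cs) []       ρ       t = dot-zero (c ∷ cs) ρ t
  dot-mono (c ∷ cs) (d ∷ ds) []      t = z≤n
  dot-mono (c ∷ cs) (d ∷ ds) (x ∷ ρ) t with Equivalence.to T-∧ t
  ... | p , q = +-mono-≤ (*-monoˡ-≤ x (≤ᵇ⇒≤ c d p)) (dot-mono cs ds ρ q)

  refutes : LF → LF → Bool
  refutes (c , cs) (d , ds) = (suc d ≤ᵇ c) ∧ leL ds cs

  lin⊥ : ∀ ρ (fs : List (Fact ρ)) {_ : T (refutes (lhsΣ fs) (rhsΣ fs))} → ⊥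
  lin⊥ ρ fs {ok} with lhsΣ fs | rhsΣ fs | sum-ok fs
  ... | c , cs | d , ds | le with Equivalence.to T-∧ ok
  ... | p , q = <-irrefl refl (≤-trans (+-mono-≤ (≤ᵇ⇒≤ (suc d) c p) (dot-mono ds cs ρ q)) le)

  -- The negation `1 + y ≤ x` of the goal joins the facts with multiplicity `m`, and the combination
  -- must have a larger constant and no smaller coefficients on the left. The implicit argument
  -- computes to the unit type when this succeeds, so a call displays just its facts.
  lin≤ : ∀ ρ m x y (fs : List (Fact ρ)) →
         {_ : T (refutes (scale m (nf (# 1 ⊹ y)) ⊞ lhsΣ fs) (scale m (nf x) ⊞ rhsΣ fs))} →
         ⟦ x ⟧ ρ ≤ ⟦ y ⟧ ρ
  lin≤ ρ m x y fs {ok} with ⟦ x ⟧ ρ ≤? ⟦ y ⟧ ρ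
  ... | yes p = p
  ... | no ¬p = ⊥-elim (lin⊥ ρ (fact m (# 1 ⊹ y) x (≰⇒> ¬p) ∷ fs) {ok})

open Linear using (Ex; #; $; _⊹_; _⊠_; _⊴_∋_; _≐_∋_; lin⊥; lin≤)

-- Integer identities for weights and indices.

ring1 : ∀ a b c → a ℤ.+ c ℤ.+ b ≡ a ℤ.+ b ℤ.+ c
ring1 = ℤR.solve-∀

ring2 : ∀ a b → a ℤ.- + 1 ℤ.+ b ≡ a ℤ.+ b ℤ.- + 1
ring2 = ℤR.solve-∀

ring3 : ∀ a b → a ℤ.+ + 1 ℤ.+ b ≡ a ℤ.+ b ℤ.+ + 1
ring3 = ℤR.solve-∀

ring4 : ∀ a → a ℤ.+ + 1 ℤ.- + 1 ≡ a
ring4 = ℤR.solve-∀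

ring5 : ∀ a b c d → a ℤ.+ b ℤ.+ (c ℤ.+ d) ≡ a ℤ.+ c ℤ.+ (b ℤ.+ d)
ring5 = ℤR.solve-∀

ring6 : ∀ a b c a' b' c' → a ℤ.+ b ℤ.+ c ℤ.+ (a' ℤ.+ b' ℤ.+ c') ≡ (a ℤ.+ a') ℤ.+ (b ℤ.+ c') ℤ.+ (c ℤ.+ b')
ring6 = ℤR.solve-∀

ring7 : ∀ a b c → a ℤ.* (b ℤ.* ℤ.- c) ≡ ℤ.- (a ℤ.* (b ℤ.* c))
ring7 = ℤR.solve-∀

ring8 : ∀ a b → a ≡ b ℤ.+ a ℤ.+ ℤ.- b
ring8 = ℤR.solve-∀

ring9 : ∀ c d → c ℤ.* (d ℤ.* + 0) ≡ + 0
ring9 = ℤR.solve-∀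

ring10 : ∀ c d x y → c ℤ.* (d ℤ.* (x ℤ.+ y)) ≡ c ℤ.* (d ℤ.* x) ℤ.+ c ℤ.* (d ℤ.* y)
ring10 = ℤR.solve-∀

ring11 : ∀ s s' x y z → ℤ.- s ℤ.* (x ℤ.* (s' ℤ.* (y ℤ.* z))) ℤ.+ s' ℤ.* (y ℤ.* (s ℤ.* (x ℤ.* z))) ≡ + 0
ring11 = ℤR.solve-∀

ring12 : ∀ a b → a ≡ a ℤ.- b ℤ.+ b
ring12 = ℤR.solve-∀

ring13 : ∀ a b c → a ℤ.+ b ℤ.- c ℤ.- + 1 ≡ a ℤ.- + 1 ℤ.+ b ℤ.- c
ring13 = ℤR.solve-∀

ring14 : ∀ a b c → a ℤ.- + 1 ℤ.+ b ℤ.- c ≡ a ℤ.+ b ℤ.- (+ 1 ℤ.+ c)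
ring14 = ℤR.solve-∀

ring15 : ∀ a b c → a ℤ.+ + 1 ℤ.+ b ℤ.- (+ 1 ℤ.+ c) ≡ a ℤ.+ b ℤ.- c
ring15 = ℤR.solve-∀

ring16 : ∀ x y w → x ℤ.+ y ℤ.- (y ℤ.+ w) ≡ x ℤ.- w
ring16 = ℤR.solve-∀

ring17 : ∀ a b c → a ℤ.+ (+ 1 ℤ.+ b) ℤ.- (+ 1 ℤ.+ c) ≡ a ℤ.+ b ℤ.- c
ring17 = ℤR.solve-∀

ring18 : ∀ a b → a ℤ.- b ℤ.- + 1 ≡ a ℤ.- (+ 1 ℤ.+ b)
ring18 = ℤR.solve-∀

ring19 : ∀ a b c → a ℤ.+ ℤ.- b ℤ.+ (b ℤ.- c) ≡ a ℤ.+ ℤ.- c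
ring19 = ℤR.solve-∀

ring20 : ∀ a b → + 1 ℤ.+ a ℤ.- b ≡ a ℤ.- b ℤ.+ + 1
ring20 = ℤR.solve-∀

ring21 : ∀ a → a ℤ.+ + 1 ℤ.+ + 0 ≡ a ℤ.+ + 0 ℤ.+ + 1
ring21 = ℤR.solve-∀

ring22 : ∀ a → a ℤ.+ + 1 ℤ.+ ℤ.- + 1 ℤ.- + 1 ≡ a ℤ.+ ℤ.- + 1
ring22 = ℤR.solve-∀

ring23 : ∀ a → a ℤ.+ + 0 ℤ.+ + 1 ≡ a ℤ.+ + 1 ℤ.+ + 0
ring23 = ℤR.solve-∀

ring24 : ∀ b c → b ≡ b ℤ.+ c ℤ.+ ℤ.- c
ring24 = ℤR.solve-∀

ring25 : ∀ a b → a ℤ.- (a ℤ.+ b) ≡ ℤ.- b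
ring25 = ℤR.solve-∀

ring26 : ∀ a b c → a ℤ.+ (b ℤ.+ c) ≡ b ℤ.+ (a ℤ.+ c)
ring26 = ℤR.solve-∀

ring27 : ∀ a b → a ℤ.+ b ℤ.- a ≡ b
ring27 = ℤR.solve-∀

ring28 : ∀ a b → a ≡ a ℤ.+ + 0 ℤ.* b
ring28 = ℤR.solve-∀

ring29 : ∀ a b c → a ℤ.+ b ℤ.+ c ℤ.* b ≡ a ℤ.+ (+ 1 ℤ.+ c) ℤ.* b
ring29 = ℤR.solve-∀

ring30 : ∀ x m → x ℤ.+ m ≡ x ℤ.+ m ℤ.* (+ 1 ℤ.- + 0)
ring30 = ℤR.solve-∀

ring31 : ∀ x m → x ℤ.- m ≡ x ℤ.+ m ℤ.* (+ 0 ℤ.- + 1)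
ring31 = ℤR.solve-∀

ring32 : ∀ x m → x ≡ x ℤ.+ m ℤ.* (+ 0 ℤ.- + 0)
ring32 = ℤR.solve-∀

ring33 : ∀ a b → a ℤ.- b ℤ.+ + 1 ≡ a ℤ.+ + 1 ℤ.- b
ring33 = ℤR.solve-∀

ring34 : ∀ a b → a ℤ.+ + 1 ℤ.- b ℤ.+ (+ 0 ℤ.- + 1) ≡ a ℤ.- b
ring34 = ℤR.solve-∀

ring35 : ∀ a b → + 1 ℤ.+ a ℤ.- b ℤ.- + 1 ≡ a ℤ.- b
ring35 = ℤR.solve-∀

ring36 : ∀ a b → a ℤ.- b ℤ.+ + 1 ≡ a ℤ.+ + 1 ℤ.- b
ring36 = ℤR.solve-∀

ring37 : ∀ a u → a + 1 + u ≡ a + suc u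
ring37 = solve-∀

ring38 : ∀ a b c → a ℤ.+ (b ℤ.+ ℤ.- (ℤ.- c ℤ.+ b)) ≡ c ℤ.+ a
ring38 = ℤR.solve-∀

ring39 : ∀ a b → a ℤ.- (a ℤ.+ b) ≡ ℤ.- b
ring39 = ℤR.solve-∀

ring40 : ∀ a b → a ≡ a ℤ.+ b ℤ.- b
ring40 = ℤR.solve-∀

ring41 : ∀ a b → a ℤ.+ + 1 ℤ.- b ≡ a ℤ.- b ℤ.+ + 1
ring41 = ℤR.solve-∀

ring42 : ∀ a u → a + suc u + 1 ≡ a + suc (suc u)
ring42 = solve-∀

ring43 : ∀ a b → a ≡ a ℤ.+ b ℤ.- b
ring43 = ℤR.solve-∀

ring44 : ∀ a → a ℤ.+ + 0 ≡ a ℤ.+ ℤ.- + 1 ℤ.+ + 1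
ring44 = ℤR.solve-∀

ring45 : ∀ a b → a ℤ.+ b ℤ.- b ≡ a
ring45 = ℤR.solve-∀

ring46 : ∀ a b → a ≡ a ℤ.+ b ℤ.- b
ring46 = ℤR.solve-∀

ring47 : ∀ a b → a ℤ.+ b ℤ.- b ≡ a
ring47 = ℤR.solve-∀

-- Geometric series acting on weights, and their transposition symmetry.

Weight : Set
Weight = ℕ → ℤ

δ : ℕ → ℕ → ℤ
δ a r = if r ≡ᵇ a then + 1 else + 0

-- `root i j` stands for the geometric series (1 − t z_i / z_j)⁻¹ and
-- `low i` for (1 − u / z_i)⁻¹.
data Factor : Set where
  root : ℕ → ℕ → Factor
  low  : ℕ → Factor

wt : Factor → Weight
wt (root a b) r = δ a r ℤ.- δ b r
wt (low a)    r = ℤ.- δ a r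

shift : Factor → Weight → Weight
shift f γ r = γ r ℤ.+ wt f r

-- The first argument is the exponent of u, carried by the `low` factors; the second is the exponent
-- of t, carried by the `root` factors.
Ser₂ : Set
Ser₂ = ℕ → ℕ → ℤ

delay : Factor → Ser₂ → Ser₂
delay (root _ _) X e zero    = + 0
delay (root _ _) X e (suc n) = X e n
delay (low _)    X zero n    = + 0
delay (low _)    X (suc e) n = X e n

delay-cong : ∀ f {X Y : Ser₂} e n →
  (∀ e' n' → e' + n' < e + n → X e' n' ≡ Y e' n') → delay f X e n ≡ delay f Y e n
delay-cong (root _ _) e zero    h = refl
delay-cong (root _ _) e (suc n) h = h e n (+-monoʳ-< e ≤-refl)
delay-cong (low _) zero n       h = refl
delay-cong (low _) (suc e) n    h = h e n ≤-refl

delay-+ : ∀ f (X Y : Ser₂) e n →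
  delay f (λ e' n' → X e' n' ℤ.+ Y e' n') e n ≡ delay f X e n ℤ.+ delay f Y e n
delay-+ (root _ _) X Y e zero    = refl
delay-+ (root _ _) X Y e (suc n) = refl
delay-+ (low _) X Y zero n       = refl
delay-+ (low _) X Y (suc e) n    = refl

delay-neg : ∀ f (X : Ser₂) e n → delay f (λ e' n' → ℤ.- X e' n') e n ≡ ℤ.- delay f X e n
delay-neg (root _ _) X e zero    = refl
delay-neg (root _ _) X e (suc n) = refl
delay-neg (low _) X zero n       = refl
delay-neg (low _) X (suc e) n    = refl

delay-zero : ∀ f (X : Ser₂) e n → (∀ e' n' → X e' n' ≡ + 0) → delay f X e n ≡ + 0
delay-zero (root _ _) X e zero    h = refl
delay-zero (root _ _) X e (suc n) h = h e n
delay-zero (low _) X zero n       h = refl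
delay-zero (low _) X (suc e) n    h = h e n

delay-comm : ∀ f g (X : Ser₂) e n → delay f (delay g X) e n ≡ delay g (delay f X) e n
delay-comm (root _ _) (root _ _) X e zero          = refl
delay-comm (root _ _) (root _ _) X e (suc zero)    = refl
delay-comm (root _ _) (root _ _) X e (suc (suc n)) = refl
delay-comm (root _ _) (low _) X zero zero          = refl
delay-comm (root _ _) (low _) X zero (suc n)       = refl
delay-comm (root _ _) (low _) X (suc e) zero       = refl
delay-comm (root _ _) (low _) X (suc e) (suc n)    = refl
delay-comm (low _) (root _ _) X zero zero          = refl
delay-comm (low _) (root _ _) X zero (suc n)       = refl
delay-comm (low _) (root _ _) X (suc e) zero       = refl
delay-comm (low _) (root _ _) X (suc e) (suc n)    = refl
delay-comm (low _) (low _) X zero n                = refl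
delay-comm (low _) (low _) X (suc zero) n          = refl
delay-comm (low _) (low _) X (suc (suc e)) n       = refl

shift-comm : ∀ f g γ → shift f (shift g γ) ≗ shift g (shift f γ)
shift-comm f g γ r = lem (γ r) (wt f r) (wt g r)
  where
  lem = ring1

shift-cong : ∀ f {γ γ'} → γ ≗ γ' → shift f γ ≗ shift f γ'
shift-cong f h r = cong (ℤ._+ wt f r) (h r)

swapIdx : ℕ → ℕ → ℕ
swapIdx x r = if r ≡ᵇ x then suc x else (if r ≡ᵇ suc x then x else r)

swapF : ℕ → Factor → Factor
swapF x (root a b) = root (swapIdx x a) (swapIdx x b)
swapF x (low a)    = low (swapIdx x a)

-- The transposition of x and x + 1 acting after the staircase shift: the numbers γ r - r are
-- permuted instead of the γ r.
dot : ℕ → Weight → Weight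
dot x γ r = if r ≡ᵇ x then γ (suc x) ℤ.- + 1 else (if r ≡ᵇ suc x then γ x ℤ.+ + 1 else γ r)

≡ᵇ-refl : ∀ a → (a ≡ᵇ a) ≡ true
≡ᵇ-refl zero    = refl
≡ᵇ-refl (suc a) = ≡ᵇ-refl a

≡ᵇ-≢ : ∀ {a b} → a ≢ b → (a ≡ᵇ b) ≡ false
≡ᵇ-≢ {a} {b} h with a ≡ᵇ b in eq
... | false = refl
... | true  = ⊥-elim (h (≡ᵇ⇒≡ a b (Equivalence.from T-≡ eq)))

δ-same : ∀ a → δ a a ≡ + 1
δ-same a rewrite ≡ᵇ-refl a = refl

δ-diff : ∀ {a r} → r ≢ a → δ a r ≡ + 0
δ-diff h rewrite ≡ᵇ-≢ h = refl

swapIdx-x : ∀ x → swapIdx x x ≡ suc x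
swapIdx-x x rewrite ≡ᵇ-refl x = refl

swapIdx-sx : ∀ x → swapIdx x (suc x) ≡ x
swapIdx-sx x rewrite ≡ᵇ-≢ {suc x} {x} 1+n≢n | ≡ᵇ-refl x = refl

swapIdx-else : ∀ {x r} → r ≢ x → r ≢ suc x → swapIdx x r ≡ r
swapIdx-else h g rewrite ≡ᵇ-≢ h | ≡ᵇ-≢ g = refl

dot-x : ∀ x γ → dot x γ x ≡ γ (suc x) ℤ.- + 1
dot-x x γ rewrite ≡ᵇ-refl x = refl

dot-sx : ∀ x γ → dot x γ (suc x) ≡ γ x ℤ.+ + 1
dot-sx x γ rewrite ≡ᵇ-≢ {suc x} {x} 1+n≢n | ≡ᵇ-refl x = refl

dot-else : ∀ {x r} γ → r ≢ x → r ≢ suc x → dot x γ r ≡ γ r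
dot-else γ h g rewrite ≡ᵇ-≢ h | ≡ᵇ-≢ g = refl

data Cmp (x r : ℕ) : Set where
  is-x  : r ≡ x → Cmp x r
  is-sx : r ≡ suc x → Cmp x r
  other : r ≢ x → r ≢ suc x → Cmp x r

cmp : ∀ x r → Cmp x r
cmp x r with r ≟ x | r ≟ suc x
... | yes p | _     = is-x p
... | no _  | yes p = is-sx p
... | no p  | no q  = other p q

swapIdx-inv : ∀ x r → swapIdx x (swapIdx x r) ≡ r
swapIdx-inv x r with cmp x r
... | is-x refl   = trans (cong (swapIdx x) (swapIdx-x x)) (swapIdx-sx x)
... | is-sx refl  = trans (cong (swapIdx x) (swapIdx-sx x)) (swapIdx-x x)
... | other p q   = trans (cong (swapIdx x) (swapIdx-else p q)) (swapIdx-else p q)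

δ-swap : ∀ x a r → δ (swapIdx x a) (swapIdx x r) ≡ δ a r
δ-swap x a r with r ≟ a
... | yes refl = trans (δ-same (swapIdx x r)) (sym (δ-same r))
... | no h     = trans (δ-diff {swapIdx x a} {swapIdx x r} (λ e → h (trans (sym (swapIdx-inv x r)) (trans (cong (swapIdx x) e) (swapIdx-inv x a)))))
                       (sym (δ-diff h))

wt-swap : ∀ x f r → wt (swapF x f) (swapIdx x r) ≡ wt f r
wt-swap x (root a b) r = cong₂ ℤ._-_ (δ-swap x a r) (δ-swap x b r)
wt-swap x (low a)    r = cong ℤ.-_ (δ-swap x a r)

shift-dot : ∀ x f γ → shift (swapF x f) (dot x γ) ≗ dot x (shift f γ)
shift-dot x f γ r with cmp x r
... | is-x refl = begin
  dot x γ x ℤ.+ wt (swapF x f) x                ≡⟨ cong₂ ℤ._+_ (dot-x x γ) (trans (cong (wt (swapF x f)) (sym (swapIdx-sx x))) (wt-swap x f (suc x))) ⟩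
  γ (suc x) ℤ.- + 1 ℤ.+ wt f (suc x)            ≡⟨ lem (γ (suc x)) (wt f (suc x)) ⟩
  γ (suc x) ℤ.+ wt f (suc x) ℤ.- + 1            ≡⟨ dot-x x (shift f γ) ⟨
  dot x (shift f γ) x                           ∎
  where
  open ≡-Reasoning
  lem = ring2
... | is-sx refl = begin
  dot x γ (suc x) ℤ.+ wt (swapF x f) (suc x)    ≡⟨ cong₂ ℤ._+_ (dot-sx x γ) (trans (cong (wt (swapF x f)) (sym (swapIdx-x x))) (wt-swap x f x)) ⟩
  γ x ℤ.+ + 1 ℤ.+ wt f x                        ≡⟨ lem (γ x) (wt f x) ⟩
  γ x ℤ.+ wt f x ℤ.+ + 1                        ≡⟨ dot-sx x (shift f γ) ⟨
  dot x (shift f γ) (suc x)                     ∎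
  where
  open ≡-Reasoning
  lem = ring3
... | other p q = begin
  dot x γ r ℤ.+ wt (swapF x f) r                ≡⟨ cong₂ ℤ._+_ (dot-else γ p q) (trans (cong (wt (swapF x f)) (sym (swapIdx-else p q))) (wt-swap x f r)) ⟩
  γ r ℤ.+ wt f r                                ≡⟨ dot-else (shift f γ) p q ⟨
  dot x (shift f γ) r                           ∎
  where open ≡-Reasoning

dot-cong : ∀ x {γ γ'} → γ ≗ γ' → dot x γ ≗ dot x γ'
dot-cong x h r with r ≡ᵇ x | r ≡ᵇ suc x
... | true  | _     = cong (ℤ._- + 1) (h (suc x))
... | false | true  = cong (ℤ._+ + 1) (h x)
... | false | false = h r

dot-fix : ∀ x γ → γ (suc x) ≡ γ x ℤ.+ + 1 → dot x γ ≗ γ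
dot-fix x γ h r with cmp x r
... | is-x refl  = trans (dot-x x γ) (trans (cong (ℤ._- + 1) h) (lem (γ x)))
  where
  lem = ring4
... | is-sx refl = trans (dot-sx x γ) (sym h)
... | other p q  = dot-else γ p q

neg-self : ∀ {a : ℤ} → a ≡ ℤ.- a → a ≡ + 0
neg-self {+ zero}  e = refl
neg-self {+ suc _} ()
neg-self { -[1+ _ ]} ()

module Expansion (S : Weight → ℤ) (S-cong : ∀ {γ γ'} → γ ≗ γ' → S γ ≡ S γ') where

  -- The coefficient of u^e t^n in the product of the geometric series of `fs`, applied to z^γ and
  -- sent through S. The recursion is 1 / (1 - a) = 1 + a / (1 - a); its second term has lower
  -- degree, so no infinite sum occurs.
  K : List Factor → Weight → Ser₂
  K []              γ zero    zero    = S γ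
  K []              γ zero    (suc n) = + 0
  K []              γ (suc e) n       = + 0
  K (root a b ∷ fs) γ e       zero    = K fs γ e zero
  K (root a b ∷ fs) γ e       (suc n) = K fs γ e (suc n) ℤ.+ K (root a b ∷ fs) (shift (root a b) γ) e n
  K (low a ∷ fs)    γ zero    n       = K fs γ zero n
  K (low a ∷ fs)    γ (suc e) n       = K fs γ (suc e) n ℤ.+ K (low a ∷ fs) (shift (low a) γ) e n

  K-unfold : ∀ f fs γ e n →
    K (f ∷ fs) γ e n ≡ K fs γ e n ℤ.+ delay f (K (f ∷ fs) (shift f γ)) e n
  K-unfold (root a b) fs γ e zero    = sym (ℤP.+-identityʳ _)
  K-unfold (root a b) fs γ e (suc n) = refl
  K-unfold (low a)    fs γ zero n    = sym (ℤP.+-identityʳ _)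
  K-unfold (low a)    fs γ (suc e) n = refl

  K-cong : ∀ fs {γ γ'} → γ ≗ γ' → ∀ e n → K fs γ e n ≡ K fs γ' e n
  K-cong []              h zero    zero    = S-cong h
  K-cong []              h zero    (suc n) = refl
  K-cong []              h (suc e) n       = refl
  K-cong (root a b ∷ fs) h e       zero    = K-cong fs h e zero
  K-cong (root a b ∷ fs) h e       (suc n) =
    cong₂ ℤ._+_ (K-cong fs h e (suc n)) (K-cong (root a b ∷ fs) (shift-cong (root a b) h) e n)
  K-cong (low a ∷ fs)    h zero    n       = K-cong fs h zero n
  K-cong (low a ∷ fs)    h (suc e) n       =
    cong₂ ℤ._+_ (K-cong fs h (suc e) n) (K-cong (low a ∷ fs) (shift-cong (low a) h) e n)

  -- Unfolding one factor after the other on both sides gives the same undelayed and singly delayed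
  -- terms. The doubly delayed terms have smaller total degree, which is why the induction runs on a
  -- bound N for e + n.
  K-swap : ∀ f g fs N γ e n → e + n < N → K (f ∷ g ∷ fs) γ e n ≡ K (g ∷ f ∷ fs) γ e n
  K-swap f g fs (suc N) γ e n (s≤s lt) = begin
    X γ e n
      ≡⟨ K-unfold f (g ∷ fs) γ e n ⟩
    K (g ∷ fs) γ e n ℤ.+ delay f (X (shift f γ)) e n
      ≡⟨ cong₂ ℤ._+_ (K-unfold g fs γ e n) (trans (delay-cong f e n ih₁) (delay-+ f _ _ e n)) ⟩
    k₀ ℤ.+ kg ℤ.+ (kf ℤ.+ delay f (delay g (Y (shift g (shift f γ)))) e n)
      ≡⟨ cong (λ z → k₀ ℤ.+ kg ℤ.+ (kf ℤ.+ z)) (trans (delay-comm f g (Y (shift g (shift f γ))) e n)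
           (delay-cong g e n λ e₁ n₁ l₁ → delay-cong f e₁ n₁ λ e₂ n₂ l₂ →
             trans (K-cong (g ∷ f ∷ fs) (shift-comm g f γ) e₂ n₂)
               (sym (K-swap f g fs N (shift f (shift g γ)) e₂ n₂ (≤-trans (<-trans l₂ l₁) lt))))) ⟩
    k₀ ℤ.+ kg ℤ.+ (kf ℤ.+ delay g (delay f (X (shift f (shift g γ)))) e n)
      ≡⟨ lem k₀ kg kf _ ⟩
    k₀ ℤ.+ kf ℤ.+ (kg ℤ.+ delay g (delay f (X (shift f (shift g γ)))) e n)
      ≡⟨ cong₂ ℤ._+_ (K-unfold f fs γ e n) (trans (delay-cong g e n ih₂) (delay-+ g _ _ e n)) ⟨
    K (f ∷ fs) γ e n ℤ.+ delay g (Y (shift g γ)) e n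
      ≡⟨ K-unfold g (f ∷ fs) γ e n ⟨
    Y γ e n ∎
    where
    open ≡-Reasoning
    X = K (f ∷ g ∷ fs)
    Y = K (g ∷ f ∷ fs)
    k₀ = K fs γ e n
    kf = delay f (K (f ∷ fs) (shift f γ)) e n
    kg = delay g (K (g ∷ fs) (shift g γ)) e n
    ih₁ : ∀ e' n' → e' + n' < e + n → X (shift f γ) e' n' ≡
          K (f ∷ fs) (shift f γ) e' n' ℤ.+ delay g (Y (shift g (shift f γ))) e' n'
    ih₁ e' n' l = trans (K-swap f g fs N (shift f γ) e' n' (≤-trans l lt)) (K-unfold g (f ∷ fs) (shift f γ) e' n')
    ih₂ : ∀ e' n' → e' + n' < e + n → Y (shift g γ) e' n' ≡
          K (g ∷ fs) (shift g γ) e' n' ℤ.+ delay f (X (shift f (shift g γ))) e' n'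
    ih₂ e' n' l = trans (sym (K-swap f g fs N (shift g γ) e' n' (≤-trans l lt))) (K-unfold f (g ∷ fs) (shift g γ) e' n')
    lem = ring5

  K-tail : ∀ f {fs gs} → (∀ γ e n → K fs γ e n ≡ K gs γ e n) → ∀ γ e n → K (f ∷ fs) γ e n ≡ K (f ∷ gs) γ e n
  K-tail (root a b) h γ e zero    = h γ e zero
  K-tail (root a b) h γ e (suc n) = cong₂ ℤ._+_ (h γ e (suc n)) (K-tail (root a b) h _ e n)
  K-tail (low a)    h γ zero n    = h γ zero n
  K-tail (low a)    h γ (suc e) n = cong₂ ℤ._+_ (h γ (suc e) n) (K-tail (low a) h _ e n)

  K-perm : ∀ {fs gs} → fs ↭ gs → ∀ γ e n → K fs γ e n ≡ K gs γ e n
  K-perm _↭_.refl       γ e n = refl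
  K-perm (prep f p)   γ e n = K-tail f (K-perm p) γ e n
  K-perm (swap {fs} {gs} f g p) γ e n =
    trans (K-swap f g fs (suc (e + n)) γ e n ≤-refl) (K-tail g (K-tail f (K-perm p)) γ e n)
  K-perm (_↭_.trans p q)  γ e n = trans (K-perm p γ e n) (K-perm q γ e n)

  module Mirror (x : ℕ) (S-anti : ∀ γ → S (dot x γ) ≡ ℤ.- S γ) where

    K-dot : ∀ fs γ e n → K (map (swapF x) fs) (dot x γ) e n ≡ ℤ.- K fs γ e n
    K-dot []       γ zero    zero    = S-anti γ
    K-dot []       γ zero    (suc n) = refl
    K-dot []       γ (suc e) n       = refl
    K-dot (root a b ∷ fs) γ e zero    = K-dot fs γ e zero
    K-dot (root a b ∷ fs) γ e (suc n) =
      trans (cong₂ ℤ._+_ (K-dot fs γ e (suc n))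
              (trans (K-cong (map (swapF x) (root a b ∷ fs)) (shift-dot x (root a b) γ) e n) (K-dot (root a b ∷ fs) (shift (root a b) γ) e n)))
            (sym (ℤP.neg-distrib-+ (K fs γ e (suc n)) _))
    K-dot (low a ∷ fs) γ zero n    = K-dot fs γ zero n
    K-dot (low a ∷ fs) γ (suc e) n =
      trans (cong₂ ℤ._+_ (K-dot fs γ (suc e) n)
              (trans (K-cong (map (swapF x) (low a ∷ fs)) (shift-dot x (low a) γ) e n) (K-dot (low a ∷ fs) (shift (low a) γ) e n)))
            (sym (ℤP.neg-distrib-+ (K fs γ (suc e) n) _))

    K-mirror : ∀ {fs} → map (swapF x) fs ↭ fs → ∀ γ e n → K fs (dot x γ) e n ≡ ℤ.- K fs γ e n
    K-mirror {fs} p γ e n = trans (sym (K-perm p (dot x γ) e n)) (K-dot fs γ e n)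

    -- The hypothesis makes γ a fixed point of `dot x`, so the coefficient equals its own negative.
    K-vanish : ∀ {fs} → map (swapF x) fs ↭ fs → ∀ γ → γ (suc x) ≡ γ x ℤ.+ + 1 → ∀ e n → K fs γ e n ≡ + 0
    K-vanish {fs} p γ h e n = neg-self (trans (sym (K-cong fs (dot-fix x γ h) e n)) (K-mirror p γ e n))

  -- Every weight met in the expansion arises from γ by the shifts in `fs`, so an invariant that
  -- forces S to vanish kills the whole series. It is used with a negative last entry and with a
  -- positive first nonzero entry.
  K-zero : (Z : Weight → Set) → (∀ γ → Z γ → S γ ≡ + 0) →
    ∀ fs → (∀ f → f ∈ fs → ∀ γ → Z γ → Z (shift f γ)) →
    ∀ γ → Z γ → ∀ e n → K fs γ e n ≡ + 0
  K-zero Z s []       h γ z zero    zero    = s γ z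
  K-zero Z s []       h γ z zero    (suc n) = refl
  K-zero Z s []       h γ z (suc e) n       = refl
  K-zero Z s (root a b ∷ fs) h γ z e zero    = K-zero Z s fs (λ f m → h f (there m)) γ z e zero
  K-zero Z s (root a b ∷ fs) h γ z e (suc n) =
    cong₂ ℤ._+_ (K-zero Z s fs (λ f m → h f (there m)) γ z e (suc n))
                (K-zero Z s (root a b ∷ fs) h _ (h _ (here refl) γ z) e n)
  K-zero Z s (low a ∷ fs) h γ z zero n    = K-zero Z s fs (λ f m → h f (there m)) γ z zero n
  K-zero Z s (low a ∷ fs) h γ z (suc e) n =
    cong₂ ℤ._+_ (K-zero Z s fs (λ f m → h f (there m)) γ z (suc e) n)
                (K-zero Z s (low a ∷ fs) h _ (h _ (here refl) γ z) e n)

-- Finite sums, and products of series by splitting exponent vectors.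

Σ< : ℕ → (ℕ → ℤ) → ℤ
Σ< zero    f = + 0
Σ< (suc n) f = Σ< n f ℤ.+ f n

Σ<-cong : ∀ n {f g : ℕ → ℤ} → (∀ j → j < n → f j ≡ g j) → Σ< n f ≡ Σ< n g
Σ<-cong zero    h = refl
Σ<-cong (suc n) h = cong₂ ℤ._+_ (Σ<-cong n (λ j l → h j (m<n⇒m<1+n l))) (h n ≤-refl)

Σ<-zero : ∀ n {f : ℕ → ℤ} → (∀ j → j < n → f j ≡ + 0) → Σ< n f ≡ + 0
Σ<-zero zero    h = refl
Σ<-zero (suc n) h = cong₂ ℤ._+_ (Σ<-zero n (λ j l → h j (m<n⇒m<1+n l))) (h n ≤-refl)

interchange : ∀ a b c d → a ℤ.+ b ℤ.+ (c ℤ.+ d) ≡ a ℤ.+ c ℤ.+ (b ℤ.+ d)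
interchange = ℤR.solve-∀

Σ<-+ : ∀ n (f g : ℕ → ℤ) → Σ< n (λ j → f j ℤ.+ g j) ≡ Σ< n f ℤ.+ Σ< n g
Σ<-+ zero    f g = refl
Σ<-+ (suc n) f g = trans (cong (ℤ._+ (f n ℤ.+ g n)) (Σ<-+ n f g)) (interchange (Σ< n f) (Σ< n g) (f n) (g n))

Σ<-front : ∀ n (f : ℕ → ℤ) → Σ< (suc n) f ≡ f 0 ℤ.+ Σ< n (λ j → f (suc j))
Σ<-front zero    f = trans (ℤP.+-identityˡ (f 0)) (sym (ℤP.+-identityʳ (f 0)))
Σ<-front (suc n) f = trans (cong (ℤ._+ f (suc n)) (Σ<-front n f)) (ℤP.+-assoc (f 0) _ _)

sum-applyUpTo : ∀ n (g : ℕ → ℕ) (f : ℕ → ℤ) → sumℤ (map f (applyUpTo g n)) ≡ Σ< n (λ j → f (g j))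
sum-applyUpTo zero    g f = refl
sum-applyUpTo (suc n) g f =
  trans (cong (λ z → f (g 0) ℤ.+ z) (sum-applyUpTo n (λ j → g (suc j)) f)) (sym (Σ<-front n (λ j → f (g j))))

sumℤ-upTo : ∀ n (f : ℕ → ℤ) → sumℤ (map f (upTo n)) ≡ Σ< n f
sumℤ-upTo n f = sum-applyUpTo n (λ j → j) f

sumℤ-++ : ∀ xs ys → sumℤ (xs ++ ys) ≡ sumℤ xs ℤ.+ sumℤ ys
sumℤ-++ []       ys = sym (ℤP.+-identityˡ _)
sumℤ-++ (x ∷ xs) ys = trans (cong (λ z → x ℤ.+ z) (sumℤ-++ xs ys)) (sym (ℤP.+-assoc x _ _))

sumℤ-concatMap : ∀ {A B : Set} (φ : B → ℤ) (g : A → List B) xs →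
  sumℤ (map φ (concatMap g xs)) ≡ sumℤ (map (λ x → sumℤ (map φ (g x))) xs)
sumℤ-concatMap φ g []       = refl
sumℤ-concatMap φ g (x ∷ xs) =
  trans (cong sumℤ (map-++ φ (g x) (concatMap g xs)))
    (trans (sumℤ-++ (map φ (g x)) _) (cong (λ z → sumℤ (map φ (g x)) ℤ.+ z) (sumℤ-concatMap φ g xs)))

sumℤ-map-cong : ∀ {A : Set} {f g : A → ℤ} → f ≗ g → ∀ xs → sumℤ (map f xs) ≡ sumℤ (map g xs)
sumℤ-map-cong h xs = cong sumℤ (map-cong h xs)

splitΣ : List ℕ → (List ℕ → List ℕ → ℤ) → ℤ
splitΣ []       φ = φ [] []
splitΣ (a ∷ as) φ = Σ< (suc a) (λ b → splitΣ as (λ β γ → φ (b ∷ β) (a ∸ b ∷ γ)))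

below-Σ : ∀ η (φ : List ℕ → List ℕ → ℤ) →
  sumℤ (map (λ β → φ β (zipWith _∸_ η β)) (below η)) ≡ splitΣ η φ
below-Σ []       φ = ℤP.+-identityʳ _
below-Σ (a ∷ as) φ =
  trans (sumℤ-concatMap (λ β → φ β (zipWith _∸_ (a ∷ as) β)) (λ b → map (b ∷_) (below as)) (upTo (suc a)))
    (trans (sumℤ-upTo (suc a) _)
      (Σ<-cong (suc a) λ b _ → trans (cong sumℤ (sym (map-∘ (below as)))) (below-Σ as (λ β γ → φ (b ∷ β) (a ∸ b ∷ γ)))))

⊛-Σ : ∀ F G η → (F ⊛ G) η ≡ splitΣ η (λ β γ → F β ℤ.* G γ)
⊛-Σ F G η = below-Σ η (λ β γ → F β ℤ.* G γ)

splitΣ-cong : ∀ η {φ ψ : List ℕ → List ℕ → ℤ} → (∀ β γ → φ β γ ≡ ψ β γ) → splitΣ η φ ≡ splitΣ η ψ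
splitΣ-cong []       h = h [] []
splitΣ-cong (a ∷ as) h = Σ<-cong (suc a) (λ b _ → splitΣ-cong as (λ β γ → h (b ∷ β) (a ∸ b ∷ γ)))

splitΣ-+ : ∀ η (φ ψ : List ℕ → List ℕ → ℤ) → splitΣ η (λ β γ → φ β γ ℤ.+ ψ β γ) ≡ splitΣ η φ ℤ.+ splitΣ η ψ
splitΣ-+ []       φ ψ = refl
splitΣ-+ (a ∷ as) φ ψ = trans (Σ<-cong (suc a) (λ b _ → splitΣ-+ as _ _)) (Σ<-+ (suc a) _ _)

splitΣ-zero : ∀ η {φ : List ℕ → List ℕ → ℤ} → (∀ β γ → φ β γ ≡ + 0) → splitΣ η φ ≡ + 0
splitΣ-zero []       h = h [] []
splitΣ-zero (a ∷ as) h = Σ<-zero (suc a) (λ b _ → splitΣ-zero as (λ β γ → h (b ∷ β) (a ∸ b ∷ γ)))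

splitΣ-snoc : ∀ η e (φ : List ℕ → List ℕ → ℤ) →
  splitΣ (η ++ e ∷ []) φ ≡ splitΣ η (λ β γ → Σ< (suc e) (λ b → φ (β ++ b ∷ []) (γ ++ e ∸ b ∷ [])))
splitΣ-snoc []       e φ = refl
splitΣ-snoc (a ∷ as) e φ = Σ<-cong (suc a) (λ b _ → splitΣ-snoc as e _)

⊛-snoc : ∀ F G η e → (F ⊛ G) (η ++ e ∷ []) ≡
  splitΣ η (λ β γ → Σ< (suc e) (λ b → F (β ++ b ∷ []) ℤ.* G (γ ++ e ∸ b ∷ [])))
⊛-snoc F G η e = trans (⊛-Σ F G (η ++ e ∷ [])) (splitΣ-snoc η e (λ β γ → F β ℤ.* G γ))

⊛-cong : ∀ {F F' G G' : SF} → F ≗ F' → G ≗ G' → (F ⊛ G) ≗ (F' ⊛ G')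
⊛-cong {F} {F'} {G} {G'} f g η =
  trans (⊛-Σ F G η) (trans (splitΣ-cong η (λ β γ → cong₂ ℤ._*_ (f β) (g γ))) (sym (⊛-Σ F' G' η)))

⊛-congˡ : ∀ F F' G → F ≗ F' → (F ⊛ G) ≗ (F' ⊛ G)
⊛-congˡ F F' G h = ⊛-cong {F} {F'} {G} {G} h (λ _ → refl)

⊛-congʳ : ∀ F G G' → G ≗ G' → (F ⊛ G) ≗ (F ⊛ G')
⊛-congʳ F G G' h = ⊛-cong {F} {F} {G} {G'} (λ _ → refl) h

⊛-+ˡ : ∀ F F' G → ((F ⊕ F') ⊛ G) ≗ ((F ⊛ G) ⊕ (F' ⊛ G))
⊛-+ˡ F F' G η =
  trans (⊛-Σ (F ⊕ F') G η)
    (trans (splitΣ-cong η (λ β γ → ℤP.*-distribʳ-+ (G γ) (F β) (F' β)))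
      (trans (splitΣ-+ η _ _) (sym (cong₂ ℤ._+_ (⊛-Σ F G η) (⊛-Σ F' G η)))))

⊛-+ʳ : ∀ F G G' → (F ⊛ (G ⊕ G')) ≗ ((F ⊛ G) ⊕ (F ⊛ G'))
⊛-+ʳ F G G' η =
  trans (⊛-Σ F (G ⊕ G') η)
    (trans (splitΣ-cong η (λ β γ → ℤP.*-distribˡ-+ (F β) (G γ) (G' γ)))
      (trans (splitΣ-+ η _ _) (sym (cong₂ ℤ._+_ (⊛-Σ F G η) (⊛-Σ F G' η)))))

⊛-zeroˡ : ∀ F G → (∀ η → F η ≡ + 0) → ∀ η → (F ⊛ G) η ≡ + 0
⊛-zeroˡ F G h η = trans (⊛-Σ F G η) (splitΣ-zero η (λ β γ → trans (cong (ℤ._* G γ) (h β)) (ℤP.*-zeroˡ (G γ))))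

⊛-zeroʳ : ∀ F G → (∀ η → G η ≡ + 0) → ∀ η → (F ⊛ G) η ≡ + 0
⊛-zeroʳ F G h η = trans (⊛-Σ F G η) (splitΣ-zero η (λ β γ → trans (cong (F β ℤ.*_) (h γ)) (ℤP.*-zeroʳ (F β))))

-- Determinants: the last variable, and the exchange of rows.

sgn : ℕ → ℤ
sgn j = if (j % 2) ≡ᵇ 0 then + 1 else ℤ.- (+ 1)

skip : ℕ → ℕ → ℕ
skip j c = if c <ᵇ j then c else suc c

minorAt : {A : Set} → (ℕ → ℕ → A) → ℕ → ℕ → ℕ → A
minorAt M j i c = M (suc i) (skip j c)

foldr-⊕ : ∀ (t : ℕ → SF) xs η → foldr _⊕_ zeroSF (map t xs) η ≡ sumℤ (map (λ j → t j η) xs)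
foldr-⊕ t []       η = refl
foldr-⊕ t (x ∷ xs) η = cong (λ z → t x η ℤ.+ z) (foldr-⊕ t xs η)

det-unfold : ∀ n M η →
  det (suc n) M η ≡ Σ< (suc n) (λ j → sgn j ℤ.* (M 0 j ⊛ det n (λ i c → M (suc i) (skip j c))) η)
det-unfold n M η = trans (foldr-⊕ t (upTo (suc n)) η) (sumℤ-upTo (suc n) (λ j → t j η))
  where
  t : ℕ → SF
  t j η = sgn j ℤ.* (M 0 j ⊛ det n (minorAt M j)) η

det-cong : ∀ n {M N : ℕ → ℕ → SF} → (∀ i → i < n → ∀ j → M i j ≗ N i j) → det n M ≗ det n N
det-cong zero    h η = refl
det-cong (suc n) {M} {N} h η =
  trans (det-unfold n M η)
    (trans (Σ<-cong (suc n) (λ j _ → cong (sgn j ℤ.*_)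
             (⊛-cong (h 0 (s≤s z≤n) j) (det-cong n (λ i l c → h (suc i) (s≤s l) (skip j c))) η)))
      (sym (det-unfold n N η)))

<ᵇ-true : ∀ {a b} → a < b → (a <ᵇ b) ≡ true
<ᵇ-true l = Equivalence.to T-≡ (<⇒<ᵇ l)

<ᵇ-false : ∀ {a b} → b ≤ a → (a <ᵇ b) ≡ false
<ᵇ-false {a} {b} l with a <ᵇ b in eq
... | false = refl
... | true  = ⊥-elim (<⇒≱ (<ᵇ⇒< a b (Equivalence.from T-≡ eq)) l)

skip-< : ∀ {j c} → c < j → skip j c ≡ c
skip-< l rewrite <ᵇ-true l = refl

skip-≥ : ∀ {j c} → j ≤ c → skip j c ≡ suc c
skip-≥ l rewrite <ᵇ-false l = refl

skip-bound : ∀ j c n → c < n → skip j c < suc n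
skip-bound j c n l with c <ᵇ j
... | true  = m<n⇒m<1+n l
... | false = s≤s l

skip-skip : ∀ a b c → a ≤ b → skip (suc b) (skip a c) ≡ skip a (skip b c)
skip-skip a b c l with c <? a
... | yes p = trans (cong (skip (suc b)) (skip-< {a} {c} p)) (trans (skip-< {suc b} {c} (lin≤ (c ∷ a ∷ b ∷ []) 1 (# 1 ⊹ $ 0) (# 1 ⊹ $ 2) (# 1 ⊹ $ 0 ⊴ $ 1 ∋ p ∷ $ 1 ⊴ $ 2 ∋ l ∷ [])))
                (sym (trans (cong (skip a) (skip-< {b} {c} (lin≤ (c ∷ a ∷ b ∷ []) 1 (# 1 ⊹ $ 0) ($ 2) (# 1 ⊹ $ 0 ⊴ $ 1 ∋ p ∷ $ 1 ⊴ $ 2 ∋ l ∷ [])))) (skip-< {a} {c} p))))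
... | no p with c <? b
...   | yes q = trans (cong (skip (suc b)) (skip-≥ {a} {c} (≮⇒≥ p))) (trans (skip-< {suc b} {suc c} (s≤s q))
                  (sym (trans (cong (skip a) (skip-< {b} {c} q)) (skip-≥ {a} {c} (≮⇒≥ p)))))
...   | no q = trans (cong (skip (suc b)) (skip-≥ {a} {c} (≮⇒≥ p))) (trans (skip-≥ {suc b} {suc c} (s≤s (≮⇒≥ q)))
                  (sym (trans (cong (skip a) (skip-≥ {b} {c} (≮⇒≥ q))) (skip-≥ {a} {suc c} (lin≤ (a ∷ c ∷ []) 1 ($ 0) (# 1 ⊹ $ 1) ($ 0 ⊴ $ 1 ∋ ≮⇒≥ p ∷ []))))))

sgn-suc : ∀ j → sgn (suc j) ≡ ℤ.- sgn j
sgn-suc zero          = refl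
sgn-suc (suc zero)    = refl
sgn-suc (suc (suc j)) = trans (sgn-2+ (suc j)) (trans (sgn-suc j) (cong ℤ.-_ (sym (sgn-2+ j))))
  where
  open import Data.Nat.DivMod using ([m+n]%n≡m%n)
  sgn-2+ : ∀ j → sgn (suc (suc j)) ≡ sgn j
  sgn-2+ j = cong (λ z → if z ≡ᵇ 0 then + 1 else ℤ.- (+ 1)) (trans (cong (_% 2) (+-comm 2 j)) ([m+n]%n≡m%n j 2))

det-lastRow : ∀ n M → (∀ j → j < suc n → ∀ η → M n j η ≡ + 0) → ∀ η → det (suc n) M η ≡ + 0
det-lastRow zero    M h η = trans (det-unfold 0 M η) (Σ<-zero 1 (λ j l →
  trans (cong (sgn j ℤ.*_) (⊛-zeroˡ (M 0 j) (det 0 (minorAt M j)) (h j l) η)) (ℤP.*-zeroʳ (sgn j))))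
det-lastRow (suc n) M h η = trans (det-unfold (suc n) M η) (Σ<-zero (suc (suc n)) (λ j _ →
  trans (cong (sgn j ℤ.*_) (⊛-zeroʳ (M 0 j) (det (suc n) (minorAt M j)) (det-lastRow n (minorAt M j) (λ c l → h (skip j c) (skip-bound j c (suc n) l))) η)) (ℤP.*-zeroʳ (sgn j))))

-- Multiplication by the last variable: the final exponent is lowered by one, and a zero final
-- exponent gives 0. The empty vector has no last variable, so the value there is 0 by convention.
Y : SF → SF
Y F []           = + 0
Y F (x ∷ [])     = last x
  where
  last : ℕ → ℤ
  last zero    = + 0
  last (suc x) = F (x ∷ [])
Y F (x ∷ y ∷ ys) = Y (λ ζ → F (x ∷ ζ)) (y ∷ ys)

Y-snoc-0 : ∀ F η → Y F (η ++ 0 ∷ []) ≡ + 0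
Y-snoc-0 F []           = refl
Y-snoc-0 F (x ∷ [])     = refl
Y-snoc-0 F (x ∷ y ∷ ys) = Y-snoc-0 (λ ζ → F (x ∷ ζ)) (y ∷ ys)

Y-snoc-suc : ∀ F η e → Y F (η ++ suc e ∷ []) ≡ F (η ++ e ∷ [])
Y-snoc-suc F []           e = refl
Y-snoc-suc F (x ∷ [])     e = refl
Y-snoc-suc F (x ∷ y ∷ ys) e = Y-snoc-suc (λ ζ → F (x ∷ ζ)) (y ∷ ys) e

data Snoc : List ℕ → Set where
  []   : Snoc []
  _∷ʳ_ : ∀ η e → Snoc (η ++ e ∷ [])

snoc : ∀ η → Snoc η
snoc [] = []
snoc (x ∷ xs) with snoc xs
... | []     = [] ∷ʳ x
... | η ∷ʳ e = (x ∷ η) ∷ʳ e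

Y-cong : ∀ {F G} → F ≗ G → Y F ≗ Y G
Y-cong {F} {G} h η with snoc η
... | []          = refl
... | η' ∷ʳ zero  = trans (Y-snoc-0 F η') (sym (Y-snoc-0 G η'))
... | η' ∷ʳ suc e = trans (Y-snoc-suc F η' e) (trans (h _) (sym (Y-snoc-suc G η' e)))

Y-⊛ : ∀ F G → (Y F ⊛ G) ≗ Y (F ⊛ G)
Y-⊛ F G η with snoc η
... | [] = trans (⊛-Σ (Y F) G []) refl
... | η' ∷ʳ zero = trans (⊛-snoc (Y F) G η' 0)
        (trans (splitΣ-zero η' (λ β γ → trans (ℤP.+-identityˡ _) (trans (cong (ℤ._* G (γ ++ 0 ∷ [])) (Y-snoc-0 F β)) refl)))
          (sym (Y-snoc-0 (F ⊛ G) η')))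
... | η' ∷ʳ suc e = trans (⊛-snoc (Y F) G η' (suc e))
        (trans (splitΣ-cong η' (λ β γ → trans (Σ<-front (suc e) _)
            (trans (cong₂ ℤ._+_ (cong (ℤ._* G (γ ++ suc e ∷ [])) (Y-snoc-0 F β))
                      (Σ<-cong (suc e) (λ b _ → cong (ℤ._* G (γ ++ e ∸ b ∷ [])) (Y-snoc-suc F β b)))) (ℤP.+-identityˡ _))))
          (sym (trans (Y-snoc-suc (F ⊛ G) η' e) (⊛-snoc F G η' e))))

⊛-Y : ∀ F G → (F ⊛ Y G) ≗ Y (F ⊛ G)
⊛-Y F G η with snoc η
... | [] = trans (⊛-Σ F (Y G) []) (ℤP.*-zeroʳ (F []))
... | η' ∷ʳ zero = trans (⊛-snoc F (Y G) η' 0)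
        (trans (splitΣ-zero η' (λ β γ → trans (ℤP.+-identityˡ _) (trans (cong (F (β ++ 0 ∷ []) ℤ.*_) (Y-snoc-0 G γ)) (ℤP.*-zeroʳ (F (β ++ 0 ∷ []))))))
          (sym (Y-snoc-0 (F ⊛ G) η')))
... | η' ∷ʳ suc e = trans (⊛-snoc F (Y G) η' (suc e))
        (trans (splitΣ-cong η' (λ β γ →
            trans (cong₂ ℤ._+_
              (Σ<-cong (suc e) (λ b l → cong (F (β ++ b ∷ []) ℤ.*_)
                 (trans (cong (λ z → Y G (γ ++ z ∷ [])) (+-∸-assoc 1 (≤-pred l))) (Y-snoc-suc G γ (e ∸ b)))))
              (trans (cong (F (β ++ suc e ∷ []) ℤ.*_) (trans (cong (λ z → Y G (γ ++ z ∷ [])) (n∸n≡0 (suc e))) (Y-snoc-0 G γ)))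
                 (ℤP.*-zeroʳ (F (β ++ suc e ∷ [])))))
              (ℤP.+-identityʳ _)))
          (sym (trans (Y-snoc-suc (F ⊛ G) η' e) (⊛-snoc F G η' e))))

Y-Σ : ∀ n (c : ℕ → ℤ) (F : ℕ → SF) (G : SF) → (∀ η → G η ≡ Σ< n (λ j → c j ℤ.* F j η)) →
  ∀ η → Σ< n (λ j → c j ℤ.* Y (F j) η) ≡ Y G η
Y-Σ n c F G h η with snoc η
... | []          = Σ<-zero n (λ j _ → ℤP.*-zeroʳ (c j))
... | η' ∷ʳ zero  = trans (Σ<-zero n (λ j _ → trans (cong (c j ℤ.*_) (Y-snoc-0 (F j) η')) (ℤP.*-zeroʳ (c j)))) (sym (Y-snoc-0 G η'))
... | η' ∷ʳ suc e = trans (Σ<-cong n (λ j _ → cong (c j ℤ.*_) (Y-snoc-suc (F j) η' e)))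
                      (sym (trans (Y-snoc-suc G η' e) (h _)))

-- Expansion along row 0 reduces the splitting of row r to bilinearity of the product when r = 0,
-- and to the same splitting of the minors otherwise; `Y` passes through either factor of a product.
det-row : ∀ n r (M A B : ℕ → ℕ → SF) → r < n →
  (∀ j ζ → M r j ζ ≡ A r j ζ ℤ.+ Y (B r j) ζ) →
  (∀ i → i ≢ r → ∀ j → M i j ≗ A i j) → (∀ i → i ≢ r → ∀ j → M i j ≗ B i j) →
  ∀ ζ → det n M ζ ≡ det n A ζ ℤ.+ Y (det n B) ζ
det-row (suc n) zero M A B l h ha hb ζ =
  trans (det-unfold n M ζ) (trans (Σ<-cong (suc n) (λ j _ → step j))
    (trans (Σ<-+ (suc n) _ _) (cong₂ ℤ._+_ (sym (det-unfold n A ζ)) (Y-Σ (suc n) sgn _ (det (suc n) B) (det-unfold n B) ζ))))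
  where
  mn : (ℕ → ℕ → SF) → ℕ → SF
  mn M j = det n (λ i c → M (suc i) (skip j c))
  step : ∀ j → sgn j ℤ.* (M 0 j ⊛ mn M j) ζ ≡
               sgn j ℤ.* (A 0 j ⊛ mn A j) ζ ℤ.+ sgn j ℤ.* Y (B 0 j ⊛ mn B j) ζ
  step j = trans (cong (sgn j ℤ.*_)
    (trans (⊛-congˡ (M 0 j) (A 0 j ⊕ Y (B 0 j)) (mn M j) (h j) ζ)
      (trans (⊛-+ˡ (A 0 j) (Y (B 0 j)) (mn M j) ζ)
        (cong₂ ℤ._+_ (⊛-congʳ (A 0 j) (mn M j) (mn A j) (det-cong n (λ i _ c → ha (suc i) (λ ()) (skip j c))) ζ)
          (trans (⊛-congʳ (Y (B 0 j)) (mn M j) (mn B j) (det-cong n (λ i _ c → hb (suc i) (λ ()) (skip j c))) ζ) (Y-⊛ (B 0 j) (mn B j) ζ))))))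
    (ℤP.*-distribˡ-+ (sgn j) _ _)
det-row (suc n) (suc r) M A B (s≤s l) h ha hb ζ =
  trans (det-unfold n M ζ) (trans (Σ<-cong (suc n) (λ j _ → step j))
    (trans (Σ<-+ (suc n) _ _) (cong₂ ℤ._+_ (sym (det-unfold n A ζ)) (Y-Σ (suc n) sgn _ (det (suc n) B) (det-unfold n B) ζ))))
  where
  mn : (ℕ → ℕ → SF) → ℕ → SF
  mn M j = det n (λ i c → M (suc i) (skip j c))
  ih : ∀ j ζ → mn M j ζ ≡ mn A j ζ ℤ.+ Y (mn B j) ζ
  ih j = det-row n r (minorAt M j) (minorAt A j) (minorAt B j) l (λ c → h (skip j c)) (λ i ne c → ha (suc i) (λ e → ne (suc-injective e)) (skip j c))
           (λ i ne c → hb (suc i) (λ e → ne (suc-injective e)) (skip j c))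
  step : ∀ j → sgn j ℤ.* (M 0 j ⊛ mn M j) ζ ≡
               sgn j ℤ.* (A 0 j ⊛ mn A j) ζ ℤ.+ sgn j ℤ.* Y (B 0 j ⊛ mn B j) ζ
  step j = trans (cong (sgn j ℤ.*_)
    (trans (⊛-congʳ (M 0 j) (mn M j) (mn A j ⊕ Y (mn B j)) (ih j) ζ)
      (trans (⊛-+ʳ (M 0 j) (mn A j) (Y (mn B j)) ζ)
        (cong₂ ℤ._+_ (⊛-congˡ (M 0 j) (A 0 j) (mn A j) (ha 0 (λ ()) j) ζ)
          (trans (⊛-congˡ (M 0 j) (B 0 j) (Y (mn B j)) (hb 0 (λ ()) j) ζ) (⊛-Y (B 0 j) (mn B j) ζ))))))
    (ℤP.*-distribˡ-+ (sgn j) _ _)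

constLast : ∀ n (M M' : ℕ → ℕ → SF) →
  (∀ i j η → M i j (η ++ 0 ∷ []) ≡ M' i j η) → (∀ i j η e → M i j (η ++ suc e ∷ []) ≡ + 0) →
  ∀ η → det n M (η ++ 0 ∷ []) ≡ det n M' η × (∀ e → det n M (η ++ suc e ∷ []) ≡ + 0)
constLast zero M M' h h' η = one-0 η , one-suc η
  where
  open import Data.Nat.ListAction.Properties using (sum-++)
  one-0 : ∀ η → oneSF (η ++ 0 ∷ []) ≡ oneSF η
  one-0 η = cong (λ z → if z ≡ᵇ 0 then + 1 else + 0) (trans (sum-++ η (0 ∷ [])) (+-identityʳ (sum η)))
  one-suc : ∀ η e → oneSF (η ++ suc e ∷ []) ≡ + 0
  one-suc η e = cong (λ z → if z ≡ᵇ 0 then + 1 else + 0) (trans (sum-++ η (suc e ∷ [])) (+-suc (sum η) (e + 0)))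
constLast (suc n) M M' h h' η = zeroCase , sucCase
  where
  mn : (ℕ → ℕ → SF) → ℕ → SF
  mn M j = det n (λ i c → M (suc i) (skip j c))
  ih : ∀ j η → mn M j (η ++ 0 ∷ []) ≡ mn M' j η × (∀ e → mn M j (η ++ suc e ∷ []) ≡ + 0)
  ih j = constLast n (minorAt M j) (minorAt M' j) (λ i c → h (suc i) (skip j c)) (λ i c → h' (suc i) (skip j c))
  zeroCase : det (suc n) M (η ++ 0 ∷ []) ≡ det (suc n) M' η
  zeroCase = trans (det-unfold n M (η ++ 0 ∷ [])) (trans (Σ<-cong (suc n) (λ j _ → cong (sgn j ℤ.*_)
    (trans (⊛-snoc (M 0 j) (mn M j) η 0)
      (trans (splitΣ-cong η (λ β γ → trans (ℤP.+-identityˡ _) (cong₂ ℤ._*_ (h 0 j β) (proj₁ (ih j γ))))) (sym (⊛-Σ (M' 0 j) (mn M' j) η))))))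
    (sym (det-unfold n M' η)))
  prod : ∀ j e b → b < suc (suc e) → ∀ β γ → M 0 j (β ++ b ∷ []) ℤ.* mn M j (γ ++ suc e ∸ b ∷ []) ≡ + 0
  prod j e zero    l β γ = trans (cong (M 0 j (β ++ 0 ∷ []) ℤ.*_) (proj₂ (ih j γ) e)) (ℤP.*-zeroʳ (M 0 j (β ++ 0 ∷ [])))
  prod j e (suc b) l β γ = trans (cong (ℤ._* mn M j (γ ++ e ∸ b ∷ [])) (h' 0 j β b)) refl
  sucCase : ∀ e → det (suc n) M (η ++ suc e ∷ []) ≡ + 0
  sucCase e = trans (det-unfold n M (η ++ suc e ∷ [])) (Σ<-zero (suc n) (λ j _ → trans (cong (sgn j ℤ.*_)
    (trans (⊛-snoc (M 0 j) (mn M j) η (suc e))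
      (splitΣ-zero η (λ β γ → Σ<-zero (suc (suc e)) (λ b l → prod j e b l β γ))))) (ℤP.*-zeroʳ (sgn j))))

detℤ : ℕ → (ℕ → ℕ → ℤ) → ℤ
detℤ zero    m = + 1
detℤ (suc n) m = Σ< (suc n) (λ j → sgn j ℤ.* (m 0 j ℤ.* detℤ n (λ i c → m (suc i) (skip j c))))

-- At the empty exponent vector the product of series is the product of integers, so questions of
-- sign can be settled for integer matrices.
det-[] : ∀ n M → det n M [] ≡ detℤ n (λ i j → M i j [])
det-[] zero    M = refl
det-[] (suc n) M = trans (det-unfold n M []) (Σ<-cong (suc n) (λ j _ → cong (sgn j ℤ.*_)
  (trans (ℤP.+-identityʳ _) (cong (M 0 j [] ℤ.*_) (det-[] n (minorAt M j))))))

detℤ-cong : ∀ n {m m' : ℕ → ℕ → ℤ} → (∀ i j → m i j ≡ m' i j) → detℤ n m ≡ detℤ n m'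
detℤ-cong zero    h = refl
detℤ-cong (suc n) h = Σ<-cong (suc n) (λ j _ → cong (sgn j ℤ.*_) (cong₂ ℤ._*_ (h 0 j) (detℤ-cong n (λ i c → h (suc i) (skip j c)))))

Σ<-neg : ∀ n (f : ℕ → ℤ) → Σ< n (λ j → ℤ.- f j) ≡ ℤ.- Σ< n f
Σ<-neg zero    f = refl
Σ<-neg (suc n) f = trans (cong (ℤ._+ ℤ.- f n) (Σ<-neg n f)) (sym (ℤP.neg-distrib-+ (Σ< n f) (f n)))

-- Index pairs (a, j), j < N, encode ordered pairs of distinct columns below N + 1;
-- the two encodings of an unordered pair are (a, b) and (b + 1, a) with a ≤ b.
pairs-cancel : ∀ N (X Z : ℕ → ℕ → ℤ) →
  (∀ a b → a ≤ b → X (suc b) a ℤ.+ Z a b ≡ + 0) → (∀ a b → a ≤ b → X a b ℤ.+ Z (suc b) a ≡ + 0) →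
  Σ< (suc N) (λ a → Σ< N (X a)) ℤ.+ Σ< (suc N) (λ a → Σ< N (Z a)) ≡ + 0
pairs-cancel zero    X Z p q = refl
pairs-cancel (suc N) X Z p q =
  trans (cong₂ ℤ._+_ (grow X) (grow Z))
    (trans (lem (total X) (Σ< (suc N) (λ a → X a N)) (Σ< (suc N) (X (suc N))) (total Z) (Σ< (suc N) (λ a → Z a N)) (Σ< (suc N) (Z (suc N))))
      (cong₂ ℤ._+_ (cong₂ ℤ._+_ (pairs-cancel N X Z p q) c₁) c₂))
  where
  total : (ℕ → ℕ → ℤ) → ℤ
  total X = Σ< (suc N) (λ a → Σ< N (X a))
  grow : ∀ (X : ℕ → ℕ → ℤ) → Σ< (suc (suc N)) (λ a → Σ< (suc N) (X a)) ≡
    Σ< (suc N) (λ a → Σ< N (X a)) ℤ.+ Σ< (suc N) (λ a → X a N) ℤ.+ Σ< (suc N) (X (suc N))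
  grow X = cong (ℤ._+ Σ< (suc N) (X (suc N))) (Σ<-+ (suc N) (λ a → Σ< N (X a)) (λ a → X a N))
  lem = ring6
  c₁ : Σ< (suc N) (λ a → X a N) ℤ.+ Σ< (suc N) (Z (suc N)) ≡ + 0
  c₁ = trans (sym (Σ<-+ (suc N) _ _)) (Σ<-zero (suc N) (λ a l → q a N (≤-pred l)))
  c₂ : Σ< (suc N) (X (suc N)) ℤ.+ Σ< (suc N) (λ a → Z a N) ≡ + 0
  c₂ = trans (sym (Σ<-+ (suc N) _ _)) (Σ<-zero (suc N) (λ a l → p a N (≤-pred l)))

swapIdx-suc : ∀ x i → swapIdx (suc x) (suc i) ≡ suc (swapIdx x i)
swapIdx-suc x i with i ≡ᵇ x | i ≡ᵇ suc x
... | true  | _     = refl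
... | false | true  = refl
... | false | false = refl

-- Below the top, the exchange takes place inside every minor. For rows 0 and 1 both determinants
-- are expanded twice; the terms that give the same columns to the same original rows carry opposite
-- signs.
detℤ-swap : ∀ n x (m : ℕ → ℕ → ℤ) → suc x < n → detℤ n (λ i → m (swapIdx x i)) ≡ ℤ.- detℤ n m
detℤ-swap (suc n) (suc x) m (s≤s l) =
  trans (Σ<-cong (suc n) (λ j _ → trans (cong (λ z → sgn j ℤ.* (m 0 j ℤ.* z))
     (trans (detℤ-cong n (λ i c → cong (λ r → m r (skip j c)) (swapIdx-suc x i))) (detℤ-swap n x (λ i c → m (suc i) (skip j c)) l)))
     (lem (sgn j) (m 0 j) _)))
   (Σ<-neg (suc n) _)
  where
  lem = ring7
detℤ-swap (suc zero) zero m (s≤s ())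
detℤ-swap (suc (suc n)) zero m l =
  from-sum (trans (cong₂ ℤ._+_ (expand m) (expand (λ i → m (swapIdx 0 i)))) (pairs-cancel (suc n) (W m) (W (λ i → m (swapIdx 0 i))) p q))
  where
  from-sum : ∀ {a b : ℤ} → b ℤ.+ a ≡ + 0 → a ≡ ℤ.- b
  from-sum {a} {b} e = trans (lem a b) (trans (cong (ℤ._+ ℤ.- b) e) (ℤP.+-identityˡ _))
    where
    lem = ring8
  P : (ℕ → ℕ → ℤ) → ℕ → ℕ → ℤ
  P w a j = detℤ n (λ i c → w (suc (suc i)) (skip a (skip j c)))
  W : (ℕ → ℕ → ℤ) → ℕ → ℕ → ℤ
  W w a j = sgn a ℤ.* (w 0 a ℤ.* (sgn j ℤ.* (w 1 (skip a j) ℤ.* P w a j)))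
  factor : ∀ n c d (f : ℕ → ℤ) → c ℤ.* (d ℤ.* Σ< n f) ≡ Σ< n (λ j → c ℤ.* (d ℤ.* f j))
  factor zero    c d f = lem c d
    where
    lem = ring9
  factor (suc n) c d f = trans (lem c d (Σ< n f) (f n)) (cong (ℤ._+ c ℤ.* (d ℤ.* f n)) (factor n c d f))
    where
    lem = ring10
  expand : ∀ w → detℤ (suc (suc n)) w ≡ Σ< (suc (suc n)) (λ a → Σ< (suc n) (W w a))
  expand w = Σ<-cong (suc (suc n)) (λ a _ →
    factor (suc n) (sgn a) (w 0 a) (λ j → sgn j ℤ.* (w 1 (skip a j) ℤ.* P w a j)))
  P-sym : ∀ a b → a ≤ b → P m (suc b) a ≡ P m a b
  P-sym a b l = detℤ-cong n (λ i c → cong (m (suc (suc i))) (skip-skip a b c l))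
  lem = ring11
  pair : ∀ r r' a b → a ≤ b →
    sgn (suc b) ℤ.* (m r (suc b) ℤ.* (sgn a ℤ.* (m r' (skip (suc b) a) ℤ.* P m (suc b) a))) ℤ.+
    sgn a ℤ.* (m r' a ℤ.* (sgn b ℤ.* (m r (skip a b) ℤ.* P m a b))) ≡ + 0
  pair r r' a b l rewrite sgn-suc b | skip-< {suc b} {a} (s≤s l) | skip-≥ {a} {b} l | P-sym a b l =
    lem (sgn b) (sgn a) (m r (suc b)) (m r' a) (P m a b)
  p : ∀ a b → a ≤ b → W m (suc b) a ℤ.+ W (λ i → m (swapIdx 0 i)) a b ≡ + 0
  p = pair 0 1
  q : ∀ a b → a ≤ b → W m a b ℤ.+ W (λ i → m (swapIdx 0 i)) (suc b) a ≡ + 0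
  q a b l = trans (ℤP.+-comm (W m a b) (W (λ i → m (swapIdx 0 i)) (suc b) a)) (pair 1 0 a b l)

-- Permutations of factor lists.

-- Factor lists are compared through membership alone, since they have no repetitions; the resulting
-- permutation is the form that `K-perm` consumes.
set-↭ : {A : Set} {xs ys : List A} → Unique xs → Unique ys →
  (∀ {x} → x ∈ xs → x ∈ ys) → (∀ {x} → x ∈ ys → x ∈ xs) → xs ↭ ys
set-↭ u w f g = ∼bag⇒↭ (unique∧set⇒bag u w (mk⇔ f g))

unique-concatMap : {A B : Set} (f : A → List B) {xs : List A} → Unique xs → (∀ x → Unique (f x)) →
  (∀ {x y b} → b ∈ f x → b ∈ f y → x ≡ y) → Unique (concatMap f xs)
unique-concatMap f {[]}     []       u d = []
unique-concatMap f {x ∷ xs} (n ∷ us) u d = UniqueP.++⁺ (u x) (unique-concatMap f us u d) (λ (p , q) → sep n q p)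
  where
  sep : ∀ {b ys} → All (x ≢_) ys → b ∈ concatMap f ys → b ∈ f x → ⊥
  sep {b} {y ∷ ys} (m ∷ ms) q p with ∈-++⁻ (f y) q
  ... | inj₁ r = m (d p r)
  ... | inj₂ r = sep ms r p

lows : ℕ → ℕ → List Factor
lows zero    i = []
lows (suc m) i = low i ∷ lows m (suc i)

∈-lows⁻ : ∀ m i {f} → f ∈ lows m i → ∃[ a ] f ≡ low a × i ≤ a × a < i + m
∈-lows⁻ (suc m) i (here refl) = i , refl , ≤-refl , (lin≤ (i ∷ m ∷ []) 1 (# 1 ⊹ $ 0) ($ 0 ⊹ (# 1 ⊹ $ 1)) [])
∈-lows⁻ (suc m) i (there p) with ∈-lows⁻ m (suc i) p
... | a , e , l , u = a , e , (lin≤ (i ∷ a ∷ []) 1 ($ 0) ($ 1) (# 1 ⊹ $ 0 ⊴ $ 1 ∋ l ∷ [])) , (lin≤ (a ∷ i ∷ m ∷ []) 1 (# 1 ⊹ $ 0) ($ 1 ⊹ (# 1 ⊹ $ 2)) (# 1 ⊹ $ 0 ⊴ # 1 ⊹ ($ 1 ⊹ $ 2) ∋ u ∷ []))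

∈-lows⁺ : ∀ m i a → i ≤ a → a < i + m → low a ∈ lows m i
∈-lows⁺ zero    i a l u = ⊥-elim (lin⊥ (i ∷ a ∷ []) ($ 0 ⊴ $ 1 ∋ l ∷ # 1 ⊹ $ 1 ⊴ $ 0 ⊹ # 0 ∋ u ∷ []))
∈-lows⁺ (suc m) i a l u with i ≟ a
... | yes refl = here refl
... | no ne    = there (∈-lows⁺ m (suc i) a (≤∧≢⇒< l ne) (lin≤ (a ∷ i ∷ m ∷ []) 1 (# 1 ⊹ $ 0) (# 1 ⊹ $ 1 ⊹ $ 2) (# 1 ⊹ $ 0 ⊴ $ 1 ⊹ (# 1 ⊹ $ 2) ∋ u ∷ [])))

lows-unique : ∀ m i → Unique (lows m i)
lows-unique zero    i = []
lows-unique (suc m) i = All.tabulate apart ∷ lows-unique m (suc i)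
  where
  apart : ∀ {f} → f ∈ lows m (suc i) → low i ≢ f
  apart p refl with ∈-lows⁻ m (suc i) p
  ... | a , refl , l , _ = lin⊥ (a ∷ []) (# 1 ⊹ $ 0 ⊴ $ 0 ∋ l ∷ [])

swapF-inv : ∀ x f → swapF x (swapF x f) ≡ f
swapF-inv x (root a b) = cong₂ root (swapIdx-inv x a) (swapIdx-inv x b)
swapF-inv x (low a)    = cong low (swapIdx-inv x a)

swapF-injective : ∀ x {f g} → swapF x f ≡ swapF x g → f ≡ g
swapF-injective x {f} {g} e = trans (sym (swapF-inv x f)) (trans (cong (swapF x) e) (swapF-inv x g))

swap-↭ : ∀ x {fs} → Unique fs → (∀ {f} → f ∈ fs → swapF x f ∈ fs) → map (swapF x) fs ↭ fs
swap-↭ x {fs} u h = set-↭ (UniqueP.map⁺ (swapF-injective x) u) u to from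
  where
  to : ∀ {f} → f ∈ map (swapF x) fs → f ∈ fs
  to p with ∈-map⁻ (swapF x) p
  ... | g , q , refl = h q
  from : ∀ {f} → f ∈ fs → f ∈ map (swapF x) fs
  from {f} p = subst (_∈ map (swapF x) fs) (swapF-inv x f) (∈-map⁺ (swapF x) (h p))

swapIdx-range : ∀ {x a} i j → (x ≢ a → suc x ≢ a → i ≤ a × a < j) → i ≤ x × suc x < j → i ≤ swapIdx x a × swapIdx x a < j
swapIdx-range {x} {a} i j h (l , u) with cmp x a
... | is-x refl  = subst (λ z → i ≤ z × z < j) (sym (swapIdx-x x)) ((lin≤ (i ∷ x ∷ []) 1 ($ 0) (# 1 ⊹ $ 1) ($ 0 ⊴ $ 1 ∋ l ∷ [])) , u)
... | is-sx refl = subst (λ z → i ≤ z × z < j) (sym (swapIdx-sx x)) (l , (lin≤ (x ∷ j ∷ []) 1 (# 1 ⊹ $ 0) ($ 1) (# 1 ⊹ (# 1 ⊹ $ 0) ⊴ $ 1 ∋ u ∷ [])))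
... | other p q  = subst (λ z → i ≤ z × z < j) (sym (swapIdx-else p q)) (h (λ e → p (sym e)) (λ e → q (sym e)))

lows-swap : ∀ x m i → (suc x < i) ⊎ (i ≤ x × suc x < i + m) → ∀ {f} → f ∈ lows m i → swapF x f ∈ lows m i
lows-swap x m i h p with ∈-lows⁻ m i p
lows-swap x m i (inj₁ s) p | a , refl , l , u =
  subst (λ z → low z ∈ lows m i) (sym (swapIdx-else (λ e → (lin⊥ (a ∷ x ∷ i ∷ []) ($ 0 ≐ $ 1 ∋ e ∷ # 1 ⊹ (# 1 ⊹ $ 1) ⊴ $ 2 ∋ s ∷ $ 2 ⊴ $ 0 ∋ l ∷ []))) (λ e → (lin⊥ (a ∷ x ∷ i ∷ []) ($ 0 ≐ # 1 ⊹ $ 1 ∋ e ∷ # 1 ⊹ (# 1 ⊹ $ 1) ⊴ $ 2 ∋ s ∷ $ 2 ⊴ $ 0 ∋ l ∷ []))))) p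
lows-swap x m i (inj₂ r) p | a , refl , l , u with swapIdx-range {x} {a} i (i + m) (λ _ _ → l , u) r
... | l' , u' = ∈-lows⁺ m i _ l' u'

-- Schur functions of integral weights: branching, antisymmetry, vanishing.

SchurMatrix : Weight → ℕ → ℕ → SF
SchurMatrix γ i j = hSF (γ i ℤ.+ + j ℤ.- + i)

Schur : ℕ → Weight → SF
Schur ℓ γ = det ℓ (SchurMatrix γ)

Schur-cong : ∀ ℓ {γ γ'} η → (∀ r → r < ℓ → γ r ≡ γ' r) → Schur ℓ γ η ≡ Schur ℓ γ' η
Schur-cong ℓ η h = det-cong ℓ (λ i l j ζ → cong (λ z → hSF (z ℤ.+ + j ℤ.- + i) ζ) (h i l)) η

-- The part of h_a free of the last variable.
hInit : ℤ → SF
hInit a ζ = hSF a ζ ℤ.- Y (hSF (a ℤ.- + 1)) ζ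

sum-snoc : ∀ η e → sum (η ++ e ∷ []) ≡ sum η + e
sum-snoc []      e = +-identityʳ e
sum-snoc (x ∷ η) e = trans (cong (λ z → x + z) (sum-snoc η e)) (sym (+-assoc x (sum η) e))

hSF-snoc-0 : ∀ a η → hSF a (η ++ 0 ∷ []) ≡ hSF a η
hSF-snoc-0 (+ a)    η = cong (λ z → if z ≡ᵇ a then + 1 else + 0) (trans (sum-snoc η 0) (+-identityʳ _))
hSF-snoc-0 -[1+ a ] η = refl

hSF-snoc-suc : ∀ a η e → hSF a (η ++ suc e ∷ []) ≡ hSF (a ℤ.- + 1) (η ++ e ∷ [])
hSF-snoc-suc (+ zero)  η e = cong (λ z → if z ≡ᵇ 0 then + 1 else + 0) (trans (sum-snoc η (suc e)) (+-suc _ _))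
hSF-snoc-suc (+ suc a) η e = cong₂ (λ y z → if y ≡ᵇ z then + 1 else + 0)
  (trans (sum-snoc η (suc e)) (trans (+-suc _ _) (cong suc (sym (sum-snoc η e))))) refl
hSF-snoc-suc -[1+ a ]  η e = refl

hInit-snoc-0 : ∀ a η → hInit a (η ++ 0 ∷ []) ≡ hSF a η
hInit-snoc-0 a η = trans (cong₂ ℤ._-_ (hSF-snoc-0 a η) (Y-snoc-0 (hSF (a ℤ.- + 1)) η)) (ℤP.+-identityʳ _)

hInit-snoc-suc : ∀ a η e → hInit a (η ++ suc e ∷ []) ≡ + 0
hInit-snoc-suc a η e =
  trans (cong₂ ℤ._-_ (hSF-snoc-suc a η e) (Y-snoc-suc (hSF (a ℤ.- + 1)) η e)) (ℤP.+-inverseʳ (hSF (a ℤ.- + 1) (η ++ e ∷ [])))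

-- Rows below i carry only the variables before the last.
mixedMatrix : ℕ → Weight → ℕ → ℕ → SF
mixedMatrix i γ r j = if r <ᵇ i then hInit (γ r ℤ.+ + j ℤ.- + r) else hSF (γ r ℤ.+ + j ℤ.- + r)

-- With y the last variable, h_a is its part free of y plus y h_(a-1). Row i splits accordingly, and
-- the second summand belongs to the weight lowered in row i.
mixed-step : ∀ ℓ i γ → i < ℓ → ∀ ζ →
  det ℓ (mixedMatrix i γ) ζ ≡ det ℓ (mixedMatrix (suc i) γ) ζ ℤ.+ Y (det ℓ (mixedMatrix i (shift (low i) γ))) ζ
mixed-step ℓ i γ l = det-row ℓ i (mixedMatrix i γ) (mixedMatrix (suc i) γ) (mixedMatrix i (shift (low i) γ)) l rowᵢ rowsA rowsB
  where
  lem₁ = ring12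
  lem₂ = ring13
  rowᵢ : ∀ j ζ → mixedMatrix i γ i j ζ ≡ mixedMatrix (suc i) γ i j ζ ℤ.+ Y (mixedMatrix i (shift (low i) γ) i j) ζ
  rowᵢ j ζ rewrite <ᵇ-false {i} {i} ≤-refl | <ᵇ-true {i} {suc i} ≤-refl | δ-same i =
    trans (lem₁ (hSF a ζ) (Y (hSF (a ℤ.- + 1)) ζ))
      (cong (λ z → hInit a ζ ℤ.+ Y (hSF z) ζ) (lem₂ (γ i) (+ j) (+ i)))
    where
    a = γ i ℤ.+ + j ℤ.- + i
  rowsA : ∀ r → r ≢ i → ∀ j → mixedMatrix i γ r j ≗ mixedMatrix (suc i) γ r j
  rowsA r ne j ζ with r <? i
  ... | yes p rewrite <ᵇ-true p | <ᵇ-true {r} {suc i} (m<n⇒m<1+n p) = refl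
  ... | no p rewrite <ᵇ-false {r} {i} (≮⇒≥ p) | <ᵇ-false {r} {suc i} (≤∧≢⇒< (≮⇒≥ p) (λ e → ne (sym e))) = refl
  rowsB : ∀ r → r ≢ i → ∀ j → mixedMatrix i γ r j ≗ mixedMatrix i (shift (low i) γ) r j
  rowsB r ne j ζ rewrite δ-diff {i} {r} ne | ℤP.+-identityʳ (γ r) = refl

module _ (ℓ : ℕ) (η : List ℕ) where
  open Expansion (λ γ → Schur ℓ γ η) (λ h → Schur-cong ℓ η (λ r _ → h r))

  mixed-K : ∀ m i → i + m ≡ ℓ → ∀ e γ → det ℓ (mixedMatrix i γ) (η ++ e ∷ []) ≡ K (lows m i) γ e 0
  mixed-K zero i eq e γ rewrite trans (sym (+-identityʳ i)) eq =
    trans (det-cong ℓ (λ r l j ζ → cong (λ b → (if b then hInit (γ r ℤ.+ + j ℤ.- + r) else hSF (γ r ℤ.+ + j ℤ.- + r)) ζ) (<ᵇ-true l)) (η ++ e ∷ []))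
      (last e)
    where
    C = constLast ℓ (λ r j → hInit (γ r ℤ.+ + j ℤ.- + r)) (SchurMatrix γ) (λ r j ζ → hInit-snoc-0 (γ r ℤ.+ + j ℤ.- + r) ζ) (λ r j ζ e → hInit-snoc-suc (γ r ℤ.+ + j ℤ.- + r) ζ e) η
    last : ∀ e → det ℓ (λ r j → hInit (γ r ℤ.+ + j ℤ.- + r)) (η ++ e ∷ []) ≡ K [] γ e 0
    last zero    = proj₁ C
    last (suc e) = proj₂ C e
  mixed-K (suc m) i eq zero γ =
    trans (mixed-step ℓ i γ (lin≤ (i ∷ m ∷ ℓ ∷ []) 1 (# 1 ⊹ $ 0) ($ 2) ($ 0 ⊹ (# 1 ⊹ $ 1) ≐ $ 2 ∋ eq ∷ [])) (η ++ 0 ∷ []))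
      (trans (cong₂ ℤ._+_ (mixed-K m (suc i) (≤-antisym (lin≤ (i ∷ m ∷ ℓ ∷ []) 1 (# 1 ⊹ $ 0 ⊹ $ 1) ($ 2) ($ 0 ⊹ (# 1 ⊹ $ 1) ≐ $ 2 ∋ eq ∷ [])) (lin≤ (i ∷ m ∷ ℓ ∷ []) 1 ($ 2) (# 1 ⊹ $ 0 ⊹ $ 1) ($ 2 ≐ $ 0 ⊹ (# 1 ⊹ $ 1) ∋ sym eq ∷ []))) 0 γ) (Y-snoc-0 _ η)) (ℤP.+-identityʳ _))
  mixed-K (suc m) i eq (suc e) γ =
    trans (mixed-step ℓ i γ (lin≤ (i ∷ m ∷ ℓ ∷ []) 1 (# 1 ⊹ $ 0) ($ 2) ($ 0 ⊹ (# 1 ⊹ $ 1) ≐ $ 2 ∋ eq ∷ [])) (η ++ suc e ∷ []))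
      (cong₂ ℤ._+_ (mixed-K m (suc i) (≤-antisym (lin≤ (i ∷ m ∷ ℓ ∷ []) 1 (# 1 ⊹ $ 0 ⊹ $ 1) ($ 2) ($ 0 ⊹ (# 1 ⊹ $ 1) ≐ $ 2 ∋ eq ∷ [])) (lin≤ (i ∷ m ∷ ℓ ∷ []) 1 ($ 2) (# 1 ⊹ $ 0 ⊹ $ 1) ($ 2 ≐ $ 0 ⊹ (# 1 ⊹ $ 1) ∋ sym eq ∷ []))) (suc e) γ)
        (trans (Y-snoc-suc (det ℓ (mixedMatrix i (shift (low i) γ))) η e) (mixed-K (suc m) i eq e (shift (low i) γ))))

  -- The branching s_γ(x, y) = ∏ (1 - y / z_i)^(-1) s_γ(x), where the exponent e of the new variable
  -- y is read as the exponent of u.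
  Schur-snoc : ∀ e γ → Schur ℓ γ (η ++ e ∷ []) ≡ K (lows ℓ 0) γ e 0
  Schur-snoc e γ = mixed-K ℓ 0 refl e γ

-- Induction on the number of variables. With none, the integer matrix of `dot x γ` is that of γ
-- with two rows exchanged; a new variable brings in the factors `lows ℓ 0`, which are stable under
-- the transposition.
Schur-anti : ∀ ℓ x → suc x < ℓ → ∀ η γ → Schur ℓ (dot x γ) η ≡ ℤ.- Schur ℓ γ η
Schur-anti ℓ x l η = go (reverseView η)
  where
  dot-entry : ∀ γ i j → dot x γ i ℤ.+ + j ℤ.- + i ≡ γ (swapIdx x i) ℤ.+ + j ℤ.- + swapIdx x i
  dot-entry γ i j with cmp x i
  ... | is-x refl  rewrite dot-x x γ | swapIdx-x x = trans (lem (γ (suc x)) (+ j) (+ x)) (cong (λ z → γ (suc x) ℤ.+ + j ℤ.- z) (sym (ℤP.pos-+ 1 x)))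
    where
    lem = ring14
  ... | is-sx refl rewrite dot-sx x γ | swapIdx-sx x = trans (cong (λ z → γ x ℤ.+ + 1 ℤ.+ + j ℤ.- z) (ℤP.pos-+ 1 x)) (lem (γ x) (+ j) (+ x))
    where
    lem = ring15
  ... | other p q  rewrite dot-else γ p q | swapIdx-else p q = refl
  go : ∀ {η} → Reverse η → ∀ γ → Schur ℓ (dot x γ) η ≡ ℤ.- Schur ℓ γ η
  go [] γ =
    trans (det-[] ℓ (SchurMatrix (dot x γ)))
      (trans (detℤ-cong ℓ (λ i j → cong (λ z → hSF z []) (dot-entry γ i j)))
        (trans (detℤ-swap ℓ x (λ i j → SchurMatrix γ i j []) l) (cong ℤ.-_ (sym (det-[] ℓ (SchurMatrix γ))))))
  go (η ∶ rs ∶ʳ e) γ =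
    trans (Schur-snoc ℓ η e (dot x γ))
      (trans (K-mirror (swap-↭ x (lows-unique ℓ 0) (lows-swap x ℓ 0 (inj₂ (z≤n , l)))) γ e 0) (cong ℤ.-_ (sym (Schur-snoc ℓ η e γ))))
    where
    open Expansion (λ γ → Schur ℓ γ η) (λ h → Schur-cong ℓ η (λ r _ → h r))
    open Mirror x (go rs)

isNeg : ℤ → Set
isNeg z = ∃[ a ] z ≡ -[1+ a ]

neg-+ : ∀ {z} a b → isNeg z → a ≤ b → isNeg (z ℤ.+ + a ℤ.- + b)
neg-+ {z} a b (c , refl) l with m≤n⇒∃[o]m+o≡n l
... | o , refl = o + c , trans (cong (λ w → -[1+ c ] ℤ.+ + a ℤ.- w) (ℤP.pos-+ a o))
    (trans (lem -[1+ c ] (+ a) (+ o)) (eq o))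
  where
  lem = ring16
  eq : ∀ o → -[1+ c ] ℤ.- + o ≡ -[1+ o + c ]
  eq zero    = refl
  eq (suc o) = cong -[1+_] (cong suc (+-comm c o))

-- The last row of the Jacobi-Trudi matrix has the indices γ ℓ + j - ℓ with j at most ℓ, so all its
-- entries are h of a negative number.
Schur-lastNeg : ∀ ℓ γ → isNeg (γ ℓ) → ∀ η → Schur (suc ℓ) γ η ≡ + 0
Schur-lastNeg ℓ γ n η = det-lastRow ℓ (SchurMatrix γ) entry η
  where
  entry : ∀ j → j < suc ℓ → ∀ η → SchurMatrix γ ℓ j η ≡ + 0
  entry j l η with γ ℓ ℤ.+ + j ℤ.- + ℓ | neg-+ j ℓ n (≤-pred l)
  ... | _ | _ , refl = refl

-- For γ 0 = 0 the constant terms of the first row are 1, 0, 0, ....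
Schur-[]-tail : ∀ ℓ γ → γ 0 ≡ + 0 → Schur (suc ℓ) γ [] ≡ Schur ℓ (λ r → γ (suc r)) []
Schur-[]-tail ℓ γ z =
  trans (det-[] (suc ℓ) (SchurMatrix γ)) (trans (Σ<-front ℓ _)
    (trans (cong₂ ℤ._+_ first (Σ<-zero ℓ rest)) (trans (ℤP.+-identityʳ _) (sym (det-[] ℓ (SchurMatrix (λ r → γ (suc r))))))))
  where
  lem = ring17
  first : sgn 0 ℤ.* (SchurMatrix γ 0 0 [] ℤ.* detℤ ℓ (λ i c → SchurMatrix γ (suc i) (suc c) [])) ≡
          detℤ ℓ (λ i j → SchurMatrix (λ r → γ (suc r)) i j [])
  first rewrite z = trans (ℤP.*-identityˡ _) (trans (ℤP.*-identityˡ _) (detℤ-cong ℓ (λ i j → cong (λ w → hSF w [])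
    (trans (cong₂ (λ p q → γ (suc i) ℤ.+ p ℤ.- q) (ℤP.pos-+ 1 j) (ℤP.pos-+ 1 i)) (lem (γ (suc i)) (+ j) (+ i))))))
  rest : ∀ j → j < ℓ → sgn (suc j) ℤ.* (SchurMatrix γ 0 (suc j) [] ℤ.* detℤ ℓ (minorAt (λ i j → SchurMatrix γ i j []) (suc j))) ≡ + 0
  rest j _ rewrite z = trans (cong (λ w → sgn (suc j) ℤ.* w) refl) (ℤP.*-zeroʳ (sgn (suc j)))

Schur-[]-pos : ∀ ℓ γ a → γ 0 ≡ + suc a → Schur (suc ℓ) γ [] ≡ + 0
Schur-[]-pos ℓ γ a z = trans (det-[] (suc ℓ) (SchurMatrix γ)) (Σ<-zero (suc ℓ) entry)
  where
  entry : ∀ j → j < suc ℓ → sgn j ℤ.* (SchurMatrix γ 0 j [] ℤ.* detℤ ℓ (minorAt (λ i j → SchurMatrix γ i j []) j)) ≡ + 0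
  entry j _ rewrite z = trans (cong (λ w → sgn j ℤ.* w) (cong (ℤ._* detℤ ℓ (minorAt (λ i j → SchurMatrix γ i j []) j)) (h0 a j))) (ℤP.*-zeroʳ (sgn j))
    where
    h0 : ∀ a j → hSF (+ suc a ℤ.+ + j ℤ.- + 0) [] ≡ + 0
    h0 a j = refl

-- Root ideals, Catalan functions and collisions of equal rows.

toRoot : ℕ × ℕ → Factor
toRoot (i , j) = root i j

-- When `i < d i`, the value `d i` is the first root column of row i; the row is empty once `d i` is
-- at least ℓ.
Ψ : ℕ → (ℕ → ℕ) → List Factor
Ψ ℓ d = map toRoot (filter (λ p → d (proj₁ p) ≤? proj₂ p) (pairsLt ℓ))

∈-pairsLt⁺ : ∀ ℓ {i j} → i < j → j < ℓ → (i , j) ∈ pairsLt ℓ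
∈-pairsLt⁺ ℓ {i} {j} l u = ∈-concatMap⁺ (λ j → map (λ i → i , j) (upTo j))
  (Data.List.Relation.Unary.Any.map (λ { refl → ∈-map⁺ (λ i → i , j) (∈-upTo⁺ l) }) (∈-upTo⁺ u))
  where import Data.List.Relation.Unary.Any

∈-pairsLt⁻ : ∀ ℓ {p} → p ∈ pairsLt ℓ → proj₁ p < proj₂ p × proj₂ p < ℓ
∈-pairsLt⁻ ℓ {p} m with find (∈-concatMap⁻ (λ j → map (λ i → i , j) (upTo j)) {xs = upTo ℓ} m)
  where open import Data.List.Membership.Propositional using (find)
... | j , q , r with ∈-map⁻ (λ i → i , j) r
... | i , s , refl = ∈-upTo⁻ s , ∈-upTo⁻ q

pairsLt-unique : ∀ ℓ → Unique (pairsLt ℓ)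
pairsLt-unique ℓ = unique-concatMap (λ j → map (λ i → i , j) (upTo j)) (UniqueP.upTo⁺ ℓ)
  (λ j → UniqueP.map⁺ (cong proj₁) (UniqueP.upTo⁺ j)) same
  where
  same : ∀ {x y b} → b ∈ map (λ i → i , x) (upTo x) → b ∈ map (λ i → i , y) (upTo y) → x ≡ y
  same p q with ∈-map⁻ _ p | ∈-map⁻ _ q
  ... | _ , _ , refl | _ , _ , e = cong proj₂ e

toRoot-injective : ∀ {p q} → toRoot p ≡ toRoot q → p ≡ q
toRoot-injective refl = refl

Ψ-unique : ∀ ℓ d → Unique (Ψ ℓ d)
Ψ-unique ℓ d = UniqueP.map⁺ toRoot-injective (UniqueP.filter⁺ (λ p → d (proj₁ p) ≤? proj₂ p) (pairsLt-unique ℓ))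

∈-Ψ⁺ : ∀ ℓ d {i j} → i < j → j < ℓ → d i ≤ j → root i j ∈ Ψ ℓ d
∈-Ψ⁺ ℓ d l u r = ∈-map⁺ toRoot (∈-filter⁺ (λ p → d (proj₁ p) ≤? proj₂ p) (∈-pairsLt⁺ ℓ l u) r)

data InΨ (ℓ : ℕ) (d : ℕ → ℕ) : Factor → Set where
  inΨ : ∀ {i j} → i < j → j < ℓ → d i ≤ j → InΨ ℓ d (root i j)

∈-Ψ⁻ : ∀ ℓ d {f} → f ∈ Ψ ℓ d → InΨ ℓ d f
∈-Ψ⁻ ℓ d m with ∈-map⁻ toRoot m
... | p , q , refl with ∈-filter⁻ (λ p → d (proj₁ p) ≤? proj₂ p) {xs = pairsLt ℓ} q
... | r , s = inΨ (proj₁ (∈-pairsLt⁻ ℓ r)) (proj₂ (∈-pairsLt⁻ ℓ r)) s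

raiseAt lowerAt : ℕ → (ℕ → ℕ) → ℕ → ℕ
raiseAt j d r = if r ≡ᵇ j then suc (d r) else d r
lowerAt j d r = if r ≡ᵇ j then pred (d r) else d r

raiseAt-same : ∀ j d → raiseAt j d j ≡ suc (d j)
raiseAt-same j d rewrite ≡ᵇ-refl j = refl

raiseAt-diff : ∀ {j r} d → r ≢ j → raiseAt j d r ≡ d r
raiseAt-diff d ne rewrite ≡ᵇ-≢ ne = refl

lowerAt-same : ∀ j d → lowerAt j d j ≡ pred (d j)
lowerAt-same j d rewrite ≡ᵇ-refl j = refl

lowerAt-diff : ∀ {j r} d → r ≢ j → lowerAt j d r ≡ d r
lowerAt-diff d ne rewrite ≡ᵇ-≢ ne = refl

-- The weight μ read off from d by μ_r = n + r − d r.
weightOf : ℕ → (ℕ → ℕ) → Weight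
weightOf n d r = + (n + r) ℤ.- + d r

module Catalan (ℓ n : ℕ) (η : List ℕ) where
  open Expansion (λ γ → Schur ℓ γ η) (λ h → Schur-cong ℓ η (λ r _ → h r)) public

  factors : ℕ → (ℕ → ℕ) → List Factor
  factors z d = lows (ℓ ∸ z) z ++ Ψ ℓ d

  factors-unique : ∀ z d → Unique (factors z d)
  factors-unique z d = UniqueP.++⁺ (lows-unique (ℓ ∸ z) z) (Ψ-unique ℓ d) disj
    where
    disj : ∀ {f} → f ∈ lows (ℓ ∸ z) z × f ∈ Ψ ℓ d → ⊥
    disj (p , q) with ∈-lows⁻ (ℓ ∸ z) z p | ∈-Ψ⁻ ℓ d q
    ... | _ , refl , _ | ()

  -- A Catalan function in which the powers of u lower only the rows z, ..., ℓ - 1. In the count of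
  -- tableaux, z bounds from below the marks still allowed in the current block.
  F : ℕ → (ℕ → ℕ) → Ser₂
  F z d = K (factors z d) (weightOf n d)

  -- One unit of row j has been taken from the weight while the roots are unchanged; such terms are
  -- unrolled along the bounce path of j.
  A : ℕ → (ℕ → ℕ) → ℕ → Ser₂
  A z d j = K (factors z d) (shift (low j) (weightOf n d))

  factors-↭ : ∀ z {d d'} → (∀ i j → i < j → j < ℓ → d i ≤ j → d' i ≤ j) →
    (∀ i j → i < j → j < ℓ → d' i ≤ j → d i ≤ j) → factors z d ↭ factors z d'
  factors-↭ z {d} {d'} f g = set-↭ (factors-unique z d) (factors-unique z d') (tr f) (tr g)
    where
    tr : ∀ {d d'} → (∀ i j → i < j → j < ℓ → d i ≤ j → d' i ≤ j) → ∀ {x} → x ∈ factors z d → x ∈ factors z d'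
    tr {d} {d'} f p with ∈-++⁻ (lows (ℓ ∸ z) z) p
    ... | inj₁ q = ∈-++⁺ˡ q
    ... | inj₂ q with ∈-Ψ⁻ ℓ d q
    ... | inΨ {i} {j} l u r = ∈-++⁺ʳ (lows (ℓ ∸ z) z) (∈-Ψ⁺ ℓ d' l u (f i j l u r))

  F-cong : ∀ z {d d'} → (∀ r → d r ≡ d' r) → ∀ e t → F z d e t ≡ F z d' e t
  F-cong z {d} {d'} h e t =
    trans (K-perm (factors-↭ z (λ i j _ _ l → ≤-trans (≤-reflexive (sym (h i))) l) (λ i j _ _ l → ≤-trans (≤-reflexive (h i)) l)) (weightOf n d) e t)
      (K-cong (factors z d') (λ r → cong (λ w → + (n + r) ℤ.- + w) (h r)) e t)

  weight-raise : ∀ j d → shift (low j) (weightOf n d) ≗ weightOf n (raiseAt j d)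
  weight-raise j d r with r ≟ j
  ... | yes refl rewrite δ-same r | ≡ᵇ-refl r = trans (lem (+ (n + r)) (+ d r)) (cong (λ z → + (n + r) ℤ.- z) (sym (ℤP.pos-+ 1 (d r))))
    where
    lem = ring18
  ... | no ne rewrite δ-diff {j} {r} ne | ≡ᵇ-≢ ne = ℤP.+-identityʳ _

  raise-perm : ∀ z d j → j < d j → d j < ℓ → factors z d ↭ root j (d j) ∷ factors z (raiseAt j d)
  raise-perm z d j l u = set-↭ (factors-unique z d) (fresh ∷ factors-unique z (raiseAt j d)) to from
    where
    fresh : All (root j (d j) ≢_) (factors z (raiseAt j d))
    fresh = All.tabulate λ {f} p → notIn p
      where
      notIn : ∀ {f} → f ∈ factors z (raiseAt j d) → root j (d j) ≢ f
      notIn p refl with ∈-++⁻ (lows (ℓ ∸ z) z) p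
      ... | inj₁ q with ∈-lows⁻ (ℓ ∸ z) z q
      ... | _ , () , _
      notIn p refl | inj₂ q with ∈-Ψ⁻ ℓ (raiseAt j d) q
      ... | inΨ _ _ r = lin⊥ ((if j ≡ᵇ j then suc (d j) else d j) ∷ d j ∷ []) ($ 0 ⊴ $ 1 ∋ r ∷ # 1 ⊹ $ 1 ≐ $ 0 ∋ sym (raiseAt-same j d) ∷ [])
    to : ∀ {f} → f ∈ factors z d → f ∈ root j (d j) ∷ factors z (raiseAt j d)
    to p with ∈-++⁻ (lows (ℓ ∸ z) z) p
    ... | inj₁ q = there (∈-++⁺ˡ q)
    ... | inj₂ q with ∈-Ψ⁻ ℓ d q
    ... | inΨ {a} {b} l' u' r with a ≟ j
    ...   | no ne = there (∈-++⁺ʳ (lows (ℓ ∸ z) z) (∈-Ψ⁺ ℓ (raiseAt j d) l' u' (lin≤ (d a ∷ b ∷ raiseAt j d a ∷ []) 1 ($ 2) ($ 1) ($ 0 ⊴ $ 1 ∋ r ∷ $ 2 ≐ $ 0 ∋ raiseAt-diff d ne ∷ []))))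
    ...   | yes refl with b ≟ d a
    ...     | yes refl = here refl
    ...     | no ne = there (∈-++⁺ʳ (lows (ℓ ∸ z) z) (∈-Ψ⁺ ℓ (raiseAt a d) l' u' (≤-trans (≤-reflexive (raiseAt-same a d)) (≤∧≢⇒< r (λ e → ne (sym e))))))
    from : ∀ {f} → f ∈ root j (d j) ∷ factors z (raiseAt j d) → f ∈ factors z d
    from (here refl) = ∈-++⁺ʳ (lows (ℓ ∸ z) z) (∈-Ψ⁺ ℓ d l u ≤-refl)
    from (there p) with ∈-++⁻ (lows (ℓ ∸ z) z) p
    ... | inj₁ q = ∈-++⁺ˡ q
    ... | inj₂ q with ∈-Ψ⁻ ℓ (raiseAt j d) q
    ... | inΨ {a} {b} l' u' r with a ≟ j
    ...   | no ne = ∈-++⁺ʳ (lows (ℓ ∸ z) z) (∈-Ψ⁺ ℓ d l' u' (lin≤ ((if a ≡ᵇ j then suc (d a) else d a) ∷ b ∷ d a ∷ []) 1 ($ 2) ($ 1) ($ 0 ⊴ $ 1 ∋ r ∷ $ 2 ≐ $ 0 ∋ sym (raiseAt-diff d ne) ∷ [])))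
    ...   | yes refl = ∈-++⁺ʳ (lows (ℓ ∸ z) z) (∈-Ψ⁺ ℓ d l' u' (lin≤ ((if a ≡ᵇ a then suc (d a) else d a) ∷ b ∷ d a ∷ []) 1 ($ 2) ($ 1) ($ 0 ⊴ $ 1 ∋ r ∷ # 1 ⊹ $ 2 ≐ $ 0 ∋ sym (raiseAt-same a d) ∷ [])))

  shift-root-low : ∀ i j γ → shift (root i j) (shift (low i) γ) ≗ shift (low j) γ
  shift-root-low i j γ r = lem (γ r) (δ i r) (δ j r)
    where
    lem = ring19

  A-expand-0 : ∀ z d j → j < d j → d j < ℓ → ∀ e → A z d j e 0 ≡ F z (raiseAt j d) e 0
  A-expand-0 z d j l u e =
    trans (K-perm (raise-perm z d j l u) _ e 0) (K-cong (factors z (raiseAt j d)) (weight-raise j d) e 0)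

  -- The root from j to `d j` is split off. Leaving it out, the lowered weight and the smaller root
  -- ideal both belong to d raised at j; using it once moves the missing unit from row j to row
  -- `d j` at the price of t.
  A-expand : ∀ z d j → j < d j → d j < ℓ → ∀ e t → A z d j e (suc t) ≡ F z (raiseAt j d) e (suc t) ℤ.+ A z d (d j) e t
  A-expand z d j l u e t =
    trans (K-perm (raise-perm z d j l u) _ e (suc t))
      (cong₂ ℤ._+_ (K-cong (factors z (raiseAt j d)) (weight-raise j d) e (suc t))
        (trans (sym (K-perm (raise-perm z d j l u) _ e t)) (K-cong (factors z d) (shift-root-low j (d j) (weightOf n d)) e t)))

  A-end : ∀ z d j → ℓ ≤ d j → ∀ e t → A z d j e t ≡ F z (raiseAt j d) e t
  A-end z d j u e t = trans (K-perm (factors-↭ z to from) _ e t) (K-cong (factors z (raiseAt j d)) (weight-raise j d) e t)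
    where
    to : ∀ i b → i < b → b < ℓ → d i ≤ b → raiseAt j d i ≤ b
    to i b l u' r with i ≟ j
    ... | yes refl = ⊥-elim (lin⊥ (ℓ ∷ d i ∷ b ∷ []) ($ 0 ⊴ $ 1 ∋ u ∷ # 1 ⊹ $ 2 ⊴ $ 0 ∋ u' ∷ $ 1 ⊴ $ 2 ∋ r ∷ []))
    ... | no ne    = lin≤ (d i ∷ b ∷ raiseAt j d i ∷ []) 1 ($ 2) ($ 1) ($ 0 ⊴ $ 1 ∋ r ∷ $ 2 ≐ $ 0 ∋ raiseAt-diff d ne ∷ [])
    from : ∀ i b → i < b → b < ℓ → raiseAt j d i ≤ b → d i ≤ b
    from i b l u' r with i ≟ j
    ... | yes refl = lin≤ ((if i ≡ᵇ i then suc (d i) else d i) ∷ b ∷ d i ∷ []) 1 ($ 2) ($ 1) ($ 0 ⊴ $ 1 ∋ r ∷ # 1 ⊹ $ 2 ≐ $ 0 ∋ sym (raiseAt-same i d) ∷ [])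
    ... | no ne    = lin≤ ((if i ≡ᵇ j then suc (d i) else d i) ∷ b ∷ d i ∷ []) 1 ($ 2) ($ 1) ($ 0 ⊴ $ 1 ∋ r ∷ $ 2 ≐ $ 0 ∋ sym (raiseAt-diff d ne) ∷ [])

  -- The equality makes rows x and x + 1 of the root ideal alike, `gap` excludes the root between
  -- them, and `avoid` makes columns x and x + 1 alike in the rows above.
  factors-swap : ∀ z x d → z ≤ ℓ → suc x < ℓ → (suc x < z) ⊎ (z ≤ x) → d x ≡ d (suc x) → suc x < d x →
    (∀ y → y < x → d y ≢ suc x) → map (swapF x) (factors z d) ↭ factors z d
  factors-swap z x d zl xl zx eq gap avoid = swap-↭ x (factors-unique z d) closed
    where
    range : (suc x < z) ⊎ (z ≤ x) → (suc x < z) ⊎ (z ≤ x × suc x < z + (ℓ ∸ z))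
    range (inj₁ p) = inj₁ p
    range (inj₂ p) = inj₂ (p , (lin≤ (x ∷ ℓ ∷ z ∷ (ℓ ∸ z) ∷ []) 1 (# 1 ⊹ (# 1 ⊹ $ 0)) ($ 2 ⊹ $ 3) (# 1 ⊹ (# 1 ⊹ $ 0) ⊴ $ 1 ∋ xl ∷ $ 1 ≐ $ 2 ⊹ $ 3 ∋ sym (m+[n∸m]≡n zl) ∷ [])))
    row : ∀ {i j} → suc i < j → j < ℓ → d i ≤ j → root i j ∈ Ψ ℓ d
    row l u r = ∈-Ψ⁺ ℓ d (<⇒≤ l) u r
    closedΨ : ∀ {f} → f ∈ Ψ ℓ d → swapF x f ∈ Ψ ℓ d
    closedΨ p with ∈-Ψ⁻ ℓ d p
    ... | inΨ {i} {j} l u r with cmp x i | cmp x j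
    ...   | is-x refl  | is-x refl  = ⊥-elim (lin⊥ (i ∷ []) (# 1 ⊹ $ 0 ⊴ $ 0 ∋ l ∷ []))
    ...   | is-x refl  | is-sx refl = ⊥-elim (lin⊥ (d i ∷ i ∷ []) ($ 0 ⊴ # 1 ⊹ $ 1 ∋ r ∷ # 1 ⊹ (# 1 ⊹ $ 1) ⊴ $ 0 ∋ gap ∷ []))
    ...   | is-x refl  | other a b rewrite swapIdx-x x | swapIdx-else a b =
            ∈-Ψ⁺ ℓ d (≤∧≢⇒< l (λ e → b (sym e))) u (lin≤ (d i ∷ j ∷ d (suc i) ∷ []) 1 ($ 2) ($ 1) ($ 0 ⊴ $ 1 ∋ r ∷ $ 2 ≐ $ 0 ∋ sym eq ∷ []))
    ...   | is-sx refl | is-x refl  = ⊥-elim (lin⊥ (j ∷ []) (# 1 ⊹ (# 1 ⊹ $ 0) ⊴ $ 0 ∋ l ∷ []))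
    ...   | is-sx refl | is-sx refl = ⊥-elim (lin⊥ (x ∷ []) (# 1 ⊹ (# 1 ⊹ $ 0) ⊴ # 1 ⊹ $ 0 ∋ l ∷ []))
    ...   | is-sx refl | other a b rewrite swapIdx-sx x | swapIdx-else a b = ∈-Ψ⁺ ℓ d (lin≤ (x ∷ j ∷ []) 1 (# 1 ⊹ $ 0) ($ 1) (# 1 ⊹ (# 1 ⊹ $ 0) ⊴ $ 1 ∋ l ∷ [])) u (lin≤ (d (suc x) ∷ j ∷ d x ∷ []) 1 ($ 2) ($ 1) ($ 0 ⊴ $ 1 ∋ r ∷ $ 2 ≐ $ 0 ∋ eq ∷ []))
    ...   | other a b  | is-x refl rewrite swapIdx-x x | swapIdx-else a b = ∈-Ψ⁺ ℓ d (lin≤ (i ∷ j ∷ []) 1 (# 1 ⊹ $ 0) (# 1 ⊹ $ 1) (# 1 ⊹ $ 0 ⊴ $ 1 ∋ l ∷ [])) xl (lin≤ (d i ∷ j ∷ []) 1 ($ 0) (# 1 ⊹ $ 1) ($ 0 ⊴ $ 1 ∋ r ∷ []))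
    ...   | other a b  | is-sx refl rewrite swapIdx-sx x | swapIdx-else a b =
            ∈-Ψ⁺ ℓ d i<x (lin≤ (x ∷ ℓ ∷ []) 1 (# 1 ⊹ $ 0) ($ 1) (# 1 ⊹ (# 1 ⊹ $ 0) ⊴ $ 1 ∋ u ∷ [])) (≤-pred (≤∧≢⇒< r (avoid i i<x)))
            where
            i<x : i < x
            i<x = ≤∧≢⇒< (≤-pred l) a
    ...   | other a b  | other a' b' rewrite swapIdx-else a b | swapIdx-else a' b' = p
    closed : ∀ {f} → f ∈ factors z d → swapF x f ∈ factors z d
    closed p with ∈-++⁻ (lows (ℓ ∸ z) z) p
    ... | inj₁ q = ∈-++⁺ˡ (lows-swap x (ℓ ∸ z) z (range zx) q)
    ... | inj₂ q = ∈-++⁺ʳ (lows (ℓ ∸ z) z) (closedΨ q)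

  weight-step : ∀ x d → d x ≡ d (suc x) → weightOf n d (suc x) ≡ weightOf n d x ℤ.+ + 1
  weight-step x d eq rewrite sym eq | +-suc n x = trans (cong (λ z → z ℤ.- + d x) (ℤP.pos-+ 1 (n + x))) (lem (+ (n + x)) (+ d x))
    where
    lem = ring20

  module Collision (z x : ℕ) (zl : z ≤ ℓ) (xl : suc x < ℓ) (zx : (suc x < z) ⊎ (z ≤ x)) where
    open Mirror x (Schur-anti ℓ x xl η)

    F-vanish : ∀ d → d x ≡ d (suc x) → suc x < d x → (∀ y → y < x → d y ≢ suc x) → ∀ e t → F z d e t ≡ + 0
    F-vanish d eq gap avoid = K-vanish (factors-swap z x d zl xl zx eq gap avoid) (weightOf n d) (weight-step x d eq)

    A-vanish : ∀ d j → j ≢ x → j ≢ suc x → d x ≡ d (suc x) → suc x < d x → (∀ y → y < x → d y ≢ suc x) → ∀ e t → A z d j e t ≡ + 0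
    A-vanish d j a b eq gap avoid =
      K-vanish (factors-swap z x d zl xl zx eq gap avoid) (shift (low j) (weightOf n d)) step
      where
      step : shift (low j) (weightOf n d) (suc x) ≡ shift (low j) (weightOf n d) x ℤ.+ + 1
      step rewrite δ-diff {j} {suc x} (λ e → b (sym e)) | δ-diff {j} {x} (λ e → a (sym e)) | weight-step x d eq =
        lem (weightOf n d x)
        where
        lem = ring21

    -- The weights lowered in row x and in row x + 1 are exchanged by `dot x`.
    A-flip : ∀ d → d x ≡ d (suc x) → suc x < d x → (∀ y → y < x → d y ≢ suc x) → ∀ e t → A z d x e t ≡ ℤ.- A z d (suc x) e t
    A-flip d eq gap avoid e t =
      trans (K-cong (factors z d) (λ r → sym (dotted r)) e t)
        (K-mirror (factors-swap z x d zl xl zx eq gap avoid) (shift (low (suc x)) (weightOf n d)) e t)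
      where
      dotted : dot x (shift (low (suc x)) (weightOf n d)) ≗ shift (low x) (weightOf n d)
      dotted r with cmp x r
      ... | is-x refl rewrite dot-x x (shift (low (suc x)) (weightOf n d)) | δ-same x | weight-step x d eq = lem (weightOf n d x)
        where
        lem = ring22
      ... | is-sx refl rewrite dot-sx x (shift (low (suc x)) (weightOf n d)) | δ-diff {suc x} {x} (λ e → 1+n≢n (sym e)) | δ-diff {x} {suc x} 1+n≢n | weight-step x d eq = lem (weightOf n d x)
        where
        lem = ring23
      ... | other p q rewrite dot-else (shift (low (suc x)) (weightOf n d)) p q | δ-diff {suc x} {r} q | δ-diff {x} {r} p = refl

    module _ (d : ℕ → ℕ) (eq : d x ≡ d (suc x)) (gap : suc x < d x)
             (y : ℕ) (y<x : y < x) (dy : d y ≡ suc x) (only : ∀ y' → y' < x → y' ≢ y → d y' ≢ suc x) where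
      private
        d' = lowerAt y d
        d'y : d' y ≡ x
        d'y = trans (lowerAt-same y d) (cong pred dy)
        d'x : d' x ≡ d x
        d'x = lowerAt-diff d (>⇒≢ y<x)
        d'sx : d' (suc x) ≡ d (suc x)
        d'sx = lowerAt-diff {y} {suc x} d (λ e → (lin⊥ (x ∷ y ∷ []) (# 1 ⊹ $ 0 ≐ $ 1 ∋ e ∷ # 1 ⊹ $ 1 ⊴ $ 0 ∋ y<x ∷ [])))
        eq' : d' x ≡ d' (suc x)
        eq' = trans d'x (trans eq (sym d'sx))
        gap' : suc x < d' x
        gap' = ≤-trans gap (≤-reflexive (sym d'x))
        avoid : ∀ y' → y' < x → d' y' ≢ suc x
        avoid y' l e with y' ≟ y
        ... | yes refl = lin⊥ ((if y' ≡ᵇ y' then d y' ∸ 1 else d y') ∷ x ∷ []) (# 1 ⊹ $ 1 ≐ $ 0 ∋ sym e ∷ $ 0 ≐ $ 1 ∋ d'y ∷ [])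
        ... | no ne    = only y' l ne (trans (sym (lowerAt-diff d ne)) e)
        back : ∀ r → d r ≡ raiseAt y d' r
        back r with r ≟ y
        ... | yes refl = trans dy (sym (trans (raiseAt-same y d') (cong suc d'y)))
        ... | no ne    = sym (trans (raiseAt-diff d' ne) (lowerAt-diff d ne))
        bound : y < d' y
        bound = ≤-trans y<x (≤-reflexive (sym d'y))
        inside : d' y < ℓ
        inside = lin≤ (d' y ∷ x ∷ ℓ ∷ []) 1 (# 1 ⊹ $ 0) ($ 2) ($ 0 ≐ $ 1 ∋ d'y ∷ # 1 ⊹ (# 1 ⊹ $ 1) ⊴ $ 2 ∋ xl ∷ [])
        cancel : ∀ {a b c : ℤ} → a ≡ + 0 → a ≡ b ℤ.+ c → b ≡ ℤ.- c
        cancel {a} {b} {c} p q = trans (lem b c) (trans (cong (ℤ._+ ℤ.- c) (trans (sym q) p)) (ℤP.+-identityˡ _))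
          where
          lem = ring24
        target : ∀ e t → A z d' (suc x) e t ≡ F z (raiseAt (suc x) d') e t
        target e t with d' (suc x) <? ℓ
        ... | no p = A-end z d' (suc x) (≮⇒≥ p) e t
        ... | yes p = split t
          where
          w>sx : suc x < d' (suc x)
          w>sx = ≤-trans gap' (≤-reflexive eq')
          split : ∀ t → A z d' (suc x) e t ≡ F z (raiseAt (suc x) d') e t
          split zero    = A-expand-0 z d' (suc x) w>sx p e
          split (suc t) = trans (A-expand z d' (suc x) w>sx p e t)
            (trans (cong (λ w → F z (raiseAt (suc x) d') e (suc t) ℤ.+ w)
                     (A-vanish d' (d' (suc x)) (>⇒≢ (<⇒≤ w>sx)) (>⇒≢ w>sx) eq' gap' avoid e t))
              (ℤP.+-identityʳ _))

      F-push-0 : ∀ e → F z d e 0 ≡ + 0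
      F-push-0 e = trans (F-cong z back e 0)
        (trans (sym (A-expand-0 z d' y bound inside e)) (A-vanish d' y (<⇒≢ y<x) (λ e → (lin⊥ (y ∷ x ∷ []) (# 1 ⊹ $ 1 ≐ $ 0 ∋ sym e ∷ # 1 ⊹ $ 0 ⊴ $ 1 ∋ y<x ∷ []))) eq' gap' avoid e 0))

      -- The single row y with d y = x + 1 breaks the symmetry of the columns. Lowering d y to x
      -- restores it, so `A z d' y` vanishes, and its expansion reads 0 = F z d + t A z d' x. The
      -- mirror turns - A z d' x into A z d' (x + 1), of which only the first term of the expansion
      -- survives.
      F-push : ∀ e t → F z d e (suc t) ≡ F z (raiseAt (suc x) (lowerAt y d)) e t
      F-push e t =
        trans (F-cong z back e (suc t))
          (trans (cancel (A-vanish d' y (<⇒≢ y<x) (λ e → (lin⊥ (y ∷ x ∷ []) (# 1 ⊹ $ 1 ≐ $ 0 ∋ sym e ∷ # 1 ⊹ $ 0 ⊴ $ 1 ∋ y<x ∷ []))) eq' gap' avoid e (suc t)) (A-expand z d' y bound inside e t))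
            (trans (cong (λ w → ℤ.- A z d' w e t) d'y)
              (trans (cong ℤ.-_ (A-flip d' eq' gap' avoid e t))
                (trans (ℤP.neg-involutive _) (target e t)))))

module _ (ℓ n : ℕ) (η : List ℕ) where
  open Catalan (suc ℓ) n η

  -- The weight is negative in row ℓ and stays so: a root raises a row strictly above the one it
  -- lowers, hence never the last row.
  F-lastNeg : ∀ z d → n + ℓ < d ℓ → ∀ e t → F z d e t ≡ + 0
  F-lastNeg z d l = K-zero (λ γ → isNeg (γ ℓ)) (λ γ h → Schur-lastNeg ℓ γ h η) (factors z d) stable (weightOf n d) start
    where
    start : isNeg (weightOf n d ℓ)
    start with m≤n⇒∃[o]m+o≡n l
    ... | o , eq rewrite sym eq = o , trans (cong (λ w → + (n + ℓ) ℤ.- w) (trans (cong +_ (sym (+-suc (n + ℓ) o))) (ℤP.pos-+ (n + ℓ) (suc o)))) (lem (+ (n + ℓ)) (+ suc o))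
      where
      lem = ring25
    drop-δ : ∀ b r z → isNeg z → isNeg (z ℤ.+ ℤ.- δ b r)
    drop-δ b r z (a , refl) with r ≡ᵇ b
    ... | true  = suc (a + 0) , refl
    ... | false = a , refl
    stable : ∀ f → f ∈ factors z d → ∀ γ → isNeg (γ ℓ) → isNeg (shift f γ ℓ)
    stable f p γ h with ∈-++⁻ (lows (suc ℓ ∸ z) z) p
    stable f p γ h | inj₁ q with ∈-lows⁻ (suc ℓ ∸ z) z q
    ... | a , refl , _ = drop-δ a ℓ (γ ℓ) h
    stable f p γ h | inj₂ q with ∈-Ψ⁻ (suc ℓ) d q
    ... | inΨ {i} {j} i<j j<ℓ _ rewrite δ-diff {i} {ℓ} (λ e → (lin⊥ (ℓ ∷ i ∷ j ∷ []) ($ 0 ≐ $ 1 ∋ e ∷ # 1 ⊹ $ 1 ⊴ $ 2 ∋ i<j ∷ # 1 ⊹ $ 2 ⊴ # 1 ⊹ $ 0 ∋ j<ℓ ∷ []))) | ℤP.+-identityˡ (ℤ.- δ j ℓ) = drop-δ j ℓ (γ ℓ) h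

-- Cores as bead configurations.

-- κ is the row-length function of a core and d the map on rows sending the bead
-- κ_i − i to the bead n positions lower, so that the i-th part of 𝔭(κ) is n + i − d i.
record IsCore (n : ℕ) (κ d : ℕ → ℕ) : Set where
  field
    mono : ∀ i → κ (suc i) ≤ κ i
    eqn  : ∀ i → κ i + d i ≡ κ (d i) + (n + i)
    pos  : 1 ≤ n

  mono-≤ : ∀ {i j} → i ≤ j → κ j ≤ κ i
  mono-≤ {i} {j} l with m≤n⇒∃[o]m+o≡n l
  ... | o , refl = go o
    where
    go : ∀ o → κ (i + o) ≤ κ i
    go zero    = ≤-reflexive (cong κ (+-identityʳ i))
    go (suc o) = ≤-trans (≤-trans (≤-reflexive (cong κ (+-suc i o))) (mono (i + o))) (go o)

  bead-< : ∀ {i j} → i < j → κ j + i < κ i + j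
  bead-< {i} {j} l = lin≤ (κ j ∷ κ i ∷ i ∷ j ∷ []) 1 (# 1 ⊹ ($ 0 ⊹ $ 2)) ($ 1 ⊹ $ 3) ($ 0 ⊴ $ 1 ∋ mono-≤ (<⇒≤ l) ∷ # 1 ⊹ $ 2 ⊴ $ 3 ∋ l ∷ [])

  idx-< : ∀ {i j} → κ j + i < κ i + j → i < j
  idx-< {i} {j} l with i <? j
  ... | yes p = p
  ... | no p  = ⊥-elim (lin⊥ (κ j ∷ i ∷ κ i ∷ j ∷ []) (# 1 ⊹ ($ 0 ⊹ $ 1) ⊴ $ 2 ⊹ $ 3 ∋ l ∷ $ 2 ⊴ $ 0 ∋ mono-≤ (≮⇒≥ p) ∷ $ 3 ⊴ $ 1 ∋ ≮⇒≥ p ∷ []))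

  idx-≡ : ∀ {i j} → κ j + i ≡ κ i + j → i ≡ j
  idx-≡ {i} {j} e with <-cmp i j
  ... | tri< l _ _ = ⊥-elim (lin⊥ (κ j ∷ i ∷ κ i ∷ j ∷ []) ($ 2 ⊹ $ 3 ≐ $ 0 ⊹ $ 1 ∋ sym e ∷ # 1 ⊹ ($ 0 ⊹ $ 1) ⊴ $ 2 ⊹ $ 3 ∋ bead-< l ∷ []))
  ... | tri≈ _ p _ = p
  ... | tri> _ _ l = ⊥-elim (lin⊥ (κ j ∷ i ∷ κ i ∷ j ∷ []) ($ 0 ⊹ $ 1 ≐ $ 2 ⊹ $ 3 ∋ e ∷ # 1 ⊹ ($ 2 ⊹ $ 3) ⊴ $ 0 ⊹ $ 1 ∋ bead-< l ∷ []))

  -- All beads are moved by the same amount n, so their order is kept.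
  d-mono : ∀ {i j} → i < j → d i < d j
  d-mono {i} {j} l = idx-< (lin≤ (κ i ∷ d i ∷ κ (d i) ∷ n ∷ i ∷ κ j ∷ d j ∷ κ (d j) ∷ j ∷ []) 1 (# 1 ⊹ ($ 7 ⊹ $ 1)) ($ 2 ⊹ $ 6) ($ 0 ⊹ $ 1 ≐ $ 2 ⊹ ($ 3 ⊹ $ 4) ∋ eqn i ∷ $ 7 ⊹ ($ 3 ⊹ $ 8) ≐ $ 5 ⊹ $ 6 ∋ sym (eqn j) ∷ # 1 ⊹ ($ 5 ⊹ $ 4) ⊴ $ 0 ⊹ $ 8 ∋ bead-< l ∷ []))

  d-mono-≤ : ∀ {i j} → i ≤ j → d i ≤ d j
  d-mono-≤ {i} {j} l with i ≟ j
  ... | yes refl = ≤-refl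
  ... | no ne    = <⇒≤ (d-mono (≤∧≢⇒< l ne))

  d-reflects : ∀ {i j} → d i < d j → i < j
  d-reflects {i} {j} l with i <? j
  ... | yes p = p
  ... | no p  = ⊥-elim (lin⊥ (d i ∷ d j ∷ []) (# 1 ⊹ $ 0 ⊴ $ 1 ∋ l ∷ $ 1 ⊴ $ 0 ∋ d-mono-≤ (≮⇒≥ p) ∷ []))

  d-inj : ∀ {i j} → d i ≡ d j → i ≡ j
  d-inj {i} {j} e with <-cmp i j
  ... | tri< l _ _ = ⊥-elim (lin⊥ (d i ∷ d j ∷ []) ($ 1 ≐ $ 0 ∋ sym e ∷ # 1 ⊹ $ 0 ⊴ $ 1 ∋ d-mono l ∷ []))
  ... | tri≈ _ p _ = p
  ... | tri> _ _ l = ⊥-elim (lin⊥ (d i ∷ d j ∷ []) ($ 0 ≐ $ 1 ∋ e ∷ # 1 ⊹ $ 1 ⊴ $ 0 ∋ d-mono l ∷ []))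

  d-> : ∀ i → i < d i
  d-> i = idx-< (lin≤ (κ i ∷ d i ∷ κ (d i) ∷ n ∷ i ∷ []) 1 (# 1 ⊹ ($ 2 ⊹ $ 4)) ($ 0 ⊹ $ 1) ($ 2 ⊹ ($ 3 ⊹ $ 4) ≐ $ 0 ⊹ $ 1 ∋ sym (eqn i) ∷ # 1 ⊴ $ 3 ∋ pos ∷ []))

  d-≤ : ∀ i → d i ≤ n + i
  d-≤ i = lin≤ (κ i ∷ d i ∷ κ (d i) ∷ n ∷ i ∷ []) 1 ($ 1) ($ 3 ⊹ $ 4) ($ 0 ⊹ $ 1 ≐ $ 2 ⊹ ($ 3 ⊹ $ 4) ∋ eqn i ∷ $ 2 ⊴ $ 0 ∋ mono-≤ (<⇒≤ (d-> i)) ∷ [])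

  d-next : ∀ {u v} → d v ≡ suc (d u) → v ≡ suc u
  d-next {u} {v} e with <-cmp v (suc u)
  ... | tri< l _ _ = ⊥-elim (lin⊥ (d v ∷ d u ∷ []) (# 1 ⊹ $ 1 ≐ $ 0 ∋ sym e ∷ $ 0 ⊴ $ 1 ∋ d-mono-≤ (≤-pred l) ∷ []))
  ... | tri≈ _ p _ = p
  ... | tri> _ _ l = ⊥-elim (lin⊥ (d v ∷ d u ∷ d (suc u) ∷ []) ($ 0 ≐ # 1 ⊹ $ 1 ∋ e ∷ # 1 ⊹ $ 1 ⊴ $ 2 ∋ d-mono {u} ≤-refl ∷ # 1 ⊹ $ 2 ⊴ $ 0 ∋ d-mono l ∷ []))

  d-zero : ∀ i → κ i ≡ 0 → d i ≡ n + i
  d-zero i z = ≤-antisym (lin≤ (κ i ∷ d i ∷ κ (d i) ∷ n ∷ i ∷ []) 1 ($ 1) ($ 3 ⊹ $ 4) ($ 0 ⊹ $ 1 ≐ $ 2 ⊹ ($ 3 ⊹ $ 4) ∋ eqn i ∷ $ 2 ⊴ $ 0 ∋ mono-≤ (<⇒≤ (d-> i)) ∷ [])) (lin≤ (κ i ∷ d i ∷ κ (d i) ∷ n ∷ i ∷ []) 1 ($ 3 ⊹ $ 4) ($ 1) ($ 2 ⊹ ($ 3 ⊹ $ 4) ≐ $ 0 ⊹ $ 1 ∋ sym (eqn i) ∷ $ 0 ≐ # 0 ∋ z ∷ []))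

  d-grow : ∀ i m → d i + m ≤ d (i + m)
  d-grow i zero    = ≤-reflexive (trans (+-identityʳ _) (cong d (sym (+-identityʳ i))))
  d-grow i (suc m) = lin≤ (d i ∷ m ∷ d (i + m) ∷ d (suc (i + m)) ∷ d (i + suc m) ∷ []) 1 ($ 0 ⊹ (# 1 ⊹ $ 1)) ($ 4) ($ 0 ⊹ $ 1 ⊴ $ 2 ∋ d-grow i m ∷ # 1 ⊹ $ 2 ⊴ $ 3 ∋ d-mono {i + m} {suc (i + m)} ≤-refl ∷ $ 3 ≐ $ 4 ∋ sym (cong d (+-suc i m)) ∷ [])

  -- d grows by at least one per row, so minimal growth over the whole interval leaves minimal
  -- growth on every initial piece.
  d-run : ∀ i m → d (i + m) ≡ d i + m → ∀ a → a ≤ m → d (i + a) ≡ d i + a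
  d-run i m e a l with m≤n⇒∃[o]m+o≡n l
  ... | o , refl = ≤-antisym (lin≤ (d (i + (a + o)) ∷ d i ∷ a ∷ o ∷ d (i + a) ∷ d (i + a + o) ∷ []) 1 ($ 4) ($ 1 ⊹ $ 2) ($ 0 ≐ $ 1 ⊹ ($ 2 ⊹ $ 3) ∋ e ∷ $ 4 ⊹ $ 3 ⊴ $ 5 ∋ d-grow (i + a) o ∷ $ 5 ≐ $ 0 ∋ cong d (+-assoc i a o) ∷ [])) (d-grow i a)

  up? : ∀ j → (∃[ u ] d u ≡ j) ⊎ (∀ u → d u ≢ j)
  up? j with anyUpTo? (λ u → d u ≟ j) j
  ... | yes (u , _ , e) = inj₁ (u , e)
  ... | no h            = inj₂ (λ u e → h (u , ≤-trans (d-> u) (≤-reflexive e) , e))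

d-unique : ∀ {n κ d d'} → IsCore n κ d → IsCore n κ d' → ∀ i → d i ≡ d' i
d-unique {n} {κ} {d} {d'} c c' i = IsCore.idx-≡ c (≤-antisym (lin≤ (κ i ∷ d i ∷ κ (d i) ∷ n ∷ i ∷ d' i ∷ κ (d' i) ∷ []) 1 ($ 6 ⊹ $ 1) ($ 2 ⊹ $ 5) ($ 0 ⊹ $ 1 ≐ $ 2 ⊹ ($ 3 ⊹ $ 4) ∋ IsCore.eqn c i ∷ $ 6 ⊹ ($ 3 ⊹ $ 4) ≐ $ 0 ⊹ $ 5 ∋ sym (IsCore.eqn c' i) ∷ [])) (lin≤ (κ i ∷ d i ∷ κ (d i) ∷ n ∷ i ∷ d' i ∷ κ (d' i) ∷ []) 1 ($ 2 ⊹ $ 5) ($ 6 ⊹ $ 1) ($ 2 ⊹ ($ 3 ⊹ $ 4) ≐ $ 0 ⊹ $ 1 ∋ sym (IsCore.eqn c i) ∷ $ 0 ⊹ $ 5 ≐ $ 6 ⊹ ($ 3 ⊹ $ 4) ∋ IsCore.eqn c' i ∷ [])))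

-- The rows of the components of the cover removing a ribbon of height w + 1 with
-- top row j as lowest component: u runs over the top rows above j, and the w beads
-- passed in each component have further copies, in rows y, …, y + w − 1.
data Tower (d : ℕ → ℕ) (w : ℕ) : ℕ → ℕ → ℕ → Set where
  top  : ∀ {j y} → (∀ u → d u ≢ j) → y + w ≤ j → (∀ a → a < w → d (y + a) ≡ suc (j + a)) → Tower d w j 1 y
  step : ∀ {j u c y} → (∀ a → a ≤ w → d (u + a) ≡ j + a) → Tower d w u c y → Tower d w j (suc c) y

-- The removed ribbons have height w + 1, where w is the full length of the run of consecutive
-- values of d from row j on. The field `small` is what keeps the rows of different ribbons apart.
record Cover (d : ℕ → ℕ) (j : ℕ) : Set where
  constructor cover
  field
    {w c y} : ℕ
    run     : d (j + w) ≡ d j + w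
    stop    : d (j + suc w) ≢ d j + suc w
    small   : j + w < d j
    tower   : Tower d w j c y

tower-weaken : ∀ {d w w' j c y} → w ≤ w' → Tower d w' j c y → Tower d w j c y
tower-weaken l (top f b g)  = top f (≤-trans (+-monoʳ-≤ _ l) b) (λ a q → g a (≤-trans q l))
tower-weaken l (step g t) = step (λ a q → g a (≤-trans q l)) (tower-weaken l t)

tower-low : ∀ {n κ d w j c y} → IsCore n κ d → Tower d w j c y → y + w ≤ j
tower-low C (top _ b _) = b
tower-low {d = d} {w = w} {j = j} {y = y} C (step {u = u} g t) =
  (lin≤ (y ∷ w ∷ u ∷ d u ∷ j ∷ []) 1 ($ 0 ⊹ $ 1) ($ 4) ($ 0 ⊹ $ 1 ⊴ $ 2 ∋ tower-low C t ∷ $ 3 ≐ $ 4 ⊹ # 0 ∋ trans (cong d (sym (+-identityʳ u))) (g 0 z≤n) ∷ # 1 ⊹ $ 2 ⊴ $ 3 ∋ IsCore.d-> C u ∷ []))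

-- The d of the core below the cover: its runner swap raises d on the bottom ribbon and lowers it on rows y, …, y + w − 1.
dMove : (ℕ → ℕ) → ℕ → ℕ → ℕ → ℕ → ℕ
dMove d j y zero    = raiseAt j d
dMove d j y (suc w) = raiseAt (j + suc w) (lowerAt (y + w) (dMove d j y w))

-- Resolving a raised row: collisions travel up a tower.

delayBy : ℕ → Ser₂ → Ser₂
delayBy zero    X e t       = X e t
delayBy (suc c) X e zero    = + 0
delayBy (suc c) X e (suc t) = delayBy c X e t

delayBy-cong : ∀ c {X Y : Ser₂} → (∀ e t → X e t ≡ Y e t) → ∀ e t → delayBy c X e t ≡ delayBy c Y e t
delayBy-cong zero    h e t       = h e t
delayBy-cong (suc c) h e zero    = refl
delayBy-cong (suc c) h e (suc t) = delayBy-cong c h e t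

delayBy-+ : ∀ a b (X : Ser₂) e t → delayBy (a + b) X e t ≡ delayBy a (delayBy b X) e t
delayBy-+ zero    b X e t       = refl
delayBy-+ (suc a) b X e zero    = refl
delayBy-+ (suc a) b X e (suc t) = delayBy-+ a b X e t

delayBy-zero : ∀ c {X : Ser₂} → (∀ e t → X e t ≡ + 0) → ∀ e t → delayBy c X e t ≡ + 0
delayBy-zero zero    h e t       = h e t
delayBy-zero (suc c) h e zero    = refl
delayBy-zero (suc c) h e (suc t) = delayBy-zero c h e t

data Path (d : ℕ → ℕ) (z : ℕ) : ℕ → Set where
  here : Path d z z
  down : ∀ {u j} → Path d z u → d u ≡ j → Path d z j

tower-next : ∀ {n κ d w j c y} → IsCore n κ d → Tower d w (d j) c y → ∃[ c' ] c ≡ suc c' × Tower d w j c' y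
tower-next C (top nu _ _) = ⊥-elim (nu _ refl)
tower-next {d = d} C (step {u = u} g t) with IsCore.d-inj C (trans (cong d (sym (+-identityʳ u))) (trans (g 0 z≤n) (+-identityʳ _)))
... | refl = _ , refl , t

module Moves (ℓ n : ℕ) (η : List ℕ) {κ d : ℕ → ℕ} (C : IsCore n κ d) where
  open IsCore C
  open Catalan ℓ n η

  path-≤ : ∀ {z j} → Path d z j → z ≤ j
  path-≤ here         = ≤-refl
  path-≤ (down p refl) = ≤-trans (path-≤ p) (<⇒≤ (d-> _))

  -- Row j lies on the bounce path of z, or the rows j, …, j + w + 1 are all above z.
  Position : ℕ → ℕ → ℕ → Set
  Position z w j = Path d z j ⊎ (suc (j + w) < z)

  position-up : ∀ {z w u j} → d u ≡ j → suc (u + w) < j → Position z w j → Position z w u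
  position-up e l (inj₁ here) = inj₂ l
  position-up e l (inj₁ (down p refl)) with d-inj e
  ... | refl = inj₁ p
  position-up {z = z} {w = w} {u = u} {j = j} e l (inj₂ q) = inj₂ (lin≤ (u ∷ w ∷ j ∷ z ∷ []) 1 (# 1 ⊹ (# 1 ⊹ ($ 0 ⊹ $ 1))) ($ 3) (# 1 ⊹ (# 1 ⊹ ($ 0 ⊹ $ 1)) ⊴ $ 2 ∋ l ∷ # 1 ⊹ (# 1 ⊹ ($ 2 ⊹ $ 1)) ⊴ $ 3 ∋ q ∷ []))

  side : ∀ {z w j} → Position z w j → (suc (j + w) < z) ⊎ (z ≤ j + w)
  side {w = w} {j} (inj₁ p) = inj₂ (≤-trans (path-≤ p) (m≤m+n j w))
  side (inj₂ q)             = inj₁ q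

  -- Snapshot before a push. Rows j + w and j + w + 1 have equal values of e; above row j, e differs
  -- from d just in rows y, ..., y + w - 1, already lowered by one.
  record State (w y j : ℕ) (e : ℕ → ℕ) : Set where
    field
      level   : e (j + w) ≡ e (suc (j + w))
      gap     : suc (j + w) < e (j + w)
      lowered : ∀ r → r < j → y ≤ r → r < y + w → suc (e r) ≡ d r
      kept    : ∀ r → r < j → (r < y ⊎ y + w ≤ r) → e r ≡ d r
      apart   : ∀ r → j ≤ r → r < j + w → e r ≢ suc (j + w)

  d+0 : ∀ u → d (u + 0) ≡ d u
  d+0 u = cong d (+-identityʳ u)

  range? : ∀ y w r → (y ≤ r × r < y + w) ⊎ (r < y ⊎ y + w ≤ r)
  range? y w r with y ≤? r | r <? y + w
  ... | no p  | _     = inj₂ (inj₁ (≰⇒> p))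
  ... | yes p | yes q = inj₁ (p , q)
  ... | yes p | no q  = inj₂ (inj₂ (≮⇒≥ q))

  record Pushed (z w j c y : ℕ) (e : ℕ → ℕ) : Set where
    field
      {y'}   : ℕ
      tower' : Tower d (suc w) j c y'
      same   : 0 < w → y' ≡ y
      result : ∀ a t → F z e a t ≡ delayBy c (F z (raiseAt (j + suc w) (lowerAt (y' + w) e))) a t

  record Stuck (z w j : ℕ) (e : ℕ → ℕ) : Set where
    field
      noTower : ∀ c y → ¬ Tower d (suc w) j c y
      vanish  : ∀ a t → F z e a t ≡ + 0

  module Step {z w y j : ℕ} {e : ℕ → ℕ} (zl : z ≤ ℓ) (S : State w y j e) (pos : Position z w j)
              (xl : suc (j + w) < ℓ) (yj : y + w ≤ j) (small : suc (j + w) < d j)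
              (lowVals : ∀ r → y ≤ r → r < y + w → d r ≤ suc (j + w)) where
    open State S
    open Collision z (j + w) zl xl (side pos)

    avoid : ∀ r → r < j + w → d r ≢ suc (j + w) → e r ≢ suc (j + w)
    avoid r l ne q with r <? j
    ... | no p = apart r (≮⇒≥ p) l q
    ... | yes p with range? y w r
    ...   | inj₁ (a , b) = lin⊥ (d r ∷ j ∷ w ∷ e r ∷ []) ($ 0 ⊴ # 1 ⊹ ($ 1 ⊹ $ 2) ∋ lowVals r a b ∷ # 1 ⊹ $ 3 ≐ $ 0 ∋ lowered r p a b ∷ # 1 ⊹ ($ 1 ⊹ $ 2) ≐ $ 3 ∋ sym q ∷ [])
    ...   | inj₂ o       = ne (trans (sym (kept r p o)) q)

    none : (∀ v → d v ≢ suc (j + w)) → ∀ a t → F z e a t ≡ + 0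
    none nu = F-vanish e level gap (λ r l → avoid r l (nu r))

    module Hit (v : ℕ) (dv : d v ≡ suc (j + w)) (vr : v < y ⊎ y + w ≤ v) where
      v<j : v < j
      v<j with v <? j
      ... | yes p = p
      ... | no p  = ⊥-elim (lin⊥ (j ∷ w ∷ d j ∷ d v ∷ []) (# 1 ⊹ (# 1 ⊹ ($ 0 ⊹ $ 1)) ⊴ $ 2 ∋ small ∷ $ 3 ≐ # 1 ⊹ ($ 0 ⊹ $ 1) ∋ dv ∷ $ 2 ⊴ $ 3 ∋ d-mono-≤ (≮⇒≥ p) ∷ []))
      ev : e v ≡ suc (j + w)
      ev = trans (kept v v<j vr) dv
      e' = raiseAt (suc (j + w)) (lowerAt v e)
      pushed : ∀ a t → F z e a t ≡ delayBy 1 (F z e') a t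
      pushed a zero    = F-push-0 e level gap v (lin≤ (v ∷ j ∷ w ∷ []) 1 (# 1 ⊹ $ 0) ($ 1 ⊹ $ 2) (# 1 ⊹ $ 0 ⊴ $ 1 ∋ v<j ∷ [])) ev (λ r l ne → avoid r l (λ q → ne (d-inj (trans q (sym dv))))) a
      pushed a (suc t) = F-push e level gap v (lin≤ (v ∷ j ∷ w ∷ []) 1 (# 1 ⊹ $ 0) ($ 1 ⊹ $ 2) (# 1 ⊹ $ 0 ⊴ $ 1 ∋ v<j ∷ [])) ev (λ r l ne → avoid r l (λ q → ne (d-inj (trans q (sym dv))))) a t
      e'v : suc (e' v) ≡ e v
      e'v = trans (cong suc (trans (raiseAt-diff {suc (j + w)} {v} (lowerAt v e) (λ q → (lin⊥ (v ∷ j ∷ w ∷ []) (# 1 ⊹ ($ 1 ⊹ $ 2) ≐ $ 0 ∋ sym q ∷ # 1 ⊹ $ 0 ⊴ $ 1 ∋ v<j ∷ [])))) (lowerAt-same v e)))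
              (trans (cong (λ q → suc (pred q)) ev) (sym ev))
      e'sx : e' (suc (j + w)) ≡ suc (e (suc (j + w)))
      e'sx = trans (raiseAt-same (suc (j + w)) (lowerAt v e)) (cong suc (lowerAt-diff {v} {suc (j + w)} e (λ q → (lin⊥ (j ∷ w ∷ v ∷ []) (# 1 ⊹ ($ 0 ⊹ $ 1) ≐ $ 2 ∋ q ∷ # 1 ⊹ $ 2 ⊴ $ 0 ∋ v<j ∷ [])))))
      e'r : ∀ r → r ≢ v → r ≢ suc (j + w) → e' r ≡ e r
      e'r r p q = trans (raiseAt-diff (lowerAt v e) q) (lowerAt-diff e p)

  tower-values : ∀ {w j c y} → Tower d w j c y → ∀ a → a < w → d (y + a) ≤ suc (j + a)
  tower-values (top _ _ g)  a l = ≤-reflexive (g a l)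
  tower-values {j = j} {y = y} (step {u = u} h t) a l = lin≤ (d (y + a) ∷ u ∷ a ∷ d u ∷ j ∷ []) 1 ($ 0) (# 1 ⊹ ($ 4 ⊹ $ 2)) ($ 0 ⊴ # 1 ⊹ ($ 1 ⊹ $ 2) ∋ tower-values t a l ∷ $ 3 ≐ $ 4 ⊹ # 0 ∋ trans (sym (d+0 u)) (h 0 z≤n) ∷ # 1 ⊹ $ 1 ⊴ $ 3 ∋ d-> u ∷ [])

  tower-lowVals : ∀ {w j c y} → Tower d w j c y → ∀ r → y ≤ r → r < y + w → d r ≤ suc (j + w)
  tower-lowVals {w} {j} {c} {y} t r l u with m≤n⇒∃[o]m+o≡n l
  ... | o , refl = lin≤ (d (y + o) ∷ j ∷ o ∷ y ∷ w ∷ []) 1 ($ 0) (# 1 ⊹ ($ 1 ⊹ $ 4)) ($ 0 ⊴ # 1 ⊹ ($ 1 ⊹ $ 2) ∋ tower-values t o (+-cancelˡ-< y o w u) ∷ # 1 ⊹ ($ 3 ⊹ $ 2) ⊴ $ 3 ⊹ $ 4 ∋ u ∷ [])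

  copies-next : ∀ {w j y v} → w ≢ 0 → (∀ a → a < w → d (y + a) ≡ suc (j + a)) → d v ≡ suc (j + w) → v ≡ y + w
  copies-next {zero}           ne g dv = ⊥-elim (ne refl)
  copies-next {suc w} {j} {y} ne g dv =
    trans (d-next (trans dv (cong suc (trans (+-suc j w) (sym (g w ≤-refl)))))) (sym (+-suc y w))

  -- One round widens the ribbons by one row. The collision at j + w is traded for one at u + w in
  -- the component above, and so on to the top, with a factor t per component; there a last row is
  -- lowered and the collision is gone. If at some level the row needed for the trade is missing,
  -- the series vanishes and no tower of width w + 1 exists.
  push : ∀ {z w y j c e} → z ≤ ℓ → Tower d w j c y → State w y j e → Position z w j →
    suc (j + w) < ℓ → suc (j + w) < d j → Pushed z w j c y e ⊎ Stuck z w j e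
  push {z} {w} {y} {j} {.1} {e} zl T@(top nu yw g) S pos xl small with up? (suc (j + w))
  ... | inj₂ nov = inj₂ (record { noTower = imposs ; vanish = Step.none zl S pos xl (tower-low C T) small (tower-lowVals T) nov })
    where
    imposs : ∀ c y → ¬ Tower d (suc w) j c y
    imposs _ y (top _ _ g')   = nov (y + w) (g' w ≤-refl)
    imposs _ _ (step {u = u} g' _) = nu u (trans (sym (d+0 u)) (trans (g' 0 z≤n) (+-identityʳ j)))
  ... | inj₁ (v , dv) = inj₁ (finish (w ≟ 0))
    where
    finish : Dec (w ≡ 0) → Pushed z w j 1 y e
    -- At width 0 a tower says nothing about its row y; the preimage v found now fixes it.
    finish (yes refl) = record
      { tower' = top {y = v} nu (lin≤ (v ∷ j ∷ []) 1 ($ 0 ⊹ (# 1 ⊹ # 0)) ($ 1) (# 1 ⊹ $ 0 ⊴ $ 1 ∋ Step.Hit.v<j zl S pos xl (tower-low C T) small (tower-lowVals T) v dv vr ∷ [])) (λ { zero _ → trans (d+0 v) dv ; (suc a) (s≤s ()) })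
      ; same = λ ()
      ; result = λ a t → trans (Step.Hit.pushed zl S pos xl (tower-low C T) small (tower-lowVals T) v dv vr a t) (delayBy-cong 1 (F-cong z (λ r → cong₂ (λ p q → raiseAt p (lowerAt q e) r) (sym (+-suc j 0)) (sym (+-identityʳ v)))) a t) }
      where
      vr : v < y ⊎ y + 0 ≤ v
      vr with v <? y
      ... | yes p = inj₁ p
      ... | no p  = inj₂ (lin≤ (y ∷ v ∷ []) 1 ($ 0 ⊹ # 0) ($ 1) ($ 0 ⊴ $ 1 ∋ ≮⇒≥ p ∷ []))
    finish (no w≢0) = record
      { tower' = top nu (lin≤ (v ∷ j ∷ y ∷ w ∷ []) 1 ($ 2 ⊹ (# 1 ⊹ $ 3)) ($ 1) (# 1 ⊹ $ 0 ⊴ $ 1 ∋ Step.Hit.v<j zl S pos xl (tower-low C T) small (tower-lowVals T) v dv (inj₂ (≤-reflexive (sym vy))) ∷ $ 2 ⊹ $ 3 ≐ $ 0 ∋ sym vy ∷ [])) more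
      ; same = λ _ → refl
      ; result = λ a t → trans (Step.Hit.pushed zl S pos xl (tower-low C T) small (tower-lowVals T) v dv (inj₂ (≤-reflexive (sym vy))) a t) (delayBy-cong 1 (F-cong z (λ r → cong₂ (λ p q → raiseAt p (lowerAt q e) r) (sym (+-suc j w)) vy)) a t) }
      where
      vy : v ≡ y + w
      vy = copies-next w≢0 g dv
      more : ∀ a → a < suc w → d (y + a) ≡ suc (j + a)
      more a l with a ≟ w
      ... | yes refl = trans (cong d (sym vy)) dv
      ... | no ne    = g a (≤∧≢⇒< (≤-pred l) ne)
  push {z} {w} {y} {j} {.(suc _)} {e} zl T@(step {u = u} {c = c} g T') S pos xl small with up? (suc (j + w))
  ... | inj₂ nov = inj₂ (record { noTower = imposs ; vanish = Step.none zl S pos xl (tower-low C T) small (tower-lowVals T) nov })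
    where
    imposs : ∀ c y → ¬ Tower d (suc w) j c y
    imposs _ y (top nu _ _)   = nu u (trans (sym (d+0 u)) (trans (g 0 z≤n) (+-identityʳ j)))
    imposs _ _ (step {u = u'} g' _) = nov (u' + suc w) (trans (g' (suc w) ≤-refl) (+-suc j w))
  ... | inj₁ (v , dv) = continue
    where
    open Step zl S pos xl (tower-low C T) small (tower-lowVals T)
    open State S
    du : d u ≡ j
    du = trans (sym (d+0 u)) (trans (g 0 z≤n) (+-identityʳ j))
    vu : v ≡ suc (u + w)
    vu = d-next (trans dv (cong suc (sym (g w ≤-refl))))
    yu : y + w ≤ u
    yu = tower-low C T'
    vr : v < y ⊎ y + w ≤ v
    vr = inj₂ (lin≤ (v ∷ u ∷ w ∷ y ∷ []) 1 ($ 3 ⊹ $ 2) ($ 0) (# 1 ⊹ ($ 1 ⊹ $ 2) ≐ $ 0 ∋ sym vu ∷ $ 3 ⊹ $ 2 ⊴ $ 1 ∋ yu ∷ []))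
    open Hit v dv vr
    g+ : ∀ a → a ≤ suc w → d (u + a) ≡ j + a
    g+ a l with a ≟ suc w
    ... | yes refl = trans (cong d (trans (+-suc u w) (sym vu))) (trans dv (sym (+-suc j w)))
    ... | no ne    = g a (≤-pred (≤∧≢⇒< l ne))
    -- Otherwise row j would belong to the run starting at u, so that d j would be at most j + w +
    -- 1, against `small`.
    u+w<j : suc (u + w) < j
    u+w<j with suc (u + w) <? j
    ... | yes p = p
    ... | no p with m≤n⇒∃[o]m+o≡n (<⇒≤ (≤-trans (d-> u) (≤-reflexive du)))
    ...   | o , eq = ⊥-elim (lin⊥ (j ∷ w ∷ d j ∷ d (u + o) ∷ o ∷ u ∷ []) (# 1 ⊹ (# 1 ⊹ ($ 0 ⊹ $ 1)) ⊴ $ 2 ∋ small ∷ $ 3 ≐ $ 0 ⊹ $ 4 ∋ g+ o (lin≤ (j ∷ u ∷ w ∷ o ∷ []) 1 ($ 3) (# 1 ⊹ $ 2) ($ 0 ⊴ # 1 ⊹ ($ 1 ⊹ $ 2) ∋ ≮⇒≥ p ∷ $ 1 ⊹ $ 3 ≐ $ 0 ∋ eq ∷ [])) ∷ $ 2 ≐ $ 3 ∋ sym (cong d eq) ∷ $ 5 ⊹ $ 4 ≐ $ 0 ∋ eq ∷ $ 0 ⊴ # 1 ⊹ ($ 5 ⊹ $ 1) ∋ ≮⇒≥ p ∷ []))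
    eu+w : e (u + w) ≡ j + w
    eu+w = trans (kept (u + w) (lin≤ (u ∷ w ∷ j ∷ []) 1 (# 1 ⊹ ($ 0 ⊹ $ 1)) ($ 2) (# 1 ⊹ (# 1 ⊹ ($ 0 ⊹ $ 1)) ⊴ $ 2 ∋ u+w<j ∷ [])) (inj₂ (lin≤ (y ∷ w ∷ u ∷ []) 1 ($ 0 ⊹ $ 1) ($ 2 ⊹ $ 1) ($ 0 ⊹ $ 1 ⊴ $ 2 ∋ yu ∷ [])))) (g w ≤-refl)
    S' : State w y u e'
    S' = record
      { level   = ≤-antisym (lin≤ (e' (u + w) ∷ e (u + w) ∷ j ∷ w ∷ e' v ∷ e v ∷ e' (suc (u + w)) ∷ []) 1 ($ 0) ($ 6) ($ 0 ≐ $ 1 ∋ e'r (u + w) (λ q → (lin⊥ (u ∷ w ∷ v ∷ []) ($ 2 ≐ $ 0 ⊹ $ 1 ∋ sym q ∷ # 1 ⊹ ($ 0 ⊹ $ 1) ≐ $ 2 ∋ sym vu ∷ []))) (λ q → (lin⊥ (u ∷ w ∷ j ∷ []) (# 1 ⊹ ($ 2 ⊹ $ 1) ≐ $ 0 ⊹ $ 1 ∋ sym q ∷ # 1 ⊹ (# 1 ⊹ ($ 0 ⊹ $ 1)) ⊴ $ 2 ∋ u+w<j ∷ []))) ∷ $ 1 ≐ $ 2 ⊹ $ 3 ∋ eu+w ∷ $ 5 ≐ # 1 ⊹ $ 4 ∋ sym e'v ∷ # 1 ⊹ ($ 2 ⊹ $ 3) ≐ $ 5 ∋ sym ev ∷ $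 4 ≐ $ 6 ∋ cong e' vu ∷ [])) (lin≤ (e' (u + w) ∷ e (u + w) ∷ j ∷ w ∷ e' v ∷ e v ∷ e' (suc (u + w)) ∷ []) 1 ($ 6) ($ 0) ($ 1 ≐ $ 0 ∋ sym (e'r (u + w) (λ q → (lin⊥ (u ∷ w ∷ v ∷ []) ($ 2 ≐ $ 0 ⊹ $ 1 ∋ sym q ∷ # 1 ⊹ ($ 0 ⊹ $ 1) ≐ $ 2 ∋ sym vu ∷ []))) (λ q → (lin⊥ (u ∷ w ∷ j ∷ []) (# 1 ⊹ ($ 2 ⊹ $ 1) ≐ $ 0 ⊹ $ 1 ∋ sym q ∷ # 1 ⊹ (# 1 ⊹ ($ 0 ⊹ $ 1)) ⊴ $ 2 ∋ u+w<j ∷ [])))) ∷ $ 2 ⊹ $ 3 ≐ $ 1 ∋ sym eu+w ∷ # 1 ⊹ $ 4 ≐ $ 5 ∋ e'v ∷ $ 5 ≐ # 1 ⊹ ($ 2 ⊹ $ 3) ∋ ev ∷ $ 6 ≐ $ 4 ∋ sym (cong e' vu) ∷ []))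
      ; gap     = lin≤ (e' (u + w) ∷ e (u + w) ∷ j ∷ w ∷ u ∷ []) 1 (# 1 ⊹ (# 1 ⊹ ($ 4 ⊹ $ 3))) ($ 0) ($ 1 ≐ $ 0 ∋ sym (e'r (u + w) (λ q → (lin⊥ (u ∷ w ∷ v ∷ []) ($ 2 ≐ $ 0 ⊹ $ 1 ∋ sym q ∷ # 1 ⊹ ($ 0 ⊹ $ 1) ≐ $ 2 ∋ sym vu ∷ []))) (λ q → (lin⊥ (u ∷ w ∷ j ∷ []) (# 1 ⊹ ($ 2 ⊹ $ 1) ≐ $ 0 ⊹ $ 1 ∋ sym q ∷ # 1 ⊹ (# 1 ⊹ ($ 0 ⊹ $ 1)) ⊴ $ 2 ∋ u+w<j ∷ [])))) ∷ $ 2 ⊹ $ 3 ≐ $ 1 ∋ sym eu+w ∷ # 1 ⊹ (# 1 ⊹ ($ 4 ⊹ $ 3)) ⊴ $ 2 ∋ u+w<j ∷ [])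
      ; lowered = λ r l a b → trans (cong suc (e'r r (λ q → (lin⊥ (r ∷ v ∷ u ∷ w ∷ []) ($ 1 ≐ $ 0 ∋ sym q ∷ # 1 ⊹ ($ 2 ⊹ $ 3) ≐ $ 1 ∋ sym vu ∷ # 1 ⊹ $ 0 ⊴ $ 2 ∋ l ∷ []))) (λ q → (lin⊥ (r ∷ j ∷ w ∷ u ∷ []) (# 1 ⊹ ($ 1 ⊹ $ 2) ≐ $ 0 ∋ sym q ∷ # 1 ⊹ (# 1 ⊹ ($ 3 ⊹ $ 2)) ⊴ $ 1 ∋ u+w<j ∷ # 1 ⊹ $ 0 ⊴ $ 3 ∋ l ∷ []))))) (lowered r (lin≤ (r ∷ u ∷ w ∷ j ∷ []) 1 (# 1 ⊹ $ 0) ($ 3) (# 1 ⊹ $ 0 ⊴ $ 1 ∋ l ∷ # 1 ⊹ (# 1 ⊹ ($ 1 ⊹ $ 2)) ⊴ $ 3 ∋ u+w<j ∷ [])) a b)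
      ; kept    = λ r l o → trans (e'r r (λ q → (lin⊥ (r ∷ v ∷ u ∷ w ∷ []) ($ 1 ≐ $ 0 ∋ sym q ∷ # 1 ⊹ ($ 2 ⊹ $ 3) ≐ $ 1 ∋ sym vu ∷ # 1 ⊹ $ 0 ⊴ $ 2 ∋ l ∷ []))) (λ q → (lin⊥ (r ∷ j ∷ w ∷ u ∷ []) (# 1 ⊹ ($ 1 ⊹ $ 2) ≐ $ 0 ∋ sym q ∷ # 1 ⊹ (# 1 ⊹ ($ 3 ⊹ $ 2)) ⊴ $ 1 ∋ u+w<j ∷ # 1 ⊹ $ 0 ⊴ $ 3 ∋ l ∷ [])))) (kept r (lin≤ (r ∷ u ∷ w ∷ j ∷ []) 1 (# 1 ⊹ $ 0) ($ 3) (# 1 ⊹ $ 0 ⊴ $ 1 ∋ l ∷ # 1 ⊹ (# 1 ⊹ ($ 1 ⊹ $ 2)) ⊴ $ 3 ∋ u+w<j ∷ [])) o)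
      ; apart   = λ r l b → upper r l b }
      where
      upper : ∀ r → u ≤ r → r < u + w → e' r ≢ suc (u + w)
      upper r l b q with m≤n⇒∃[o]m+o≡n l
      ... | o , refl = lin⊥ ((if u + o ≡ᵇ suc (j + w) then suc (if u + o ≡ᵇ v then e (u + o) ∸ 1 else e (u + o)) else (if u + o ≡ᵇ v then e (u + o) ∸ 1 else e (u + o))) ∷ u ∷ w ∷ e (u + o) ∷ d (u + o) ∷ j ∷ o ∷ []) ($ 0 ≐ # 1 ⊹ ($ 1 ⊹ $ 2) ∋ q ∷ $ 3 ≐ $ 0 ∋ sym (e'r (u + o) (λ q → (lin⊥ (u ∷ o ∷ v ∷ w ∷ []) ($ 2 ≐ $ 0 ⊹ $ 1 ∋ sym q ∷ # 1 ⊹ ($ 0 ⊹ $ 3) ≐ $ 2 ∋ sym vu ∷ # 1 ⊹ ($ 0 ⊹ $ 1) ⊴ $ 0 ⊹ $ 3 ∋ b ∷ []))) (λ q → (lin⊥ (u ∷ o ∷ j ∷ w ∷ []) (# 1 ⊹ ($ 2 ⊹ $ 3) ≐ $ 0 ⊹ $ 1 ∋ sym q ∷ # 1 ⊹ (# 1 ⊹ ($ 0 ⊹ $ 3)) ⊴ $ 2 ∋ u+w<j ∷ # 1 ⊹ ($ 0 ⊹ $ 1) ⊴ $ 0 ⊹ $ 3 ∋ b ∷ [])))) ∷ $ 4 ≐ $ 3 ∋ sym (kept (u + o) (lin≤ (u ∷ o ∷ w ∷ j ∷ []) 1 (# 1 ⊹ ($ 0 ⊹ $ 1)) ($ 3)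 (# 1 ⊹ ($ 0 ⊹ $ 1) ⊴ $ 0 ⊹ $ 2 ∋ b ∷ # 1 ⊹ (# 1 ⊹ ($ 0 ⊹ $ 2)) ⊴ $ 3 ∋ u+w<j ∷ [])) (inj₂ (lin≤ (y ∷ w ∷ u ∷ o ∷ []) 1 ($ 0 ⊹ $ 1) ($ 2 ⊹ $ 3) ($ 0 ⊹ $ 1 ⊴ $ 2 ∋ yu ∷ [])))) ∷ $ 5 ⊹ $ 6 ≐ $ 4 ∋ sym (g o (lin≤ (u ∷ o ∷ w ∷ []) 1 ($ 1) ($ 2) (# 1 ⊹ ($ 0 ⊹ $ 1) ⊴ $ 0 ⊹ $ 2 ∋ b ∷ []))) ∷ # 1 ⊹ (# 1 ⊹ ($ 1 ⊹ $ 2)) ⊴ $ 5 ∋ u+w<j ∷ [])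
    continue : Pushed z w j (suc c) y e ⊎ Stuck z w j e
    continue with push zl T' S' (position-up du u+w<j pos) (lin≤ (u ∷ w ∷ j ∷ ℓ ∷ []) 1 (# 1 ⊹ (# 1 ⊹ ($ 0 ⊹ $ 1))) ($ 3) (# 1 ⊹ (# 1 ⊹ ($ 0 ⊹ $ 1)) ⊴ $ 2 ∋ u+w<j ∷ # 1 ⊹ (# 1 ⊹ ($ 2 ⊹ $ 1)) ⊴ $ 3 ∋ xl ∷ [])) (≤-trans u+w<j (≤-reflexive (sym du)))
    ... | inj₂ s = inj₂ (record { noTower = imposs ; vanish = λ a t → trans (pushed a t) (delayBy-zero 1 (Stuck.vanish s) a t) })
      where
      imposs : ∀ c y → ¬ Tower d (suc w) j c y
      imposs _ _ (top nu _ _) = nu u du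
      imposs _ _ (step {u = u'} g' t) with d-inj (trans (sym (d+0 u')) (trans (g' 0 z≤n) (trans (+-identityʳ j) (sym du))))
      ... | refl = Stuck.noTower s _ _ t
    ... | inj₁ p = inj₁ (record { tower' = step g+ tower' ; same = same ; result = res })
      where
      open Pushed p
      y'u : y' + w < u
      y'u = ≤-trans (≤-reflexive (sym (+-suc y' w))) (tower-low C tower')
      -- Row v = u + w + 1 is lowered by the lowest push and raised again by those above it, so only
      -- the two ends of the round remain changed.
      agree : ∀ r → raiseAt (u + suc w) (lowerAt (y' + w) e') r ≡ raiseAt (j + suc w) (lowerAt (y' + w) e) r
      agree r with r ≟ y' + w | r ≟ v | r ≟ suc (j + w)
      ... | yes refl | _ | _ = begin
        raiseAt (u + suc w) (lowerAt r e') r  ≡⟨ raiseAt-diff {u + suc w} {r} (lowerAt r e') (λ q → (lin⊥ (Pushed.y' p ∷ w ∷ u ∷ []) ($ 2 ⊹ (# 1 ⊹ $ 1) ≐ $ 0 ⊹ $ 1 ∋ sym q ∷ # 1 ⊹ ($ 0 ⊹ $ 1) ⊴ $ 2 ∋ y'u ∷ []))) ⟩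
        lowerAt r e' r                        ≡⟨ lowerAt-same r e' ⟩
        pred (e' r)                           ≡⟨ cong pred (e'r r (λ q → (lin⊥ (Pushed.y' p ∷ w ∷ v ∷ u ∷ []) ($ 2 ≐ $ 0 ⊹ $ 1 ∋ sym q ∷ # 1 ⊹ ($ 3 ⊹ $ 1) ≐ $ 2 ∋ sym vu ∷ # 1 ⊹ ($ 0 ⊹ $ 1) ⊴ $ 3 ∋ y'u ∷ []))) (λ q → (lin⊥ (Pushed.y' p ∷ w ∷ j ∷ u ∷ []) (# 1 ⊹ ($ 2 ⊹ $ 1) ≐ $ 0 ⊹ $ 1 ∋ sym q ∷ # 1 ⊹ ($ 0 ⊹ $ 1) ⊴ $ 3 ∋ y'u ∷ # 1 ⊹ (# 1 ⊹ ($ 3 ⊹ $ 1)) ⊴ $ 2 ∋ u+w<j ∷ [])))) ⟩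
        pred (e r)                            ≡⟨ lowerAt-same r e ⟨
        lowerAt r e r                         ≡⟨ raiseAt-diff {j + suc w} {r} (lowerAt r e) (λ q → (lin⊥ (Pushed.y' p ∷ w ∷ j ∷ u ∷ []) ($ 2 ⊹ (# 1 ⊹ $ 1) ≐ $ 0 ⊹ $ 1 ∋ sym q ∷ # 1 ⊹ ($ 0 ⊹ $ 1) ⊴ $ 3 ∋ y'u ∷ # 1 ⊹ (# 1 ⊹ ($ 3 ⊹ $ 1)) ⊴ $ 2 ∋ u+w<j ∷ []))) ⟨
        raiseAt (j + suc w) (lowerAt r e) r   ∎
        where open ≡-Reasoning
      ... | no a | yes refl | _ = begin
        raiseAt (u + suc w) (lowerAt (y' + w) e') r  ≡⟨ cong (λ x → raiseAt x (lowerAt (y' + w) e') r) (trans (+-suc u w) (sym vu)) ⟩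
        raiseAt r (lowerAt (y' + w) e') r            ≡⟨ raiseAt-same r (lowerAt (y' + w) e') ⟩
        suc (lowerAt (y' + w) e' r)                  ≡⟨ cong suc (lowerAt-diff e' a) ⟩
        suc (e' r)                                   ≡⟨ e'v ⟩
        e r                                          ≡⟨ lowerAt-diff e a ⟨
        lowerAt (y' + w) e r                         ≡⟨ raiseAt-diff {j + suc w} {r} (lowerAt (y' + w) e) (λ q → (lin⊥ (r ∷ j ∷ w ∷ u ∷ []) ($ 1 ⊹ (# 1 ⊹ $ 2) ≐ $ 0 ∋ sym q ∷ $ 0 ≐ # 1 ⊹ ($ 3 ⊹ $ 2) ∋ vu ∷ # 1 ⊹ (# 1 ⊹ ($ 3 ⊹ $ 2)) ⊴ $ 1 ∋ u+w<j ∷ []))) ⟨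
        raiseAt (j + suc w) (lowerAt (y' + w) e) r   ∎
        where open ≡-Reasoning
      ... | no a | no b | yes refl = begin
        raiseAt (u + suc w) (lowerAt (y' + w) e') r  ≡⟨ raiseAt-diff {u + suc w} {r} (lowerAt (y' + w) e') (λ q → (lin⊥ (j ∷ w ∷ u ∷ []) (# 1 ⊹ ($ 0 ⊹ $ 1) ≐ $ 2 ⊹ (# 1 ⊹ $ 1) ∋ q ∷ # 1 ⊹ (# 1 ⊹ ($ 2 ⊹ $ 1)) ⊴ $ 0 ∋ u+w<j ∷ []))) ⟩
        lowerAt (y' + w) e' r                        ≡⟨ lowerAt-diff e' a ⟩
        e' r                                         ≡⟨ e'sx ⟩
        suc (e r)                                    ≡⟨ cong suc (lowerAt-diff e a) ⟨
        suc (lowerAt (y' + w) e r)                   ≡⟨ raiseAt-same r (lowerAt (y' + w) e) ⟨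
        raiseAt r (lowerAt (y' + w) e) r             ≡⟨ cong (λ x → raiseAt x (lowerAt (y' + w) e) r) (sym (+-suc j w)) ⟩
        raiseAt (j + suc w) (lowerAt (y' + w) e) r   ∎
        where open ≡-Reasoning
      ... | no a | no b | no q' = begin
        raiseAt (u + suc w) (lowerAt (y' + w) e') r  ≡⟨ raiseAt-diff {u + suc w} {r} (lowerAt (y' + w) e') (λ q → b (trans q (trans (+-suc u w) (sym vu)))) ⟩
        lowerAt (y' + w) e' r                        ≡⟨ lowerAt-diff e' a ⟩
        e' r                                         ≡⟨ e'r r b q' ⟩
        e r                                          ≡⟨ lowerAt-diff e a ⟨
        lowerAt (y' + w) e r                         ≡⟨ raiseAt-diff {j + suc w} {r} (lowerAt (y' + w) e) (λ q → q' (trans q (+-suc j w))) ⟨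
        raiseAt (j + suc w) (lowerAt (y' + w) e) r   ∎
        where open ≡-Reasoning
      res : ∀ a t → F z e a t ≡ delayBy (suc c) (F z (raiseAt (j + suc w) (lowerAt (y' + w) e))) a t
      res a t = trans (pushed a t) (trans (delayBy-cong 1 (λ a t → trans (result a t) (delayBy-cong c (F-cong z agree) a t)) a t)
        (sym (delayBy-+ 1 c _ a t)))

  dMove-up : ∀ {j y} w → y + w ≤ j → ∀ a → a ≤ w → dMove d j y w (j + a) ≡ suc (d (j + a))
  dMove-up {j} zero yj zero l rewrite +-identityʳ j = raiseAt-same j d
  dMove-up {j} {y} (suc w) yj a l with a ≟ suc w
  ... | yes refl = trans (raiseAt-same (j + suc w) (lowerAt (y + w) (dMove d j y w)))
        (cong suc (trans (lowerAt-diff (dMove d j y w) (λ q → (lin⊥ (j ∷ w ∷ y ∷ []) ($ 0 ⊹ (# 1 ⊹ $ 1) ≐ $ 2 ⊹ $ 1 ∋ q ∷ $ 2 ⊹ (# 1 ⊹ $ 1) ⊴ $ 0 ∋ yj ∷ [])))) (above w ≤-refl)))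
    where
    above : ∀ w' → w' ≤ w → dMove d j y w' (j + suc w) ≡ d (j + suc w)
    above zero     l = raiseAt-diff {j} {j + suc w} d (λ q → (lin⊥ (j ∷ w ∷ []) ($ 0 ⊹ (# 1 ⊹ $ 1) ≐ $ 0 ∋ q ∷ [])))
    above (suc w') l = trans (raiseAt-diff {j + suc w'} {j + suc w} (lowerAt (y + w') (dMove d j y w')) (λ q → (lin⊥ (j ∷ w ∷ w' ∷ []) ($ 0 ⊹ (# 1 ⊹ $ 1) ≐ $ 0 ⊹ (# 1 ⊹ $ 2) ∋ q ∷ # 1 ⊹ $ 2 ⊴ $ 1 ∋ l ∷ []))))
      (trans (lowerAt-diff {y + w'} {j + suc w} (dMove d j y w') (λ q → (lin⊥ (j ∷ w ∷ y ∷ w' ∷ []) ($ 0 ⊹ (# 1 ⊹ $ 1) ≐ $ 2 ⊹ $ 3 ∋ q ∷ 2 ⊠ # 1 ⊹ $ 3 ⊴ $ 1 ∋ l ∷ $ 2 ⊹ (# 1 ⊹ $ 1) ⊴ $ 0 ∋ yj ∷ [])))) (above w' (<⇒≤ l)))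
  ... | no ne = trans (raiseAt-diff {j + suc w} {j + a} (lowerAt (y + w) (dMove d j y w)) (λ q → ne (+-cancelˡ-≡ j _ _ q)))
      (trans (lowerAt-diff {y + w} {j + a} (dMove d j y w) (λ q → (lin⊥ (j ∷ a ∷ y ∷ w ∷ []) ($ 0 ⊹ $ 1 ≐ $ 2 ⊹ $ 3 ∋ q ∷ $ 2 ⊹ (# 1 ⊹ $ 3) ⊴ $ 0 ∋ yj ∷ [])))) (dMove-up w (lin≤ (y ∷ w ∷ j ∷ []) 1 ($ 0 ⊹ $ 1) ($ 2) ($ 0 ⊹ (# 1 ⊹ $ 1) ⊴ $ 2 ∋ yj ∷ [])) a (≤-pred (≤∧≢⇒< l ne))))

  dMove-above : ∀ {j y} w → y + w ≤ j → ∀ r → j + w < r → dMove d j y w r ≡ d r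
  dMove-above {j} zero yj r l = raiseAt-diff {j} {r} d (λ q → (lin⊥ (r ∷ j ∷ []) ($ 0 ≐ $ 1 ∋ q ∷ # 1 ⊹ ($ 1 ⊹ # 0) ⊴ $ 0 ∋ l ∷ [])))
  dMove-above {j} {y} (suc w) yj r l = trans (raiseAt-diff {j + suc w} {r} (lowerAt (y + w) (dMove d j y w)) (λ q → (lin⊥ (r ∷ j ∷ w ∷ []) ($ 0 ≐ $ 1 ⊹ (# 1 ⊹ $ 2) ∋ q ∷ # 1 ⊹ ($ 1 ⊹ (# 1 ⊹ $ 2)) ⊴ $ 0 ∋ l ∷ []))))
      (trans (lowerAt-diff {y + w} {r} (dMove d j y w) (λ q → (lin⊥ (r ∷ y ∷ w ∷ j ∷ []) ($ 0 ≐ $ 1 ⊹ $ 2 ∋ q ∷ $ 1 ⊹ (# 1 ⊹ $ 2) ⊴ $ 3 ∋ yj ∷ # 1 ⊹ ($ 3 ⊹ (# 1 ⊹ $ 2)) ⊴ $ 0 ∋ l ∷ [])))) (dMove-above w (lin≤ (y ∷ w ∷ j ∷ []) 1 ($ 0 ⊹ $ 1) ($ 2) ($ 0 ⊹ (# 1 ⊹ $ 1) ⊴ $ 2 ∋ yj ∷ [])) r (lin≤ (j ∷ w ∷ r ∷ []) 1 (# 1 ⊹ ($ 0 ⊹ $ 1)) ($ 2) (# 1 ⊹ ($ 0 ⊹ (# 1 ⊹ $ 1)) ⊴ $ 2 ∋ l ∷ []))))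

  dMove-out : ∀ {j y} w → y + w ≤ j → ∀ r → r < j → (r < y ⊎ y + w ≤ r) → dMove d j y w r ≡ d r
  dMove-out {j} zero yj r l o = raiseAt-diff {j} {r} d (λ q → (lin⊥ (r ∷ j ∷ []) ($ 1 ≐ $ 0 ∋ sym q ∷ # 1 ⊹ $ 0 ⊴ $ 1 ∋ l ∷ [])))
  dMove-out {j} {y} (suc w) yj r l o = trans (raiseAt-diff {j + suc w} {r} (lowerAt (y + w) (dMove d j y w)) (λ q → (lin⊥ (r ∷ j ∷ w ∷ []) ($ 1 ⊹ (# 1 ⊹ $ 2) ≐ $ 0 ∋ sym q ∷ # 1 ⊹ $ 0 ⊴ $ 1 ∋ l ∷ []))))
      (trans (lowerAt-diff {y + w} {r} (dMove d j y w) (ne o)) (dMove-out w (lin≤ (y ∷ w ∷ j ∷ []) 1 ($ 0 ⊹ $ 1) ($ 2) ($ 0 ⊹ (# 1 ⊹ $ 1) ⊴ $ 2 ∋ yj ∷ [])) r l (weak o)))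
    where
    ne : (r < y ⊎ y + suc w ≤ r) → r ≢ y + w
    ne (inj₁ p) q = lin⊥ (r ∷ y ∷ w ∷ []) (# 1 ⊹ $ 0 ⊴ $ 1 ∋ p ∷ $ 1 ⊹ $ 2 ≐ $ 0 ∋ sym q ∷ [])
    ne (inj₂ p) q = lin⊥ (y ∷ w ∷ r ∷ []) ($ 0 ⊹ (# 1 ⊹ $ 1) ⊴ $ 2 ∋ p ∷ $ 2 ≐ $ 0 ⊹ $ 1 ∋ q ∷ [])
    weak : (r < y ⊎ y + suc w ≤ r) → (r < y ⊎ y + w ≤ r)
    weak (inj₁ p) = inj₁ p
    weak (inj₂ p) = inj₂ (lin≤ (y ∷ w ∷ r ∷ []) 1 ($ 0 ⊹ $ 1) ($ 2) ($ 0 ⊹ (# 1 ⊹ $ 1) ⊴ $ 2 ∋ p ∷ []))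

  dMove-low : ∀ {j y} w → y + w ≤ j → ∀ r → y ≤ r → r < y + w → suc (dMove d j y w r) ≡ d r
  dMove-low {j} {y} zero yj r l u = ⊥-elim (lin⊥ (y ∷ r ∷ []) ($ 0 ⊴ $ 1 ∋ l ∷ # 1 ⊹ $ 1 ⊴ $ 0 ⊹ # 0 ∋ u ∷ []))
  dMove-low {j} {y} (suc w) yj r l u with r ≟ y + w
  ... | yes refl = trans (cong suc (trans (raiseAt-diff {j + suc w} {r} (lowerAt r (dMove d j y w)) (λ q → (lin⊥ (y ∷ w ∷ j ∷ []) ($ 2 ⊹ (# 1 ⊹ $ 1) ≐ $ 0 ⊹ $ 1 ∋ sym q ∷ $ 0 ⊹ (# 1 ⊹ $ 1) ⊴ $ 2 ∋ yj ∷ []))))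
        (trans (lowerAt-same r (dMove d j y w)) (cong pred (dMove-out w (lin≤ (y ∷ w ∷ j ∷ []) 1 ($ 0 ⊹ $ 1) ($ 2) ($ 0 ⊹ (# 1 ⊹ $ 1) ⊴ $ 2 ∋ yj ∷ [])) r (lin≤ (y ∷ w ∷ j ∷ []) 1 (# 1 ⊹ ($ 0 ⊹ $ 1)) ($ 2) ($ 0 ⊹ (# 1 ⊹ $ 1) ⊴ $ 2 ∋ yj ∷ [])) (inj₂ ≤-refl))))))
        (suc-pred-d (d-> r))
    where
    suc-pred-d : ∀ {a b} → a < b → suc (pred b) ≡ b
    suc-pred-d (s≤s _) = refl
  ... | no ne = trans (cong suc (trans (raiseAt-diff {j + suc w} {r} (lowerAt (y + w) (dMove d j y w)) (λ q → (lin⊥ (r ∷ j ∷ w ∷ y ∷ []) ($ 1 ⊹ (# 1 ⊹ $ 2) ≐ $ 0 ∋ sym q ∷ # 1 ⊹ $ 0 ⊴ $ 3 ⊹ (# 1 ⊹ $ 2) ∋ u ∷ $ 3 ⊹ (# 1 ⊹ $ 2) ⊴ $ 1 ∋ yj ∷ []))))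
        (lowerAt-diff {y + w} {r} (dMove d j y w) ne)))
        (dMove-low w (lin≤ (y ∷ w ∷ j ∷ []) 1 ($ 0 ⊹ $ 1) ($ 2) ($ 0 ⊹ (# 1 ⊹ $ 1) ⊴ $ 2 ∋ yj ∷ [])) r l (≤∧≢⇒< (lin≤ (r ∷ y ∷ w ∷ []) 1 ($ 0) ($ 1 ⊹ $ 2) (# 1 ⊹ $ 0 ⊴ $ 1 ⊹ (# 1 ⊹ $ 2) ∋ u ∷ [])) ne))

  cover-wider : ∀ {j w} → d (j + suc w) ≡ d j + suc w → (cv : Cover d j) → suc w ≤ Cover.w cv
  cover-wider {j} {w} e cv with suc w ≤? Cover.w cv
  ... | yes p = p
  ... | no p  = ⊥-elim (Cover.stop cv (d-run j (suc w) e (suc (Cover.w cv)) (≰⇒> p)))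

  data Outcome (z j : ℕ) : Set where
    covered : (cv : Cover d j) →
      (∀ a t → F z (raiseAt j d) a t ≡ delayBy (Cover.c cv * Cover.w cv) (F z (dMove d j (Cover.y cv) (Cover.w cv))) a t) → Outcome z j
    barren  : ¬ Cover d j → (∀ a t → F z (raiseAt j d) a t ≡ + 0) → Outcome z j

  climb : ∀ j → ∃[ c ] Tower d 0 j c 0
  climb j = go j j ≤-refl
    where
    go : ∀ N j → j ≤ N → ∃[ c ] Tower d 0 j c 0
    go N j l with up? j
    ... | inj₂ nu = 1 , top nu z≤n (λ a ())
    go zero    j l | inj₁ (u , refl) = ⊥-elim (lin⊥ (d u ∷ u ∷ []) ($ 0 ⊴ # 0 ∋ l ∷ # 1 ⊹ $ 1 ⊴ $ 0 ∋ d-> u ∷ []))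
    go (suc N) j l | inj₁ (u , refl) with go N u (≤-pred (≤-trans (d-> u) l))
    ... | c , t = suc c , step (λ { zero _ → trans (d+0 u) (sym (+-identityʳ _)) ; (suc a) () }) t

module Resolve (ℓ n : ℕ) (η : List ℕ) {κ d : ℕ → ℕ} (C : IsCore n κ d) (end : κ (suc ℓ) ≡ 0) where
  open IsCore C
  open Catalan (suc ℓ) n η
  open Moves (suc ℓ) n η C

  zero-from : ∀ r → suc ℓ ≤ r → d r ≡ n + r
  zero-from r l = d-zero r (n≤0⇒n≡0 (≤-trans (mono-≤ l) (≤-reflexive end)))

  -- The width grows by one per round. While the run of d continues, the raised row j + w collides
  -- with row j + w + 1, and each round costs t^c, whence the exponent c w when the run stops.
  extend : ∀ {z j c y} m w → z ≤ suc ℓ → Path d z j → j + w + m ≡ ℓ → Tower d w j c y → d (j + w) ≡ d j + w → j + w < d j →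
    (∀ a t → F z (raiseAt j d) a t ≡ delayBy (c * w) (F z (dMove d j y w)) a t) → Outcome z j
  extend {z} {j} {c} {y} m w zl P eq T run small res with d (j + suc w) ≟ d j + suc w
  ... | no stop = covered (cover run stop small T) res
  ... | yes run' = go m eq
    where
    e = dMove d j y w
    yj = tower-low C T
    e-last : e (j + w) ≡ suc (d (j + w))
    e-last = dMove-up w yj w ≤-refl
    d-last : d (suc (j + w)) ≡ suc (d (j + w))
    d-last = trans (cong d (sym (+-suc j w))) (trans run' (trans (+-suc (d j) w) (cong suc (sym run))))
    vanishing : (∀ a t → F z e a t ≡ + 0) → ∀ a t → F z (raiseAt j d) a t ≡ + 0
    vanishing h a t = trans (res a t) (delayBy-zero (c * w) h a t)
    S : suc (j + w) ≤ d j → suc (j + w) < e (j + w) → State w y j e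
    S l g = record
      { level   = trans e-last (trans (sym d-last) (sym (dMove-above w yj (suc (j + w)) ≤-refl)))
      ; gap     = g
      ; lowered = λ r l a b → dMove-low w yj r a b
      ; kept    = dMove-out w yj
      ; apart   = λ r a b q → raised r a b q }
      where
      raised : ∀ r → j ≤ r → r < j + w → e r ≢ suc (j + w)
      raised r a b q with m≤n⇒∃[o]m+o≡n a
      ... | o , refl = lin⊥ (dMove d j y w (j + o) ∷ j ∷ w ∷ d (j + o) ∷ d j ∷ []) ($ 0 ≐ # 1 ⊹ ($ 1 ⊹ $ 2) ∋ q ∷ # 1 ⊹ $ 3 ≐ $ 0 ∋ sym (dMove-up w yj o (lin≤ (j ∷ o ∷ w ∷ []) 1 ($ 1) ($ 2) (# 1 ⊹ ($ 0 ⊹ $ 1) ⊴ $ 0 ⊹ $ 2 ∋ b ∷ []))) ∷ $ 4 ⊴ $ 3 ∋ d-mono-≤ a ∷ # 1 ⊹ ($ 1 ⊹ $ 2) ⊴ $ 4 ∋ l ∷ [])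
    go : ∀ m → j + w + m ≡ ℓ → Outcome z j
    -- The run has reached the last row ℓ, where the raised value makes the weight negative. No
    -- cover exists, since d r = n + r from row ℓ + 1 on and the run never stops.
    go zero eq = barren imposs (vanishing (F-lastNeg ℓ n η z e (lin≤ (e ℓ ∷ e (j + w) ∷ d ℓ ∷ d (j + w) ∷ d (suc (j + w)) ∷ d (suc ℓ) ∷ n ∷ ℓ ∷ []) 1 (# 1 ⊹ ($ 6 ⊹ $ 7)) ($ 0) ($ 1 ≐ $ 0 ∋ sym (cong e (sym last)) ∷ # 1 ⊹ $ 3 ≐ $ 1 ∋ sym e-last ∷ $ 4 ≐ # 1 ⊹ $ 3 ∋ d-last ∷ $ 6 ⊹ (# 1 ⊹ $ 7) ≐ $ 5 ∋ sym (zero-from (suc ℓ) ≤-refl) ∷ $ 5 ≐ $ 4 ∋ sym (cong (λ x → d (suc x)) last) ∷ []))))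
      where
      last : j + w ≡ ℓ
      last = trans (sym (+-identityʳ _)) eq
      imposs : ¬ Cover d j
      imposs cv = Cover.stop cv (≤-antisym (lin≤ (w ∷ Cover.w cv ∷ d (j + suc (Cover.w cv)) ∷ n ∷ j ∷ d (j + suc w) ∷ d j ∷ []) 1 ($ 2) ($ 6 ⊹ (# 1 ⊹ $ 1)) ($ 2 ≐ $ 3 ⊹ ($ 4 ⊹ (# 1 ⊹ $ 1)) ∋ zero-from (j + suc (Cover.w cv)) (lin≤ (w ∷ Cover.w cv ∷ j ∷ ℓ ∷ []) 1 (# 1 ⊹ $ 3) ($ 2 ⊹ (# 1 ⊹ $ 1)) (# 1 ⊹ $ 0 ⊴ $ 1 ∋ cover-wider run' cv ∷ $ 3 ≐ $ 2 ⊹ $ 0 ∋ sym last ∷ [])) ∷ $ 5 ≐ $ 6 ⊹ (# 1 ⊹ $ 0) ∋ run' ∷ $ 3 ⊹ ($ 4 ⊹ (# 1 ⊹ $ 0)) ≐ $ 5 ∋ sym (zero-from (j + suc w) (lin≤ (j ∷ w ∷ ℓ ∷ []) 1 (# 1 ⊹ $ 2) ($ 0 ⊹ (# 1 ⊹ $ 1)) ($ 2 ≐ $ 0 ⊹ $ 1 ∋ sym last ∷ []))) ∷ [])) (lin≤ (w ∷ Cover.w cv ∷ d (j + suc (Cover.w cv)) ∷ n ∷ j ∷ d (j + suc w) ∷ d j ∷ []) 1 ($ 6 ⊹ (# 1 ⊹ $ 1)) ($ 2) ($ 3 ⊹ ($ 4 ⊹ (# 1 ⊹ $ 1)) ≐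 $ 2 ∋ sym (zero-from (j + suc (Cover.w cv)) (lin≤ (w ∷ Cover.w cv ∷ j ∷ ℓ ∷ []) 1 (# 1 ⊹ $ 3) ($ 2 ⊹ (# 1 ⊹ $ 1)) (# 1 ⊹ $ 0 ⊴ $ 1 ∋ cover-wider run' cv ∷ $ 3 ≐ $ 2 ⊹ $ 0 ∋ sym last ∷ []))) ∷ $ 6 ⊹ (# 1 ⊹ $ 0) ≐ $ 5 ∋ sym run' ∷ $ 5 ≐ $ 3 ⊹ ($ 4 ⊹ (# 1 ⊹ $ 0)) ∋ zero-from (j + suc w) (lin≤ (j ∷ w ∷ ℓ ∷ []) 1 (# 1 ⊹ $ 2) ($ 0 ⊹ (# 1 ⊹ $ 1)) ($ 2 ≐ $ 0 ⊹ $ 1 ∋ sym last ∷ [])) ∷ [])))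
    go (suc m) eq with suc (j + w) <? d j
    -- Here d j = j + w + 1, so a wider ribbon would meet the row d j. No row above j + w has the
    -- value j + w + 1 under e, so the collision is symmetric and the series vanishes.
    ... | no p = barren (λ cv → (lin⊥ (w ∷ Cover.w cv ∷ j ∷ d j ∷ []) (# 1 ⊹ $ 0 ⊴ $ 1 ∋ cover-wider run' cv ∷ # 1 ⊹ ($ 2 ⊹ $ 1) ⊴ $ 3 ∋ Cover.small cv ∷ $ 3 ≐ # 1 ⊹ ($ 2 ⊹ $ 0) ∋ p' ∷ []))) (vanishing (Collision.F-vanish z (j + w) zl (lin≤ (j ∷ w ∷ m ∷ ℓ ∷ []) 1 (# 1 ⊹ (# 1 ⊹ ($ 0 ⊹ $ 1))) (# 1 ⊹ $ 3) ($ 0 ⊹ $ 1 ⊹ (# 1 ⊹ $ 2) ≐ $ 3 ∋ eq ∷ [])) (inj₂ (≤-trans (path-≤ P) (m≤m+n j w))) e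
          (State.level St) (State.gap St) avoid))
      where
      p' : d j ≡ suc (j + w)
      p' = ≤-antisym (lin≤ (j ∷ w ∷ d j ∷ []) 1 ($ 2) (# 1 ⊹ ($ 0 ⊹ $ 1)) ($ 2 ⊴ # 1 ⊹ ($ 0 ⊹ $ 1) ∋ ≮⇒≥ p ∷ [])) (lin≤ (j ∷ w ∷ d j ∷ []) 1 (# 1 ⊹ ($ 0 ⊹ $ 1)) ($ 2) (# 1 ⊹ ($ 0 ⊹ $ 1) ⊴ $ 2 ∋ small ∷ []))
      St = S (≤-reflexive (sym p')) (lin≤ (e (j + w) ∷ d (j + w) ∷ d j ∷ j ∷ w ∷ []) 1 (# 1 ⊹ (# 1 ⊹ ($ 3 ⊹ $ 4))) ($ 0) (# 1 ⊹ $ 1 ≐ $ 0 ∋ sym e-last ∷ $ 2 ⊴ $ 1 ∋ d-mono-≤ (m≤m+n j w) ∷ # 1 ⊹ ($ 3 ⊹ $ 4) ≐ $ 2 ∋ sym p' ∷ []))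
      avoid : ∀ r → r < j + w → e r ≢ suc (j + w)
      avoid r l q with r <? j
      ... | no r≥j = State.apart St r (≮⇒≥ r≥j) l q
      ... | yes r<j with range? y w r
      ...   | inj₁ (a , b) = lin⊥ (dMove d j y w r ∷ j ∷ w ∷ d r ∷ []) (# 1 ⊹ ($ 1 ⊹ $ 2) ≐ $ 0 ∋ sym q ∷ # 1 ⊹ $ 0 ≐ $ 3 ∋ dMove-low w yj r a b ∷ $ 3 ⊴ # 1 ⊹ ($ 1 ⊹ $ 2) ∋ tower-lowVals T r a b ∷ [])
      ...   | inj₂ o       = lin⊥ (dMove d j y w r ∷ j ∷ w ∷ d r ∷ d j ∷ []) (# 1 ⊹ ($ 1 ⊹ $ 2) ≐ $ 0 ∋ sym q ∷ $ 0 ≐ $ 3 ∋ dMove-out w yj r r<j o ∷ # 1 ⊹ $ 3 ⊴ $ 4 ∋ d-mono r<j ∷ $ 4 ≐ # 1 ⊹ ($ 1 ⊹ $ 2) ∋ p' ∷ [])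
    ... | yes p with push zl T (S (<⇒≤ p) (lin≤ (j ∷ w ∷ d j ∷ e (j + w) ∷ d (j + w) ∷ []) 1 (# 1 ⊹ (# 1 ⊹ ($ 0 ⊹ $ 1))) ($ 3) (# 1 ⊹ (# 1 ⊹ ($ 0 ⊹ $ 1)) ⊴ $ 2 ∋ p ∷ # 1 ⊹ $ 4 ≐ $ 3 ∋ sym e-last ∷ $ 2 ⊴ $ 4 ∋ d-mono-≤ (m≤m+n j w) ∷ []))) (inj₁ P) (lin≤ (j ∷ w ∷ m ∷ ℓ ∷ []) 1 (# 1 ⊹ (# 1 ⊹ ($ 0 ⊹ $ 1))) (# 1 ⊹ $ 3) ($ 0 ⊹ $ 1 ⊹ (# 1 ⊹ $ 2) ≐ $ 3 ∋ eq ∷ [])) p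
    ...   | inj₂ s = barren (λ cv → Stuck.noTower s _ _ (tower-weaken (cover-wider run' cv) (Cover.tower cv))) (vanishing (Stuck.vanish s))
    ...   | inj₁ q = extend m (suc w) zl P (≤-antisym (lin≤ (j ∷ w ∷ m ∷ ℓ ∷ []) 1 ($ 0 ⊹ (# 1 ⊹ $ 1) ⊹ $ 2) ($ 3) ($ 0 ⊹ $ 1 ⊹ (# 1 ⊹ $ 2) ≐ $ 3 ∋ eq ∷ [])) (lin≤ (j ∷ w ∷ m ∷ ℓ ∷ []) 1 ($ 3) ($ 0 ⊹ (# 1 ⊹ $ 1) ⊹ $ 2) ($ 3 ≐ $ 0 ⊹ $ 1 ⊹ (# 1 ⊹ $ 2) ∋ sym eq ∷ []))) (Pushed.tower' q) run' (≤-trans (s≤s (≤-reflexive (+-suc j w))) p) res'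
      where
      open Pushed q
      y-same : ∀ w → (0 < w → y' ≡ y) → ∀ r → dMove d j y w r ≡ dMove d j y' w r
      y-same zero    h r = refl
      y-same (suc w) h r rewrite h (s≤s z≤n) = refl
      update-cong : ∀ {f g : ℕ → ℕ} → (∀ r → f r ≡ g r) → ∀ r → raiseAt (j + suc w) (lowerAt (y' + w) f) r ≡ raiseAt (j + suc w) (lowerAt (y' + w) g) r
      update-cong {f} {g} h r with r ≡ᵇ j + suc w | r ≡ᵇ y' + w
      ... | true  | true  = cong (λ x → suc (pred x)) (h r)
      ... | true  | false = cong suc (h r)
      ... | false | true  = cong pred (h r)
      ... | false | false = h r
      res' : ∀ a t → F z (raiseAt j d) a t ≡ delayBy (c * suc w) (F z (dMove d j y' (suc w))) a t
      res' a t = trans (res a t) (trans (delayBy-cong (c * w) (λ a t → trans (result a t)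
          (delayBy-cong c (F-cong z (update-cong (y-same w same))) a t)) a t)
        (trans (sym (delayBy-+ (c * w) c _ a t)) (cong (λ x → delayBy x (F z (dMove d j y' (suc w))) a t) (trans (+-comm (c * w) c) (sym (*-suc c w))))))

  resolve : ∀ {z j} → z ≤ suc ℓ → j ≤ ℓ → Path d z j → Outcome z j
  resolve {z} {j} zl jl P with climb j | m≤n⇒∃[o]m+o≡n jl
  ... | c , T | m , eq = extend m 0 zl P (trans (cong (_+ m) (+-identityʳ j)) eq) T (trans (d+0 j) (sym (+-identityʳ _)))
        (≤-trans (s≤s (≤-reflexive (+-identityʳ j))) (d-> j)) (λ a t → cong (λ x → delayBy x (F z (raiseAt j d)) a t) (sym (*-zeroʳ c)))

-- The core obtained by moving beads along a cover.

tops : ∀ {d w j c y} → Tower d w j c y → List ℕ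
tops {j = j} (top _ _ _) = j ∷ []
tops {j = j} (step _ t)  = j ∷ tops t

tops-length : ∀ {d w j c y} (t : Tower d w j c y) → length (tops t) ≡ c
tops-length (top _ _ _) = refl
tops-length (step _ t)  = cong suc (tops-length t)

Separated : ℕ → List ℕ → Set
Separated w = AllPairs (λ x x' → x' + w < x)

-- Each bead x of the list moves down by L, past the w following beads.
moved : (ℕ → ℕ) → ℕ → ℕ → List ℕ → ℕ → ℕ
moved κ w L []       r = κ r
moved κ w L (x ∷ xs) r with r <? x | r <? x + w | r ≟ x + w
... | yes _ | _     | _     = moved κ w L xs r
... | no _  | yes _ | _     = pred (κ (suc r))
... | no _  | no _  | yes _ = κ x + w ∸ L
... | no _  | no _  | no _  = moved κ w L xs r

module _ (κ : ℕ → ℕ) (w L : ℕ) where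

  moved-mid : ∀ {xs x} → Separated w xs → x ∈ xs → ∀ a → a < w → moved κ w L xs (x + a) ≡ pred (κ (suc (x + a)))
  moved-mid {x ∷ xs} (s ∷ ss) (here refl) a l with x + a <? x | x + a <? x + w | x + a ≟ x + w
  ... | yes p | _     | _ = ⊥-elim (lin⊥ (x ∷ a ∷ []) (# 1 ⊹ ($ 0 ⊹ $ 1) ⊴ $ 0 ∋ p ∷ []))
  ... | no _  | yes _ | _ = refl
  ... | no _  | no p  | _ = ⊥-elim (p (+-monoʳ-< x l))
  moved-mid {x' ∷ xs} {x} (s ∷ ss) (there m) a l with x + a <? x' | x + a <? x' + w | x + a ≟ x' + w
  ... | yes _ | _     | _ = moved-mid ss m a l
  ... | no p  | _     | _ = ⊥-elim (lin⊥ (x ∷ w ∷ x' ∷ a ∷ []) (# 1 ⊹ ($ 0 ⊹ $ 1) ⊴ $ 2 ∋ All.lookup s m ∷ # 1 ⊹ $ 3 ⊴ $ 1 ∋ l ∷ $ 2 ⊴ $ 0 ⊹ $ 3 ∋ ≮⇒≥ p ∷ []))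

  moved-end : ∀ {xs x} → Separated w xs → x ∈ xs → moved κ w L xs (x + w) ≡ κ x + w ∸ L
  moved-end {x ∷ xs} (s ∷ ss) (here refl) with x + w <? x | x + w <? x + w | x + w ≟ x + w
  ... | yes p | _     | _     = ⊥-elim (lin⊥ (x ∷ w ∷ []) (# 1 ⊹ ($ 0 ⊹ $ 1) ⊴ $ 0 ∋ p ∷ []))
  ... | no _  | yes p | _     = ⊥-elim (<-irrefl refl p)
  ... | no _  | no _  | yes _ = refl
  ... | no _  | no _  | no ne = ⊥-elim (ne refl)
  moved-end {x' ∷ xs} {x} (s ∷ ss) (there m) with x + w <? x' | x + w <? x' + w | x + w ≟ x' + w
  ... | yes _ | _     | _ = moved-end ss m
  ... | no p  | _     | _ = ⊥-elim (p (All.lookup s m))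

  moved-out : ∀ xs r → (∀ x → x ∈ xs → r < x ⊎ x + w < r) → moved κ w L xs r ≡ κ r
  moved-out []       r h = refl
  moved-out (x ∷ xs) r h with r <? x | r <? x + w | r ≟ x + w | h x (here refl)
  ... | yes _ | _     | _     | _      = moved-out xs r (λ x m → h x (there m))
  ... | no p  | _     | _     | inj₁ q = ⊥-elim (p q)
  ... | no _  | yes p | _     | inj₂ q = ⊥-elim (lin⊥ (r ∷ x ∷ w ∷ []) (# 1 ⊹ $ 0 ⊴ $ 1 ⊹ $ 2 ∋ p ∷ # 1 ⊹ ($ 1 ⊹ $ 2) ⊴ $ 0 ∋ q ∷ []))
  ... | no _  | no _  | yes p | inj₂ q = ⊥-elim (lin⊥ (r ∷ x ∷ w ∷ []) ($ 0 ≐ $ 1 ⊹ $ 2 ∋ p ∷ # 1 ⊹ ($ 1 ⊹ $ 2) ⊴ $ 0 ∋ q ∷ []))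
  ... | no _  | no _  | no _  | inj₂ q = moved-out xs r (λ x m → h x (there m))

data Located (w : ℕ) (xs : List ℕ) (r : ℕ) : Set where
  inside  : ∀ x a → x ∈ xs → a ≤ w → r ≡ x + a → Located w xs r
  outside : (∀ x → x ∈ xs → r < x ⊎ x + w < r) → Located w xs r

locate : ∀ w xs r → Located w xs r
locate w []       r = outside (λ x ())
locate w (x ∷ xs) r with r <? x | x + w <? r
... | no p | no q with m≤n⇒∃[o]m+o≡n (≮⇒≥ p)
...   | a , refl = inside x a (here refl) (lin≤ (x ∷ a ∷ w ∷ []) 1 ($ 1) ($ 2) ($ 0 ⊹ $ 1 ⊴ $ 0 ⊹ $ 2 ∋ ≮⇒≥ q ∷ [])) refl
locate w (x ∷ xs) r | yes p | _ with locate w xs r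
... | inside x' a m l e = inside x' a (there m) l e
... | outside h = outside (λ { x (here refl) → inj₁ p ; x (there m) → h x m })
locate w (x ∷ xs) r | no _ | yes q with locate w xs r
... | inside x' a m l e = inside x' a (there m) l e
... | outside h = outside (λ { x (here refl) → inj₂ q ; x (there m) → h x m })

module Below {n κ d} (C : IsCore n κ d) {j : ℕ} (cv : Cover d j) where
  open IsCore C
  open Cover cv

  run-≤ : ∀ a → a ≤ w → d (j + a) ≡ d j + a
  run-≤ = d-run j w run

  xs : List ℕ
  xs = tops tower

  private
    d+0 : ∀ u → d (u + 0) ≡ d u
    d+0 u = cong d (+-identityʳ u)

    -- Disjointness passes to the component above: otherwise the run from u would contain row d u =
    -- j, and d j would be at most j + w.
    small-up : ∀ {j u} → (∀ a → a ≤ w → d (u + a) ≡ j + a) → j + w < d j → u + w < d u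
    small-up {j} {u} g l with u + w <? d u
    ... | yes p = p
    ... | no p with m≤n⇒∃[o]m+o≡n (<⇒≤ (d-> u))
    ...   | o , eq = ⊥-elim (lin⊥ (j ∷ Cover.w cv ∷ d j ∷ d (u + o) ∷ o ∷ d (d u) ∷ u ∷ d u ∷ d (u + 0) ∷ []) (# 1 ⊹ ($ 0 ⊹ $ 1) ⊴ $ 2 ∋ l ∷ $ 3 ≐ $ 0 ⊹ $ 4 ∋ g o (lin≤ (d u ∷ u ∷ Cover.w cv ∷ o ∷ []) 1 ($ 3) ($ 2) ($ 0 ⊴ $ 1 ⊹ $ 2 ∋ ≮⇒≥ p ∷ $ 1 ⊹ $ 3 ≐ $ 0 ∋ eq ∷ [])) ∷ $ 5 ≐ $ 3 ∋ sym (cong d eq) ∷ $ 6 ⊹ $ 4 ≐ $ 7 ∋ eq ∷ $ 7 ⊴ $ 6 ⊹ $ 1 ∋ ≮⇒≥ p ∷ $ 2 ≐ $ 5 ∋ sym (cong d (trans (sym (trans (d+0 u) refl)) (trans (g 0 z≤n) (+-identityʳ j)))) ∷ []))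

    base : ∀ {j u} → (∀ a → a ≤ w → d (u + a) ≡ j + a) → d u ≡ j
    base {j} {u} g = trans (sym (d+0 u)) (trans (g 0 z≤n) (+-identityʳ j))

  tops-≤ : ∀ {j c y x} (t : Tower d w j c y) → x ∈ tops t → x ≤ j
  tops-≤ (top _ _ _) (here refl) = ≤-refl
  tops-≤ (step g t)  (here refl) = ≤-refl
  tops-≤ (step g t)  (there m)   = ≤-trans (tops-≤ t m) (<⇒≤ (≤-trans (d-> _) (≤-reflexive (base g))))

  tops-separated : ∀ {j c y} (t : Tower d w j c y) → j + w < d j → Separated w (tops t)
  tops-separated (top _ _ _) l = [] ∷ []
  tops-separated {j} (step {u = u} g t) l = All.tabulate (λ {x} m → (lin≤ (x ∷ u ∷ Cover.w cv ∷ d u ∷ j ∷ []) 1 (# 1 ⊹ ($ 0 ⊹ $ 2)) ($ 4) ($ 0 ⊴ $ 1 ∋ tops-≤ t m ∷ # 1 ⊹ ($ 1 ⊹ $ 2) ⊴ $ 3 ∋ small-up g l ∷ $ 3 ≐ $ 4 ∋ base g ∷ []))) ∷ tops-separated t (small-up g l)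

  separated : Separated w xs
  separated = tops-separated tower small

  tops-small : ∀ {j c y x} (t : Tower d w j c y) → j + w < d j → x ∈ tops t → x + w < d x
  tops-small (top _ _ _) l (here refl) = l
  tops-small (step g t)  l (here refl) = l
  tops-small (step g t)  l (there m)   = tops-small t (small-up g l) m

  tops-down : ∀ {j c y x} (t : Tower d w j c y) → x ∈ tops t → x ≡ j ⊎ (d x ∈ tops t × (∀ a → a ≤ w → d (x + a) ≡ d x + a))
  tops-down (top _ _ _) (here refl) = inj₁ refl
  tops-down (step g t)  (here refl) = inj₁ refl
  tops-down (step g t)  (there m) with tops-down t m
  ... | inj₁ refl    = inj₂ (here (base g) , λ a l → trans (g a l) (cong (_+ a) (sym (base g))))
  ... | inj₂ (p , q) = inj₂ (there p , q)

  head∈ : ∀ {j c y} (t : Tower d w j c y) → j ∈ tops t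
  head∈ (top _ _ _) = here refl
  head∈ (step g t)  = here refl

  tops-up : ∀ {j c y x} (t : Tower d w j c y) → x ∈ tops t →
    (∃[ u ] u ∈ tops t × (∀ a → a ≤ w → d (u + a) ≡ x + a)) ⊎ ((∀ u → d u ≢ x) × (∀ a → a < w → d (y + a) ≡ suc (x + a)) × y + w ≤ x)
  tops-up (top nu b g) (here refl) = inj₂ (nu , g , b)
  tops-up (step g t)   (here refl) = inj₁ (_ , there (head∈ t) , g)
  tops-up (step g t)   (there m) with tops-up t m
  ... | inj₁ (u , p , q) = inj₁ (u , there p , q)
  ... | inj₂ q           = inj₂ q

  y-below : ∀ {j c y x} (t : Tower d w j c y) → x ∈ tops t → y + w ≤ x
  y-below t@(top _ _ _) (here refl) = tower-low C t
  y-below t@(step _ _)  (here refl) = tower-low C t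
  y-below (step g t)    (there m)   = y-below t m

  -- The common length of the ribbons, namely the distance between the beads of rows d j and d j + w
  -- + 1: the moved bead of row j must sit n positions above the latter.
  L : ℕ
  L = κ (d j) + suc w ∸ κ (d j + suc w)

  L-eq : L + κ (d j + suc w) ≡ κ (d j) + suc w
  L-eq = m∸n+n≡m (≤-trans (mono-≤ (m≤m+n (d j) (suc w))) (m≤m+n _ (suc w)))

  -- This and `bead-next` place the bead of row x, lowered by L, strictly between the beads of rows
  -- x + w and x + w + 1. Both are checked at row j from the choice of L and carried up the tower,
  -- along which d preserves distances of beads.
  bead-last : ∀ x → x ∈ xs → κ x + w < κ (x + w) + L
  bead-last = go tower λ { refl → (lin≤ (κ j ∷ d j ∷ κ (d j) ∷ n ∷ j ∷ κ (j + Cover.w cv) ∷ d (j + Cover.w cv) ∷ κ (d (j + Cover.w cv)) ∷ Cover.w cv ∷ L ∷ κ (d j + suc (Cover.w cv)) ∷ κ (d j + Cover.w cv) ∷ []) 1 (# 1 ⊹ ($ 0 ⊹ $ 8)) ($ 5 ⊹ $ 9) ($ 0 ⊹ $ 1 ≐ $ 2 ⊹ ($ 3 ⊹ $ 4) ∋ eqn j ∷ $ 7 ⊹ ($ 3 ⊹ ($ 4 ⊹ $ 8)) ≐ $ 5 ⊹ $ 6 ∋ sym (eqn (j + w)) ∷ $ 2 ⊹ (# 1 ⊹ $ 8) ≐ $ 9 ⊹ $ 10 ∋ sym L-eq ∷ $ 6 ≐ $ 1 ⊹ $ 8 ∋ run ∷ $ 11 ≐ $ 7 ∋ sym (cong κ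 run) ∷ # 1 ⊹ ($ 10 ⊹ ($ 1 ⊹ $ 8)) ⊴ $ 11 ⊹ ($ 1 ⊹ (# 1 ⊹ $ 8)) ∋ bead-< {d j + w} {d j + suc w} (lin≤ (d j ∷ Cover.w cv ∷ []) 1 (# 1 ⊹ ($ 0 ⊹ $ 1)) ($ 0 ⊹ (# 1 ⊹ $ 1)) []) ∷ [])) }
    where
    go : ∀ {j' c y} (t : Tower d w j' c y) → (j' ≡ j' → κ j' + w < κ (j' + w) + L) → ∀ x → x ∈ tops t → κ x + w < κ (x + w) + L
    go (top _ _ _) h x (here refl) = h refl
    go (step g t)  h x (here refl) = h refl
    go {j'} (step {u = u} g t)  h x (there m) = go t (λ _ → (lin≤ (κ j' ∷ Cover.w cv ∷ κ (j' + Cover.w cv) ∷ L ∷ κ u ∷ d u ∷ κ (d u) ∷ n ∷ u ∷ κ (u + Cover.w cv) ∷ d (u + Cover.w cv) ∷ κ (d (u + Cover.w cv)) ∷ j' ∷ []) 1 (# 1 ⊹ ($ 4 ⊹ $ 1)) ($ 9 ⊹ $ 3) (# 1 ⊹ ($ 0 ⊹ $ 1) ⊴ $ 2 ⊹ $ 3 ∋ h refl ∷ $ 4 ⊹ $ 5 ≐ $ 6 ⊹ ($ 7 ⊹ $ 8) ∋ eqn u ∷ $ 11 ⊹ ($ 7 ⊹ ($ 8 ⊹ $ 1)) ≐ $ 9 ⊹ $ 10 ∋ sym (eqn (u + w)) ∷ $ 10 ≐ $ 12 ⊹ $ 1 ∋ g w ≤-refl ∷ $ 12 ≐ $ 5 ∋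 sym (base g) ∷ $ 2 ≐ $ 11 ∋ sym (cong κ (g w ≤-refl)) ∷ $ 6 ≐ $ 0 ∋ cong κ (base g) ∷ []))) x m

  bead-next : ∀ x → x ∈ xs → κ (suc (x + w)) + L ≤ κ x + w
  bead-next = go tower λ { refl → (lin≤ (κ j ∷ d j ∷ κ (d j) ∷ n ∷ j ∷ κ (suc (j + Cover.w cv)) ∷ d (suc (j + Cover.w cv)) ∷ κ (d (suc (j + Cover.w cv))) ∷ Cover.w cv ∷ L ∷ κ (d j + suc (Cover.w cv)) ∷ []) 1 ($ 5 ⊹ $ 9) ($ 0 ⊹ $ 8) ($ 2 ⊹ ($ 3 ⊹ $ 4) ≐ $ 0 ⊹ $ 1 ∋ sym (eqn j) ∷ $ 5 ⊹ $ 6 ≐ $ 7 ⊹ ($ 3 ⊹ (# 1 ⊹ ($ 4 ⊹ $ 8))) ∋ eqn (suc (j + w)) ∷ $ 9 ⊹ $ 10 ≐ $ 2 ⊹ (# 1 ⊹ $ 8) ∋ L-eq ∷ # 1 ⊹ ($ 7 ⊹ ($ 1 ⊹ (# 1 ⊹ $ 8))) ⊴ $ 10 ⊹ $ 6 ∋ bead-< {d j + suc w} {d (suc (j + w))} after ∷ [])) }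
    where
    after : d j + suc w < d (suc (j + w))
    after = ≤∧≢⇒< (≤-trans (d-grow j (suc w)) (≤-reflexive (cong d (+-suc j w)))) (λ e → stop (trans (cong d (+-suc j w)) (sym e)))
    go : ∀ {j' c y} (t : Tower d w j' c y) → (j' ≡ j' → κ (suc (j' + w)) + L ≤ κ j' + w) → ∀ x → x ∈ tops t → κ (suc (x + w)) + L ≤ κ x + w
    go (top _ _ _) h x (here refl) = h refl
    go (step g t)  h x (here refl) = h refl
    go {j'} (step {u = u} g t)  h x (there m) =
      go t (λ _ → (lin≤ (κ (suc (j' + Cover.w cv)) ∷ L ∷ κ j' ∷ Cover.w cv ∷ κ u ∷ d u ∷ κ (d u) ∷ n ∷ u ∷ κ (suc (u + Cover.w cv)) ∷ d (suc (u + Cover.w cv)) ∷ κ (d (suc (u + Cover.w cv))) ∷ j' ∷ []) 1 ($ 9 ⊹ $ 1) ($ 4 ⊹ $ 3) ($ 0 ⊹ $ 1 ⊴ $ 2 ⊹ $ 3 ∋ h refl ∷ $ 6 ⊹ ($ 7 ⊹ $ 8) ≐ $ 4 ⊹ $ 5 ∋ sym (eqn u) ∷ $ 9 ⊹ $ 10 ≐ $ 11 ⊹ ($ 7 ⊹ (# 1 ⊹ ($ 8 ⊹ $ 3))) ∋ eqn (suc (u + w)) ∷ $ 5 ≐ $ 12 ∋ base g ∷ $ 2 ≐ $ 6 ∋ sym (cong κ (base g)) ∷ $ 11 ⊴ $ 0 ∋ mono-≤ {suc (j' + w)} {d (suc (u + w))} far ∷ # 1 ⊹ ($ 12 ⊹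 $ 3) ⊴ $ 10 ∋ far ∷ []))) x m
      where
      far : suc (j' + w) ≤ d (suc (u + w))
      far = lin≤ (d (u + Cover.w cv) ∷ d (suc (u + Cover.w cv)) ∷ j' ∷ Cover.w cv ∷ []) 1 (# 1 ⊹ ($ 2 ⊹ $ 3)) ($ 1) (# 1 ⊹ $ 0 ⊴ $ 1 ∋ d-mono {u + w} {suc (u + w)} ≤-refl ∷ $ 2 ⊹ $ 3 ≐ $ 0 ∋ sym (g w ≤-refl) ∷ [])

  τ : ℕ → ℕ
  τ = moved κ w L xs

  dτ : ℕ → ℕ
  dτ = dMove d j y w

  τ-end : ∀ x → x ∈ xs → τ (x + w) + L ≡ κ x + w
  τ-end x m = trans (cong (_+ L) (moved-end κ w L separated m)) (m∸n+n≡m (≤-trans (m≤n+m L _) (bead-next x m)))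

  τ-mid : ∀ x → x ∈ xs → ∀ a → a < w → suc (τ (x + a)) ≡ κ (suc (x + a))
  τ-mid x m a l = trans (cong suc (moved-mid κ w L separated m a l)) (suc-pred-pos (lin≤ (κ x ∷ Cover.w cv ∷ κ (x + Cover.w cv) ∷ L ∷ τ (x + Cover.w cv) ∷ κ (suc (x + a)) ∷ []) 1 (# 1 ⊹ # 0) ($ 5) (# 1 ⊹ ($ 0 ⊹ $ 1) ⊴ $ 2 ⊹ $ 3 ∋ bead-last x m ∷ $ 4 ⊹ $ 3 ≐ $ 0 ⊹ $ 1 ∋ τ-end x m ∷ $ 2 ⊴ $ 5 ∋ mono-≤ {suc (x + a)} {x + w} (lin≤ (a ∷ Cover.w cv ∷ x ∷ []) 1 (# 1 ⊹ ($ 2 ⊹ $ 0)) ($ 2 ⊹ $ 1) (# 1 ⊹ $ 0 ⊴ $ 1 ∋ l ∷ [])) ∷ [])))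
    where
    suc-pred-pos : ∀ {b} → 0 < b → suc (pred b) ≡ b
    suc-pred-pos (s≤s _) = refl

  τ-out : ∀ r → (∀ x → x ∈ xs → r < x ⊎ x + w < r) → τ r ≡ κ r
  τ-out = moved-out κ w L xs

  τ-≤ : ∀ r → τ r ≤ κ r
  τ-≤ r with locate w xs r
  ... | outside h = ≤-reflexive (τ-out r h)
  ... | inside x a m l refl with a ≟ w
  ...   | yes refl = lin≤ (τ (x + Cover.w cv) ∷ L ∷ κ x ∷ Cover.w cv ∷ κ (x + Cover.w cv) ∷ []) 1 ($ 0) ($ 4) ($ 0 ⊹ $ 1 ≐ $ 2 ⊹ $ 3 ∋ τ-end x m ∷ # 1 ⊹ ($ 2 ⊹ $ 3) ⊴ $ 4 ⊹ $ 1 ∋ bead-last x m ∷ [])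
  ...   | no ne    = lin≤ (τ (x + a) ∷ κ (suc (x + a)) ∷ κ (x + a) ∷ []) 1 ($ 0) ($ 2) (# 1 ⊹ $ 0 ≐ $ 1 ∋ τ-mid x m a (≤∧≢⇒< l ne) ∷ $ 1 ⊴ $ 2 ∋ mono (x + a) ∷ [])

  τ-mono : ∀ r → τ (suc r) ≤ τ r
  τ-mono r with locate w xs r
  ... | outside h = ≤-trans (τ-≤ (suc r)) (≤-trans (mono r) (≤-reflexive (sym (τ-out r h))))
  ... | inside x a m l refl with a ≟ w
  ...   | yes refl = lin≤ (τ (x + Cover.w cv) ∷ L ∷ κ x ∷ Cover.w cv ∷ κ (suc (x + Cover.w cv)) ∷ τ (suc (x + Cover.w cv)) ∷ []) 1 ($ 5) ($ 0) ($ 2 ⊹ $ 3 ≐ $ 0 ⊹ $ 1 ∋ sym (τ-end x m) ∷ $ 4 ⊹ $ 1 ⊴ $ 2 ⊹ $ 3 ∋ bead-next x m ∷ $ 5 ⊴ $ 4 ∋ τ-≤ (suc (x + a)) ∷ [])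
  ...   | no ne with suc a ≟ w
  ...     | yes refl = lin≤ (τ (x + a) ∷ κ (suc (x + a)) ∷ τ (x + suc a) ∷ L ∷ κ x ∷ a ∷ κ (x + suc a) ∷ τ (suc (x + a)) ∷ []) 1 ($ 7) ($ 0) ($ 1 ≐ # 1 ⊹ $ 0 ∋ sym (τ-mid x m a ≤-refl) ∷ $ 2 ⊹ $ 3 ≐ $ 4 ⊹ (# 1 ⊹ $ 5) ∋ τ-end x m ∷ # 1 ⊹ ($ 4 ⊹ (# 1 ⊹ $ 5)) ⊴ $ 6 ⊹ $ 3 ∋ bead-last x m ∷ $ 6 ≐ $ 1 ∋ cong κ (+-suc x a) ∷ $ 7 ≐ $ 2 ∋ sym (cong τ (+-suc x a)) ∷ [])
  ...     | no ne'   = lin≤ (τ (x + a) ∷ κ (suc (x + a)) ∷ τ (x + suc a) ∷ κ (suc (x + suc a)) ∷ κ (suc (suc (x + a))) ∷ τ (suc (x + a)) ∷ []) 1 ($ 5) ($ 0) ($ 1 ≐ # 1 ⊹ $ 0 ∋ sym (τ-mid x m a (≤∧≢⇒< l ne)) ∷ # 1 ⊹ $ 2 ≐ $ 3 ∋ τ-mid x m (suc a) (≤∧≢⇒< (≤∧≢⇒< l ne) ne') ∷ $ 4 ⊴ $ 1 ∋ mono (suc (x + a)) ∷ $ 3 ≐ $ 4 ∋ cong κ (cong suc (+-suc x a)) ∷ $ 5 ≐ $ 2 ∋ sym (cong τ (+-suc x a)) ∷ [])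

  open Moves 0 n [] C using (dMove-up; dMove-above; dMove-out; dMove-low)

  yj : y + w ≤ j
  yj = tower-low C tower

  -- A row of the lowest ribbon gains one in d, a row of a higher ribbon keeps its value and lands
  -- in the ribbon below, and row y + o is sent to row x + o of the highest ribbon instead of x + o
  -- + 1. The remaining rows keep their value, and their images avoid the ribbons.
  τ-eqn : ∀ r → τ r + dτ r ≡ τ (dτ r) + (n + r)
  τ-eqn r with locate w xs r
  τ-eqn r | inside x a m l refl with tops-down tower m
  τ-eqn r | inside x a m l refl | inj₁ refl = bottom (a ≟ w)
    where
    δr : dτ (x + a) ≡ suc (d x + a)
    δr = trans (dMove-up w yj a l) (cong suc (run-≤ a l))
    far : τ (suc (d x + a)) ≡ κ (suc (d x + a))
    far = τ-out _ (λ x' m' → inj₂ (lin≤ (x' ∷ x ∷ Cover.w cv ∷ d x ∷ a ∷ []) 1 (# 1 ⊹ ($ 0 ⊹ $ 2)) (# 1 ⊹ ($ 3 ⊹ $ 4)) ($ 0 ⊴ $ 1 ∋ tops-≤ tower m' ∷ # 1 ⊹ ($ 1 ⊹ $ 2) ⊴ $ 3 ∋ small ∷ [])))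
    bottom : Dec (a ≡ w) → τ (x + a) + dτ (x + a) ≡ τ (dτ (x + a)) + (n + (x + a))
    bottom (yes refl) = ≤-antisym (lin≤ (dτ (x + Cover.w cv) ∷ d x ∷ Cover.w cv ∷ τ (dτ (x + Cover.w cv)) ∷ τ (suc (d x + Cover.w cv)) ∷ κ (suc (d x + Cover.w cv)) ∷ τ (x + Cover.w cv) ∷ L ∷ κ x ∷ κ (d x + suc (Cover.w cv)) ∷ κ (d x) ∷ n ∷ x ∷ []) 1 ($ 6 ⊹ $ 0) ($ 3 ⊹ ($ 11 ⊹ ($ 12 ⊹ $ 2))) ($ 0 ≐ # 1 ⊹ ($ 1 ⊹ $ 2) ∋ δr ∷ $ 4 ≐ $ 3 ∋ sym (cong τ δr) ∷ $ 5 ≐ $ 4 ∋ sym far ∷ $ 6 ⊹ $ 7 ≐ $ 8 ⊹ $ 2 ∋ τ-end x m ∷ $ 10 ⊹ (# 1 ⊹ $ 2) ≐ $ 7 ⊹ $ 9 ∋ sym L-eq ∷ $ 8 ⊹ $ 1 ≐ $ 10 ⊹ ($ 11 ⊹ $ 12) ∋ eqn x ∷ $ 9 ≐ $ 5 ∋ cong κ (+-suc (d x) a) ∷ [])) (lin≤ (dτ (x + Cover.w cv) ∷ d x ∷ Cover.w cv ∷ τ (dτ (x + Cover.w cv)) ∷ τ (suc (d x + Cover.w cv)) ∷ κ (suc (d x + Cover.w cv)) ∷ τ (x + Cover.w cv) ∷ L ∷ κ x ∷ κ (d x + suc (Cover.w cv)) ∷ κ (d x) ∷ n ∷ x ∷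 []) 1 ($ 3 ⊹ ($ 11 ⊹ ($ 12 ⊹ $ 2))) ($ 6 ⊹ $ 0) (# 1 ⊹ ($ 1 ⊹ $ 2) ≐ $ 0 ∋ sym δr ∷ $ 3 ≐ $ 4 ∋ cong τ δr ∷ $ 4 ≐ $ 5 ∋ far ∷ $ 8 ⊹ $ 2 ≐ $ 6 ⊹ $ 7 ∋ sym (τ-end x m) ∷ $ 7 ⊹ $ 9 ≐ $ 10 ⊹ (# 1 ⊹ $ 2) ∋ L-eq ∷ $ 10 ⊹ ($ 11 ⊹ $ 12) ≐ $ 8 ⊹ $ 1 ∋ sym (eqn x) ∷ $ 5 ≐ $ 9 ∋ sym (cong κ (+-suc (d x) a)) ∷ []))
    bottom (no ne) = ≤-antisym (lin≤ (dτ (x + a) ∷ d x ∷ a ∷ τ (dτ (x + a)) ∷ τ (suc (d x + a)) ∷ κ (suc (d x + a)) ∷ τ (x + a) ∷ κ (suc (x + a)) ∷ d (suc (x + a)) ∷ κ (d (suc (x + a))) ∷ n ∷ x ∷ []) 1 ($ 6 ⊹ $ 0) ($ 3 ⊹ ($ 10 ⊹ ($ 11 ⊹ $ 2))) ($ 0 ≐ # 1 ⊹ ($ 1 ⊹ $ 2) ∋ δr ∷ $ 4 ≐ $ 3 ∋ sym (cong τ δr) ∷ $ 5 ≐ $ 4 ∋ sym far ∷ # 1 ⊹ $ 6 ≐ $ 7 ∋ τ-mid x m a a<w ∷ $ 7 ⊹ $ 8 ≐ $ 9 ⊹ ($ 10 ⊹ (# 1 ⊹ ($ 11 ⊹ $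 2))) ∋ eqn (suc (x + a)) ∷ # 1 ⊹ ($ 1 ⊹ $ 2) ≐ $ 8 ∋ sym e ∷ $ 9 ≐ $ 5 ∋ cong κ e ∷ [])) (lin≤ (dτ (x + a) ∷ d x ∷ a ∷ τ (dτ (x + a)) ∷ τ (suc (d x + a)) ∷ κ (suc (d x + a)) ∷ τ (x + a) ∷ κ (suc (x + a)) ∷ d (suc (x + a)) ∷ κ (d (suc (x + a))) ∷ n ∷ x ∷ []) 1 ($ 3 ⊹ ($ 10 ⊹ ($ 11 ⊹ $ 2))) ($ 6 ⊹ $ 0) (# 1 ⊹ ($ 1 ⊹ $ 2) ≐ $ 0 ∋ sym δr ∷ $ 3 ≐ $ 4 ∋ cong τ δr ∷ $ 4 ≐ $ 5 ∋ far ∷ $ 7 ≐ # 1 ⊹ $ 6 ∋ sym (τ-mid x m a a<w) ∷ $ 9 ⊹ ($ 10 ⊹ (# 1 ⊹ ($ 11 ⊹ $ 2))) ≐ $ 7 ⊹ $ 8 ∋ sym (eqn (suc (x + a))) ∷ $ 8 ≐ # 1 ⊹ ($ 1 ⊹ $ 2) ∋ e ∷ $ 5 ≐ $ 9 ∋ sym (cong κ e) ∷ []))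
      where
      a<w = ≤∧≢⇒< l ne
      e : d (suc (x + a)) ≡ suc (d x + a)
      e = trans (cong d (sym (+-suc x a))) (trans (run-≤ (suc a) a<w) (+-suc (d x) a))
  τ-eqn r | inside x a m l refl | inj₂ (m' , g) = upper (a ≟ w)
    where
    x<j : x + w < j
    x<j = lin≤ (d x ∷ j ∷ x ∷ Cover.w cv ∷ []) 1 (# 1 ⊹ ($ 2 ⊹ $ 3)) ($ 1) ($ 0 ⊴ $ 1 ∋ tops-≤ tower m' ∷ # 1 ⊹ ($ 2 ⊹ $ 3) ⊴ $ 0 ∋ tops-small tower small m ∷ [])
    δr : dτ (x + a) ≡ d x + a
    δr = trans (dMove-out w yj (x + a) (lin≤ (x ∷ Cover.w cv ∷ j ∷ a ∷ []) 1 (# 1 ⊹ ($ 0 ⊹ $ 3)) ($ 2) (# 1 ⊹ ($ 0 ⊹ $ 1) ⊴ $ 2 ∋ x<j ∷ $ 3 ⊴ $ 1 ∋ l ∷ [])) (inj₂ (≤-trans (y-below tower m) (m≤m+n x a)))) (g a l)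
    upper : Dec (a ≡ w) → τ (x + a) + dτ (x + a) ≡ τ (dτ (x + a)) + (n + (x + a))
    upper (yes refl) = ≤-antisym (lin≤ (dτ (x + Cover.w cv) ∷ d x ∷ Cover.w cv ∷ τ (dτ (x + Cover.w cv)) ∷ τ (d x + Cover.w cv) ∷ τ (x + Cover.w cv) ∷ L ∷ κ x ∷ κ (d x) ∷ n ∷ x ∷ []) 1 ($ 5 ⊹ $ 0) ($ 3 ⊹ ($ 9 ⊹ ($ 10 ⊹ $ 2))) ($ 0 ≐ $ 1 ⊹ $ 2 ∋ δr ∷ $ 4 ≐ $ 3 ∋ sym (cong τ δr) ∷ $ 5 ⊹ $ 6 ≐ $ 7 ⊹ $ 2 ∋ τ-end x m ∷ $ 8 ⊹ $ 2 ≐ $ 4 ⊹ $ 6 ∋ sym (τ-end (d x) m') ∷ $ 7 ⊹ $ 1 ≐ $ 8 ⊹ ($ 9 ⊹ $ 10) ∋ eqn x ∷ [])) (lin≤ (dτ (x + Cover.w cv) ∷ d x ∷ Cover.w cv ∷ τ (dτ (x + Cover.w cv)) ∷ τ (d x + Cover.w cv) ∷ τ (x + Cover.w cv) ∷ L ∷ κ x ∷ κ (d x) ∷ n ∷ x ∷ []) 1 ($ 3 ⊹ ($ 9 ⊹ ($ 10 ⊹ $ 2))) ($ 5 ⊹ $ 0) ($ 1 ⊹ $ 2 ≐ $ 0 ∋ sym δr ∷ $ 3 ≐ $ 4 ∋ cong τ δr ∷ $ 7 ⊹ $ 2 ≐ $ 5 ⊹ $ 6 ∋ sym (τ-end x m)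 ∷ $ 4 ⊹ $ 6 ≐ $ 8 ⊹ $ 2 ∋ τ-end (d x) m' ∷ $ 8 ⊹ ($ 9 ⊹ $ 10) ≐ $ 7 ⊹ $ 1 ∋ sym (eqn x) ∷ []))
    upper (no ne) = ≤-antisym (lin≤ (dτ (x + a) ∷ d x ∷ a ∷ τ (dτ (x + a)) ∷ τ (d x + a) ∷ τ (x + a) ∷ κ (suc (x + a)) ∷ κ (suc (d x + a)) ∷ d (suc (x + a)) ∷ κ (d (suc (x + a))) ∷ n ∷ x ∷ []) 1 ($ 5 ⊹ $ 0) ($ 3 ⊹ ($ 10 ⊹ ($ 11 ⊹ $ 2))) ($ 0 ≐ $ 1 ⊹ $ 2 ∋ δr ∷ $ 4 ≐ $ 3 ∋ sym (cong τ δr) ∷ # 1 ⊹ $ 5 ≐ $ 6 ∋ τ-mid x m a a<w ∷ $ 7 ≐ # 1 ⊹ $ 4 ∋ sym (τ-mid (d x) m' a a<w) ∷ $ 6 ⊹ $ 8 ≐ $ 9 ⊹ ($ 10 ⊹ (# 1 ⊹ ($ 11 ⊹ $ 2))) ∋ eqn (suc (x + a)) ∷ # 1 ⊹ ($ 1 ⊹ $ 2) ≐ $ 8 ∋ sym e ∷ $ 9 ≐ $ 7 ∋ cong κ e ∷ [])) (lin≤ (dτ (x + a) ∷ d x ∷ a ∷ τ (dτ (x + a)) ∷ τ (d x + a) ∷ τ (x + a) ∷ κ (suc (x + a)) ∷ κ (suc (d x + a)) ∷ d (suc (x + a)) ∷ κ (d (suc (x + a))) ∷ n ∷ x ∷ [])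 1 ($ 3 ⊹ ($ 10 ⊹ ($ 11 ⊹ $ 2))) ($ 5 ⊹ $ 0) ($ 1 ⊹ $ 2 ≐ $ 0 ∋ sym δr ∷ $ 3 ≐ $ 4 ∋ cong τ δr ∷ $ 6 ≐ # 1 ⊹ $ 5 ∋ sym (τ-mid x m a a<w) ∷ # 1 ⊹ $ 4 ≐ $ 7 ∋ τ-mid (d x) m' a a<w ∷ $ 9 ⊹ ($ 10 ⊹ (# 1 ⊹ ($ 11 ⊹ $ 2))) ≐ $ 6 ⊹ $ 8 ∋ sym (eqn (suc (x + a))) ∷ $ 8 ≐ # 1 ⊹ ($ 1 ⊹ $ 2) ∋ e ∷ $ 7 ≐ $ 9 ∋ sym (cong κ e) ∷ []))
      where
      a<w = ≤∧≢⇒< l ne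
      e : d (suc (x + a)) ≡ suc (d x + a)
      e = trans (cong d (sym (+-suc x a))) (trans (g (suc a) a<w) (+-suc (d x) a))
  τ-eqn r | outside h = off (copy? r)
    where
    copy? : ∀ r → (y ≤ r × r < y + w) ⊎ (r < y ⊎ y + w ≤ r)
    copy? = Moves.range? 0 n [] C y w
    τr : τ r ≡ κ r
    τr = τ-out r h
    topmost : ∀ {j c y} (t : Tower d w j c y) → ∃[ x ] x ∈ tops t × (∀ a → a < w → d (y + a) ≡ suc (x + a))
    topmost (top _ _ g) = _ , here refl , g
    topmost (step _ t) with topmost t
    ... | x , m , g = x , there m , g
    off : (y ≤ r × r < y + w) ⊎ (r < y ⊎ y + w ≤ r) → τ r + dτ r ≡ τ (dτ r) + (n + r)
    off (inj₁ (a , b)) with m≤n⇒∃[o]m+o≡n a | topmost tower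
    ... | o , refl | x , m , g = ≤-antisym (lin≤ (τ (Cover.y cv + o) ∷ κ (Cover.y cv + o) ∷ dτ (Cover.y cv + o) ∷ d (Cover.y cv + o) ∷ τ (dτ (Cover.y cv + o)) ∷ τ (x + o) ∷ x ∷ o ∷ κ (suc (x + o)) ∷ κ (d (Cover.y cv + o)) ∷ n ∷ Cover.y cv ∷ []) 1 ($ 0 ⊹ $ 2) ($ 4 ⊹ ($ 10 ⊹ ($ 11 ⊹ $ 7))) ($ 0 ≐ $ 1 ∋ τr ∷ # 1 ⊹ $ 2 ≐ $ 3 ∋ δr ∷ $ 5 ≐ $ 4 ∋ sym (cong τ δ≡) ∷ $ 8 ≐ # 1 ⊹ $ 5 ∋ sym (τ-mid x m o o<w) ∷ $ 1 ⊹ $ 3 ≐ $ 9 ⊹ ($ 10 ⊹ ($ 11 ⊹ $ 7)) ∋ eqn (y + o) ∷ $ 9 ≐ $ 8 ∋ cong κ (g o o<w) ∷ [])) (lin≤ (τ (Cover.y cv + o) ∷ κ (Cover.y cv + o) ∷ dτ (Cover.y cv + o) ∷ d (Cover.y cv + o) ∷ τ (dτ (Cover.y cv + o)) ∷ τ (x + o) ∷ x ∷ o ∷ κ (suc (x + o)) ∷ κ (d (Cover.y cv + o)) ∷ n ∷ Cover.y cv ∷ []) 1 ($ 4 ⊹ ($ 10 ⊹ ($ 11 ⊹ $ 7))) ($ 0 ⊹ $ 2) ($ 1 ≐ $ 0 ∋ sym τr ∷ $ 3 ≐ # 1 ⊹ $ 2 ∋ sym δr ∷ $ 4 ≐ $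 5 ∋ cong τ δ≡ ∷ # 1 ⊹ $ 5 ≐ $ 8 ∋ τ-mid x m o o<w ∷ $ 9 ⊹ ($ 10 ⊹ ($ 11 ⊹ $ 7)) ≐ $ 1 ⊹ $ 3 ∋ sym (eqn (y + o)) ∷ $ 8 ≐ $ 9 ∋ sym (cong κ (g o o<w)) ∷ []))
      where
      o<w : o < w
      o<w = +-cancelˡ-< y o w b
      δr : suc (dτ (y + o)) ≡ d (y + o)
      δr = dMove-low w yj (y + o) a b
      δ≡ : dτ (y + o) ≡ x + o
      δ≡ = suc-injective (trans δr (g o o<w))
    off (inj₂ o) = trans (cong₂ _+_ τr δr) (trans (eqn r) (cong (_+ (n + r)) (trans (sym (τ-out (d r) clear)) (cong τ (sym δr)))))
      where
      δr : dτ r ≡ d r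
      δr with h j (head∈ tower)
      ... | inj₁ l = dMove-out w yj r l o
      ... | inj₂ l = dMove-above w yj r l
      not-inside : (r < y ⊎ y + w ≤ r) → ∀ x a → x ∈ xs → a ≤ w → d r ≢ x + a
      not-inside s x a m l e with tops-up tower m
      ... | inj₁ (u , m' , g) with d-inj (trans e (sym (g a l))) | h u m'
      ...   | refl | inj₁ q = lin⊥ (u ∷ a ∷ []) (# 1 ⊹ ($ 0 ⊹ $ 1) ⊴ $ 0 ∋ q ∷ [])
      ...   | refl | inj₂ q = lin⊥ (u ∷ Cover.w cv ∷ a ∷ []) (# 1 ⊹ ($ 0 ⊹ $ 1) ⊴ $ 0 ⊹ $ 2 ∋ q ∷ $ 2 ⊴ $ 1 ∋ l ∷ [])
      not-inside s x zero    m l e | inj₂ (nu , _ , _) = nu r (trans e (+-identityʳ x))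
      not-inside s x (suc a) m l e | inj₂ (nu , g , _) with d-inj (trans e (trans (+-suc x a) (sym (g a l)))) | s
      ... | refl | inj₁ q = lin⊥ (Cover.y cv ∷ a ∷ []) (# 1 ⊹ ($ 0 ⊹ $ 1) ⊴ $ 0 ∋ q ∷ [])
      ... | refl | inj₂ q = lin⊥ (Cover.y cv ∷ Cover.w cv ∷ a ∷ []) ($ 0 ⊹ $ 1 ⊴ $ 0 ⊹ $ 2 ∋ q ∷ # 1 ⊹ $ 2 ⊴ $ 1 ∋ l ∷ [])
      clear : ∀ x → x ∈ xs → d r < x ⊎ x + w < d r
      clear x m with d r <? x | x + w <? d r
      ... | yes p | _     = inj₁ p
      ... | no _  | yes q = inj₂ q
      ... | no p  | no q with m≤n⇒∃[o]m+o≡n (≮⇒≥ p)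
      ...   | a , e = ⊥-elim (not-inside o x a m (lin≤ (x ∷ a ∷ d r ∷ Cover.w cv ∷ []) 1 ($ 1) ($ 3) ($ 0 ⊹ $ 1 ≐ $ 2 ∋ e ∷ $ 2 ⊴ $ 0 ⊹ $ 3 ∋ ≮⇒≥ q ∷ [])) (sym e))

  core : IsCore n τ dτ
  core = record { mono = τ-mono ; eqn = τ-eqn ; pos = pos }

tops-weaken : ∀ {d w w' j c y} (l : w ≤ w') (t : Tower d w' j c y) → tops (tower-weaken l t) ≡ tops t
tops-weaken l (top _ _ _) = refl
tops-weaken l (step _ t)  = cong (_ ∷_) (tops-weaken l t)

-- Every smaller core lies below a cover.

-- A core κ' strictly inside κ stays inside some core covered by κ.  The descent
-- follows the bounce path of a row without preimage; G is the distance from the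
-- bead of row j to a bead of κ' lying in the gap of κ after row j + v.
module Descent {n κ d κ' d'} (C : IsCore n κ d) (C' : IsCore n κ' d') (sub : ∀ r → κ' r ≤ κ r)
               (N : ℕ) (end : κ N ≡ 0) where
  open IsCore C
  module ′ = IsCore C'

  zero-after : ∀ r → N ≤ r → κ r ≡ 0
  zero-after r l = n≤0⇒n≡0 (≤-trans (mono-≤ l) (≤-reflexive end))

  Goal : Set
  Goal = ∃[ j ] Σ (Cover d j) λ cv → ∀ r → κ' r ≤ Below.τ C cv r

  finish : ∀ {j} (cv : Cover d j) →
    (∀ x → x ∈ Below.xs C cv → ∀ a → a < Cover.w cv → κ' (x + a) < κ (suc (x + a))) →
    (∀ x → x ∈ Below.xs C cv → κ' (x + Cover.w cv) + Below.L C cv ≤ κ x + Cover.w cv) → Goal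
  finish {j} cv hA hE = j , cv , inclusion
    where
    open Below C cv
    open Cover cv
    inclusion : ∀ r → κ' r ≤ τ r
    inclusion r with locate w xs r
    ... | outside h = ≤-trans (sub r) (≤-reflexive (sym (τ-out r h)))
    ... | inside x a m l refl with a ≟ w
    ...   | yes refl = lin≤ (κ' (x + Cover.w cv) ∷ (κ (d j) + suc (Cover.w cv) ∸ κ (d j + suc (Cover.w cv))) ∷ κ x ∷ Cover.w cv ∷ Below.τ C cv (x + Cover.w cv) ∷ []) 1 ($ 0) ($ 4) ($ 0 ⊹ $ 1 ⊴ $ 2 ⊹ $ 3 ∋ hE x m ∷ $ 2 ⊹ $ 3 ≐ $ 4 ⊹ $ 1 ∋ sym (τ-end x m) ∷ [])
    ...   | no ne    = lin≤ (κ' (x + a) ∷ κ (suc (x + a)) ∷ Below.τ C cv (x + a) ∷ []) 1 ($ 0) ($ 2) (# 1 ⊹ $ 0 ⊴ $ 1 ∋ hA x m a (≤∧≢⇒< l ne) ∷ $ 1 ≐ # 1 ⊹ $ 2 ∋ sym (τ-mid x m a (≤∧≢⇒< l ne)) ∷ [])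

  -- `q` names rows of κ' that accompany rows j, ..., j + v: for a < v the bead of `q a` is at most
  -- that of row j + a + 1 of κ, and the bead of `q v` lies exactly G below that of row j. As d and
  -- d' both lower beads by n, these relations survive a step of the bounce path.
  record Window (v G j : ℕ) : Set where
    field
      {c y}  : ℕ
      tower  : Tower d v j c y
      small  : j + v < d j
      within : ∀ x → x ∈ tops tower → ∀ a → a < v → κ' (x + a) < κ (suc (x + a))
      last   : ∀ x → x ∈ tops tower → κ' (x + v) + G ≤ κ x + v
      gap-lo : κ (suc (j + v)) + G ≤ κ j + v
      gap-hi : κ j + v < κ (j + v) + G
      q      : ℕ → ℕ
      q-mono : ∀ a → a < v → q a < q (suc a)
      q-le   : ∀ a → a ≤ v → q a ≤ j + a
      q-A    : ∀ a → a < v → κ' (q a) + suc (j + a) ≤ κ (suc (j + a)) + q a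
      q-E    : κ' (q v) + G + j ≡ κ j + q v

  firstStop : ∀ j v → (∃[ w ] w < v × d (j + w) ≡ d j + w × d (j + suc w) ≢ d j + suc w) ⊎ (d (j + v) ≡ d j + v)
  firstStop j zero    = inj₂ (trans (cong d (+-identityʳ j)) (sym (+-identityʳ _)))
  firstStop j (suc v) with firstStop j v
  ... | inj₁ (w , l , p , q) = inj₁ (w , m<n⇒m<1+n l , p , q)
  ... | inj₂ p with d (j + suc v) ≟ d j + suc v
  ...   | yes e = inj₂ e
  ...   | no ne = inj₁ (v , ≤-refl , p , ne)

  -- Three outcomes at row j. A run of d that breaks off before v gives a narrower cover; a full run
  -- whose bead in row d j + v + 1 is within distance G of that in row d j gives a cover of width v;
  -- otherwise the gap reappears at row d j and the tower grows by one level.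
  descend : ∀ fuel {v G j} → N ≤ j + fuel → Window v G j → Goal
  descend fuel {v} {G} {j} fl W with firstStop j v
  ... | inj₁ (w , w<v , run , stop) = finish cv hA hE
    where
    open Window W
    cv : Cover d j
    cv = cover run stop (lin≤ (j ∷ v ∷ d j ∷ w ∷ []) 1 (# 1 ⊹ ($ 0 ⊹ $ 3)) ($ 2) (# 1 ⊹ ($ 0 ⊹ $ 1) ⊴ $ 2 ∋ small ∷ # 1 ⊹ $ 3 ⊴ $ 1 ∋ w<v ∷ [])) (tower-weaken (<⇒≤ w<v) tower)
    mem : ∀ {x} → x ∈ Below.xs C cv → x ∈ tops tower
    mem {x} = subst (x ∈_) (tops-weaken (<⇒≤ w<v) tower)
    hA : ∀ x → x ∈ Below.xs C cv → ∀ a → a < w → κ' (x + a) < κ (suc (x + a))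
    hA x m a l = within x (mem m) a (<-trans l w<v)
    hE : ∀ x → x ∈ Below.xs C cv → κ' (x + w) + Below.L C cv ≤ κ x + w
    hE x m = lin≤ (κ' (x + w) ∷ κ (suc (x + w)) ∷ Below.L C cv ∷ κ x ∷ Cover.w cv ∷ []) 1 ($ 0 ⊹ $ 2) ($ 3 ⊹ $ 4) (# 1 ⊹ $ 0 ⊴ $ 1 ∋ within x (mem m) w w<v ∷ $ 1 ⊹ $ 2 ⊴ $ 3 ⊹ $ 4 ∋ Below.bead-next C cv x m ∷ [])
  ... | inj₂ run with κ (d j) + suc v ≤? κ (d j + suc v) + G
  ...   | yes far = finish cv within hE
    where
    open Window W
    stop : d (j + suc v) ≢ d j + suc v
    stop e = lin⊥ (κ (suc (j + v)) ∷ G ∷ κ j ∷ v ∷ d j ∷ κ (d j) ∷ n ∷ j ∷ κ (j + suc v) ∷ d (j + suc v) ∷ κ (d (j + suc v)) ∷ κ (d j + suc v) ∷ []) ($ 0 ⊹ $ 1 ⊴ $ 2 ⊹ $ 3 ∋ gap-lo ∷ $ 2 ⊹ $ 4 ≐ $ 5 ⊹ ($ 6 ⊹ $ 7) ∋ eqn j ∷ $ 10 ⊹ ($ 6 ⊹ ($ 7 ⊹ (# 1 ⊹ $ 3))) ≐ $ 8 ⊹ $ 9 ∋ sym (eqn (j + suc v)) ∷ $ 9 ≐ $ 4 ⊹ (# 1 ⊹ $ 3) ∋ e ∷ $ 5 ⊹ (# 1 ⊹ $ 3) ⊴ $ 11 ⊹ $ 1 ∋ far ∷ $ 11 ≐ $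 10 ∋ sym (cong κ e) ∷ $ 8 ≐ $ 0 ∋ cong κ (+-suc j v) ∷ [])
    cv : Cover d j
    cv = cover run stop small tower
    hE : ∀ x → x ∈ Below.xs C cv → κ' (x + v) + Below.L C cv ≤ κ x + v
    hE x m = lin≤ (κ' (x + v) ∷ G ∷ κ x ∷ v ∷ Below.L C cv ∷ κ (d j + suc (Cover.w cv)) ∷ κ (d j) ∷ []) 1 ($ 0 ⊹ $ 4) ($ 2 ⊹ $ 3) ($ 0 ⊹ $ 1 ⊴ $ 2 ⊹ $ 3 ∋ last x m ∷ $ 4 ⊹ $ 5 ≐ $ 6 ⊹ (# 1 ⊹ $ 3) ∋ Below.L-eq C cv ∷ $ 6 ⊹ (# 1 ⊹ $ 3) ⊴ $ 5 ⊹ $ 1 ∋ far ∷ [])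
  ...   | no near = next fuel fl
    where
    open Window W
    q' : ℕ → ℕ
    q' a = d' (q a)
    run-≤ : ∀ a → a ≤ v → d (j + a) ≡ d j + a
    run-≤ = d-run j v run
    q'-E : κ' (q' v) + G + d j ≡ κ (d j) + q' v
    q'-E = ≤-antisym (lin≤ (κ' (Window.q W v) ∷ G ∷ j ∷ κ j ∷ Window.q W v ∷ d' (Window.q W v) ∷ κ' (d' (Window.q W v)) ∷ n ∷ d j ∷ κ (d j) ∷ []) 1 ($ 6 ⊹ $ 1 ⊹ $ 8) ($ 9 ⊹ $ 5) ($ 0 ⊹ $ 1 ⊹ $ 2 ≐ $ 3 ⊹ $ 4 ∋ q-E ∷ $ 6 ⊹ ($ 7 ⊹ $ 4) ≐ $ 0 ⊹ $ 5 ∋ sym (′.eqn (q v)) ∷ $ 3 ⊹ $ 8 ≐ $ 9 ⊹ ($ 7 ⊹ $ 2) ∋ eqn j ∷ [])) (lin≤ (κ' (Window.q W v) ∷ G ∷ j ∷ κ j ∷ Window.q W v ∷ d' (Window.q W v) ∷ κ' (d' (Window.q W v)) ∷ n ∷ d j ∷ κ (d j) ∷ []) 1 ($ 9 ⊹ $ 5) ($ 6 ⊹ $ 1 ⊹ $ 8) ($ 3 ⊹ $ 4 ≐ $ 0 ⊹ $ 1 ⊹ $ 2 ∋ sym q-E ∷ $ 0 ⊹ $ 5 ≐ $ 6 ⊹ ($ 7 ⊹ $ 4) ∋ ′.eqn (q v) ∷ $ 9 ⊹ ($ 7 ⊹ $ 2) ≐ $ 3 ⊹ $ 8 ∋ sym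 (eqn j) ∷ []))
    small' : d j + v < d (d j)
    small' with d j + v <? d (d j)
    ... | yes p = p
    ... | no p = ⊥-elim (lin⊥ (j ∷ v ∷ d j ∷ o' ∷ d (d j) ∷ d (d j + 0) ∷ []) (# 1 ⊹ ($ 0 ⊹ $ 1) ⊴ $ 2 ∋ small ∷ $ 2 ≐ $ 0 ⊹ $ 3 ∋ sym grow ∷ $ 3 ⊴ $ 1 ∋ over ∷ []))
      where
      o' = proj₁ (m≤n⇒∃[o]m+o≡n (<⇒≤ (d-> (d j))))
      e' : d j + o' ≡ d (d j)
      e' = proj₂ (m≤n⇒∃[o]m+o≡n (<⇒≤ (d-> (d j))))
      grow : j + o' ≡ d j
      grow = d-inj (trans (run-≤ o' (lin≤ (d j ∷ o' ∷ d (d j) ∷ v ∷ []) 1 ($ 1) ($ 3) ($ 0 ⊹ $ 1 ≐ $ 2 ∋ e' ∷ $ 2 ⊴ $ 0 ⊹ $ 3 ∋ ≮⇒≥ p ∷ []))) e')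
      over : o' ≤ v
      over = lin≤ (d j ∷ o' ∷ d (d j) ∷ v ∷ []) 1 ($ 1) ($ 3) ($ 0 ⊹ $ 1 ≐ $ 2 ∋ e' ∷ $ 2 ⊴ $ 0 ⊹ $ 3 ∋ ≮⇒≥ p ∷ [])
    q'v-le : q' v ≤ d j + v
    q'v-le with q' v ≤? d j + v
    ... | yes p = p
    ... | no p = ⊥-elim (lin⊥ (κ' (q' v) ∷ G ∷ d j ∷ κ (d j) ∷ q' v ∷ κ (d j + suc v) ∷ v ∷ κ' (d j + suc v) ∷ []) ($ 3 ⊹ $ 4 ≐ $ 0 ⊹ $ 1 ⊹ $ 2 ∋ sym q'-E ∷ # 1 ⊹ ($ 5 ⊹ $ 1) ⊴ $ 3 ⊹ (# 1 ⊹ $ 6) ∋ ≰⇒> near ∷ $ 7 ⊴ $ 5 ∋ sub (d j + suc v) ∷ $ 0 ⊴ $ 7 ∋ ′.mono-≤ {d j + suc v} {q' v} (lin≤ (d j ∷ v ∷ d' (Window.q W v) ∷ []) 1 ($ 0 ⊹ (# 1 ⊹ $ 1)) ($ 2) (# 1 ⊹ ($ 0 ⊹ $ 1) ⊴ $ 2 ∋ ≰⇒> p ∷ [])) ∷ # 1 ⊹ ($ 2 ⊹ $ 6) ⊴ $ 4 ∋ ≰⇒> p ∷ []))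
    q'-mono : ∀ a → a < v → q' a < q' (suc a)
    q'-mono a l = ′.d-mono (q-mono a l)
    q'-le : ∀ a → a ≤ v → q' a ≤ d j + a
    q'-le a l with m≤n⇒∃[o]m+o≡n l
    ... | o , refl = go o a refl
      where
      go : ∀ o a → a + o ≡ v → q' a ≤ d j + a
      go zero    a e rewrite +-identityʳ a | e = q'v-le
      go (suc o) a e = ≤-pred (≤-trans (q'-mono a (subst (a <_) e (m<m+n a z<s))) (≤-trans (go o (suc a) (trans (sym (+-suc a o)) e)) (≤-reflexive (+-suc (d j) a))))
    shifted : ∀ a → a < v → d (suc (j + a)) ≡ suc (d j + a)
    shifted a l = trans (cong d (sym (+-suc j a))) (trans (run-≤ (suc a) l) (+-suc (d j) a))
    q'-A : ∀ a → a < v → κ' (q' a) + suc (d j + a) ≤ κ (suc (d j + a)) + q' a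
    q'-A a l = lin≤ (κ' (Window.q W a) ∷ j ∷ a ∷ κ (suc (j + a)) ∷ Window.q W a ∷ d' (Window.q W a) ∷ κ' (d' (Window.q W a)) ∷ n ∷ d (suc (j + a)) ∷ κ (d (suc (j + a))) ∷ d j ∷ κ (suc (d j + a)) ∷ []) 1 ($ 6 ⊹ (# 1 ⊹ ($ 10 ⊹ $ 2))) ($ 11 ⊹ $ 5) ($ 0 ⊹ (# 1 ⊹ ($ 1 ⊹ $ 2)) ⊴ $ 3 ⊹ $ 4 ∋ q-A a l ∷ $ 6 ⊹ ($ 7 ⊹ $ 4) ≐ $ 0 ⊹ $ 5 ∋ sym (′.eqn (q a)) ∷ $ 3 ⊹ $ 8 ≐ $ 9 ⊹ ($ 7 ⊹ (# 1 ⊹ ($ 1 ⊹ $ 2))) ∋ eqn (suc (j + a)) ∷ # 1 ⊹ ($ 10 ⊹ $ 2) ≐ $ 8 ∋ sym (shifted a l) ∷ $ 9 ≐ $ 11 ∋ cong κ (shifted a l) ∷ [])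
    tower' : Tower d v (d j) (suc c) y
    tower' = step run-≤ tower
    W' : Window v G (d j)
    W' = record
      { tower  = tower'
      ; small  = small'
      ; within = λ { x (here refl) a l → (lin≤ (κ' (q' a) ∷ d j ∷ a ∷ κ (suc (d j + a)) ∷ q' a ∷ κ' (d j + a) ∷ []) 1 (# 1 ⊹ $ 5) ($ 3) ($ 0 ⊹ (# 1 ⊹ ($ 1 ⊹ $ 2)) ⊴ $ 3 ⊹ $ 4 ∋ q'-A a l ∷ $ 4 ⊴ $ 1 ⊹ $ 2 ∋ q'-le a (<⇒≤ l) ∷ $ 5 ⊴ $ 0 ∋ ′.mono-≤ (q'-le a (<⇒≤ l)) ∷ []))
                   ; x (there m) a l → within x m a l }
      ; last   = λ { x (here refl) → (lin≤ (κ' (q' v) ∷ G ∷ d j ∷ κ (d j) ∷ q' v ∷ v ∷ κ' (d j + v) ∷ []) 1 ($ 6 ⊹ $ 1) ($ 3 ⊹ $ 5) ($ 0 ⊹ $ 1 ⊹ $ 2 ≐ $ 3 ⊹ $ 4 ∋ q'-E ∷ $ 4 ⊴ $ 2 ⊹ $ 5 ∋ q'v-le ∷ $ 6 ⊴ $ 0 ∋ ′.mono-≤ q'v-le ∷ []))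
                   ; x (there m) → last x m }
      ; gap-lo = lin≤ (κ (d j + suc v) ∷ G ∷ κ (d j) ∷ v ∷ κ (suc (d j + v)) ∷ []) 1 ($ 4 ⊹ $ 1) ($ 2 ⊹ $ 3) (# 1 ⊹ ($ 0 ⊹ $ 1) ⊴ $ 2 ⊹ (# 1 ⊹ $ 3) ∋ ≰⇒> near ∷ $ 4 ≐ $ 0 ∋ sym (cong κ (+-suc (d j) v)) ∷ [])
      ; gap-hi = lin≤ (κ j ∷ v ∷ κ (j + v) ∷ G ∷ d j ∷ κ (d j) ∷ n ∷ j ∷ d (j + v) ∷ κ (d (j + v)) ∷ κ (d j + v) ∷ []) 1 (# 1 ⊹ ($ 5 ⊹ $ 1)) ($ 10 ⊹ $ 3) (# 1 ⊹ ($ 0 ⊹ $ 1) ⊴ $ 2 ⊹ $ 3 ∋ gap-hi ∷ $ 5 ⊹ ($ 6 ⊹ $ 7) ≐ $ 0 ⊹ $ 4 ∋ sym (eqn j) ∷ $ 2 ⊹ $ 8 ≐ $ 9 ⊹ ($ 6 ⊹ ($ 7 ⊹ $ 1)) ∋ eqn (j + v) ∷ $ 4 ⊹ $ 1 ≐ $ 8 ∋ sym run ∷ $ 9 ≐ $ 10 ∋ cong κ run ∷ [])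
      ; q = q' ; q-mono = q'-mono ; q-le = q'-le ; q-A = q'-A ; q-E = q'-E }
    next : ∀ fuel → N ≤ j + fuel → Goal
    -- Row j + v is empty here, and `gap-hi` with `q-E` would force a negative part of κ'.
    next zero    fl = ⊥-elim (lin⊥ (κ' (Window.q W v) ∷ G ∷ j ∷ κ j ∷ Window.q W v ∷ v ∷ κ (j + v) ∷ []) ($ 0 ⊹ $ 1 ⊹ $ 2 ≐ $ 3 ⊹ $ 4 ∋ q-E ∷ $ 4 ⊴ $ 2 ⊹ $ 5 ∋ q-le v ≤-refl ∷ # 1 ⊹ ($ 3 ⊹ $ 5) ⊴ $ 6 ⊹ $ 1 ∋ gap-hi ∷ $ 6 ≐ # 0 ∋ zero-after (j + v) (lin≤ (N ∷ j ∷ v ∷ []) 1 ($ 0) ($ 1 ⊹ $ 2) ($ 0 ⊴ $ 1 ⊹ # 0 ∋ fl ∷ [])) ∷ []))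
    next (suc fuel) fl = descend fuel (lin≤ (N ∷ j ∷ fuel ∷ d j ∷ []) 1 ($ 0) ($ 3 ⊹ $ 2) ($ 0 ⊴ $ 1 ⊹ (# 1 ⊹ $ 2) ∋ fl ∷ # 1 ⊹ $ 1 ⊴ $ 3 ∋ d-> j ∷ [])) W'

  firstDiff : ∀ r → κ' r < κ r → ∃[ i ] κ' i < κ i × (∀ r → r < i → κ' r ≡ κ r)
  firstDiff r l = search r 0 (λ r ()) (+-identityʳ r)
    where
    search : ∀ m i → (∀ r → r < i → κ' r ≡ κ r) → m + i ≡ r → ∃[ i ] κ' i < κ i × (∀ r → r < i → κ' r ≡ κ r)
    search m i h e with κ' i <? κ i
    search m       i h e | yes p = i , p , h
    search zero    i h e | no p = ⊥-elim (p (subst (λ r → κ' r < κ r) (sym e) l))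
    search (suc m) i h e | no p = search m (suc i) h' (trans (+-suc m i) e)
      where
      h' : ∀ r → r < suc i → κ' r ≡ κ r
      h' r q with r ≟ i
      ... | yes refl = ≤-antisym (sub r) (≮⇒≥ p)
      ... | no ne    = h r (≤∧≢⇒< (≤-pred q) ne)

  -- Were i = d u, the bead of row u, common to κ and κ', would force the bead of row i of κ into
  -- κ'. The rows before i agree and row i of κ' is shorter, so that bead is missing there.
  firstDiff-noUp : ∀ {i} → κ' i < κ i → (∀ r → r < i → κ' r ≡ κ r) → ∀ u → d u ≢ i
  firstDiff-noUp {i} l h u refl with d' u <? d u
  ... | yes p = lin⊥ (d u ∷ d' u ∷ []) ($ 0 ≐ $ 1 ∋ idx-≡ {d u} {d' u} (≤-antisym (lin≤ (κ u ∷ d u ∷ κ (d u) ∷ n ∷ u ∷ κ' u ∷ d' u ∷ κ' (d' u) ∷ κ (d' u) ∷ []) 1 ($ 8 ⊹ $ 1) ($ 2 ⊹ $ 6) ($ 0 ⊹ $ 1 ≐ $ 2 ⊹ ($ 3 ⊹ $ 4) ∋ eqn u ∷ $ 7 ⊹ ($ 3 ⊹ $ 4) ≐ $ 5 ⊹ $ 6 ∋ sym (′.eqn u) ∷ $ 5 ≐ $ 0 ∋ h u (d-> u) ∷ $ 8 ≐ $ 7 ∋ sym (h (d' u) p) ∷ [])) (lin≤ (κ u ∷ d u ∷ κ (d u) ∷ n ∷ u ∷ κ' u ∷ d' u ∷ κ' (d' u) ∷ κ (d' u) ∷ []) 1 ($ 2 ⊹ $ 6) ($ 8 ⊹ $ 1)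 ($ 2 ⊹ ($ 3 ⊹ $ 4) ≐ $ 0 ⊹ $ 1 ∋ sym (eqn u) ∷ $ 5 ⊹ $ 6 ≐ $ 7 ⊹ ($ 3 ⊹ $ 4) ∋ ′.eqn u ∷ $ 0 ≐ $ 5 ∋ sym (h u (d-> u)) ∷ $ 7 ≐ $ 8 ∋ h (d' u) p ∷ []))) ∷ # 1 ⊹ $ 1 ⊴ $ 0 ∋ p ∷ [])
  ... | no p  = lin⊥ (κ u ∷ d u ∷ κ (d u) ∷ n ∷ u ∷ κ' u ∷ d' u ∷ κ' (d' u) ∷ κ' (d u) ∷ []) ($ 2 ⊹ ($ 3 ⊹ $ 4) ≐ $ 0 ⊹ $ 1 ∋ sym (eqn u) ∷ $ 5 ⊹ $ 6 ≐ $ 7 ⊹ ($ 3 ⊹ $ 4) ∋ ′.eqn u ∷ $ 0 ≐ $ 5 ∋ sym (h u (d-> u)) ∷ $ 7 ⊴ $ 8 ∋ ′.mono-≤ (≮⇒≥ p) ∷ # 1 ⊹ $ 8 ⊴ $ 2 ∋ l ∷ $ 1 ⊴ $ 6 ∋ ≮⇒≥ p ∷ [])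

  -- m is the first row from i on whose bead in κ' lies above the next bead of κ.
  firstGap : ∀ i → κ' i < κ i → ∃[ m ] i ≤ m × κ (suc m) ≤ κ' m × κ' m < κ m × (∀ r → i ≤ r → r < m → κ' r < κ (suc r))
  firstGap i l = search N i ≤-refl l (λ r a b → ⊥-elim (lin⊥ (i ∷ r ∷ []) ($ 0 ⊴ $ 1 ∋ a ∷ # 1 ⊹ $ 1 ⊴ $ 0 ∋ b ∷ []))) (m≤m+n N i)
    where
    search : ∀ fuel m → i ≤ m → κ' m < κ m → (∀ r → i ≤ r → r < m → κ' r < κ (suc r)) → N ≤ fuel + m →
      ∃[ m ] i ≤ m × κ (suc m) ≤ κ' m × κ' m < κ m × (∀ r → i ≤ r → r < m → κ' r < κ (suc r))
    search fuel m im lt h fl with κ (suc m) ≤? κ' m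
    ... | yes p = m , im , p , lt , h
    search zero m im lt h fl | no p = ⊥-elim (lin⊥ (κ' m ∷ κ m ∷ []) (# 1 ⊹ $ 0 ⊴ $ 1 ∋ lt ∷ $ 1 ≐ # 0 ∋ zero-after m fl ∷ []))
    search (suc fuel) m im lt h fl | no p = search fuel (suc m) (m≤n⇒m≤1+n im) (≤-trans (s≤s (′.mono m)) (≰⇒> p)) h' (≤-trans fl (≤-reflexive (sym (+-suc fuel m))))
      where
      h' : ∀ r → i ≤ r → r < suc m → κ' r < κ (suc r)
      h' r a b with r ≟ m
      ... | yes refl = ≰⇒> p
      ... | no ne    = h r a (≤∧≢⇒< (≤-pred b) ne)

  lastNoUp : ∀ i m → i ≤ m → (∀ u → d u ≢ i) → ∃[ x ] i ≤ x × x ≤ m × (∀ u → d u ≢ x) × (∀ r → x < r → r ≤ m → ∃[ u ] d u ≡ r)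
  lastNoUp i m l nu with up? m
  ... | inj₂ p = m , l , ≤-refl , p , (λ r a b → ⊥-elim (lin⊥ (m ∷ r ∷ []) (# 1 ⊹ $ 0 ⊴ $ 1 ∋ a ∷ $ 1 ⊴ $ 0 ∋ b ∷ [])))
  lastNoUp i m l nu | inj₁ (u , e) with i ≟ m
  ... | yes refl = ⊥-elim (nu u e)
  lastNoUp i zero    l nu | inj₁ (u , e) | no ne = ⊥-elim (ne (n≤0⇒n≡0 l))
  lastNoUp i (suc m) l nu | inj₁ (u , e) | no ne with lastNoUp i m (≤-pred (≤∧≢⇒< l ne)) nu
  ... | x , a , b , c , h = x , a , m≤n⇒m≤1+n b , c , h'
    where
    h' : ∀ r → x < r → r ≤ suc m → ∃[ u ] d u ≡ r
    h' r p q with r ≟ suc m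
    ... | yes refl = u , e
    ... | no ne    = h r p (≤-pred (≤∧≢⇒< q ne))

  lastPath : ∀ fuel {x} j m → Path d x j → j ≤ m → m ≤ j + fuel → ∃[ j ] Path d x j × j ≤ m × m < d j
  lastPath fuel j m p l fl with d j ≤? m
  ... | no q = j , p , l , ≰⇒> q
  lastPath zero       j m p l fl | yes q = ⊥-elim (lin⊥ (m ∷ j ∷ d j ∷ []) ($ 0 ⊴ $ 1 ⊹ # 0 ∋ fl ∷ $ 2 ⊴ $ 0 ∋ q ∷ # 1 ⊹ $ 1 ⊴ $ 2 ∋ d-> j ∷ []))
  lastPath (suc fuel) j m p l fl | yes q = lastPath fuel (d j) m (down p refl) q (lin≤ (m ∷ j ∷ fuel ∷ d j ∷ []) 1 ($ 0) ($ 3 ⊹ $ 2) ($ 0 ⊴ $ 1 ⊹ (# 1 ⊹ $ 2) ∋ fl ∷ # 1 ⊹ $ 1 ⊴ $ 3 ∋ d-> j ∷ []))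

  path-≤′ : ∀ {z j} → Path d z j → z ≤ j
  path-≤′ here          = ≤-refl
  path-≤′ (down p refl) = ≤-trans (path-≤′ p) (<⇒≤ (d-> _))

  -- Rows x + 1, ..., m all lie in the image of d, and preimages of consecutive rows are
  -- consecutive. This supplies each level of the tower from j back to x and, at x, the copies y, y
  -- + 1, ....
  buildTower : ∀ {x m} v → (∀ u → d u ≢ x) → (∀ r → x < r → r ≤ m → ∃[ u ] d u ≡ r) →
    ∀ {j} → Path d x j → j + v ≤ m → j + v < d j → ∃[ c ] ∃[ y ] Σ (Tower d v j c y) λ t → ∀ z → z ∈ tops t → x ≤ z
  buildTower {x} {m} zero nu ups here l s = 1 , 0 , top nu z≤n (λ a ()) , λ { z (here refl) → ≤-refl }
  buildTower {x} {m} (suc v) nu ups here l s with ups (suc x) ≤-refl (lin≤ (x ∷ v ∷ m ∷ []) 1 (# 1 ⊹ $ 0) ($ 2) ($ 0 ⊹ (# 1 ⊹ $ 1) ⊴ $ 2 ∋ l ∷ []))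
  ... | y , dy = 1 , y , top nu bound copies , λ { z (here refl) → ≤-refl }
    where
    copies : ∀ a → a < suc v → d (y + a) ≡ suc (x + a)
    copies zero    q = trans (cong d (+-identityʳ y)) (trans dy (cong suc (sym (+-identityʳ x))))
    copies (suc a) q with ups (suc (x + suc a)) (s≤s (m≤m+n x (suc a))) (lin≤ (x ∷ v ∷ m ∷ a ∷ []) 1 (# 1 ⊹ ($ 0 ⊹ (# 1 ⊹ $ 3))) ($ 2) ($ 0 ⊹ (# 1 ⊹ $ 1) ⊴ $ 2 ∋ l ∷ # 1 ⊹ (# 1 ⊹ $ 3) ⊴ # 1 ⊹ $ 1 ∋ q ∷ []))
    ... | u , e = trans (cong d (trans (+-suc y a) (sym (d-next (trans e (cong suc (trans (+-suc x a) (sym (copies a (<-trans ≤-refl q))))))))) ) e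
    bound : y + suc v ≤ x
    bound = ≤-trans (≤-reflexive (+-suc y v)) (d-reflects (lin≤ (d (y + v) ∷ x ∷ v ∷ d x ∷ []) 1 (# 1 ⊹ $ 0) ($ 3) ($ 0 ≐ # 1 ⊹ ($ 1 ⊹ $ 2) ∋ copies v ≤-refl ∷ # 1 ⊹ ($ 1 ⊹ (# 1 ⊹ $ 2)) ⊴ $ 3 ∋ s ∷ [])))
  buildTower {x} {m} v nu ups (down {u = u} p refl) l s with buildTower v nu ups p (lin≤ (d u ∷ v ∷ m ∷ u ∷ []) 1 ($ 3 ⊹ $ 1) ($ 2) ($ 0 ⊹ $ 1 ⊴ $ 2 ∋ l ∷ # 1 ⊹ $ 3 ⊴ $ 0 ∋ d-> u ∷ [])) small
    where
    run : ∀ a → a ≤ v → d (u + a) ≡ d u + a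
    run zero    q = trans (cong d (+-identityʳ u)) (sym (+-identityʳ _))
    run (suc a) q with ups (d u + suc a) (lin≤ (x ∷ u ∷ d u ∷ a ∷ []) 1 (# 1 ⊹ $ 0) ($ 2 ⊹ (# 1 ⊹ $ 3)) ($ 0 ⊴ $ 1 ∋ path-≤′ p ∷ # 1 ⊹ $ 1 ⊴ $ 2 ∋ d-> u ∷ [])) (lin≤ (d u ∷ v ∷ m ∷ a ∷ []) 1 ($ 0 ⊹ (# 1 ⊹ $ 3)) ($ 2) ($ 0 ⊹ $ 1 ⊴ $ 2 ∋ l ∷ # 1 ⊹ $ 3 ⊴ $ 1 ∋ q ∷ []))
    ... | t , e = trans (cong d (trans (+-suc u a) (sym (d-next (trans e (trans (+-suc (d u) a) (cong suc (sym (run a (<⇒≤ q)))))))))) e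
    small : u + v < d u
    small with u + v <? d u
    ... | yes p = p
    ... | no p with m≤n⇒∃[o]m+o≡n (<⇒≤ (d-> u))
    ...   | o , e = ⊥-elim (lin⊥ (d u ∷ v ∷ d (d u) ∷ d (u + o) ∷ o ∷ u ∷ []) (# 1 ⊹ ($ 0 ⊹ $ 1) ⊴ $ 2 ∋ s ∷ $ 3 ≐ $ 0 ⊹ $ 4 ∋ run o (lin≤ (u ∷ o ∷ d u ∷ v ∷ []) 1 ($ 1) ($ 3) ($ 0 ⊹ $ 1 ≐ $ 2 ∋ e ∷ $ 2 ⊴ $ 0 ⊹ $ 3 ∋ ≮⇒≥ p ∷ [])) ∷ $ 2 ≐ $ 3 ∋ sym (cong d e) ∷ $ 5 ⊹ $ 4 ≐ $ 0 ∋ e ∷ $ 0 ⊴ $ 5 ⊹ $ 1 ∋ ≮⇒≥ p ∷ []))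
  ... | c , y , t , h = suc c , y , step run t , λ { z (here refl) → ≤-trans (path-≤′ p) (<⇒≤ (d-> u)) ; z (there m) → h z m }
    where
    run : ∀ a → a ≤ v → d (u + a) ≡ d u + a
    run zero    q = trans (cong d (+-identityʳ u)) (sym (+-identityʳ _))
    run (suc a) q with ups (d u + suc a) (lin≤ (x ∷ u ∷ d u ∷ a ∷ []) 1 (# 1 ⊹ $ 0) ($ 2 ⊹ (# 1 ⊹ $ 3)) ($ 0 ⊴ $ 1 ∋ path-≤′ p ∷ # 1 ⊹ $ 1 ⊴ $ 2 ∋ d-> u ∷ [])) (lin≤ (d u ∷ v ∷ m ∷ a ∷ []) 1 ($ 0 ⊹ (# 1 ⊹ $ 3)) ($ 2) ($ 0 ⊹ $ 1 ⊴ $ 2 ∋ l ∷ # 1 ⊹ $ 3 ⊴ $ 1 ∋ q ∷ []))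
    ... | t , e = trans (cong d (trans (+-suc u a) (sym (d-next (trans e (trans (+-suc (d u) a) (cong suc (sym (run a (<⇒≤ q)))))))))) e

  tops-bound : ∀ {w j c y x} (t : Tower d w j c y) → x ∈ tops t → x ≤ j
  tops-bound (top _ _ _) (here refl) = ≤-refl
  tops-bound (step g t)  (here refl) = ≤-refl
  tops-bound {j = j} (step {u = u} g t)  (there m)   = ≤-trans (tops-bound t m) (lin≤ (u ∷ d u ∷ d (u + 0) ∷ j ∷ []) 1 ($ 0) ($ 3) (# 1 ⊹ $ 0 ⊴ $ 1 ∋ d-> u ∷ $ 2 ≐ $ 3 ⊹ # 0 ∋ g 0 z≤n ∷ $ 1 ≐ $ 2 ∋ sym (cong d (+-identityʳ u)) ∷ []))

  tops-gap : ∀ {w G j c y} (t : Tower d w j c y) → κ (suc (j + w)) + G ≤ κ j + w → ∀ x → x ∈ tops t → κ (suc (x + w)) + G ≤ κ x + w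
  tops-gap (top _ _ _) h x (here refl) = h
  tops-gap (step g t)  h x (here refl) = h
  tops-gap {w} {G} {j} (step {u = u} g t) h x (there m) = tops-gap t up x m
    where
    du : d u ≡ j
    du = trans (cong d (sym (+-identityʳ u))) (trans (g 0 z≤n) (+-identityʳ j))
    far : suc (j + w) ≤ d (suc (u + w))
    far = lin≤ (d (u + w) ∷ d (suc (u + w)) ∷ j ∷ w ∷ []) 1 (# 1 ⊹ ($ 2 ⊹ $ 3)) ($ 1) (# 1 ⊹ $ 0 ⊴ $ 1 ∋ d-mono {u + w} {suc (u + w)} ≤-refl ∷ $ 2 ⊹ $ 3 ≐ $ 0 ∋ sym (g w ≤-refl) ∷ [])
    up : κ (suc (u + w)) + G ≤ κ u + w
    up = lin≤ (κ (suc (j + w)) ∷ G ∷ κ j ∷ w ∷ κ u ∷ d u ∷ κ (d u) ∷ n ∷ u ∷ κ (suc (u + w)) ∷ d (suc (u + w)) ∷ κ (d (suc (u + w))) ∷ j ∷ []) 1 ($ 9 ⊹ $ 1) ($ 4 ⊹ $ 3) ($ 0 ⊹ $ 1 ⊴ $ 2 ⊹ $ 3 ∋ h ∷ $ 6 ⊹ ($ 7 ⊹ $ 8) ≐ $ 4 ⊹ $ 5 ∋ sym (eqn u) ∷ $ 9 ⊹ $ 10 ≐ $ 11 ⊹ ($ 7 ⊹ (# 1 ⊹ ($ 8 ⊹ $ 3))) ∋ eqn (suc (u + w)) ∷ $ 5 ≐ $ 12 ∋ du ∷ $ 2 ≐ $ 6 ∋ sym (cong κ du) ∷ $ 11 ⊴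 $ 0 ∋ mono-≤ far ∷ # 1 ⊹ ($ 12 ⊹ $ 3) ⊴ $ 10 ∋ far ∷ [])

  -- With m from `firstGap`, x is the last row up to m without a preimage and j the last row up to m
  -- on its bounce path. Then v = m - j, and G is the distance from the bead of row j of κ to the
  -- bead of row m of κ'.
  exists : ∀ r → κ' r < κ r → Goal
  exists r lt with firstDiff r lt
  ... | i , il , ih with firstGap i il
  ... | m , im , glo , ghi , gin with lastNoUp i m im (firstDiff-noUp il ih)
  ... | x , ix , xm , nu , ups with lastPath m x m here xm (m≤n+m m x)
  ... | j , P , jm , mdj with m≤n⇒∃[o]m+o≡n jm
  ... | v , refl with buildTower v nu ups P ≤-refl mdj
  ... | c , y , t , above with m≤n⇒∃[o]m+o≡n {κ' (j + v)} {κ j + v} (≤-trans (sub (j + v)) (≤-trans (mono-≤ jm) (m≤m+n _ v)))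
  ... | G , eG = descend N {v} {G} {j} (m≤n+m N j) record
    { tower = t ; small = mdj
    ; within = λ z zt a l → gin (z + a) (lin≤ (i ∷ x ∷ z ∷ a ∷ []) 1 ($ 0) ($ 2 ⊹ $ 3) ($ 0 ⊴ $ 1 ∋ ix ∷ $ 1 ⊴ $ 2 ∋ above z zt ∷ [])) (lin≤ (z ∷ j ∷ a ∷ v ∷ []) 1 (# 1 ⊹ ($ 0 ⊹ $ 2)) ($ 1 ⊹ $ 3) ($ 0 ⊴ $ 1 ∋ tops-bound t zt ∷ # 1 ⊹ $ 2 ⊴ $ 3 ∋ l ∷ []))
    ; last = λ z zt → final z zt (z + v <? j + v)
    ; gap-lo = lo
    ; gap-hi = lin≤ (κ' (j + v) ∷ κ (j + v) ∷ G ∷ κ j ∷ v ∷ []) 1 (# 1 ⊹ ($ 3 ⊹ $ 4)) ($ 1 ⊹ $ 2) (# 1 ⊹ $ 0 ⊴ $ 1 ∋ ghi ∷ $ 3 ⊹ $ 4 ≐ $ 0 ⊹ $ 2 ∋ sym eG ∷ [])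
    ; q = λ a → j + a ; q-mono = λ a l → ≤-reflexive (sym (+-suc j a)) ; q-le = λ a l → ≤-refl
    ; q-A = λ a l → (lin≤ (κ' (j + a) ∷ κ (suc (j + a)) ∷ j ∷ a ∷ []) 1 ($ 0 ⊹ (# 1 ⊹ ($ 2 ⊹ $ 3))) ($ 1 ⊹ ($ 2 ⊹ $ 3)) (# 1 ⊹ $ 0 ⊴ $ 1 ∋ gin (j + a) (lin≤ (i ∷ x ∷ j ∷ a ∷ []) 1 ($ 0) ($ 2 ⊹ $ 3) ($ 0 ⊴ $ 1 ∋ ix ∷ $ 1 ⊴ $ 2 ∋ path-≤′ P ∷ [])) (lin≤ (a ∷ v ∷ j ∷ []) 1 (# 1 ⊹ ($ 2 ⊹ $ 0)) ($ 2 ⊹ $ 1) (# 1 ⊹ $ 0 ⊴ $ 1 ∋ l ∷ [])) ∷ []))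
    ; q-E = (≤-antisym (lin≤ (κ' (j + v) ∷ G ∷ κ j ∷ v ∷ j ∷ []) 1 ($ 0 ⊹ $ 1 ⊹ $ 4) ($ 2 ⊹ ($ 4 ⊹ $ 3)) ($ 0 ⊹ $ 1 ≐ $ 2 ⊹ $ 3 ∋ eG ∷ [])) (lin≤ (κ' (j + v) ∷ G ∷ κ j ∷ v ∷ j ∷ []) 1 ($ 2 ⊹ ($ 4 ⊹ $ 3)) ($ 0 ⊹ $ 1 ⊹ $ 4) ($ 2 ⊹ $ 3 ≐ $ 0 ⊹ $ 1 ∋ sym eG ∷ []))) }
    where
    lo : κ (suc (j + v)) + G ≤ κ j + v
    lo = lin≤ (κ (suc (j + v)) ∷ κ' (j + v) ∷ G ∷ κ j ∷ v ∷ []) 1 ($ 0 ⊹ $ 2) ($ 3 ⊹ $ 4) ($ 0 ⊴ $ 1 ∋ glo ∷ $ 1 ⊹ $ 2 ≐ $ 3 ⊹ $ 4 ∋ eG ∷ [])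
    final : ∀ z → z ∈ tops t → Dec (z + v < j + v) → κ' (z + v) + G ≤ κ z + v
    final z zt (yes l) = lin≤ (κ' (z + v) ∷ κ (suc (z + v)) ∷ G ∷ κ z ∷ v ∷ []) 1 ($ 0 ⊹ $ 2) ($ 3 ⊹ $ 4) (# 1 ⊹ $ 0 ⊴ $ 1 ∋ gin (z + v) (lin≤ (i ∷ x ∷ z ∷ v ∷ []) 1 ($ 0) ($ 2 ⊹ $ 3) ($ 0 ⊴ $ 1 ∋ ix ∷ $ 1 ⊴ $ 2 ∋ above z zt ∷ [])) l ∷ $ 1 ⊹ $ 2 ⊴ $ 3 ⊹ $ 4 ∋ tops-gap {G = G} t lo z zt ∷ [])
    final z zt (no l) with ≤-antisym (tops-bound t zt) (+-cancelʳ-≤ v j z (≮⇒≥ l))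
    ... | refl = ≤-reflexive eG

-- Partitions as lists, hook lengths and the bounded partition.

∧-T : ∀ {a b} → T (a ∧ b) → T a × T b
∧-T = Equivalence.to T-∧

T-∧⁺ : ∀ {a b} → T a → T b → T (a ∧ b)
T-∧⁺ p q = Equivalence.from T-∧ (p , q)

not-T : ∀ {b} → T (not b) → ¬ T b
not-T {false} _ ()

T-not : ∀ {b} → ¬ T b → T (not b)
T-not {false} h = tt
T-not {true}  h = h tt

all⁻ : {A : Set} (p : A → Bool) {xs : List A} → T (all p xs) → ∀ {x} → x ∈ xs → T (p x)
all⁻ p {x ∷ xs} t (here refl) = proj₁ (∧-T {p x} t)
all⁻ p {x ∷ xs} t (there m)   = all⁻ p (proj₂ (∧-T {p x} t)) m

all⁺ : {A : Set} (p : A → Bool) (xs : List A) → (∀ {x} → x ∈ xs → T (p x)) → T (all p xs)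
all⁺ p []       h = tt
all⁺ p (x ∷ xs) h = T-∧⁺ (h (here refl)) (all⁺ p xs (λ m → h (there m)))

Decr : (ℕ → ℕ) → Set
Decr f = ∀ i → f (suc i) ≤ f i

decr-≤ : ∀ {f} → Decr f → ∀ {i j} → i ≤ j → f j ≤ f i
decr-≤ {f} h {i} l with m≤n⇒∃[o]m+o≡n l
... | o , refl = go o
  where
  go : ∀ o → f (i + o) ≤ f i
  go zero    = ≤-reflexive (cong f (+-identityʳ i))
  go (suc o) = ≤-trans (≤-trans (≤-reflexive (cong f (+-suc i o))) (h (i + o))) (go o)

at-length : ∀ xs r → length xs ≤ r → at xs r ≡ 0
at-length []       r       l       = refl
at-length (x ∷ xs) (suc r) (s≤s l) = at-length xs r l

at-drop : ∀ m xs q → at (drop m xs) q ≡ at xs (m + q)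
at-drop zero    xs       q = refl
at-drop (suc m) []       q = refl
at-drop (suc m) (x ∷ xs) q = at-drop m xs q

partition-decr : ∀ {κ} → T (isPartition κ) → Decr (at κ)
partition-decr {[]}         t i       = z≤n
partition-decr {x ∷ []}     t i       = z≤n
partition-decr {x ∷ y ∷ κ}  t zero    = ≤ᵇ⇒≤ y x (proj₁ (∧-T {y ≤ᵇ x} t))
partition-decr {x ∷ y ∷ κ}  t (suc i) = partition-decr {y ∷ κ} (proj₂ (∧-T {y ≤ᵇ x} t)) i

partition-pos : ∀ {κ} → T (isPartition κ) → ∀ r → r < length κ → 1 ≤ at κ r
partition-pos {x ∷ []}    t zero    l = ≤ᵇ⇒≤ 1 x t
partition-pos {x ∷ []}    t (suc r) (s≤s ())
partition-pos {x ∷ y ∷ κ} t zero    l = ≤-trans (partition-pos {y ∷ κ} (proj₂ (∧-T {y ≤ᵇ x} t)) 0 (s≤s z≤n)) (≤ᵇ⇒≤ y x (proj₁ (∧-T {y ≤ᵇ x} t)))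
partition-pos {x ∷ y ∷ κ} t (suc r) (s≤s l) = partition-pos {y ∷ κ} (proj₂ (∧-T {y ≤ᵇ x} t)) r l

partition-intro : ∀ κ → Decr (at κ) → (∀ r → r < length κ → 1 ≤ at κ r) → T (isPartition κ)
partition-intro []          h p = tt
partition-intro (x ∷ [])    h p = ≤⇒≤ᵇ (p 0 (s≤s z≤n))
partition-intro (x ∷ y ∷ κ) h p = T-∧⁺ (≤⇒≤ᵇ (h 0)) (partition-intro (y ∷ κ) (λ i → h (suc i)) (λ r l → p (suc r) (s≤s l)))

partition-ext : ∀ {κ τ} → T (isPartition κ) → T (isPartition τ) → (∀ r → at κ r ≡ at τ r) → κ ≡ τ
partition-ext {κ} {τ} p q h = go κ τ (partition-pos {κ} p) (partition-pos {τ} q) h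
  where
  go : ∀ κ τ → (∀ r → r < length κ → 1 ≤ at κ r) → (∀ r → r < length τ → 1 ≤ at τ r) → (∀ r → at κ r ≡ at τ r) → κ ≡ τ
  go []      []      p q h = refl
  go []      (y ∷ τ) p q h = ⊥-elim (lin⊥ (at (y ∷ τ) 0 ∷ []) (# 1 ⊴ $ 0 ∋ q 0 (s≤s z≤n) ∷ $ 0 ≐ # 0 ∋ sym (h 0) ∷ []))
  go (x ∷ κ) []      p q h = ⊥-elim (lin⊥ (at (x ∷ κ) 0 ∷ []) (# 1 ⊴ $ 0 ∋ p 0 (s≤s z≤n) ∷ $ 0 ≐ # 0 ∋ h 0 ∷ []))
  go (x ∷ κ) (y ∷ τ) p q h = cong₂ _∷_ (h 0) (go κ τ (λ r l → p (suc r) (s≤s l)) (λ r l → q (suc r) (s≤s l)) (λ r → h (suc r)))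

count-≤ : ∀ c xs → Decr (at xs) → ∀ q → at xs q ≤ c → countB (λ x → c <ᵇ x) xs ≤ q
count-≤ c []       h q       l = z≤n
count-≤ c (x ∷ xs) h zero    l rewrite <ᵇ-false {c} {x} l = count-≤ c xs (λ i → h (suc i)) 0 (≤-trans (h 0) l)
count-≤ c (x ∷ xs) h (suc q) l with c <ᵇ x
... | true  = s≤s (count-≤ c xs (λ i → h (suc i)) q l)
... | false = m≤n⇒m≤1+n (count-≤ c xs (λ i → h (suc i)) q l)

count-> : ∀ c xs → Decr (at xs) → ∀ q → c < at xs q → q < countB (λ x → c <ᵇ x) xs
count-> c (x ∷ xs) h zero    l rewrite <ᵇ-true l = s≤s z≤n
count-> c (x ∷ xs) h (suc q) l rewrite <ᵇ-true {c} {x} (≤-trans l (decr-≤ h {0} {suc q} z≤n)) = s≤s (count-> c xs (λ i → h (suc i)) q l)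

drop-decr : ∀ m xs → Decr (at xs) → Decr (at (drop m xs))
drop-decr m xs h i = subst₂ _≤_ (trans (cong (at xs) (sym (+-suc m i))) (sym (at-drop m xs (suc i)))) (sym (at-drop m xs i)) (h (m + i))

legs : List ℕ → ℕ → ℕ → ℕ
legs κ r c = countB (λ x → c <ᵇ x) (drop (suc r) κ)

legs-≤ : ∀ κ → Decr (at κ) → ∀ r c q → at κ (suc r + q) ≤ c → legs κ r c ≤ q
legs-≤ κ h r c q l = count-≤ c (drop (suc r) κ) (drop-decr (suc r) κ h) q (≤-trans (≤-reflexive (at-drop (suc r) κ q)) l)

legs-> : ∀ κ → Decr (at κ) → ∀ r c q → c < at κ (suc r + q) → q < legs κ r c
legs-> κ h r c q l = count-> c (drop (suc r) κ) (drop-decr (suc r) κ h) q (≤-trans l (≤-reflexive (sym (at-drop (suc r) κ q))))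

countB-from : ∀ (p : ℕ → Bool) a b → a ≤ b → (∀ c → c < a → ¬ T (p c)) → (∀ c → a ≤ c → c < b → T (p c)) →
  a + countB p (upTo b) ≡ b
countB-from p a b l no' yes' = go (λ i → i) b a l no' yes'
  where
  go : ∀ (g : ℕ → ℕ) b a → a ≤ b → (∀ c → c < a → ¬ T (p (g c))) → (∀ c → a ≤ c → c < b → T (p (g c))) → a + countB p (applyUpTo g b) ≡ b
  go g zero    zero    l n y = refl
  go g (suc b) zero    l n y with p (g 0) | y 0 z≤n (s≤s z≤n)
  ... | true | _ = cong suc (go (λ i → g (suc i)) b 0 z≤n (λ c ()) (λ c _ q → y (suc c) z≤n (s≤s q)))
  go g (suc b) (suc a) (s≤s l) n y with p (g 0) | n 0 (s≤s z≤n)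
  ... | true  | h = ⊥-elim (h tt)
  ... | false | _ = cong suc (go (λ i → g (suc i)) b a l (λ c q → n (suc c) (s≤s q)) (λ c q q' → y (suc c) (s≤s q) (s≤s q')))

at-applyUpTo : ∀ (g : ℕ → ℕ) (f : ℕ → ℕ) n r → r < n → at (map g (applyUpTo f n)) r ≡ g (f r)
at-applyUpTo g f (suc n) zero    l       = refl
at-applyUpTo g f (suc n) (suc r) (s≤s l) = at-applyUpTo g (λ i → f (suc i)) n r l

module _ (k : ℕ) where

  -- If the position n = k + 1 below the bead of row r were empty, it would fall between the beads
  -- of two consecutive rows i and i + 1, and the box of row r in the matching column would have leg
  -- i - r and hook length k + 1.
  core-d : ∀ {κ} → Decr (at κ) → T (isCore k κ) → ∃[ d ] IsCore (suc k) (at κ) d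
  core-d {κ} h t = (λ r → proj₁ (find r)) , record { mono = h ; eqn = λ r → proj₂ (find r) ; pos = s≤s z≤n }
    where
    noHook : ∀ r c → c < at κ r → hook κ r c ≢ suc k
    noHook r c l e with r <? length κ
    ... | no p  = lin⊥ (c ∷ at κ r ∷ []) (# 1 ⊹ $ 0 ⊴ $ 1 ∋ l ∷ $ 1 ≐ # 0 ∋ at-length κ r (≮⇒≥ p) ∷ [])
    ... | yes p = not-T (all⁻ (λ c → not (hook κ r c ≡ᵇ suc k)) (all⁻ _ t (∈-upTo⁺ p)) (∈-upTo⁺ l)) (≡⇒≡ᵇ _ _ e)
    bad : ∀ r i → r ≤ i → i < suc k + r → at κ (suc i) + (suc k + r) ≤ at κ r + i → ¬ (at κ i + (suc k + r) ≤ at κ r + i) → ⊥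
    bad r i ri lt a b with m≤n⇒∃[o]m+o≡n (≤-trans (m≤n+m (suc k + r) (at κ (suc i))) a) | m≤n⇒∃[o]m+o≡n ri
    ... | c , ec | o , refl = noHook r c (lin≤ (k ∷ r ∷ c ∷ at κ r ∷ o ∷ []) 1 (# 1 ⊹ $ 2) ($ 3) (# 1 ⊹ ($ 0 ⊹ $ 1 ⊹ $ 2) ≐ $ 3 ⊹ ($ 1 ⊹ $ 4) ∋ ec ∷ # 1 ⊹ ($ 1 ⊹ $ 4) ⊴ # 1 ⊹ ($ 0 ⊹ $ 1) ∋ lt ∷ [])) hook≡
      where
      up≤ : legs κ r c ≤ o
      up≤ = legs-≤ κ h r c o (lin≤ (k ∷ r ∷ c ∷ at κ r ∷ o ∷ at κ (suc (r + o)) ∷ []) 1 ($ 5) ($ 2) ($ 3 ⊹ ($ 1 ⊹ $ 4) ≐ # 1 ⊹ ($ 0 ⊹ $ 1 ⊹ $ 2) ∋ sym ec ∷ $ 5 ⊹ (# 1 ⊹ $ 0 ⊹ $ 1) ⊴ $ 3 ⊹ ($ 1 ⊹ $ 4) ∋ a ∷ []))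
      lo : ∀ o → c < at κ (r + o) → o ≤ legs κ r c
      lo zero    q = z≤n
      lo (suc o) q = legs-> κ h r c o (≤-trans q (≤-reflexive (cong (at κ) (+-suc r o))))
      legs≡ : legs κ r c ≡ o
      legs≡ = ≤-antisym up≤ (lo o (lin≤ (k ∷ r ∷ c ∷ at κ r ∷ o ∷ at κ (r + o) ∷ []) 1 (# 1 ⊹ $ 2) ($ 5) (# 1 ⊹ ($ 0 ⊹ $ 1 ⊹ $ 2) ≐ $ 3 ⊹ ($ 1 ⊹ $ 4) ∋ ec ∷ # 1 ⊹ ($ 3 ⊹ ($ 1 ⊹ $ 4)) ⊴ $ 5 ⊹ (# 1 ⊹ ($ 0 ⊹ $ 1)) ∋ ≰⇒> b ∷ [])))
      hook≡ : hook κ r c ≡ suc k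
      hook≡ = ≤-antisym (lin≤ (legs κ r c ∷ o ∷ (at κ r ∸ c) ∷ c ∷ at κ r ∷ k ∷ r ∷ []) 1 ($ 0 ⊹ $ 2) (# 1 ⊹ $ 5) ($ 0 ≐ $ 1 ∋ legs≡ ∷ $ 2 ⊹ $ 3 ≐ $ 4 ∋ m∸n+n≡m {at κ r} {c} (lin≤ (k ∷ r ∷ c ∷ at κ r ∷ o ∷ []) 1 ($ 2) ($ 3) (# 1 ⊹ ($ 0 ⊹ $ 1 ⊹ $ 2) ≐ $ 3 ⊹ ($ 1 ⊹ $ 4) ∋ ec ∷ # 1 ⊹ ($ 1 ⊹ $ 4) ⊴ # 1 ⊹ ($ 0 ⊹ $ 1) ∋ lt ∷ [])) ∷ $ 4 ⊹ ($ 6 ⊹ $ 1) ≐ # 1 ⊹ ($ 5 ⊹ $ 6 ⊹ $ 3) ∋ sym ec ∷ [])) (lin≤ (legs κ r c ∷ o ∷ (at κ r ∸ c) ∷ c ∷ at κ r ∷ k ∷ r ∷ []) 1 (# 1 ⊹ $ 5) ($ 0 ⊹ $ 2) ($ 1 ≐ $ 0 ∋ sym legs≡ ∷ $ 4 ≐ $ 2 ⊹ $ 3 ∋ sym (m∸n+n≡m {at κ r} {c} (lin≤ (k ∷ r ∷ c ∷ at κ r ∷ o ∷ []) 1 ($ 2) ($ 3) (# 1 ⊹ ($ 0 ⊹ $ 1 ⊹ $ 2) ≐ $ 3 ⊹ ($ 1 ⊹ $ 4) ∋ ec ∷ # 1 ⊹ ($ 1 ⊹ $ 4) ⊴ # 1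 ⊹ ($ 0 ⊹ $ 1) ∋ lt ∷ []))) ∷ # 1 ⊹ ($ 5 ⊹ $ 6 ⊹ $ 3) ≐ $ 4 ⊹ ($ 6 ⊹ $ 1) ∋ ec ∷ []))
    find : ∀ r → ∃[ j ] at κ r + j ≡ at κ j + (suc k + r)
    find r = search (suc k) r ≤-refl (λ q → (lin⊥ (at κ r ∷ k ∷ r ∷ []) ($ 0 ⊹ (# 1 ⊹ $ 1 ⊹ $ 2) ⊴ $ 0 ⊹ $ 2 ∋ q ∷ []))) refl
      where
      search : ∀ fuel i → r ≤ i → ¬ (at κ i + (suc k + r) ≤ at κ r + i) → fuel + i ≡ suc k + r → ∃[ j ] at κ r + j ≡ at κ j + (suc k + r)
      search zero i ri q e = ⊥-elim (q (lin≤ (i ∷ k ∷ r ∷ at κ i ∷ at κ r ∷ []) 1 ($ 3 ⊹ (# 1 ⊹ $ 1 ⊹ $ 2)) ($ 4 ⊹ $ 0) (# 1 ⊹ $ 1 ⊹ $ 2 ≐ # 0 ⊹ $ 0 ∋ sym e ∷ $ 3 ⊴ $ 4 ∋ decr-≤ h ri ∷ [])))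
      search (suc fuel) i ri q e with at κ (suc i) + (suc k + r) ≤? at κ r + suc i
      ... | no p = search fuel (suc i) (m≤n⇒m≤1+n ri) p (trans (+-suc fuel i) e)
      ... | yes p with at κ r + suc i ≟ at κ (suc i) + (suc k + r)
      ...   | yes eq = suc i , eq
      ...   | no ne = ⊥-elim (bad r i ri (lin≤ (fuel ∷ i ∷ k ∷ r ∷ []) 1 (# 1 ⊹ $ 1) (# 1 ⊹ $ 2 ⊹ $ 3) (# 1 ⊹ ($ 0 ⊹ $ 1) ≐ # 1 ⊹ ($ 2 ⊹ $ 3) ∋ e ∷ [])) (≤-pred (≤-trans (≤∧≢⇒< p (λ e → ne (sym e))) (≤-reflexive (+-suc (at κ r) i)))) q)

  module FromCore {κ : List ℕ} {d : ℕ → ℕ} (C : IsCore (suc k) (at κ) d) where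
    open IsCore C

    hook-small : ∀ r c → c < at κ r → at κ (d r) ≤ c → hook κ r c ≤ k
    hook-small r c l q with m≤n⇒∃[o]m+o≡n (d-> r)
    ... | o , e = lin≤ (legs κ r c ∷ o ∷ at κ r ∷ d r ∷ at κ (d r) ∷ k ∷ r ∷ c ∷ (at κ r ∸ c) ∷ []) 1 ($ 0 ⊹ $ 8) ($ 5) ($ 0 ⊴ $ 1 ∋ legs-≤ κ mono r c o (≤-trans (≤-reflexive (cong (at κ) e)) q) ∷ $ 2 ⊹ $ 3 ≐ $ 4 ⊹ (# 1 ⊹ $ 5 ⊹ $ 6) ∋ eqn r ∷ $ 4 ⊴ $ 7 ∋ q ∷ # 1 ⊹ ($ 6 ⊹ $ 1) ≐ $ 3 ∋ e ∷ $ 8 ⊹ $ 7 ≐ $ 2 ∋ m∸n+n≡m (<⇒≤ l) ∷ [])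

    hook-large : ∀ r c → c < at κ (d r) → suc k < hook κ r c
    hook-large r c q with m≤n⇒∃[o]m+o≡n (d-> r)
    ... | o , e = lin≤ (o ∷ legs κ r c ∷ at κ r ∷ d r ∷ at κ (d r) ∷ k ∷ r ∷ c ∷ (at κ r ∸ c) ∷ []) 1 (# 1 ⊹ (# 1 ⊹ $ 5)) ($ 1 ⊹ $ 8) (# 1 ⊹ $ 0 ⊴ $ 1 ∋ legs-> κ mono r c o (≤-trans q (≤-reflexive (cong (at κ) (sym e)))) ∷ $ 4 ⊹ (# 1 ⊹ $ 5 ⊹ $ 6) ≐ $ 2 ⊹ $ 3 ∋ sym (eqn r) ∷ # 1 ⊹ $ 7 ⊴ $ 4 ∋ q ∷ $ 3 ≐ # 1 ⊹ ($ 6 ⊹ $ 0) ∋ sym e ∷ $ 2 ≐ $ 8 ⊹ $ 7 ∋ sym (m∸n+n≡m {at κ r} {c} (lin≤ (c ∷ at κ (d r) ∷ at κ r ∷ []) 1 ($ 0) ($ 2) (# 1 ⊹ $ 0 ⊴ $ 1 ∋ q ∷ $ 1 ⊴ $ 2 ∋ mono-≤ {r} {d r} (<⇒≤ (d-> r)) ∷ []))) ∷ [])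

    isCore-T : T (isCore k κ)
    isCore-T = all⁺ _ (upTo (length κ)) λ {r} _ → all⁺ (λ c → not (hook κ r c ≡ᵇ suc k)) (upTo (at κ r)) λ {c} m →
      T-not λ t → ne r c (∈-upTo⁻ m) (≡ᵇ⇒≡ (hook κ r c) (suc k) t)
      where
      ne : ∀ r c → c < at κ r → hook κ r c ≢ suc k
      ne r c l e with at κ (d r) ≤? c
      ... | yes p = lin⊥ (countB (_<ᵇ_ c) (drop (suc r) κ) ∷ (at κ r ∸ c) ∷ k ∷ []) ($ 0 ⊹ $ 1 ⊴ $ 2 ∋ hook-small r c l p ∷ # 1 ⊹ $ 2 ≐ $ 0 ⊹ $ 1 ∋ sym e ∷ [])
      ... | no p  = lin⊥ (k ∷ countB (_<ᵇ_ c) (drop (suc r) κ) ∷ (at κ r ∸ c) ∷ []) (# 1 ⊹ (# 1 ⊹ $ 0) ⊴ $ 1 ⊹ $ 2 ∋ hook-large r c (≰⇒> p) ∷ $ 1 ⊹ $ 2 ≐ # 1 ⊹ $ 0 ∋ e ∷ [])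

    length-𝔭 : length (𝔭 k κ) ≡ length κ
    length-𝔭 = trans (length-map _ (upTo (length κ))) (Data.List.Properties.length-upTo (length κ))
      where import Data.List.Properties

    -- The boxes of row r with hook length at most k are those in columns from κ (d r) on, so their
    -- number κ r - κ (d r) is k + 1 + r - d r.
    at-𝔭 : ∀ r → at (𝔭 k κ) r + d r ≡ suc k + r
    at-𝔭 r with r <? length κ
    ... | no p = trans (cong (_+ d r) (at-length (𝔭 k κ) r (≤-trans (≤-reflexive length-𝔭) (≮⇒≥ p)))) (d-zero r (at-length κ r (≮⇒≥ p)))
    ... | yes p = ≤-antisym (lin≤ (at (map g (applyUpTo (λ i → i) (length κ))) r ∷ g r ∷ at κ r ∷ d r ∷ at κ (d r) ∷ k ∷ r ∷ []) 1 ($ 0 ⊹ $ 3) (# 1 ⊹ ($ 5 ⊹ $ 6)) ($ 0 ≐ $ 1 ∋ at-applyUpTo g (λ i → i) (length κ) r p ∷ $ 2 ⊹ $ 3 ≐ $ 4 ⊹ (# 1 ⊹ $ 5 ⊹ $ 6) ∋ eqn r ∷ $ 4 ⊹ $ 1 ≐ $ 2 ∋ count ∷ [])) (lin≤ (at (map g (applyUpTo (λ i → i) (length κ))) r ∷ g r ∷ at κ r ∷ d r ∷ at κ (d r) ∷ k ∷ r ∷ []) 1 (# 1 ⊹ ($ 5 ⊹ $ 6)) ($ 0 ⊹ $ 3) ($ 1 ≐ $ 0 ∋ sym (at-applyUpTo g (λ i → i) (length κ) r p) ∷ $ 4 ⊹ (# 1 ⊹ $ 5 ⊹ $ 6) ≐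 $ 2 ⊹ $ 3 ∋ sym (eqn r) ∷ $ 2 ≐ $ 4 ⊹ $ 1 ∋ sym count ∷ []))
      where
      g : ℕ → ℕ
      g r = countB (λ c → hook κ r c ≤ᵇ k) (boxesRow κ r)
      count : at κ (d r) + g r ≡ at κ r
      count = countB-from (λ c → hook κ r c ≤ᵇ k) (at κ (d r)) (at κ r) (mono-≤ (<⇒≤ (d-> r)))
        (λ c l t → <⇒≱ (hook-large r c l) (m≤n⇒m≤1+n (≤ᵇ⇒≤ (hook κ r c) k t)))
        (λ c l u → ≤⇒≤ᵇ (hook-small r c u l))

-- Enumeration of subpartitions.

unique-map : {A B : Set} {f : A → B} {xs : List A} → Unique xs → (∀ {x y} → x ∈ xs → y ∈ xs → f x ≡ f y → x ≡ y) → Unique (map f xs)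
unique-map {xs = []}     []       h = []
unique-map {f = f} {xs = x ∷ xs} (n ∷ us) h = All.tabulate fresh ∷ unique-map us (λ p q → h (there p) (there q))
  where
  fresh : ∀ {b} → b ∈ map f xs → f x ≢ b
  fresh m e with ∈-map⁻ f m
  ... | y , q , refl = All.lookup n q (h (here refl) (there q) e)

stripZeros-at : ∀ σ → Decr (at σ) → ∀ r → at (stripZeros σ) r ≡ at σ r
stripZeros-at []            h r = refl
stripZeros-at (zero ∷ σ)    h r = trans (stripZeros-at σ (λ i → h (suc i)) r)
  (trans (n≤0⇒n≡0 (decr-≤ h {0} {suc r} z≤n)) (sym (n≤0⇒n≡0 (decr-≤ h {0} {r} z≤n))))
stripZeros-at (suc x ∷ σ)   h zero    = refl
stripZeros-at (suc x ∷ σ)   h (suc r) = stripZeros-at σ (λ i → h (suc i)) r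

stripZeros-pos : ∀ σ r → r < length (stripZeros σ) → 1 ≤ at (stripZeros σ) r
stripZeros-pos (zero ∷ σ)  r       l       = stripZeros-pos σ r l
stripZeros-pos (suc x ∷ σ) zero    l       = s≤s z≤n
stripZeros-pos (suc x ∷ σ) (suc r) (s≤s l) = stripZeros-pos σ r l

stripZeros-partition : ∀ σ → Decr (at σ) → T (isPartition (stripZeros σ))
stripZeros-partition σ h = partition-intro (stripZeros σ)
  (λ i → subst₂ _≤_ (sym (stripZeros-at σ h (suc i))) (sym (stripZeros-at σ h i)) (h i)) (stripZeros-pos σ)

∈-concatMap-intro : {A B : Set} (f : A → List B) {xs : List A} {x : A} {b : B} → x ∈ xs → b ∈ f x → b ∈ concatMap f xs
∈-concatMap-intro f {x ∷ xs} (here refl) m = ∈-++⁺ˡ m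
∈-concatMap-intro f {x ∷ xs} (there p)   m = ∈-++⁺ʳ (f x) (∈-concatMap-intro f p m)

∈-concatMap-elim : {A B : Set} (f : A → List B) (xs : List A) {b : B} → b ∈ concatMap f xs → ∃[ x ] x ∈ xs × b ∈ f x
∈-concatMap-elim f (x ∷ xs) m with ∈-++⁻ (f x) m
... | inj₁ p = x , here refl , p
... | inj₂ p with ∈-concatMap-elim f xs p
...   | y , q , r = y , there q , r

subBelow-⁻ : ∀ b κ {σ} → σ ∈ subBelow b κ → length σ ≡ length κ × Decr (at σ) × at σ 0 ≤ b × (∀ r → at σ r ≤ at κ r)
subBelow-⁻ b []       (here refl) = refl , (λ i → z≤n) , z≤n , λ r → z≤n
subBelow-⁻ b (a ∷ as) m with ∈-concatMap-elim (λ x → map (x ∷_) (subBelow x as)) (upTo (suc (a ⊓ b))) m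
... | x , p , q with ∈-map⁻ (x ∷_) q
... | σ , r , refl with subBelow-⁻ x as r
... | l , h , z , s = cong suc l , (λ { zero → z ; (suc i) → h i }) , ≤-trans x≤ (m⊓n≤n a b) , λ { zero → ≤-trans x≤ (m⊓n≤m a b) ; (suc r) → s r }
  where
  x≤ : x ≤ a ⊓ b
  x≤ = ≤-pred (∈-upTo⁻ p)

subBelow-⁺ : ∀ b κ σ → length σ ≡ length κ → Decr (at σ) → at σ 0 ≤ b → (∀ r → at σ r ≤ at κ r) → σ ∈ subBelow b κ
subBelow-⁺ b []       []      l h z s = here refl
subBelow-⁺ b (a ∷ as) (x ∷ σ) l h z s = ∈-concatMap-intro (λ x → map (x ∷_) (subBelow x as)) (∈-upTo⁺ (s≤s (⊓-glb (s 0) z)))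
  (∈-map⁺ (x ∷_) (subBelow-⁺ x as σ (suc-injective l) (λ i → h (suc i)) (h 0) (λ r → s (suc r))))

subBelow-unique : ∀ b κ → Unique (subBelow b κ)
subBelow-unique b []       = [] ∷ []
subBelow-unique b (a ∷ as) = unique-concatMap (λ x → map (x ∷_) (subBelow x as)) (UniqueP.upTo⁺ (suc (a ⊓ b)))
  (λ x → UniqueP.map⁺ (λ { refl → refl }) (subBelow-unique x as)) same
  where
  same : ∀ {x y σ} → σ ∈ map (x ∷_) (subBelow x as) → σ ∈ map (y ∷_) (subBelow y as) → x ≡ y
  same {x} {y} p q with ∈-map⁻ (x ∷_) p | ∈-map⁻ (y ∷_) q
  ... | _ , _ , refl | _ , _ , refl = refl

at-ext : ∀ xs ys → length xs ≡ length ys → (∀ r → at xs r ≡ at ys r) → xs ≡ ys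
at-ext []       []       l h = refl
at-ext (x ∷ xs) (y ∷ ys) l h = cong₂ _∷_ (h 0) (at-ext xs ys (suc-injective l) (λ r → h (suc r)))

subPartitions-unique : ∀ κ → Unique (subPartitions κ)
subPartitions-unique κ = unique-map (subBelow-unique (sum κ) κ) same
  where
  same : ∀ {σ ρ} → σ ∈ subBelow (sum κ) κ → ρ ∈ subBelow (sum κ) κ → stripZeros σ ≡ stripZeros ρ → σ ≡ ρ
  same {σ} {ρ} p q e with subBelow-⁻ (sum κ) κ p | subBelow-⁻ (sum κ) κ q
  ... | l , h , _ | l' , h' , _ = at-ext σ ρ (trans l (sym l')) (λ r → trans (sym (stripZeros-at σ h r)) (trans (cong (λ z → at z r) e) (stripZeros-at ρ h' r)))

∈-subPartitions-⁻ : ∀ κ {τ} → τ ∈ subPartitions κ → T (isPartition τ) × (∀ r → at τ r ≤ at κ r)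
∈-subPartitions-⁻ κ m with ∈-map⁻ stripZeros m
... | σ , p , refl with subBelow-⁻ (sum κ) κ p
... | _ , h , _ , s = stripZeros-partition σ h , λ r → ≤-trans (≤-reflexive (stripZeros-at σ h r)) (s r)

toRows : (ℕ → ℕ) → ℕ → List ℕ
toRows f n = map f (upTo n)

at-toRows : ∀ f n → (∀ r → n ≤ r → f r ≡ 0) → ∀ r → at (toRows f n) r ≡ f r
at-toRows f n z r with r <? n
... | yes p = at-applyUpTo f (λ i → i) n r p
... | no p  = trans (at-length (toRows f n) r (≤-trans (≤-reflexive (trans (length-map f (upTo n)) (Data.List.Properties.length-upTo n))) (≮⇒≥ p))) (sym (z r (≮⇒≥ p)))
  where import Data.List.Properties

module _ (κ : List ℕ) (f : ℕ → ℕ) (h : Decr f) (s : ∀ r → f r ≤ at κ r) where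

  shape : List ℕ
  shape = stripZeros (toRows f (length κ))

  private
    at-rows : ∀ r → at (toRows f (length κ)) r ≡ f r
    at-rows = at-toRows f (length κ) (λ r l → n≤0⇒n≡0 (≤-trans (s r) (≤-reflexive (at-length κ r l))))
    rows-decr : Decr (at (toRows f (length κ)))
    rows-decr i = subst₂ _≤_ (sym (at-rows (suc i))) (sym (at-rows i)) (h i)

  at-shape : ∀ r → at shape r ≡ f r
  at-shape r = trans (stripZeros-at (toRows f (length κ)) rows-decr r) (at-rows r)

  shape-partition : T (isPartition shape)
  shape-partition = stripZeros-partition (toRows f (length κ)) rows-decr

  shape∈ : shape ∈ subPartitions κ
  shape∈ = ∈-map⁺ stripZeros (subBelow-⁺ (sum κ) κ (toRows f (length κ))
    (trans (length-map f (upTo (length κ))) (Data.List.Properties.length-upTo (length κ))) rows-decr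
    (≤-trans (≤-reflexive (at-rows 0)) (≤-trans (s 0) (head≤ κ))) (λ r → ≤-trans (≤-reflexive (at-rows r)) (s r)))
    where
    import Data.List.Properties
    head≤ : ∀ κ → at κ 0 ≤ sum κ
    head≤ []      = z≤n
    head≤ (x ∷ κ) = m≤m+n x (sum κ)

-- Correctness of the search for connected components.

filterB-∈⁻ : {A : Set} (p : A → Bool) (xs : List A) {x : A} → x ∈ filterB p xs → x ∈ xs × T (p x)
filterB-∈⁻ p (y ∷ xs) m with p y in eq
filterB-∈⁻ p (y ∷ xs) (here refl) | true = here refl , Equivalence.from T-≡ eq
filterB-∈⁻ p (y ∷ xs) (there m)   | true with filterB-∈⁻ p xs m
... | a , b = there a , b
filterB-∈⁻ p (y ∷ xs) m           | false with filterB-∈⁻ p xs m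
... | a , b = there a , b

filterB-∈⁺ : {A : Set} (p : A → Bool) (xs : List A) {x : A} → x ∈ xs → T (p x) → x ∈ filterB p xs
filterB-∈⁺ p (y ∷ xs) (here refl) t with p y
... | true = here refl
filterB-∈⁺ p (y ∷ xs) (there m) t with p y
... | true  = there (filterB-∈⁺ p xs m t)
... | false = filterB-∈⁺ p xs m t

filterB-unique : {A : Set} (p : A → Bool) {xs : List A} → Unique xs → Unique (filterB p xs)
filterB-unique p {[]}     []       = []
filterB-unique p {x ∷ xs} (n ∷ us) with p x
... | true  = All.tabulate (λ m → All.lookup n (proj₁ (filterB-∈⁻ p xs m))) ∷ filterB-unique p us
... | false = filterB-unique p us

any⁻ : {A : Set} (p : A → Bool) (xs : List A) → T (any p xs) → ∃[ x ] x ∈ xs × T (p x)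
any⁻ p (x ∷ xs) t with p x in eq
... | true  = x , here refl , Equivalence.from T-≡ eq
... | false with any⁻ p xs t
...   | y , m , q = y , there m , q

any⁺ : {A : Set} (p : A → Bool) {xs : List A} {x : A} → x ∈ xs → T (p x) → T (any p xs)
any⁺ p {x ∷ xs} (here refl) t with p x
... | true = tt
any⁺ p {y ∷ xs} (there m) t with p y
... | true  = tt
... | false = any⁺ p m t

filterB-length : {A : Set} (p : A → Bool) (xs : List A) → length (filterB p xs) ≤ length xs
filterB-length p []       = z≤n
filterB-length p (x ∷ xs) with p x
... | true  = s≤s (filterB-length p xs)
... | false = m≤n⇒m≤1+n (filterB-length p xs)

filterB-complement : {A : Set} (p : A → Bool) (xs : List A) → filterB p xs ≢ [] → length (filterB (λ x → not (p x)) xs) < length xs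
filterB-complement p []       ne = ⊥-elim (ne refl)
filterB-complement p (x ∷ xs) ne with p x
... | true  = s≤s (filterB-length (λ x → not (p x)) xs)
... | false = s≤s (filterB-complement p xs ne)

data Linked (bs : List Box) (ρ : Box) : Box → Set where
  root : Linked bs ρ ρ
  via  : ∀ {b p} → p ∈ bs → T (adjacent b p) → T (adjacent p b) → Linked bs ρ p → Linked bs ρ b

-- The search is compared with a labelling of boxes. `compat` keeps a component within one label
-- class, and the links to a common root keep a class within one component.
module Components (bs₀ : List Box) (lab : Box → ℕ) (rootOf : ℕ → Box)
  (compat : ∀ {b b'} → b ∈ bs₀ → b' ∈ bs₀ → T (adjacent b b') → lab b ≡ lab b')
  (linked : ∀ {b} → b ∈ bs₀ → Linked bs₀ (rootOf (lab b)) b) where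

  record Closed (C rest C' rest' : List Box) : Set where
    field
      keep    : ∀ {x} → x ∈ C → x ∈ C'
      covers   : ∀ {x} → x ∈ C ⊎ x ∈ rest → x ∈ C' ⊎ x ∈ rest'
      back    : ∀ {x} → x ∈ C' ⊎ x ∈ rest' → x ∈ C ⊎ x ∈ rest
      back'   : ∀ {x} → x ∈ rest' → x ∈ rest
      label   : ∀ {v} → (∀ {x} → x ∈ C ⊎ x ∈ rest → x ∈ bs₀) → (∀ {x} → x ∈ C → lab x ≡ v) → ∀ {x} → x ∈ C' → lab x ≡ v
      closed  : ∀ {r c} → r ∈ rest' → c ∈ C' → ¬ T (adjacent r c)
      apart   : (∀ {x} → x ∈ C → ¬ x ∈ rest) → ∀ {x} → x ∈ C' → ¬ x ∈ rest'
      uniq    : Unique rest → Unique rest'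
      shorter : length rest' ≤ length rest

  close-spec : ∀ f C rest → length rest < f → Closed C rest (proj₁ (close f C rest)) (proj₂ (close f C rest))
  close-spec (suc f) C rest l with filterB (λ b → any (adjacent b) C) rest in eq
  ... | [] = record
    { keep = λ m → m ; covers = λ m → m ; back = λ m → m ; back' = λ m → m ; label = λ _ h → h
    ; closed = λ {r} {c} p q t → ∉[] (subst (r ∈_) eq (filterB-∈⁺ _ rest p (any⁺ (adjacent r) q t)))
    ; apart = λ h → h ; uniq = λ u → u ; shorter = ≤-refl }
    where
    ∉[] : ∀ {x : Box} → ¬ x ∈ []
    ∉[] ()
  ... | a ∷ as = record
    { keep = λ m → keep (∈-++⁺ˡ m)
    ; covers = λ m → covers (split m)
    ; back = λ m → unsplit (back m)
    ; back' = λ m → proj₁ (filterB-∈⁻ _ rest (back' m))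
    ; label = λ inb h → label (λ m → inb (unsplit m)) (ext inb h)
    ; closed = closed
    ; apart = λ h → apart (λ p q → [ (λ p → h p (proj₁ (filterB-∈⁻ _ rest q))) , (λ p → not-T (proj₂ (filterB-∈⁻ _ rest q)) (proj₂ (touched p))) ] (∈-++⁻ C p))
    ; uniq = λ u → uniq (filterB-unique _ u)
    ; shorter = ≤-trans shorter (filterB-length _ rest) }
    where
    open import Data.Sum using ([_,_])
    touches : Box → Bool
    touches b = any (adjacent b) C
    touched : ∀ {x} → x ∈ a ∷ as → x ∈ rest × T (touches x)
    touched {x} p = filterB-∈⁻ touches rest (subst (x ∈_) (sym eq) p)
    rest₁ : List Box
    rest₁ = filterB (λ b → not (touches b)) rest
    ne : filterB touches rest ≢ []
    ne e with trans (sym eq) e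
    ... | ()
    open Closed (close-spec f (C ++ (a ∷ as)) rest₁ (≤-trans (filterB-complement touches rest ne) (≤-pred l)))
    split : ∀ {x} → x ∈ C ⊎ x ∈ rest → x ∈ C ++ (a ∷ as) ⊎ x ∈ rest₁
    split (inj₁ p) = inj₁ (∈-++⁺ˡ p)
    split {x} (inj₂ p) with touches x in e
    ... | true  = inj₁ (∈-++⁺ʳ C (subst (x ∈_) eq (filterB-∈⁺ touches rest p (Equivalence.from T-≡ e))))
    ... | false = inj₂ (filterB-∈⁺ (λ b → not (touches b)) rest p (subst (λ z → T (not z)) (sym e) tt))
    unsplit : ∀ {x} → x ∈ C ++ (a ∷ as) ⊎ x ∈ rest₁ → x ∈ C ⊎ x ∈ rest
    unsplit (inj₁ p) with ∈-++⁻ C p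
    ... | inj₁ q = inj₁ q
    ... | inj₂ q = inj₂ (proj₁ (touched q))
    unsplit (inj₂ p) = inj₂ (proj₁ (filterB-∈⁻ _ rest p))
    ext : ∀ {v} → (∀ {x} → x ∈ C ⊎ x ∈ rest → x ∈ bs₀) → (∀ {x} → x ∈ C → lab x ≡ v) → ∀ {x} → x ∈ C ++ (a ∷ as) → lab x ≡ v
    ext inb h {x} p with ∈-++⁻ C p
    ... | inj₁ q = h q
    ... | inj₂ q with any⁻ (adjacent x) C (proj₂ (touched q))
    ...   | c , m , t = trans (compat {x} {c} (inb (inj₂ (proj₁ (touched q)))) (inb (inj₁ m)) t) (h m)

  record Class (v : ℕ) (C : List Box) : Set where
    field
      sound    : ∀ {x} → x ∈ C → x ∈ bs₀ × lab x ≡ v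
      complete : ∀ {x} → x ∈ bs₀ → lab x ≡ v → x ∈ C

  data Classes : List (List Box) → List ℕ → Set where
    []  : Classes [] []
    _∷_ : ∀ {C Cs v vs} → Class v C → Classes Cs vs → Classes (C ∷ Cs) (v ∷ vs)

  record Partitioned (rest : List Box) (Cs : List (List Box)) : Set where
    field
      {vs}    : List ℕ
      classes : Classes Cs vs
      uniq    : Unique vs
      onto    : ∀ {v} → v ∈ vs → ∃[ b ] b ∈ rest × lab b ≡ v
      total   : ∀ {b} → b ∈ rest → lab b ∈ vs

  partition-spec : ∀ f rest → length rest ≤ f → Unique rest → (∀ {b} → b ∈ rest → b ∈ bs₀) →
    (∀ {b b'} → b ∈ rest → b' ∈ bs₀ → lab b' ≡ lab b → b' ∈ rest) → Partitioned rest (componentsF f rest)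
  partition-spec zero    [] l u inb sat = record { classes = [] ; uniq = [] ; onto = λ () ; total = λ () }
  partition-spec (suc f) [] l u inb sat = record { classes = [] ; uniq = [] ; onto = λ () ; total = λ () }
  partition-spec (suc f) (b ∷ bs) (s≤s l) (n ∷ us) inb sat
    with close (suc (length bs)) (b ∷ []) bs | close-spec (suc (length bs)) (b ∷ []) bs ≤-refl
  ... | C' , rest' | cs = record
    { classes = cls ∷ Partitioned.classes ih
    ; uniq = All.tabulate fresh ∷ Partitioned.uniq ih
    ; onto = λ { (here refl) → b , here refl , refl ; (there m) → from (Partitioned.onto ih m) }
    ; total = tot }
    where
    open Closed cs
    v = lab b
    inC : ∀ {x} → x ∈ C' ⊎ x ∈ rest' → x ∈ b ∷ bs
    inC m with back m
    ... | inj₁ (here refl) = here refl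
    ... | inj₂ q           = there q
    disj : ∀ {x} → x ∈ C' → ¬ x ∈ rest'
    disj = apart (λ { (here refl) q → All.lookup n q refl })
    lab-C' : ∀ {x} → x ∈ C' → lab x ≡ v
    lab-C' = label (λ { (inj₁ (here refl)) → inb (here refl) ; (inj₂ q) → inb (there q) }) (λ { (here refl) → refl })
    where-is : ∀ {x} → x ∈ bs₀ → lab x ≡ v → x ∈ C' ⊎ x ∈ rest'
    where-is m e with sat (here refl) m e
    ... | here refl = covers (inj₁ (here refl))
    ... | there q   = covers (inj₂ q)
    root∈C' : ∀ {x} → Linked bs₀ (rootOf v) x → x ∈ C' → x ∈ bs₀ → lab x ≡ v → rootOf v ∈ C'
    root∈C' root p q e = p
    root∈C' (via m a a' k) p q e with where-is m (trans (compat m q a') e)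
    ... | inj₁ r = root∈C' k r m (trans (compat m q a') e)
    ... | inj₂ r = ⊥-elim (closed r p a')
    root∈rest' : ∀ {x} → Linked bs₀ (rootOf v) x → x ∈ rest' → x ∈ bs₀ → lab x ≡ v → rootOf v ∈ rest'
    root∈rest' root p q e = p
    root∈rest' (via m a a' k) p q e with where-is m (trans (compat m q a') e)
    ... | inj₁ r = ⊥-elim (closed p r a)
    ... | inj₂ r = root∈rest' k r m (trans (compat m q a') e)
    linkedTo : ∀ {x} → x ∈ bs₀ → lab x ≡ v → Linked bs₀ (rootOf v) x
    linkedTo {x} m e = subst (λ z → Linked bs₀ (rootOf z) x) e (linked m)
    -- A box of the class left outside C' would put the common root into the rest, while b puts it
    -- into C'.
    full : ∀ {x} → x ∈ bs₀ → lab x ≡ v → x ∈ C'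
    full m e with where-is m e
    ... | inj₁ p = p
    ... | inj₂ p = ⊥-elim (disj (root∈C' (linked (inb (here refl))) (keep (here refl)) (inb (here refl)) refl) (root∈rest' (linkedTo m e) p m e))
    cls : Class v C'
    cls = record { sound = λ m → inb (inC (inj₁ m)) , lab-C' m ; complete = full }
    ih : Partitioned rest' (componentsF f rest')
    ih = partition-spec f rest' (≤-trans shorter l) (uniq us) (λ m → inb (inC (inj₂ m))) sat'
      where
      sat' : ∀ {b b'} → b ∈ rest' → b' ∈ bs₀ → lab b' ≡ lab b → b' ∈ rest'
      sat' {x} {x'} m m' e with sat (inC (inj₂ m)) m' e
      ... | q with covers (split q)
        where
        split : ∀ {x} → x ∈ b ∷ bs → x ∈ b ∷ [] ⊎ x ∈ bs
        split (here refl) = inj₁ (here refl)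
        split (there q)   = inj₂ q
      ...   | inj₂ r = r
      ...   | inj₁ r = ⊥-elim (disj (full (inb (inC (inj₂ m))) (trans (sym e) (lab-C' r))) m)
    fresh : ∀ {v'} → v' ∈ Partitioned.vs ih → v ≢ v'
    fresh m refl with Partitioned.onto ih m
    ... | x , p , e = disj (full (inb (inC (inj₂ p))) e) p
    from : ∀ {v'} → (∃[ x ] x ∈ rest' × lab x ≡ v') → ∃[ x ] x ∈ b ∷ bs × lab x ≡ v'
    from (x , p , e) = x , inC (inj₂ p) , e
    tot : ∀ {x} → x ∈ b ∷ bs → lab x ∈ v ∷ Partitioned.vs ih
    tot m with where-rest m
      where
      where-rest : ∀ {x} → x ∈ b ∷ bs → x ∈ C' ⊎ x ∈ rest'
      where-rest (here refl) = covers (inj₁ (here refl))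
      where-rest (there q)   = covers (inj₂ q)
    ... | inj₁ p = here (lab-C' p)
    ... | inj₂ p = there (Partitioned.total ih p)

bottomRow-≤ : ∀ C m → (∀ {b} → b ∈ C → proj₁ b ≤ m) → bottomRow C ≤ m
bottomRow-≤ []      m h = z≤n
bottomRow-≤ (b ∷ C) m h = ⊔-lub (h (here refl)) (bottomRow-≤ C m (λ q → h (there q)))

bottomRow-≥ : ∀ C {b} → b ∈ C → proj₁ b ≤ bottomRow C
bottomRow-≥ (b ∷ C) (here refl) = m≤m⊔n _ _
bottomRow-≥ (b ∷ C) (there m)   = ≤-trans (bottomRow-≥ C m) (m≤n⊔m (proj₁ b) _)

topRow-≡ : ∀ C v → (∀ {b} → b ∈ C → v ≤ proj₁ b) → (∃[ b ] b ∈ C × proj₁ b ≡ v) → topRow C ≡ v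
topRow-≡ C v h (b , m , refl) = ≤-antisym (lower C m) (high C (≤-trans ≤-refl (bottomRow-≥ C m)) h)
  where
  lower : ∀ {z} C → b ∈ C → foldr (λ b m → proj₁ b ⊓ m) z C ≤ proj₁ b
  lower (b ∷ C) (here refl) = m⊓n≤m _ _
  lower (b' ∷ C) (there m)  = ≤-trans (m⊓n≤n (proj₁ b') _) (lower C m)
  high : ∀ {z} C → proj₁ b ≤ z → (∀ {b'} → b' ∈ C → proj₁ b ≤ proj₁ b') → proj₁ b ≤ foldr (λ b m → proj₁ b ⊓ m) z C
  high []       l h = l
  high (b' ∷ C) l h = ⊓-glb (h (here refl)) (high C l (λ q → h (there q)))

skewBoxes-⁺ : ∀ κ τ r c → at τ r ≤ c → c < at κ r → (r , c) ∈ skewBoxes κ τ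
skewBoxes-⁺ κ τ r c l u = ∈-concatMap-intro (λ r → map (λ c → r , c) (filter (λ c → at τ r ≤? c) (upTo (at κ r)))) (∈-upTo⁺ r<)
  (∈-map⁺ (λ c → r , c) (∈-filter⁺ (λ c → at τ r ≤? c) (∈-upTo⁺ u) l))
  where
  r< : r < length κ
  r< with r <? length κ
  ... | yes p = p
  ... | no p  = ⊥-elim (lin⊥ (c ∷ at κ r ∷ []) (# 1 ⊹ $ 0 ⊴ $ 1 ∋ u ∷ $ 1 ≐ # 0 ∋ at-length κ r (≮⇒≥ p) ∷ []))

skewBoxes-⁻ : ∀ κ τ {b} → b ∈ skewBoxes κ τ → at τ (proj₁ b) ≤ proj₂ b × proj₂ b < at κ (proj₁ b)
skewBoxes-⁻ κ τ m with ∈-concatMap-elim (λ r → map (λ c → r , c) (filter (λ c → at τ r ≤? c) (upTo (at κ r)))) (upTo (length κ)) m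
... | r , _ , q with ∈-map⁻ (λ c → r , c) q
... | c , p , refl with ∈-filter⁻ (λ c → at τ r ≤? c) {xs = upTo (at κ r)} p
... | a , b = b , ∈-upTo⁻ a

skewBoxes-unique : ∀ κ τ → Unique (skewBoxes κ τ)
skewBoxes-unique κ τ = unique-concatMap (λ r → map (λ c → r , c) (filter (λ c → at τ r ≤? c) (upTo (at κ r)))) (UniqueP.upTo⁺ (length κ))
  (λ r → UniqueP.map⁺ (λ { refl → refl }) (UniqueP.filter⁺ (λ c → at τ r ≤? c) (UniqueP.upTo⁺ (at κ r)))) same
  where
  same : ∀ {x y b} → b ∈ map (λ c → x , c) (filter (λ c → at τ x ≤? c) (upTo (at κ x))) → b ∈ map (λ c → y , c) (filter (λ c → at τ y ≤? c) (upTo (at κ y))) → x ≡ y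
  same {x} {y} p q with ∈-map⁻ (λ c → x , c) p | ∈-map⁻ (λ c → y , c) q
  ... | _ , _ , refl | _ , _ , refl = refl

dist1⁻ : ∀ {a b} → T (dist1 a b) → b ≡ suc a ⊎ a ≡ suc b
dist1⁻ {a} {b} t with suc a ≡ᵇ b in e
... | true  = inj₁ (sym (≡ᵇ⇒≡ (suc a) b (Equivalence.from T-≡ e)))
... | false = inj₂ (sym (≡ᵇ⇒≡ (suc b) a t))

adjacent⁻ : ∀ {r c r' c'} → T (adjacent (r , c) (r' , c')) → r ≡ r' ⊎ (c ≡ c' × (r' ≡ suc r ⊎ r ≡ suc r'))
adjacent⁻ {r} {c} {r'} {c'} t with (r ≡ᵇ r') ∧ dist1 c c' in e
... | true  = inj₁ (≡ᵇ⇒≡ r r' (proj₁ (∧-T {r ≡ᵇ r'} (Equivalence.from T-≡ e))))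
... | false = inj₂ (≡ᵇ⇒≡ c c' (proj₁ (∧-T {c ≡ᵇ c'} t)) , dist1⁻ {r} {r'} (proj₂ (∧-T {c ≡ᵇ c'} t)))

T-∨ʳ : ∀ {a b} → T b → T (a ∨ b)
T-∨ʳ {true}  t = tt
T-∨ʳ {false} t = t

T-∨ˡ : ∀ {a b} → T a → T (a ∨ b)
T-∨ˡ {true} t = tt

≡ᵇ-T : ∀ a → T (a ≡ᵇ a)
≡ᵇ-T a = ≡⇒≡ᵇ a a refl

adjacent-row : ∀ r c → T (adjacent (r , c) (r , suc c)) × T (adjacent (r , suc c) (r , c))
adjacent-row r c = T-∨ˡ (T-∧⁺ (≡ᵇ-T r) (T-∨ˡ (≡ᵇ-T c))) , T-∨ˡ (T-∧⁺ (≡ᵇ-T r) (T-∨ʳ {suc (suc c) ≡ᵇ c} (≡ᵇ-T c)))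

adjacent-col : ∀ r c → T (adjacent (suc r , c) (r , c)) × T (adjacent (r , c) (suc r , c))
adjacent-col r c = T-∨ʳ {(suc r ≡ᵇ r) ∧ dist1 c c} (T-∧⁺ (≡ᵇ-T c) (T-∨ʳ {suc (suc r) ≡ᵇ r} (≡ᵇ-T r)))
                 , T-∨ʳ {(r ≡ᵇ suc r) ∧ dist1 c c} (T-∧⁺ (≡ᵇ-T c) (T-∨ˡ (≡ᵇ-T r)))

-- Components, markings and spin of a bead move.

module Ribbons {n : ℕ} {κ τ : List ℕ} {d : ℕ → ℕ} (C : IsCore n (at κ) d) {j : ℕ} (cv : Cover d j)
               (τ≡ : ∀ r → at τ r ≡ Below.τ C cv r) where
  open IsCore C
  open Below C cv using (xs; separated; τ-end; τ-mid; τ-out; bead-last; bead-next; L)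
  open Cover cv using (w)

  labOf : ∀ {r} → Located w xs r → ℕ
  labOf (inside x a _ _ _) = x
  -- Rows outside all ribbons contain no box of the skew shape, so this default labels no box of it.
  labOf (outside _)        = 0

  labRow : ℕ → ℕ
  labRow r = labOf (locate w xs r)

  lab : Box → ℕ
  lab b = labRow (proj₁ b)

  sep-unique : ∀ {ys x x' a a'} → Separated w ys → x ∈ ys → x' ∈ ys → a ≤ w → a' ≤ w → x + a ≡ x' + a' → x ≡ x'
  sep-unique (s ∷ ss) (here refl) (here refl) l l' e = refl
  sep-unique {x = x} {x'} {a} {a'} (s ∷ ss) (here refl) (there m')  l l' e = ⊥-elim (lin⊥ (x' ∷ Cover.w cv ∷ x ∷ a ∷ a' ∷ []) (# 1 ⊹ ($ 0 ⊹ $ 1) ⊴ $ 2 ∋ All.lookup s m' ∷ $ 2 ⊹ $ 3 ≐ $ 0 ⊹ $ 4 ∋ e ∷ $ 4 ⊴ $ 1 ∋ l' ∷ []))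
  sep-unique {x = x} {x'} {a} {a'} (s ∷ ss) (there m)   (here refl) l l' e = ⊥-elim (lin⊥ (x ∷ Cover.w cv ∷ x' ∷ a ∷ a' ∷ []) (# 1 ⊹ ($ 0 ⊹ $ 1) ⊴ $ 2 ∋ All.lookup s m ∷ $ 2 ⊹ $ 4 ≐ $ 0 ⊹ $ 3 ∋ sym e ∷ $ 3 ⊴ $ 1 ∋ l ∷ []))
  sep-unique (s ∷ ss) (there m)   (there m')  l l' e = sep-unique ss m m' l l' e

  lab-inside : ∀ {x a} → x ∈ xs → a ≤ w → labRow (x + a) ≡ x
  lab-inside {x} {a} m l with locate w xs (x + a)
  ... | inside x' a' m' l' e = sep-unique separated m' m l' l (sym e)
  ... | outside h with h x m
  ...   | inj₁ p = ⊥-elim (lin⊥ (x ∷ a ∷ []) (# 1 ⊹ ($ 0 ⊹ $ 1) ⊴ $ 0 ∋ p ∷ []))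
  ...   | inj₂ p = ⊥-elim (lin⊥ (x ∷ Cover.w cv ∷ a ∷ []) (# 1 ⊹ ($ 0 ⊹ $ 1) ⊴ $ 0 ⊹ $ 2 ∋ p ∷ $ 2 ⊴ $ 1 ∋ l ∷ []))

  bs : List Box
  bs = skewBoxes κ τ

  data InBlock : Box → Set where
    inBlock : ∀ {x a c} → x ∈ xs → a ≤ w → Below.τ C cv (x + a) ≤ c → c < at κ (x + a) → InBlock (x + a , c)

  inBlock⁻ : ∀ {b} → b ∈ bs → InBlock b
  inBlock⁻ {r , c} m with skewBoxes-⁻ κ τ m | locate w xs r
  ... | l , u | inside x a q q' refl = inBlock q q' (≤-trans (≤-reflexive (sym (τ≡ r))) l) u
  ... | l , u | outside h = ⊥-elim (lin⊥ (at τ r ∷ c ∷ at κ r ∷ Below.τ C cv r ∷ []) ($ 0 ⊴ $ 1 ∋ l ∷ # 1 ⊹ $ 1 ⊴ $ 2 ∋ u ∷ $ 3 ≐ $ 0 ∋ sym (τ≡ r) ∷ $ 2 ≐ $ 3 ∋ sym (τ-out r h) ∷ []))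

  inBlock⁺ : ∀ {b} → InBlock b → b ∈ bs
  inBlock⁺ (inBlock {x} {a} {c} m l p q) = skewBoxes-⁺ κ τ (x + a) c (≤-trans (≤-reflexive (τ≡ (x + a))) p) q

  τ<κ : ∀ {x a} → x ∈ xs → a ≤ w → Below.τ C cv (x + a) < at κ (x + a)
  τ<κ {x} {a} m l with a ≟ w
  ... | yes refl = lin≤ (Below.τ C cv (x + Cover.w cv) ∷ Below.L C cv ∷ at κ x ∷ Cover.w cv ∷ at κ (x + Cover.w cv) ∷ []) 1 (# 1 ⊹ $ 0) ($ 4) ($ 0 ⊹ $ 1 ≐ $ 2 ⊹ $ 3 ∋ τ-end x m ∷ # 1 ⊹ ($ 2 ⊹ $ 3) ⊴ $ 4 ⊹ $ 1 ∋ bead-last x m ∷ [])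
  ... | no ne    = lin≤ (Below.τ C cv (x + a) ∷ at κ (suc (x + a)) ∷ at κ (x + a) ∷ []) 1 (# 1 ⊹ $ 0) ($ 2) (# 1 ⊹ $ 0 ≐ $ 1 ∋ τ-mid x m a (≤∧≢⇒< l ne) ∷ $ 1 ⊴ $ 2 ∋ mono (x + a) ∷ [])

  vertical : ∀ {r c} → (r , c) ∈ bs → (suc r , c) ∈ bs → lab (r , c) ≡ lab (suc r , c)
  vertical {r} {c} m m' with inBlock⁻ m
  ... | inBlock {x} {a} q l p u with a ≟ w
  ...   | no ne = trans (lab-inside q l) (sym (trans (cong labRow (sym (+-suc x a))) (lab-inside {x} {suc a} q (≤∧≢⇒< l ne))))
  -- By `bead-next`, κ (x + w + 1) is at most τ (x + w), so no box lies directly below the last row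
  -- of a ribbon.
  ...   | yes refl = ⊥-elim (lin⊥ (moved (at κ) (Cover.w cv) (at κ (d j) + suc (Cover.w cv) ∸ at κ (d j + suc (Cover.w cv))) (tops (Cover.tower cv)) (x + Cover.w cv) ∷ c ∷ Below.L C cv ∷ at κ x ∷ Cover.w cv ∷ at κ (suc (x + Cover.w cv)) ∷ []) ($ 0 ⊴ $ 1 ∋ p ∷ $ 3 ⊹ $ 4 ≐ $ 0 ⊹ $ 2 ∋ sym (τ-end x q) ∷ $ 5 ⊹ $ 2 ⊴ $ 3 ⊹ $ 4 ∋ bead-next x q ∷ # 1 ⊹ $ 1 ⊴ $ 5 ∋ proj₂ (skewBoxes-⁻ κ τ m') ∷ []))

  compat : ∀ {b b'} → b ∈ bs → b' ∈ bs → T (adjacent b b') → lab b ≡ lab b'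
  compat {r , c} {r' , c'} m m' t with adjacent⁻ {r} {c} {r'} {c'} t
  ... | inj₁ refl               = refl
  ... | inj₂ (refl , inj₁ refl) = vertical m m'
  ... | inj₂ (refl , inj₂ refl) = sym (vertical m' m)

  rootOf : ℕ → Box
  rootOf x = x , pred (at κ x)

  -- The walk goes right to the end of the row and then up: the end of row x + a + 1 lies below the
  -- first box of the ribbon in row x + a, since τ (x + a) + 1 = κ (x + a + 1).
  link : ∀ {x} a c → x ∈ xs → a ≤ w → Below.τ C cv (x + a) ≤ c → ∀ o → c + suc o ≡ at κ (x + a) → Linked bs (rootOf x) (x + a , c)
  link {x} zero c m l p zero e = subst (Linked bs (rootOf x)) (cong₂ _,_ (sym (+-identityʳ x)) c≡) root
    where
    c≡ : pred (at κ x) ≡ c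
    c≡ = trans (cong (λ z → pred (at κ z)) (sym (+-identityʳ x))) (trans (cong pred (sym e)) (cong pred (trans (+-suc c 0) (cong suc (+-identityʳ c)))))
  link {x} (suc a) c m l p zero e = subst (λ r → Linked bs (rootOf x) (r , c)) (sym (+-suc x a))
    (via (inBlock⁺ (inBlock m (<⇒≤ l) (≤-reflexive τc) (lin≤ (c ∷ at κ (x + a) ∷ []) 1 (# 1 ⊹ $ 0) ($ 1) (# 1 ⊹ $ 0 ⊴ $ 1 ∋ cκ ∷ []))))
      (proj₁ (adjacent-col (x + a) c)) (proj₂ (adjacent-col (x + a) c))
      (link a c m (<⇒≤ l) (≤-reflexive τc) (at κ (x + a) ∸ suc c) (trans (+-suc c _) (m+[n∸m]≡n {suc c} cκ))))
    where
    τc : Below.τ C cv (x + a) ≡ c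
    τc = ≤-antisym (lin≤ (Below.τ C cv (x + a) ∷ at κ (suc (x + a)) ∷ c ∷ at κ (x + suc a) ∷ []) 1 ($ 0) ($ 2) (# 1 ⊹ $ 0 ≐ $ 1 ∋ τ-mid x m a l ∷ $ 3 ≐ $ 2 ⊹ (# 1 ⊹ # 0) ∋ sym e ∷ $ 1 ≐ $ 3 ∋ sym (cong (at κ) (+-suc x a)) ∷ [])) (lin≤ (Below.τ C cv (x + a) ∷ at κ (suc (x + a)) ∷ c ∷ at κ (x + suc a) ∷ []) 1 ($ 2) ($ 0) ($ 1 ≐ # 1 ⊹ $ 0 ∋ sym (τ-mid x m a l) ∷ $ 2 ⊹ (# 1 ⊹ # 0) ≐ $ 3 ∋ e ∷ $ 3 ≐ $ 1 ∋ cong (at κ) (+-suc x a) ∷ []))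
    cκ : suc c ≤ at κ (x + a)
    cκ = lin≤ (c ∷ at κ (x + suc a) ∷ at κ (suc (x + a)) ∷ at κ (x + a) ∷ []) 1 (# 1 ⊹ $ 0) ($ 3) ($ 0 ⊹ (# 1 ⊹ # 0) ≐ $ 1 ∋ e ∷ $ 1 ≐ $ 2 ∋ cong (at κ) (+-suc x a) ∷ $ 2 ⊴ $ 3 ∋ mono (x + a) ∷ [])
  link {x} a c m l p (suc o) e =
    via (inBlock⁺ (inBlock m l (m≤n⇒m≤1+n p) (lin≤ (c ∷ o ∷ at κ (x + a) ∷ []) 1 (# 1 ⊹ (# 1 ⊹ $ 0)) ($ 2) ($ 0 ⊹ (# 1 ⊹ (# 1 ⊹ $ 1)) ≐ $ 2 ∋ e ∷ [])))) (proj₁ (adjacent-row (x + a) c)) (proj₂ (adjacent-row (x + a) c))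
      (link a (suc c) m l (m≤n⇒m≤1+n p) o (trans (sym (+-suc c (suc o))) e))

  linked : ∀ {b} → b ∈ bs → Linked bs (rootOf (lab b)) b
  linked mb with inBlock⁻ mb
  ... | inBlock {x} {a} {c} m l p u = subst (λ z → Linked bs (rootOf z) (x + a , c)) (sym (lab-inside m l))
        (link a c m l p (at κ (x + a) ∸ suc c) (trans (+-suc c _) (m+[n∸m]≡n {suc c} u)))

  open Components bs lab rootOf compat linked

  parts : Partitioned bs (components bs)
  parts = partition-spec (length bs) bs ≤-refl (skewBoxes-unique κ τ) (λ m → m) (λ _ m _ → m)

  open Partitioned parts public using (vs; classes)

  xs-unique : ∀ {ys} → Separated w ys → Unique ys
  xs-unique []       = []
  xs-unique (s ∷ ss) = All.map (λ l e → <⇒≢ (≤-trans (s≤s (m≤m+n _ _)) l) (sym e)) s ∷ xs-unique ss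

  vs-↭ : vs ↭ xs
  vs-↭ = set-↭ (Partitioned.uniq parts) (xs-unique separated) to from
    where
    to : ∀ {v} → v ∈ vs → v ∈ xs
    to m with Partitioned.onto parts m
    ... | b , mb , refl with inBlock⁻ mb
    ...   | inBlock q l _ _ = subst (_∈ xs) (sym (lab-inside q l)) q
    from : ∀ {x} → x ∈ xs → x ∈ vs
    from {x} m = subst (_∈ vs) (lab-inside {x} {0} m z≤n) (Partitioned.total parts (inBlock⁺ (inBlock {x} {0} m z≤n ≤-refl (τ<κ m z≤n))))

  class-rows : ∀ {v D} → v ∈ xs → Class v D → topRow D ≡ v × numRows D ≡ suc w
  class-rows {v} {D} m cl = t≡ , cong suc (trans (cong₂ _∸_ b≡ t≡) (m+n∸m≡n v w))
    where
    open Class cl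
    rows : ∀ {b} → b ∈ D → v ≤ proj₁ b × proj₁ b ≤ v + w
    rows p with sound p
    ... | q , refl with inBlock⁻ q
    ...   | inBlock {x} {a} {c} m' l _ _ rewrite lab-inside {x} {a} m' l = m≤m+n x a , +-monoʳ-≤ x l
    row : ∀ a → a ≤ w → ∃[ b ] b ∈ D × proj₁ b ≡ v + a
    row a l = (v + a , Below.τ C cv (v + a)) , complete (inBlock⁺ (inBlock m l ≤-refl (τ<κ m l))) (lab-inside m l) , refl
    t≡ : topRow D ≡ v
    t≡ with row 0 z≤n
    ... | b , p , e = topRow-≡ D v (λ q → proj₁ (rows q)) (b , p , trans e (+-identityʳ v))
    b≡ : bottomRow D ≡ v + w
    b≡ with row w ≤-refl
    ... | b , p , e = ≤-antisym (bottomRow-≤ D (v + w) (λ q → proj₂ (rows q))) (≤-trans (≤-reflexive (sym e)) (bottomRow-≥ D p))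

  data Rows : List (List Box) → List ℕ → Set where
    []  : Rows [] []
    _∷_ : ∀ {D Ds v vs} → topRow D ≡ v × numRows D ≡ suc w → Rows Ds vs → Rows (D ∷ Ds) (v ∷ vs)

  rows : Rows (components bs) vs
  rows = go classes (λ m → Data.List.Relation.Binary.Permutation.Propositional.Properties.∈-resp-↭ vs-↭ m)
    where
    import Data.List.Relation.Binary.Permutation.Propositional.Properties
    go : ∀ {Ds us} → Classes Ds us → (∀ {v} → v ∈ us → v ∈ xs) → Rows Ds us
    go []       h = []
    go (c ∷ cs) h = class-rows (h (here refl)) c ∷ go cs (λ m → h (there m))

  markings-≡ : markings τ κ ≡ map suc vs
  markings-≡ = go rows
    where
    go : ∀ {Ds us} → Rows Ds us → map (λ D → suc (topRow D)) Ds ≡ map suc us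
    go []              = refl
    go ((refl , _) ∷ r) = cong (_ ∷_) (go r)

  spin-≡ : ∀ x → x ∈ vs → spin τ κ (suc x) ≡ length vs * w + countB (λ v → x <ᵇ v) vs
  spin-≡ x m = cong₂ _+_ (cong₂ (λ a b → a * (b ∸ 1)) (len rows) (marked rows m)) (count rows)
    where
    len : ∀ {Ds us} → Rows Ds us → length Ds ≡ length us
    len []      = refl
    len (_ ∷ r) = cong suc (len r)
    marked : ∀ {Ds us} → Rows Ds us → x ∈ us → numRows (markedComp (suc x) Ds) ≡ suc w
    marked {D ∷ Ds} ((refl , e) ∷ r) q with topRow D ≡ᵇ x in eq
    ... | true = e
    marked {D ∷ Ds} ((refl , e) ∷ r) (here refl) | false = ⊥-elim (subst T eq (≡ᵇ-T (topRow D)))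
    marked {D ∷ Ds} ((refl , e) ∷ r) (there q)   | false = marked r q
    count : ∀ {Ds us} → Rows Ds us → countB (λ D → suc x <ᵇ suc (topRow D)) Ds ≡ countB (λ v → x <ᵇ v) us
    count [] = refl
    count {D ∷ Ds} ((refl , _) ∷ r) = cong (λ z → if x <ᵇ topRow D then suc z else z) (count r)

-- Sizes of cores and uniqueness of covers.

isCore-resp : ∀ {n κ κ' d} → (∀ r → κ r ≡ κ' r) → IsCore n κ d → IsCore n κ' d
isCore-resp {κ = κ} {κ'} {d} h C = record
  { mono = λ i → subst₂ _≤_ (h (suc i)) (h i) (IsCore.mono C i)
  ; eqn  = λ i → trans (cong (_+ d i) (sym (h i))) (trans (IsCore.eqn C i) (cong (_+ _) (h (d i))))
  ; pos  = IsCore.pos C }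

Σℕ : ℕ → (ℕ → ℕ) → ℕ
Σℕ zero    f = 0
Σℕ (suc m) f = Σℕ m f + f m

Σℕ-cong : ∀ m {f g : ℕ → ℕ} → (∀ r → f r ≡ g r) → Σℕ m f ≡ Σℕ m g
Σℕ-cong zero    h = refl
Σℕ-cong (suc m) h = cong₂ _+_ (Σℕ-cong m h) (h m)

Σℕ-+ : ∀ m (f g : ℕ → ℕ) → Σℕ m (λ r → f r + g r) ≡ Σℕ m f + Σℕ m g
Σℕ-+ zero    f g = refl
Σℕ-+ (suc m) f g = ≤-antisym (lin≤ (Σℕ m (λ r → f r + g r) ∷ Σℕ m f ∷ Σℕ m g ∷ f m ∷ g m ∷ []) 1 ($ 0 ⊹ ($ 3 ⊹ $ 4)) ($ 1 ⊹ $ 3 ⊹ ($ 2 ⊹ $ 4)) ($ 0 ≐ $ 1 ⊹ $ 2 ∋ Σℕ-+ m f g ∷ [])) (lin≤ (Σℕ m (λ r → f r + g r) ∷ Σℕ m f ∷ Σℕ m g ∷ f m ∷ g m ∷ []) 1 ($ 1 ⊹ $ 3 ⊹ ($ 2 ⊹ $ 4)) ($ 0 ⊹ ($ 3 ⊹ $ 4)) ($ 1 ⊹ $ 2 ≐ $ 0 ∋ sym (Σℕ-+ m f g) ∷ []))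

Σℕ-≤ : ∀ m {f g : ℕ → ℕ} → (∀ r → f r ≤ g r) → Σℕ m f ≤ Σℕ m g
Σℕ-≤ zero    h = z≤n
Σℕ-≤ (suc m) h = +-mono-≤ (Σℕ-≤ m h) (h m)

Σℕ-< : ∀ m {f g : ℕ → ℕ} → (∀ r → f r ≤ g r) → ∀ r → r < m → f r < g r → Σℕ m f < Σℕ m g
Σℕ-< (suc m) h r l q with r ≟ m
... | yes refl = ≤-trans (≤-reflexive (sym (+-suc _ _))) (+-mono-≤ (Σℕ-≤ m h) q)
... | no ne    = +-mono-<-≤ (Σℕ-< m h r (≤∧≢⇒< (≤-pred l) ne) q) (h m)

Σℕ-raise : ∀ m j d → j < m → Σℕ m (raiseAt j d) ≡ suc (Σℕ m d)
Σℕ-raise (suc m) j d l with j ≟ m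
... | yes refl = trans (cong₂ _+_ (same m ≤-refl) (raiseAt-same j d)) (+-suc _ _)
  where
  same : ∀ i → i ≤ j → Σℕ i (raiseAt j d) ≡ Σℕ i d
  same zero    l = refl
  same (suc i) l = cong₂ _+_ (same i (<⇒≤ l)) (raiseAt-diff d (<⇒≢ l))
... | no ne = cong₂ _+_ (Σℕ-raise m j d (≤∧≢⇒< (≤-pred l) ne)) (raiseAt-diff d (λ e → ne (sym e)))

Σℕ-lower : ∀ m j d → j < m → 1 ≤ d j → suc (Σℕ m (lowerAt j d)) ≡ Σℕ m d
Σℕ-lower m j d l p = trans (sym (Σℕ-raise m j (lowerAt j d) l)) (Σℕ-cong m back)
  where
  back : ∀ r → raiseAt j (lowerAt j d) r ≡ d r
  back r with r ≟ j
  ... | yes refl = trans (raiseAt-same j (lowerAt j d)) (trans (cong suc (lowerAt-same j d)) (suc-pred′ p))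
    where
    suc-pred′ : ∀ {a} → 1 ≤ a → suc (pred a) ≡ a
    suc-pred′ (s≤s _) = refl
  ... | no ne = trans (raiseAt-diff (lowerAt j d) ne) (lowerAt-diff d ne)

sum-at : ∀ xs m → length xs ≤ m → sum xs ≡ Σℕ m (at xs)
sum-at []       zero    l = refl
sum-at []       (suc m) l = trans (sum-at [] m z≤n) (sym (+-identityʳ _))
sum-at (x ∷ xs) (suc m) (s≤s l) = trans (cong (λ z → x + z) (sum-at xs m l)) (front m)
  where
  front : ∀ m → x + Σℕ m (at xs) ≡ Σℕ (suc m) (at (x ∷ xs))
  front zero    = +-comm x 0
  front (suc m) = trans (sym (+-assoc x _ _)) (cong (_+ at xs m) (front m))

search : ∀ {P : ℕ → Set} → (∀ r → Dec (P r)) → ∀ m → (∃[ r ] P r) ⊎ (∀ r → r < m → ¬ P r)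
search P? m with anyUpTo? P? m
... | yes (r , _ , p) = inj₁ (r , p)
... | no h            = inj₂ (λ r l p → h (r , l , p))

-- The number of levels by which the top row z lies above the lowest one, if it occurs. For a cover
-- marked in row z it counts the components below the marked one, the summand N of the spin.
jumpTo : ∀ {d w j c y} → ℕ → Tower d w j c y → Maybe ℕ
jumpTo {j = j} z (top _ _ _) with z ≟ j
... | yes _ = just 0
... | no _  = nothing
jumpTo {j = j} z (step _ t) with z ≟ j
... | yes _ = just 0
... | no _  = mapᵐ suc (jumpTo z t)

pick : Maybe ℕ → (ℕ → ℤ) → ℤ
pick (just i) h = h i
pick nothing  h = + 0

module CoverFacts {n κ d} (C : IsCore n κ d) where
  open IsCore C

  private
    base : ∀ {w j u} → (∀ a → a ≤ w → d (u + a) ≡ j + a) → d u ≡ j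
    base {j = j} {u} g = trans (sym (cong d (+-identityʳ u))) (trans (g 0 z≤n) (+-identityʳ j))

  tower-unique : ∀ {w j c c' y y'} (t : Tower d w j c y) (t' : Tower d w j c' y') → c ≡ c' × tops t ≡ tops t' × (0 < w → y ≡ y')
  tower-unique (top _ _ g) (top _ _ g') = refl , refl , λ l → d-inj (trans (sym (cong d (+-identityʳ _))) (trans (g 0 l) (trans (sym (g' 0 l)) (cong d (+-identityʳ _)))))
  tower-unique (top nu _ _) (step g' _) = ⊥-elim (nu _ (base g'))
  tower-unique (step g _) (top nu _ _)  = ⊥-elim (nu _ (base g))
  tower-unique (step g t) (step g' t') with d-inj (trans (base g) (sym (base g')))
  ... | refl with tower-unique t t'
  ...   | p , q , r = cong suc p , cong (_ ∷_) q , r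

  width-unique : ∀ {j} (cv cv' : Cover d j) → Cover.w cv ≡ Cover.w cv'
  width-unique {j} cv cv' with <-cmp (Cover.w cv) (Cover.w cv')
  ... | tri< l _ _ = ⊥-elim (Cover.stop cv (d-run j (Cover.w cv') (Cover.run cv') (suc (Cover.w cv)) l))
  ... | tri≈ _ e _ = e
  ... | tri> _ _ l = ⊥-elim (Cover.stop cv' (d-run j (Cover.w cv) (Cover.run cv) (suc (Cover.w cv')) l))

  cover-unique : ∀ {j} (cv cv' : Cover d j) → Cover.w cv ≡ Cover.w cv' × Cover.c cv ≡ Cover.c cv' ×
    (∀ r → dMove d j (Cover.y cv) (Cover.w cv) r ≡ dMove d j (Cover.y cv') (Cover.w cv') r) ×
    (∀ r → Below.τ C cv r ≡ Below.τ C cv' r)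
  cover-unique {j} cv@(cover _ _ _ t) cv'@(cover _ _ _ t') with width-unique cv cv'
  ... | refl with tower-unique t t'
  ...   | e , q , h = refl , e , same (Cover.w cv) h , λ r → cong (λ xs → moved κ (Cover.w cv) (Below.L C cv) xs r) q
    where
    same : ∀ w → (0 < w → Cover.y cv ≡ Cover.y cv') → ∀ r → dMove d j (Cover.y cv) w r ≡ dMove d j (Cover.y cv') w r
    same zero    h r = refl
    same (suc w) h r = cong (λ y → dMove d j y (suc w) r) (h (s≤s z≤n))

  cover-row : ∀ {j} (cv : Cover d j) → 0 < κ (j + Cover.w cv)
  cover-row {j} cv = lin≤ (Below.τ C cv (j + Cover.w cv) ∷ Below.L C cv ∷ κ j ∷ Cover.w cv ∷ κ (j + Cover.w cv) ∷ []) 1 (# 1 ⊹ # 0) ($ 4) ($ 0 ⊹ $ 1 ≐ $ 2 ⊹ $ 3 ∋ Below.τ-end C cv j (Below.head∈ C cv (Cover.tower cv)) ∷ # 1 ⊹ ($ 2 ⊹ $ 3) ⊴ $ 4 ⊹ $ 1 ∋ Below.bead-last C cv j (Below.head∈ C cv (Cover.tower cv)) ∷ [])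

  -- `dMove` raises w + 1 entries and lowers w others. The size of the bounded partition is a
  -- constant minus the sum of d, so it drops by one.
  cover-size : ∀ {j} (cv : Cover d j) m → κ m ≡ 0 → Σℕ m (Below.dτ C cv) ≡ suc (Σℕ m d)
  cover-size {j} cv m e = go (Cover.w cv) yj (row (Cover.w cv) (cover-row cv))
    where
    open Moves 0 n [] C using (dMove-out)
    yj = tower-low C (Cover.tower cv)
    row : ∀ w → 0 < κ (j + w) → j + w < m
    row w l with j + w <? m
    ... | yes p = p
    ... | no p  = ⊥-elim (lin⊥ (κ (j + w) ∷ κ m ∷ []) (# 1 ⊴ $ 0 ∋ l ∷ $ 1 ≐ # 0 ∋ e ∷ $ 0 ⊴ $ 1 ∋ mono-≤ (≮⇒≥ p) ∷ []))
    go : ∀ w → Cover.y cv + w ≤ j → j + w < m → Σℕ m (dMove d j (Cover.y cv) w) ≡ suc (Σℕ m d)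
    go zero    b l = Σℕ-raise m j d (lin≤ (j ∷ m ∷ []) 1 (# 1 ⊹ $ 0) ($ 1) (# 1 ⊹ ($ 0 ⊹ # 0) ⊴ $ 1 ∋ l ∷ []))
    go (suc w) b l = trans (Σℕ-raise m (j + suc w) (lowerAt y' e') l)
      (trans (cong suc (suc-injective (trans (Σℕ-lower m y' e' (lin≤ (Cover.y cv ∷ w ∷ j ∷ m ∷ []) 1 (# 1 ⊹ ($ 0 ⊹ $ 1)) ($ 3) ($ 0 ⊹ (# 1 ⊹ $ 1) ⊴ $ 2 ∋ b ∷ # 1 ⊹ ($ 2 ⊹ (# 1 ⊹ $ 1)) ⊴ $ 3 ∋ l ∷ [])) (≤-trans (≤-trans (s≤s z≤n) (d-> y')) (≤-reflexive (sym (dMove-out w (lin≤ (Cover.y cv ∷ w ∷ j ∷ []) 1 ($ 0 ⊹ $ 1) ($ 2) ($ 0 ⊹ (# 1 ⊹ $ 1) ⊴ $ 2 ∋ b ∷ [])) y' (lin≤ (Cover.y cv ∷ w ∷ j ∷ []) 1 (# 1 ⊹ ($ 0 ⊹ $ 1)) ($ 2) ($ 0 ⊹ (# 1 ⊹ $ 1) ⊴ $ 2 ∋ b ∷ [])) (inj₂ ≤-refl)))))) (go w (lin≤ (Cover.y cv ∷ w ∷ j ∷ []) 1 ($ 0 ⊹ $ 1) ($ 2) ($ 0 ⊹ (# 1 ⊹ $ 1) ⊴ $ 2 ∋ b ∷ [])) (lin≤ (j ∷ w ∷ m ∷ []) 1 (# 1 ⊹ ($ 0 ⊹ $ 1)) ($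 2) (# 1 ⊹ ($ 0 ⊹ (# 1 ⊹ $ 1)) ⊴ $ 2 ∋ l ∷ [])))))) refl)
      where
      y' = Cover.y cv + w
      e' = dMove d j (Cover.y cv) w

  tops-bound′ : ∀ {w u c y x} → (t : Tower d w u c y) → x ∈ tops t → x ≤ u
  tops-bound′ (top _ _ _) (here refl) = ≤-refl
  tops-bound′ (step g t)  (here refl) = ≤-refl
  tops-bound′ (step g t)  (there m)   = ≤-trans (tops-bound′ t m) (<⇒≤ (≤-trans (d-> _) (≤-reflexive (base g))))

  jumpTo-sum : ∀ {w j c y} (t : Tower d w j c y) z (h : ℕ → ℤ) →
    sumℤ (map (λ x → if x ≡ᵇ z then h x else + 0) (tops t)) ≡ pick (jumpTo z t) (λ _ → h z)
  jumpTo-sum {j = j} (top _ _ _) z h with z ≟ j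
  ... | yes refl rewrite ≡ᵇ-refl z = ℤP.+-identityʳ _
  ... | no ne rewrite ≡ᵇ-≢ {j} {z} (λ e → ne (sym e)) = refl
  jumpTo-sum {j = j} (step {u = u} g t) z h with z ≟ j
  ... | yes refl rewrite ≡ᵇ-refl z = trans (cong (λ s → h z ℤ.+ s) (zeros (tops t) (λ {x} m e → (lin⊥ (x ∷ u ∷ z ∷ []) ($ 0 ⊴ $ 1 ∋ tops-bound′ t m ∷ # 1 ⊹ $ 1 ⊴ $ 2 ∋ u<j ∷ $ 2 ≐ $ 0 ∋ sym e ∷ []))))) (ℤP.+-identityʳ _)
    where
    u<j : u < z
    u<j = ≤-trans (d-> u) (≤-reflexive (base g))
    zeros : ∀ xs → (∀ {x} → x ∈ xs → x ≢ z) → sumℤ (map (λ x → if x ≡ᵇ z then h x else + 0) xs) ≡ + 0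
    zeros []       q = refl
    zeros (x ∷ xs) q rewrite ≡ᵇ-≢ {x} {z} (q (here refl)) = trans (ℤP.+-identityˡ _) (zeros xs (λ m → q (there m)))
  ... | no ne rewrite ≡ᵇ-≢ {j} {z} (λ e → ne (sym e)) = trans (ℤP.+-identityˡ _) (trans (jumpTo-sum t z h) (keep (jumpTo z t)))
    where
    keep : ∀ (m : Maybe ℕ) → pick m (λ _ → h z) ≡ pick (mapᵐ suc m) (λ _ → h z)
    keep (just _) = refl
    keep nothing  = refl

  count-none : ∀ z xs → (∀ {x} → x ∈ xs → x ≤ z) → countB (λ v → z <ᵇ v) xs ≡ 0
  count-none z []       h = refl
  count-none z (x ∷ xs) h rewrite <ᵇ-false {z} {x} (h (here refl)) = count-none z xs (λ m → h (there m))

  jumpTo-≤ : ∀ {w j c y} (t : Tower d w j c y) z {i} → jumpTo z t ≡ just i → z ≤ j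
  jumpTo-≤ {j = j} (top _ _ _) z e with z ≟ j
  ... | yes refl = ≤-refl
  jumpTo-≤ {j = j} (step g t) z e with z ≟ j
  ... | yes refl = ≤-refl
  ... | no ne with jumpTo z t in q
  ...   | just _ = ≤-trans (jumpTo-≤ t z q) (<⇒≤ (≤-trans (d-> _) (≤-reflexive (base g))))

  jumpTo-count : ∀ {w j c y} (t : Tower d w j c y) z {i} → jumpTo z t ≡ just i → countB (λ v → z <ᵇ v) (tops t) ≡ i
  jumpTo-count {j = j} (top _ _ _) z e with z ≟ j
  jumpTo-count (top _ _ _) z refl | yes refl = count-none z (z ∷ []) λ { (here refl) → ≤-refl }
  jumpTo-count {j = j} (step g t) z e with z ≟ j
  jumpTo-count (step g t) z refl | yes refl = count-none z (z ∷ tops t) λ { (here refl) → ≤-refl ; (there m) → ≤-trans (tops-bound′ t m) (<⇒≤ (≤-trans (d-> _) (≤-reflexive (base g)))) }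
  ... | no ne with jumpTo z t in q
  jumpTo-count {j = j} (step g t) z refl | no ne | just i rewrite <ᵇ-true {z} {j} (≤-trans (s≤s (jumpTo-≤ t z q)) (≤-trans (d-> _) (≤-reflexive (base g)))) =
    cong suc (jumpTo-count t z q)

  jumpTo-self : ∀ {w j c y} (t : Tower d w j c y) → jumpTo j t ≡ just 0
  jumpTo-self {j = j} (top _ _ _) with j ≟ j
  ... | yes _ = refl
  ... | no ne = ⊥-elim (ne refl)
  jumpTo-self {j = j} (step _ _) with j ≟ j
  ... | yes _ = refl
  ... | no ne = ⊥-elim (ne refl)

  jumpTo-above : ∀ {w j c y} (t : Tower d w j c y) z → j < z → jumpTo z t ≡ nothing
  jumpTo-above {j = j} t z l with jumpTo z t in e
  ... | nothing = refl
  ... | just i  = ⊥-elim (lin⊥ (j ∷ z ∷ []) (# 1 ⊹ $ 0 ⊴ $ 1 ∋ l ∷ $ 1 ⊴ $ 0 ∋ jumpTo-≤ t z e ∷ []))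

  -- Since d leads from a top row to the next lower one, z is one level higher than d z.
  jumpTo-down : ∀ {w j c y} (t : Tower d w j c y) z → z ≢ j → jumpTo z t ≡ mapᵐ suc (jumpTo (d z) t)
  jumpTo-down {j = j} (top nu _ _) z ne with z ≟ j | d z ≟ j
  ... | yes e | _     = ⊥-elim (ne e)
  ... | no _  | yes e = ⊥-elim (nu z e)
  ... | no _  | no _  = refl
  jumpTo-down {j = j} (step {u = u} g t) z ne with z ≟ j | d z ≟ j | z ≟ u
  ... | yes e | _     | _        = ⊥-elim (ne e)
  ... | no _  | yes e | yes refl = cong (mapᵐ suc) (jumpTo-self t)
  ... | no _  | yes e | no nu    = ⊥-elim (nu (d-inj (trans e (sym (base g)))))
  ... | no _  | no f  | yes refl = ⊥-elim (f (base g))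
  ... | no _  | no _  | no nu    = cong (mapᵐ suc) (jumpTo-down t z nu)

moved-smaller : ∀ {n κ d} (C : IsCore n κ d) M → κ M ≡ 0 → ∀ {j} (cv : Cover d j) → Σℕ M (Below.τ C cv) < Σℕ M κ
moved-smaller {κ = κ} C M end {j} cv = Σℕ-< M τ-≤ (j + w) row (at-row (τ (j + w)) (τ-end j (head∈ tower)) (bead-last j (head∈ tower)))
  where
  open Below C cv
  open Cover cv
  at-row : ∀ t {a b L} → t + L ≡ a → a < b + L → t < b
  at-row t {a} {b} {L} p q = lin≤ (t ∷ L ∷ a ∷ b ∷ []) 1 (# 1 ⊹ $ 0) ($ 3) ($ 0 ⊹ $ 1 ≐ $ 2 ∋ p ∷ # 1 ⊹ $ 2 ⊴ $ 3 ⊹ $ 1 ∋ q ∷ [])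
  row : j + w < M
  row with j + w <? M
  ... | yes p = p
  ... | no p  = ⊥-elim (lin⊥ (κ (j + Cover.w cv) ∷ κ M ∷ []) (# 1 ⊹ # 0 ⊴ $ 0 ∋ CoverFacts.cover-row C cv ∷ $ 0 ⊴ $ 1 ∋ IsCore.mono-≤ C (≮⇒≥ p) ∷ $ 1 ≐ # 0 ∋ end ∷ []))

-- Lengths of cores strictly increase with containment.
size-strict : ∀ {n κ' d'} (C' : IsCore n κ' d') M fuel {κ d} → IsCore n κ d → (∀ r → κ' r ≤ κ r) → κ M ≡ 0 → Σℕ M κ ≤ fuel →
  ∀ r → κ' r < κ r → Σℕ M d < Σℕ M d'
size-strict {n} {κ'} {d'} C' M fuel {κ} {d} C sub end fl r lt = step₁ fuel fl (Descent.exists C C' sub M end r lt)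
  where
  step₂ : ∀ fuel → Σℕ M κ ≤ fuel → ∀ {j} (cv : Cover d j) → (∀ r → κ' r ≤ Below.τ C cv r) →
    (∃[ r ] κ' r < Below.τ C cv r) ⊎ (∀ r → r < M → ¬ (κ' r < Below.τ C cv r)) → Σℕ M d < Σℕ M d'
  step₂ fuel fl cv sub' (inj₂ h) =
    ≤-reflexive (trans (sym (CoverFacts.cover-size C cv M end)) (Σℕ-cong M (d-unique (Below.core C cv) (isCore-resp same C'))))
    where
    vanish : ∀ {f : ℕ → ℕ} → (∀ r → f r ≤ κ r) → ∀ r → M ≤ r → f r ≡ 0
    vanish s r l = n≤0⇒n≡0 (≤-trans (s r) (≤-trans (IsCore.mono-≤ C l) (≤-reflexive end)))
    same : ∀ r → κ' r ≡ Below.τ C cv r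
    same r with r <? M
    ... | yes p = ≤-antisym (sub' r) (≮⇒≥ (h r p))
    ... | no p  = trans (vanish sub r (≮⇒≥ p)) (sym (vanish (Below.τ-≤ C cv) r (≮⇒≥ p)))
  step₂ zero fl cv sub' (inj₁ _) = ⊥-elim (n≮0 (≤-trans (moved-smaller C M end cv) fl))
  step₂ (suc f) fl cv sub' (inj₁ (r' , lt')) =
    <-trans (≤-reflexive (sym (CoverFacts.cover-size C cv M end)))
      (size-strict C' M f (Below.core C cv) sub' (n≤0⇒n≡0 (≤-trans (Below.τ-≤ C cv M) (≤-reflexive end)))
        (≤-pred (≤-trans (moved-smaller C M end cv) fl)) r' lt')
  step₁ : ∀ fuel → Σℕ M κ ≤ fuel → Descent.Goal C C' sub M end → Σℕ M d < Σℕ M d'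
  step₁ fuel fl (j , cv , sub') = step₂ fuel fl cv sub' (search (λ r → κ' r <? Below.τ C cv r) M)

-- Strong covers are bead moves, and the sum over marked covers.

sumℤ-↭ : {A : Set} (f : A → ℤ) {xs ys : List A} → xs ↭ ys → sumℤ (map f xs) ≡ sumℤ (map f ys)
sumℤ-↭ f _↭_.refl        = refl
sumℤ-↭ f (prep x p)      = cong (λ s → f x ℤ.+ s) (sumℤ-↭ f p)
sumℤ-↭ f (swap {xs} {ys} x y p) = trans (cong (λ s → f x ℤ.+ (f y ℤ.+ s)) (sumℤ-↭ f p)) (lem (f x) (f y) (sumℤ (map f ys)))
  where
  lem = ring26
sumℤ-↭ f (_↭_.trans p q) = trans (sumℤ-↭ f p) (sumℤ-↭ f q)

countB-↭ : {A : Set} (p : A → Bool) {xs ys : List A} → xs ↭ ys → countB p xs ≡ countB p ys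
countB-↭ p _↭_.refl        = refl
countB-↭ p (prep x q) rewrite countB-↭ p q = refl
countB-↭ p (swap x y q) rewrite countB-↭ p q with p x | p y
... | true  | true  = refl
... | true  | false = refl
... | false | true  = refl
... | false | false = refl
countB-↭ p (_↭_.trans q r) = trans (countB-↭ p q) (countB-↭ p r)

sumℤ-cong-∈ : {A : Set} {f g : A → ℤ} (xs : List A) → (∀ {x} → x ∈ xs → f x ≡ g x) → sumℤ (map f xs) ≡ sumℤ (map g xs)
sumℤ-cong-∈ []       h = refl
sumℤ-cong-∈ (x ∷ xs) h = cong₂ ℤ._+_ (h (here refl)) (sumℤ-cong-∈ xs (λ m → h (there m)))

size-eq : ∀ k {τ d} (C : IsCore (suc k) (at τ) d) M → length τ ≤ M → sum (𝔭 k τ) + Σℕ M d ≡ Σℕ M (λ r → suc k + r)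
size-eq k {τ} {d} C M l =
  trans (cong (_+ Σℕ M d) (sum-at (𝔭 k τ) M (≤-trans (≤-reflexive (FromCore.length-𝔭 k {τ} C)) l)))
    (trans (sym (Σℕ-+ M (at (𝔭 k τ)) d)) (Σℕ-cong M (FromCore.at-𝔭 k {τ} C)))

length-≤ : ∀ {τ κ} → T (isPartition τ) → (∀ r → at τ r ≤ at κ r) → length τ ≤ length κ
length-≤ {τ} {κ} p s with length τ ≤? length κ
... | yes q = q
... | no q  = ⊥-elim (n≮0 (≤-trans (≤-trans (partition-pos {τ} p (length κ) (≰⇒> q)) (s (length κ))) (≤-reflexive (at-length κ (length κ) ≤-refl))))

contained-⁺ : ∀ τ κ → (∀ r → at τ r ≤ at κ r) → T (contained τ κ)
contained-⁺ τ κ s = all⁺ (λ r → at τ r ≤ᵇ at κ r) (upTo (length τ)) (λ {r} _ → ≤⇒≤ᵇ (s r))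

module CoverSum (k ℓ : ℕ) {κ : List ℕ} {d : ℕ → ℕ} (pt : T (isPartition κ)) (C : IsCore (suc k) (at κ) d) (len : length κ ≤ suc ℓ) where
  open IsCore C

  end : at κ (suc ℓ) ≡ 0
  end = at-length κ (suc ℓ) len

  row-bound : ∀ {j} (cv : Cover d j) → j < suc ℓ
  row-bound {j} cv with j <? suc ℓ
  ... | yes p = p
  ... | no p  = ⊥-elim (n≮0 (≤-trans (CoverFacts.cover-row C cv) (≤-trans (mono-≤ (≤-trans (≮⇒≥ p) (m≤m+n j _))) (≤-reflexive end))))

  -- Existence of a cover is decided by running the resolution of a raised row, at an arbitrary
  -- exponent vector, and keeping only which case occurs.
  cover? : ∀ j → Cover d j ⊎ (¬ Cover d j)
  cover? j with j ≤? ℓ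
  ... | no p  = inj₂ (λ cv → p (≤-pred (row-bound cv)))
  ... | yes p with Resolve.resolve ℓ (suc k) [] C end {j} {j} (m≤n⇒m≤1+n p) p here
  ...   | Moves.covered cv _ = inj₁ cv
  ...   | Moves.barren h _   = inj₂ h

  moveList : ∀ {j} → Cover d j → List ℕ
  moveList cv = shape κ (Below.τ C cv) (Below.τ-mono C cv) (Below.τ-≤ C cv)

  at-move : ∀ {j} (cv : Cover d j) r → at (moveList cv) r ≡ Below.τ C cv r
  at-move cv = at-shape κ (Below.τ C cv) (Below.τ-mono C cv) (Below.τ-≤ C cv)

  move-partition : ∀ {j} (cv : Cover d j) → T (isPartition (moveList cv))
  move-partition cv = shape-partition κ (Below.τ C cv) (Below.τ-mono C cv) (Below.τ-≤ C cv)

  move-core : ∀ {j} (cv : Cover d j) → IsCore (suc k) (at (moveList cv)) (Below.dτ C cv)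
  move-core cv = isCore-resp (λ r → sym (at-move cv r)) (Below.core C cv)

  move-≤ : ∀ {j} (cv : Cover d j) r → at (moveList cv) r ≤ at κ r
  move-≤ cv r = ≤-trans (≤-reflexive (at-move cv r)) (Below.τ-≤ C cv r)

  move-length : ∀ {j} (cv : Cover d j) → length (moveList cv) ≤ suc ℓ
  move-length cv = ≤-trans (length-≤ {moveList cv} {κ} (move-partition cv) (move-≤ cv)) len

  covered : List (List ℕ)
  covered = filterB (λ τ → strongCover k τ κ) (subPartitions κ)

  moves : ℕ → List (List ℕ)
  moves j = [ (λ cv → moveList cv ∷ []) , (λ _ → []) ] (cover? j)

  sizes : ∀ a b c e s → a + b ≡ s → c + e ≡ s → e ≡ suc b → suc c ≡ a
  sizes a b c e s p q r = ≤-antisym (lin≤ (a ∷ b ∷ s ∷ c ∷ e ∷ []) 1 (# 1 ⊹ $ 3) ($ 0) ($ 2 ≐ $ 0 ⊹ $ 1 ∋ sym p ∷ $ 3 ⊹ $ 4 ≐ $ 2 ∋ q ∷ # 1 ⊹ $ 1 ≐ $ 4 ∋ sym r ∷ [])) (lin≤ (a ∷ b ∷ s ∷ c ∷ e ∷ []) 1 ($ 0) (# 1 ⊹ $ 3) ($ 0 ⊹ $ 1 ≐ $ 2 ∋ p ∷ $ 2 ≐ $ 3 ⊹ $ 4 ∋ sym q ∷ $ 4 ≐ # 1 ⊹ $ 1 ∋ r ∷ []))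

  sizes⁻ : ∀ a b c e s → a + b ≡ s → c + e ≡ s → suc c ≡ a → e ≡ suc b
  sizes⁻ a b c e s p q r = ≤-antisym (lin≤ (a ∷ b ∷ s ∷ c ∷ e ∷ []) 1 ($ 4) (# 1 ⊹ $ 1) ($ 2 ≐ $ 0 ⊹ $ 1 ∋ sym p ∷ $ 3 ⊹ $ 4 ≐ $ 2 ∋ q ∷ $ 0 ≐ # 1 ⊹ $ 3 ∋ sym r ∷ [])) (lin≤ (a ∷ b ∷ s ∷ c ∷ e ∷ []) 1 (# 1 ⊹ $ 1) ($ 4) ($ 0 ⊹ $ 1 ≐ $ 2 ∋ p ∷ $ 2 ≐ $ 3 ⊹ $ 4 ∋ sym q ∷ # 1 ⊹ $ 3 ≐ $ 0 ∋ r ∷ []))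

  move∈ : ∀ {j} (cv : Cover d j) → moveList cv ∈ covered
  move∈ cv = filterB-∈⁺ (λ τ → strongCover k τ κ) (subPartitions κ)
    (shape∈ κ (Below.τ C cv) (Below.τ-mono C cv) (Below.τ-≤ C cv))
    (T-∧⁺ (FromCore.isCore-T k {moveList cv} (move-core cv)) (T-∧⁺ (FromCore.isCore-T k {κ} C)
      (T-∧⁺ (contained-⁺ (moveList cv) κ (move-≤ cv)) (≡⇒≡ᵇ _ _
        (sizes (sum (𝔭 k κ)) (Σℕ (suc ℓ) d) (sum (𝔭 k (moveList cv))) (Σℕ (suc ℓ) (Below.dτ C cv)) _
          (size-eq k {κ} C (suc ℓ) len) (size-eq k {moveList cv} (move-core cv) (suc ℓ) (move-length cv)) (CoverFacts.cover-size C cv (suc ℓ) end))))))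

  covered⁻ : ∀ {τ} → τ ∈ covered → T (isPartition τ) × (∀ r → at τ r ≤ at κ r) × T (isCore k τ) × suc (sum (𝔭 k τ)) ≡ sum (𝔭 k κ)
  covered⁻ {τ} m with filterB-∈⁻ (λ τ → strongCover k τ κ) (subPartitions κ) m
  ... | a , t with ∈-subPartitions-⁻ κ a | ∧-T {isCore k τ} t
  ... | p , s | t₁ , t₂ = p , s , t₁ , ≡ᵇ⇒≡ (suc (sum (𝔭 k τ))) (sum (𝔭 k κ)) (proj₂ (∧-T {contained τ κ} (proj₂ (∧-T {isCore k κ} t₂))))

  -- `Descent` yields a bead move whose core contains τ. That core and τ both have bounded size one
  -- less than κ, whereas by `size-strict` a strict inclusion would lose a further unit.
  completeness : ∀ {τ} → τ ∈ covered → ∃[ j ] Σ (Cover d j) λ cv → τ ≡ moveList cv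
  completeness {τ} m with covered⁻ m
  ... | p , s , t , sz with core-d k {τ} (partition-decr {τ} p) t
  ... | d' , C' = differ (search (λ r → at τ r <? at κ r) (suc ℓ))
    where
    M = suc ℓ
    τ-len : length τ ≤ M
    τ-len = ≤-trans (length-≤ {τ} {κ} p s) len
    grown : Σℕ M d' ≡ suc (Σℕ M d)
    grown = sizes⁻ (sum (𝔭 k κ)) (Σℕ M d) (sum (𝔭 k τ)) (Σℕ M d') _ (size-eq k {κ} C M len) (size-eq k {τ} C' M τ-len) sz
    beyond : ∀ r → M ≤ r → at τ r ≡ 0
    beyond r l = at-length τ r (≤-trans τ-len l)
    agree : ∀ {f : ℕ → ℕ} → (∀ r → at τ r ≤ f r) → (∀ r → M ≤ r → f r ≡ 0) → (∀ r → r < M → ¬ (at τ r < f r)) → ∀ r → at τ r ≡ f r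
    agree s z h r with r <? M
    ... | yes q = ≤-antisym (s r) (≮⇒≥ (h r q))
    ... | no q  = trans (beyond r (≮⇒≥ q)) (sym (z r (≮⇒≥ q)))
    found : Descent.Goal C C' s M end → ∃[ j ] Σ (Cover d j) λ cv → τ ≡ moveList cv
    found (j , cv , sub') = j , cv , partition-ext {τ} {moveList cv} p (move-partition cv) (λ r → trans (same (search (λ r → at τ r <? Below.τ C cv r) M) r) (sym (at-move cv r)))
      where
      same : (∃[ r ] at τ r < Below.τ C cv r) ⊎ (∀ r → r < M → ¬ (at τ r < Below.τ C cv r)) → ∀ r → at τ r ≡ Below.τ C cv r
      same (inj₂ h) = agree sub' (λ r l → n≤0⇒n≡0 (≤-trans (Below.τ-≤ C cv r) (≤-trans (mono-≤ l) (≤-reflexive end)))) h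
      same (inj₁ (r' , lt)) = ⊥-elim (<-irrefl (trans (CoverFacts.cover-size C cv M end) (sym grown))
        (size-strict C' M (Σℕ M (Below.τ C cv)) (Below.core C cv) sub' (n≤0⇒n≡0 (≤-trans (Below.τ-≤ C cv M) (≤-reflexive end))) ≤-refl r' lt))
    differ : (∃[ r ] at τ r < at κ r) ⊎ (∀ r → r < M → ¬ (at τ r < at κ r)) → ∃[ j ] Σ (Cover d j) λ cv → τ ≡ moveList cv
    differ (inj₁ (r , lt)) = found (Descent.exists C C' s M end r lt)
    differ (inj₂ h) = ⊥-elim (1+n≢n (trans (sym grown) (Σℕ-cong M (λ r → d-unique C' (isCore-resp (λ r → sym (agree s (λ r l → at-length κ r (≤-trans len l)) h r)) C) r))))

  covered-↭ : covered ↭ concatMap moves (upTo (suc ℓ))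
  covered-↭ = set-↭ (filterB-unique _ (subPartitions-unique κ)) (unique-concatMap moves (UniqueP.upTo⁺ (suc ℓ)) single disjoint) to from
    where
    single : ∀ j → Unique (moves j)
    single j with cover? j
    ... | inj₁ cv = [] ∷ []
    ... | inj₂ _  = []
    -- The move with lowest top row j raises d j, whereas a move with a later lowest top row keeps
    -- or lowers d j.
    rows-lt : ∀ {j j'} (cv : Cover d j) (cv' : Cover d j') → j < j' → moveList cv ≢ moveList cv'
    rows-lt {j} {j'} cv cv' l e = <-irrefl refl (≤-trans (≤-reflexive (sym up)) (≤-trans (≤-reflexive same) down′))
      where
      same : Below.dτ C cv j ≡ Below.dτ C cv' j
      same = d-unique (move-core cv) (isCore-resp (λ r → cong (λ z → at z r) (sym e)) (move-core cv')) j
      open Moves 0 (suc k) [] C using (dMove-up; dMove-out; dMove-low; range?)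
      up : Below.dτ C cv j ≡ suc (d j)
      up = trans (cong (Below.dτ C cv) (sym (+-identityʳ j))) (trans (dMove-up (Cover.w cv) (tower-low C (Cover.tower cv)) 0 z≤n) (cong (λ z → suc (d z)) (+-identityʳ j)))
      down′ : Below.dτ C cv' j ≤ d j
      down′ with range? (Cover.y cv') (Cover.w cv') j
      ... | inj₁ (a , b) = ≤-trans (n≤1+n _) (≤-reflexive (dMove-low (Cover.w cv') (tower-low C (Cover.tower cv')) j a b))
      ... | inj₂ o       = ≤-reflexive (dMove-out (Cover.w cv') (tower-low C (Cover.tower cv')) j l o)
    disjoint : ∀ {x y b} → b ∈ moves x → b ∈ moves y → x ≡ y
    disjoint {x} {y} p q with cover? x | cover? y
    disjoint {x} {y} (here refl) (here e) | inj₁ cv | inj₁ cv' with <-cmp x y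
    ... | tri< l _ _ = ⊥-elim (rows-lt cv cv' l e)
    ... | tri≈ _ r _ = r
    ... | tri> _ _ l = ⊥-elim (rows-lt cv' cv l (sym e))
    to : ∀ {τ} → τ ∈ covered → τ ∈ concatMap moves (upTo (suc ℓ))
    to m with completeness m
    ... | j , cv , refl = ∈-concatMap-intro moves (∈-upTo⁺ (row-bound cv)) at-j
      where
      at-j : moveList cv ∈ moves j
      at-j with cover? j
      ... | inj₂ h   = ⊥-elim (h cv)
      ... | inj₁ cv' = here (partition-ext {moveList cv} {moveList cv'} (move-partition cv) (move-partition cv')
              (λ r → trans (at-move cv r) (trans (proj₂ (proj₂ (proj₂ (CoverFacts.cover-unique C cv cv'))) r) (sym (at-move cv' r)))))
    from : ∀ {τ} → τ ∈ concatMap moves (upTo (suc ℓ)) → τ ∈ covered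
    from m with ∈-concatMap-elim moves (upTo (suc ℓ)) m
    ... | j , _ , q with cover? j
    from m | j , _ , here refl | inj₁ cv = move∈ cv

  perCover : (List ℕ → ℕ → ℕ → ℤ) → ℕ → ℤ
  perCover g j = [ (λ cv → sumℤ (map (λ x → g (moveList cv) (suc x) (Cover.c cv * Cover.w cv + countB (λ v → x <ᵇ v) (Below.xs C cv))) (Below.xs C cv))) , (λ _ → + 0) ] (cover? j)

  coversInto-sum : ∀ (g : List ℕ → ℕ → ℕ → ℤ) →
    sumℤ (map (λ p → g (proj₁ p) (proj₁ (proj₂ p)) (proj₂ (proj₂ p))) (coversInto k κ)) ≡ Σ< (suc ℓ) (perCover g)
  coversInto-sum g = begin
    sumℤ (map g′ (coversInto k κ))
      ≡⟨ sumℤ-concatMap g′ (λ τ → map (λ r → τ , r , spin τ κ r) (markings τ κ)) covered ⟩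
    sumℤ (map (λ τ → sumℤ (map g′ (map (λ r → τ , r , spin τ κ r) (markings τ κ)))) covered)
      ≡⟨ sumℤ-map-cong (λ τ → cong sumℤ (sym (map-∘ (markings τ κ)))) covered ⟩
    sumℤ (map inner covered)
      ≡⟨ sumℤ-↭ inner covered-↭ ⟩
    sumℤ (map inner (concatMap moves (upTo (suc ℓ))))
      ≡⟨ sumℤ-concatMap inner moves (upTo (suc ℓ)) ⟩
    sumℤ (map (λ j → sumℤ (map inner (moves j))) (upTo (suc ℓ)))
      ≡⟨ sumℤ-upTo (suc ℓ) _ ⟩
    Σ< (suc ℓ) (λ j → sumℤ (map inner (moves j)))
      ≡⟨ Σ<-cong (suc ℓ) (λ j _ → each j) ⟩
    Σ< (suc ℓ) (perCover g) ∎
    where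
    open ≡-Reasoning
    g′ : List ℕ × ℕ × ℕ → ℤ
    g′ p = g (proj₁ p) (proj₁ (proj₂ p)) (proj₂ (proj₂ p))
    inner : List ℕ → ℤ
    inner τ = sumℤ (map (λ r → g τ r (spin τ κ r)) (markings τ κ))
    each : ∀ j → sumℤ (map inner (moves j)) ≡ perCover g j
    each j with cover? j
    ... | inj₂ _  = refl
    ... | inj₁ cv = trans (ℤP.+-identityʳ _) (begin
      inner τ
        ≡⟨ cong (λ rs → sumℤ (map (λ r → g τ r (spin τ κ r)) rs)) markings-≡ ⟩
      sumℤ (map (λ r → g τ r (spin τ κ r)) (map suc vs))
        ≡⟨ cong sumℤ (sym (map-∘ vs)) ⟩
      sumℤ (map (λ x → g τ (suc x) (spin τ κ (suc x))) vs)
        ≡⟨ sumℤ-cong-∈ vs (λ {x} m → cong (g τ (suc x)) (trans (spin-≡ x m)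
             (cong₂ _+_ (cong (_* w) (trans (Data.List.Relation.Binary.Permutation.Propositional.Properties.↭-length vs-↭) (tops-length tower))) (countB-↭ (λ v → x <ᵇ v) vs-↭)))) ⟩
      sumℤ (map (λ x → g τ (suc x) (c * w + countB (λ v → x <ᵇ v) (Below.xs C cv))) vs)
        ≡⟨ sumℤ-↭ _ vs-↭ ⟩
      sumℤ (map (λ x → g τ (suc x) (c * w + countB (λ v → x <ᵇ v) (Below.xs C cv))) (Below.xs C cv)) ∎)
      where
      import Data.List.Relation.Binary.Permutation.Propositional.Properties
      open Cover cv
      τ = moveList cv
      open Ribbons {κ = κ} {τ = τ} C cv (at-move cv)

  -- The coefficient extraction A z z is the sum over the covers marked in row z.
  module Marked (η : List ℕ) (z : ℕ) (zl : z ≤ suc ℓ) where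
    open Catalan (suc ℓ) (suc k) η

    -- The share of the cover with lowest top row j: if p is a top row i levels above j, the
    -- exponent c w + i is the spin of that cover marked in row p.
    contribution : ℕ → ℕ → Ser₂
    contribution p j e t = [ (λ cv → pick (jumpTo p (Cover.tower cv)) (λ i → delayBy (Cover.c cv * Cover.w cv + i) (F z (Below.dτ C cv)) e t)) , (λ _ → + 0) ] (cover? j)

    raised : ∀ {p} → p ≤ ℓ → Path d z p → ∀ e t → F z (raiseAt p d) e t ≡ contribution p p e t
    raised {p} pl P e t with cover? p | Resolve.resolve ℓ (suc k) η C end zl pl P
    ... | inj₁ cv | Moves.covered cv' h with CoverFacts.cover-unique C cv cv'
    ...   | w≡ , c≡ , d≡ , _ = trans (h e t) (trans (delayBy-cong (Cover.c cv' * Cover.w cv') (F-cong z (λ r → sym (d≡ r))) e t)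
             (trans (cong (λ s → delayBy s (F z (Below.dτ C cv)) e t) (trans (sym (cong₂ _*_ c≡ w≡)) (sym (+-identityʳ _))))
               (sym (cong (λ m → pick m (λ i → delayBy (Cover.c cv * Cover.w cv + i) (F z (Below.dτ C cv)) e t)) (CoverFacts.jumpTo-self C (Cover.tower cv))))))
    raised {p} pl P e t | inj₁ cv | Moves.barren nc h  = ⊥-elim (nc cv)
    raised {p} pl P e t | inj₂ nc | Moves.covered cv h = ⊥-elim (nc cv)
    raised {p} pl P e t | inj₂ nc | Moves.barren _ h   = h e t

    self-below : ∀ p e t → contribution (d p) p e t ≡ + 0
    self-below p e t with cover? p
    ... | inj₂ _  = refl
    ... | inj₁ cv rewrite CoverFacts.jumpTo-above C (Cover.tower cv) (d p) (d-> p) = refl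

    outside-0 : ∀ p j e t → j < p → contribution p j e t ≡ + 0
    outside-0 p j e t l with cover? j
    ... | inj₂ _  = refl
    ... | inj₁ cv rewrite CoverFacts.jumpTo-above C (Cover.tower cv) p l = refl

    shifted-0 : ∀ p j e → p ≢ j → contribution p j e 0 ≡ + 0
    shifted-0 p j e ne with cover? j
    ... | inj₂ _  = refl
    ... | inj₁ cv rewrite CoverFacts.jumpTo-down C (Cover.tower cv) p ne with jumpTo (d p) (Cover.tower cv)
    ...   | nothing = refl
    ...   | just i  rewrite +-suc (Cover.c cv * Cover.w cv) i = refl

    shifted-suc : ∀ p j e t → p ≢ j → contribution p j e (suc t) ≡ contribution (d p) j e t
    shifted-suc p j e t ne with cover? j
    ... | inj₂ _  = refl
    ... | inj₁ cv rewrite CoverFacts.jumpTo-down C (Cover.tower cv) p ne with jumpTo (d p) (Cover.tower cv)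
    ...   | nothing = refl
    ...   | just i  rewrite +-suc (Cover.c cv * Cover.w cv) i = refl

    Σ<-single : ∀ m p (f : ℕ → ℤ) → p < m → (∀ j → j ≢ p → f j ≡ + 0) → Σ< m f ≡ f p
    Σ<-single (suc m) p f l h with p ≟ m
    ... | yes refl = trans (cong (ℤ._+ f p) (Σ<-zero p (λ j q → h j (<⇒≢ q)))) (ℤP.+-identityˡ _)
    ... | no ne = trans (cong₂ ℤ._+_ (Σ<-single m p f (≤∧≢⇒< (≤-pred l) ne) h) (h m (λ e → ne (sym e)))) (ℤP.+-identityʳ _)

    Σ<-split : ∀ m p (f g : ℕ → ℤ) → p < m → g p ≡ + 0 → (∀ j → j ≢ p → f j ≡ g j) → Σ< m f ≡ f p ℤ.+ Σ< m g
    Σ<-split m p f g l gp h = trans (Σ<-cong m (λ j _ → sym (pointwise j))) (trans (Σ<-+ m _ g) (cong (ℤ._+ Σ< m g) (trans (Σ<-single m p only l (λ j ne → off j ne)) on)))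
      where
      only : ℕ → ℤ
      only j = if j ≡ᵇ p then f p else + 0
      on : only p ≡ f p
      on rewrite ≡ᵇ-refl p = refl
      off : ∀ j → j ≢ p → only j ≡ + 0
      off j ne rewrite ≡ᵇ-≢ ne = refl
      pointwise : ∀ j → only j ℤ.+ g j ≡ f j
      pointwise j with j ≟ p
      ... | yes refl = trans (cong₂ ℤ._+_ on gp) (ℤP.+-identityʳ _)
      ... | no ne    = trans (cong₂ ℤ._+_ (off j ne) (sym (h j ne))) (ℤP.+-identityˡ _)

    -- The first term of `A-expand` accounts for the cover whose lowest top row is p. The factor t
    -- of the second matches the one additional component below the mark when p stands in place of d
    -- p.
    path-sum : ∀ fuel p → suc ℓ ≤ p + fuel → p ≤ ℓ → Path d z p → ∀ e t → A z d p e t ≡ Σ< (suc ℓ) (λ j → contribution p j e t)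
    path-sum zero p fl pl P e t = ⊥-elim (lin⊥ (ℓ ∷ p ∷ []) (# 1 ⊹ $ 0 ⊴ $ 1 ⊹ # 0 ∋ fl ∷ $ 1 ⊴ $ 0 ∋ pl ∷ []))
    path-sum (suc fuel) p fl pl P e t with d p <? suc ℓ
    ... | no q = trans (A-end z d p (≮⇒≥ q) e t) (trans (raised pl P e t) (sym (Σ<-split-0 t)))
      where
      far : ∀ j → j < suc ℓ → ∀ t → contribution (d p) j e t ≡ + 0
      far j l t = outside-0 (d p) j e t (≤-trans l (≮⇒≥ q))
      only-p : ∀ t j → j < suc ℓ → j ≢ p → contribution p j e t ≡ + 0
      only-p zero    j l ne = shifted-0 p j e (λ e → ne (sym e))
      only-p (suc t) j l ne = trans (shifted-suc p j e t (λ e → ne (sym e))) (far j l t)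
      Σ<-split-0 : ∀ t → Σ< (suc ℓ) (λ j → contribution p j e t) ≡ contribution p p e t
      Σ<-split-0 t = trans (Σ<-cong (suc ℓ) (λ j l → masked j l (j ≟ p))) (trans (Σ<-single (suc ℓ) p g (s≤s pl) g-off) g-on)
        where
        g : ℕ → ℤ
        g j = if j ≡ᵇ p then contribution p p e t else + 0
        g-on : g p ≡ contribution p p e t
        g-on rewrite ≡ᵇ-refl p = refl
        g-off : ∀ j → j ≢ p → g j ≡ + 0
        g-off j ne rewrite ≡ᵇ-≢ ne = refl
        masked : ∀ j → j < suc ℓ → Dec (j ≡ p) → contribution p j e t ≡ g j
        masked j l (yes refl) = sym g-on
        masked j l (no ne)    = trans (only-p t j l ne) (sym (g-off j ne))
    path-sum (suc fuel) p fl pl P e zero | yes q =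
      trans (A-expand-0 z d p (d-> p) q e) (trans (raised pl P e 0) (sym (Σ<-single (suc ℓ) p _ (s≤s pl) (λ j ne → shifted-0 p j e (λ e → ne (sym e))))))
    path-sum (suc fuel) p fl pl P e (suc t) | yes q =
      trans (A-expand z d p (d-> p) q e t)
        (trans (cong₂ ℤ._+_ (raised pl P e (suc t)) (path-sum fuel (d p) (lin≤ (ℓ ∷ p ∷ fuel ∷ d p ∷ []) 1 (# 1 ⊹ $ 0) ($ 3 ⊹ $ 2) (# 1 ⊹ $ 0 ⊴ $ 1 ⊹ (# 1 ⊹ $ 2) ∋ fl ∷ # 1 ⊹ $ 1 ⊴ $ 3 ∋ d-> p ∷ [])) (≤-pred q) (down P refl) e t))
          (sym (Σ<-split (suc ℓ) p _ (λ j → contribution (d p) j e t) (s≤s pl) (self-below p e t) (λ j ne → shifted-suc p j e t (λ e → ne (sym e))))))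

    marked-sum : z ≤ ℓ → ∀ e t → A z d z e t ≡ Σ< (suc ℓ) (λ j → contribution z j e t)
    marked-sum zl′ = path-sum (suc ℓ) z (m≤n+m (suc ℓ) z) zl′ here

    perCover-marked : ∀ (G : List ℕ → ℕ → ℤ) e t →
      (∀ {j} (cv : Cover d j) s → G (moveList cv) s ≡ delayBy s (F z (Below.dτ C cv)) e t) →
      ∀ j → perCover (λ τ r s → if r ≡ᵇ suc z then G τ s else + 0) j ≡ contribution z j e t
    perCover-marked G e t h j with cover? j
    ... | inj₂ _  = refl
    ... | inj₁ cv = trans (CoverFacts.jumpTo-sum C tower z (λ x → G (moveList cv) (c * w + countB (λ v → x <ᵇ v) (Below.xs C cv)))) (found (jumpTo z tower) refl)
      where
      open Cover cv
      found : ∀ m → jumpTo z tower ≡ m → pick m (λ _ → G (moveList cv) (c * w + countB (λ v → z <ᵇ v) (Below.xs C cv))) ≡ pick m (λ i → delayBy (c * w + i) (F z (Below.dτ C cv)) e t)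
      found nothing  q = refl
      found (just i) q = trans (h cv _) (cong (λ s → delayBy (c * w + s) (F z (Below.dτ C cv)) e t) (CoverFacts.jumpTo-count C tower z q))

    A-covers : z ≤ ℓ → ∀ (G : List ℕ → ℕ → ℤ) e t → (∀ {j} (cv : Cover d j) s → G (moveList cv) s ≡ delayBy s (F z (Below.dτ C cv)) e t) →
      A z d z e t ≡ sumℤ (map (λ p → if proj₁ (proj₂ p) ≡ᵇ suc z then G (proj₁ p) (proj₂ (proj₂ p)) else + 0) (coversInto k κ))
    A-covers zl′ G e t h = trans (marked-sum zl′ e t)
      (trans (Σ<-cong (suc ℓ) (λ j _ → sym (perCover-marked G e t h j))) (sym (coversInto-sum (λ τ r s → if r ≡ᵇ suc z then G τ s else + 0))))

-- Peeling the last block off a marked tableau.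

bool-ext : ∀ {a b} → (T a → T b) → (T b → T a) → a ≡ b
bool-ext {false} {false} f g = refl
bool-ext {true}  {true}  f g = refl
bool-ext {false} {true}  f g = ⊥-elim (g tt)
bool-ext {true}  {false} f g = ⊥-elim (f tt)

countB-cong : {A : Set} {p q : A → Bool} → (∀ x → p x ≡ q x) → ∀ xs → countB p xs ≡ countB q xs
countB-cong h []       = refl
countB-cong {q = q} h (x ∷ xs) rewrite h x = cong (λ c → if q x then suc c else c) (countB-cong h xs)

countB-map : {A B : Set} (p : B → Bool) (f : A → B) (xs : List A) → countB p (map f xs) ≡ countB (λ x → p (f x)) xs
countB-map p f []       = refl
countB-map p f (x ∷ xs) = cong (λ c → if p (f x) then suc c else c) (countB-map p f xs)

countB-++ : {A : Set} (p : A → Bool) (xs ys : List A) → countB p (xs ++ ys) ≡ countB p xs + countB p ys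
countB-++ p []       ys = refl
countB-++ p (x ∷ xs) ys with p x
... | true  = cong suc (countB-++ p xs ys)
... | false = countB-++ p xs ys

countB-concatMap : {A B : Set} (p : B → Bool) (f : A → List B) (xs : List A) →
  + countB p (concatMap f xs) ≡ sumℤ (map (λ x → + countB p (f x)) xs)
countB-concatMap p f []       = refl
countB-concatMap p f (x ∷ xs) = trans (cong +_ (countB-++ p (f x) (concatMap f xs)))
  (trans (ℤP.pos-+ (countB p (f x)) _) (cong (λ s → + countB p (f x) ℤ.+ s) (countB-concatMap p f xs)))

countB-false : {A : Set} (xs : List A) → countB (λ _ → false) xs ≡ 0
countB-false []       = refl
countB-false (x ∷ xs) = countB-false xs

data Weighted : List ℕ → List ℕ → Set where
  []   : Weighted [] []
  _⟫_  : ∀ {e es xs rs} → length xs ≡ e × T (decreasing xs) → Weighted es rs → Weighted (e ∷ es) (xs ++ rs)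

take-drop : ∀ e rs → take' e rs ++ drop e rs ≡ rs
take-drop zero    rs       = refl
take-drop (suc e) []       = refl
take-drop (suc e) (r ∷ rs) = cong (r ∷_) (take-drop e rs)

take'-length : ∀ e rs → e ≤ length rs → length (take' e rs) ≡ e
take'-length zero    rs       l       = refl
take'-length (suc e) (r ∷ rs) (s≤s l) = cong suc (take'-length e rs l)

take'-++ : ∀ xs ys → take' (length xs) (xs ++ ys) ≡ xs
take'-++ []       ys = refl
take'-++ (x ∷ xs) ys = cong (x ∷_) (take'-++ xs ys)

drop-++ : ∀ xs (ys : List ℕ) → drop (length xs) (xs ++ ys) ≡ ys
drop-++ []       ys = refl
drop-++ (x ∷ xs) ys = drop-++ xs ys

weighted⁻ : ∀ η rs → T (weightOK η rs) → Weighted η rs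
weighted⁻ []      []       t = []
weighted⁻ (e ∷ η) rs       t with ∧-T {e ≤ᵇ length rs} t
... | a , b with ∧-T {decreasing (take' e rs)} b
...   | c , d = subst (Weighted (e ∷ η)) (take-drop e rs) ((take'-length e rs (≤ᵇ⇒≤ e _ a) , c) ⟫ weighted⁻ η (drop e rs) d)

weighted⁺ : ∀ {η rs} → Weighted η rs → T (weightOK η rs)
weighted⁺ [] = tt
weighted⁺ (_⟫_ {e} {es} {xs} {rs} (refl , d) w) = T-∧⁺ (≤⇒≤ᵇ (≤-trans (m≤m+n _ (length rs)) (≤-reflexive (sym (length-++ xs)))))
  (T-∧⁺ (subst (T ∘ decreasing) (sym (take'-++ xs rs)) d) (subst (T ∘ weightOK es) (sym (drop-++ xs rs)) (weighted⁺ w)))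

weighted-snoc⁻ : ∀ ζ e {rs} → Weighted (ζ ++ e ∷ []) rs → ∃[ xs ] ∃[ ys ] rs ≡ xs ++ ys × Weighted ζ xs × length ys ≡ e × T (decreasing ys)
weighted-snoc⁻ []      e (_⟫_ {xs = ys} (l , d) []) = [] , ys , ++-identityʳ ys , [] , l , d
weighted-snoc⁻ (a ∷ ζ) e (_⟫_ {xs = us} p w) with weighted-snoc⁻ ζ e w
... | xs , ys , refl , w' , l , d = us ++ xs , ys , sym (++-assoc us xs ys) , p ⟫ w' , l , d

weighted-snoc⁺ : ∀ ζ e {xs ys} → Weighted ζ xs → length ys ≡ e → T (decreasing ys) → Weighted (ζ ++ e ∷ []) (xs ++ ys)
weighted-snoc⁺ .[] e {ys = ys} [] l d = subst (Weighted (e ∷ [])) (++-identityʳ ys) ((l , d) ⟫ [])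
weighted-snoc⁺ (a ∷ ζ) e {ys = ys} (_⟫_ {xs = us} {rs = rs} p w) l d = subst (Weighted (a ∷ ζ ++ e ∷ [])) (sym (++-assoc us rs ys)) (_⟫_ {xs = us} p (weighted-snoc⁺ ζ e {ys = ys} w l d))

-- Checks, on the reversed mark sequence, that the last e marks decrease weakly and are at least z.
lastBlock : List ℕ → ℕ → ℕ → List ℕ → Bool
lastBlock ζ z zero    ρ       = weightOK ζ (reverse ρ)
lastBlock ζ z (suc e) []      = false
lastBlock ζ z (suc e) (r ∷ ρ) = (z ≤ᵇ r) ∧ lastBlock ζ r e ρ

decreasing-snoc⁺ : ∀ ys {z r} → T (decreasing ys) → (∀ {y} → y ∈ ys → r ≤ y) → z ≤ r →
  T (decreasing (ys ++ r ∷ [])) × (∀ {y} → y ∈ ys ++ r ∷ [] → z ≤ y)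
decreasing-snoc⁺ []       d h l = tt , λ { (here refl) → l }
decreasing-snoc⁺ (y ∷ ys) {z} {r} d h l = go y ys d h
  where
  go : ∀ y ys → T (decreasing (y ∷ ys)) → (∀ {x} → x ∈ y ∷ ys → r ≤ x) →
    T (decreasing (y ∷ ys ++ r ∷ [])) × (∀ {x} → x ∈ y ∷ ys ++ r ∷ [] → z ≤ x)
  go y []        d h = T-∧⁺ (≤⇒≤ᵇ (h (here refl))) tt , λ { (here refl) → ≤-trans l (h (here refl)) ; (there (here refl)) → l }
  go y (y' ∷ ys) d h with ∧-T {y' ≤ᵇ y} d
  ... | a , b with go y' ys b (λ m → h (there m))
  ...   | p , q = T-∧⁺ a p , λ { (here refl) → ≤-trans l (h (here refl)) ; (there m) → q m }

decreasing-snoc⁻ : ∀ ys {r} → T (decreasing (ys ++ r ∷ [])) → T (decreasing ys) × (∀ {y} → y ∈ ys → r ≤ y)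
decreasing-snoc⁻ []           d = tt , λ ()
decreasing-snoc⁻ (y ∷ ys) {r} d = go y ys d
  where
  go : ∀ y ys → T (decreasing (y ∷ ys ++ r ∷ [])) → T (decreasing (y ∷ ys)) × (∀ {x} → x ∈ y ∷ ys → r ≤ x)
  go y []        d = tt , λ { (here refl) → ≤ᵇ⇒≤ r y (proj₁ (∧-T {r ≤ᵇ y} d)) }
  go y (y' ∷ ys) d with ∧-T {y' ≤ᵇ y} d
  ... | a , b with go y' ys b
  ...   | p , q = T-∧⁺ a p , λ { (here refl) → ≤-trans (q (here refl)) (≤ᵇ⇒≤ y' y a) ; (there m) → q m }

lastBlock⁻ : ∀ ζ z e ρ → T (lastBlock ζ z e ρ) →
  ∃[ xs ] ∃[ ys ] reverse ρ ≡ xs ++ ys × Weighted ζ xs × length ys ≡ e × T (decreasing ys) × (∀ {y} → y ∈ ys → z ≤ y)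
lastBlock⁻ ζ z zero ρ t = reverse ρ , [] , sym (++-identityʳ _) , weighted⁻ ζ (reverse ρ) t , refl , tt , λ ()
lastBlock⁻ ζ z (suc e) (r ∷ ρ) t with ∧-T {z ≤ᵇ r} t
... | a , b with lastBlock⁻ ζ r e ρ b
...   | xs , ys , eq , w , l , d , h with decreasing-snoc⁺ ys d h (≤ᵇ⇒≤ z r a)
...     | d' , h' = xs , ys ++ r ∷ [] , trans (unfold-reverse r ρ) (trans (cong (_++ r ∷ []) eq) (++-assoc xs ys _)) , w ,
        trans (length-++ ys) (trans (+-comm (length ys) 1) (cong suc l)) , d' , h'

lastBlock⁺ : ∀ ζ z e xs {ys} → Reverse ys → Weighted ζ xs → length ys ≡ e → T (decreasing ys) → (∀ {y} → y ∈ ys → z ≤ y) →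
  T (lastBlock ζ z e (reverse (xs ++ ys)))
lastBlock⁺ ζ z .0 xs [] w refl d h = subst (T ∘ weightOK ζ) (sym (trans (reverse-involutive (xs ++ [])) (++-identityʳ xs))) (weighted⁺ w)
lastBlock⁺ ζ z e xs (ys ∶ rs ∶ʳ r) w l d h with decreasing-snoc⁻ ys d
... | d' , h' = subst₂ (λ e ρ → T (lastBlock ζ z e ρ)) (trans (sym (trans (length-++ ys) (+-comm (length ys) 1))) l)
      (sym (trans (cong reverse (sym (++-assoc xs ys _))) (reverse-++ (xs ++ ys) (r ∷ []))))
      (T-∧⁺ (≤⇒≤ᵇ (h (∈-++⁺ʳ ys (here refl)))) (lastBlock⁺ ζ r (length ys) xs rs w refl d' h'))

-- Chains are enumerated from their last core backwards, so the block condition is turned into one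
-- read from the end, where each mark is a lower bound for the one before it.
weightOK-snoc : ∀ ζ e rs → weightOK (ζ ++ e ∷ []) rs ≡ lastBlock ζ 0 e (reverse rs)
weightOK-snoc ζ e rs = bool-ext to from
  where
  to : T (weightOK (ζ ++ e ∷ []) rs) → T (lastBlock ζ 0 e (reverse rs))
  to t with weighted-snoc⁻ ζ e (weighted⁻ (ζ ++ e ∷ []) rs t)
  ... | xs , ys , refl , w , l , d = lastBlock⁺ ζ 0 e xs (reverseView ys) w l d (λ _ → z≤n)
  from : T (lastBlock ζ 0 e (reverse rs)) → T (weightOK (ζ ++ e ∷ []) rs)
  from t with lastBlock⁻ ζ 0 e (reverse rs) t
  ... | xs , ys , eq , w , l , d , _ =
    weighted⁺ (subst (Weighted (ζ ++ e ∷ [])) (trans (sym eq) (reverse-involutive rs)) (weighted-snoc⁺ ζ e w l d))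

module Count (k : ℕ) where

  tableaux : ℕ → List ℕ → List ℕ → ℕ → ℤ
  tableaux m κ η n = + countB (λ { (rs , s) → weightOK η rs ∧ (s ≡ᵇ n) }) (chains k m κ)

  -- Chains whose last block has e marks, all at least z, peeled off from the end.
  peel : List ℕ → ℕ → ℕ → ℕ → List ℕ → ℕ → ℤ
  peel ζ zero    z m κ n = tableaux m κ ζ n
  peel ζ (suc e) z m κ n = sumℤ (map (λ p → if z ≤ᵇ proj₁ (proj₂ p)
    then delayBy (proj₂ (proj₂ p)) (λ _ → peel ζ e (proj₁ (proj₂ p)) (pred m) (proj₁ p)) 0 n else + 0) (coversInto k κ))

  delay-count : ∀ {A : Set} (q : A → Bool) (f : A → ℕ) s n xs →
    + countB (λ x → q x ∧ (f x + s ≡ᵇ n)) xs ≡ delayBy s (λ _ n → + countB (λ x → q x ∧ (f x ≡ᵇ n)) xs) 0 n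
  delay-count q f zero n xs = cong +_ (countB-cong (λ x → cong (λ w → q x ∧ (w ≡ᵇ n)) (+-identityʳ (f x))) xs)
  delay-count q f (suc s) zero xs = cong +_ (trans (countB-cong (λ x → none x) xs) (countB-false xs))
    where
    none : ∀ x → q x ∧ (f x + suc s ≡ᵇ 0) ≡ false
    none x rewrite +-suc (f x) s with q x
    ... | true  = refl
    ... | false = refl
  delay-count q f (suc s) (suc n) xs =
    trans (cong +_ (countB-cong (λ x → cong (λ w → q x ∧ (w ≡ᵇ suc n)) (+-suc (f x) s)) xs)) (delay-count q f s n xs)

  cover-sizes : ∀ κ {p} → p ∈ coversInto k κ → suc (sum (𝔭 k (proj₁ p))) ≡ sum (𝔭 k κ)
  cover-sizes κ {p} m with ∈-concatMap-elim (λ τ → map (λ r → τ , r , spin τ κ r) (markings τ κ)) (filterB (λ τ → strongCover k τ κ) (subPartitions κ)) m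
  ... | τ , a , b with ∈-map⁻ (λ r → τ , r , spin τ κ r) b
  ... | r , _ , refl with filterB-∈⁻ (λ τ → strongCover k τ κ) (subPartitions κ) a
  ... | _ , t = ≡ᵇ⇒≡ (suc (sum (𝔭 k τ))) (sum (𝔭 k κ))
    (proj₂ (∧-T {contained τ κ} (proj₂ (∧-T {isCore k κ} (proj₂ (∧-T {isCore k τ} t))))))

  no-covers : ∀ κ → sum (𝔭 k κ) ≡ 0 → coversInto k κ ≡ []
  no-covers κ z = empty (coversInto k κ) (λ m → 0≢1+n (trans (sym z) (sym (cover-sizes κ m))))
    where
    empty : ∀ {A : Set} (xs : List A) → (∀ {x} → x ∈ xs → ⊥) → xs ≡ []
    empty []       h = refl
    empty (x ∷ xs) h = ⊥-elim (h (here refl))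

  peelSum : List ℕ → ℕ → ℕ → ℕ → ℕ → List (List ℕ × ℕ × ℕ) → ℤ
  peelSum ζ e z m n ps = sumℤ (map (λ p → if z ≤ᵇ proj₁ (proj₂ p)
    then delayBy (proj₂ (proj₂ p)) (λ _ → peel ζ e (proj₁ (proj₂ p)) m (proj₁ p)) 0 n else + 0) ps)

  lastBlockCount : List ℕ → ℕ → ℕ → ℕ → List ℕ × ℕ → Bool
  lastBlockCount ζ z e n x = lastBlock ζ z e (reverse (proj₁ x)) ∧ (proj₂ x ≡ᵇ n)

  -- The size hypothesis keeps the remaining chain length in step with the core; at length 0 there
  -- is nothing to peel, because a core of size 0 covers nothing.
  count-peel : ∀ ζ e z m κ n → sum (𝔭 k κ) ≡ m → + countB (lastBlockCount ζ z e n) (chains k m κ) ≡ peel ζ e z m κ n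
  count-peel ζ zero z m κ n sz = cong +_ (countB-cong (λ x → cong (λ ρ → weightOK ζ ρ ∧ (proj₂ x ≡ᵇ n)) (reverse-involutive (proj₁ x))) (chains k m κ))
  count-peel ζ (suc e) z zero κ n sz = sym (cong (peelSum ζ e z 0 n) (no-covers κ sz))
  count-peel ζ (suc e) z (suc m) κ n sz =
    trans (countB-concatMap (lastBlockCount ζ z (suc e) n) (λ p → map (λ x → proj₁ x ++ (proj₁ (proj₂ p) ∷ []) , proj₂ x + proj₂ (proj₂ p)) (chains k m (proj₁ p))) (coversInto k κ))
      (sumℤ-cong-∈ (coversInto k κ) λ {p} mem → each (proj₁ p) (proj₁ (proj₂ p)) (proj₂ (proj₂ p)) (suc-injective (trans (cover-sizes κ mem) sz)))
    where
    each : ∀ τ r s → sum (𝔭 k τ) ≡ m →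
      + countB (lastBlockCount ζ z (suc e) n) (map (λ x → proj₁ x ++ (r ∷ []) , proj₂ x + s) (chains k m τ)) ≡
      (if z ≤ᵇ r then delayBy s (λ _ → peel ζ e r m τ) 0 n else + 0)
    each τ r s sz′ with z ≤ᵇ r in eq
    ... | true = trans (cong +_ (trans (countB-map (lastBlockCount ζ z (suc e) n) (λ x → proj₁ x ++ (r ∷ []) , proj₂ x + s) (chains k m τ))
              (countB-cong (λ x → cong (_∧ (proj₂ x + s ≡ᵇ n)) (hit (proj₁ x))) (chains k m τ))))
          (trans (delay-count (λ x → lastBlock ζ r e (reverse (proj₁ x))) proj₂ s n (chains k m τ))
            (delayBy-cong s (λ _ n → count-peel ζ e r m τ n sz′) 0 n))
      where
      hit : ∀ rs → lastBlock ζ z (suc e) (reverse (rs ++ r ∷ [])) ≡ lastBlock ζ r e (reverse rs)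
      hit rs rewrite reverse-++ rs (r ∷ []) | eq = refl
    ... | false = cong +_ (trans (countB-map (lastBlockCount ζ z (suc e) n) (λ x → proj₁ x ++ (r ∷ []) , proj₂ x + s) (chains k m τ))
            (trans (countB-cong (λ x → cong (_∧ (proj₂ x + s ≡ᵇ n)) (miss (proj₁ x))) (chains k m τ)) (countB-false (chains k m τ))))
      where
      miss : ∀ rs → lastBlock ζ z (suc e) (reverse (rs ++ r ∷ [])) ≡ false
      miss rs rewrite reverse-++ rs (r ∷ []) | eq = refl

sumℤ-+ : {A : Set} (f g : A → ℤ) (xs : List A) → sumℤ (map (λ x → f x ℤ.+ g x) xs) ≡ sumℤ (map f xs) ℤ.+ sumℤ (map g xs)
sumℤ-+ f g []       = refl
sumℤ-+ f g (x ∷ xs) = trans (cong (λ s → f x ℤ.+ g x ℤ.+ s) (sumℤ-+ f g xs)) (interchange (f x) (g x) _ _)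

delayBy-const : ∀ s {X : Ser₂} {f : ℕ → ℤ} e → (∀ n → f n ≡ X e n) → ∀ n → delayBy s (λ _ → f) 0 n ≡ delayBy s X e n
delayBy-const zero    e h n       = h n
delayBy-const (suc s) e h zero    = refl
delayBy-const (suc s) e h (suc n) = delayBy-const s e h n

≤ᵇ-false : ∀ {a b} → b < a → (a ≤ᵇ b) ≡ false
≤ᵇ-false {a} {b} l with a ≤ᵇ b in e
... | false = refl
... | true  = ⊥-elim (<⇒≱ l (≤ᵇ⇒≤ a b (Equivalence.from T-≡ e)))

-- Adding a variable to a Catalan function, and its constant term.

data Roots (ℓ : ℕ) : List Factor → Set where
  []  : Roots ℓ []
  _∷_ : ∀ {i j fs} → i < j × j < ℓ → Roots ℓ fs → Roots ℓ (root i j ∷ fs)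

map-roots : ∀ ℓ ps → (∀ {p} → p ∈ ps → proj₁ p < proj₂ p × proj₂ p < ℓ) → Roots ℓ (map toRoot ps)
map-roots ℓ []       h = []
map-roots ℓ (p ∷ ps) h = h (here refl) ∷ map-roots ℓ ps (λ m → h (there m))

Ψ-roots : ∀ ℓ d → Roots ℓ (Ψ ℓ d)
Ψ-roots ℓ d = map-roots ℓ _ (λ m → ∈-pairsLt⁻ ℓ (proj₁ (∈-filter⁻ (λ p → d (proj₁ p) ≤? proj₂ p) {xs = pairsLt ℓ} m)))

module _ (ℓ : ℕ) (η : List ℕ) where
  open Expansion (λ γ → Schur ℓ γ η) (λ h → Schur-cong ℓ η (λ r _ → h r))

  lows-no-e : ∀ m z fs γ n → K (lows m z ++ fs) γ 0 n ≡ K fs γ 0 n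
  lows-no-e zero    z fs γ n = refl
  lows-no-e (suc m) z fs γ n = lows-no-e m (suc z) fs γ n

  lows-no-t : ∀ m z γ e n → K (lows m z) γ e (suc n) ≡ + 0
  lows-no-t zero    z γ zero    n = refl
  lows-no-t zero    z γ (suc e) n = refl
  lows-no-t (suc m) z γ zero    n = lows-no-t m (suc z) γ zero n
  lows-no-t (suc m) z γ (suc e) n = cong₂ ℤ._+_ (lows-no-t m (suc z) γ (suc e) n) (lows-no-t (suc m) z _ e n)

  roots-no-e : ∀ {fs} → Roots ℓ fs → ∀ γ e n → K fs γ (suc e) n ≡ + 0
  roots-no-e []       γ e n       = refl
  roots-no-e (r ∷ rs) γ e zero    = roots-no-e rs γ e zero
  roots-no-e (r ∷ rs) γ e (suc n) = cong₂ ℤ._+_ (roots-no-e rs γ e (suc n)) (roots-no-e (r ∷ rs) _ e n)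

module KAt (ℓ : ℕ) (η : List ℕ) = Expansion (λ γ → Schur ℓ γ η) (λ h → Schur-cong ℓ η (λ r _ → h r))

K-at : ∀ ℓ (η : List ℕ) → List Factor → Weight → Ser₂
K-at = KAt.K

-- The roots only shift the weight, so the branching of the Schur function can be applied under
-- them; the `low` factors are then moved to the front.
K-snoc : ∀ ℓ η e {fs} → Roots ℓ fs → ∀ γ n → K-at ℓ (η ++ e ∷ []) fs γ 0 n ≡ K-at ℓ η (lows ℓ 0 ++ fs) γ e n
K-snoc ℓ η e {fs} rs γ n = trans (go rs γ n) (KAt.K-perm ℓ η (++-comm fs (lows ℓ 0)) γ e n)
  where
  go : ∀ {fs} → Roots ℓ fs → ∀ γ n → K-at ℓ (η ++ e ∷ []) fs γ 0 n ≡ K-at ℓ η (fs ++ lows ℓ 0) γ e n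
  go []       γ zero    = Schur-snoc ℓ η e γ
  go []       γ (suc n) = sym (lows-no-t ℓ η ℓ 0 γ e n)
  go (r ∷ rs) γ zero    = go rs γ zero
  go (r ∷ rs) γ (suc n) = cong₂ ℤ._+_ (go rs γ (suc n)) (go (r ∷ rs) _ n)

-- At the constant coefficient a weight whose first nonzero entry is positive gives 0.
Leading : ℕ → Weight → Set
Leading ℓ γ = ∃[ i ] i < ℓ × (∀ r → r < i → γ r ≡ + 0) × ∃[ a ] γ i ≡ + suc a

Schur-leading : ∀ ℓ γ → Leading ℓ γ → Schur ℓ γ [] ≡ + 0
Schur-leading (suc ℓ) γ (zero , _ , _ , a , e) = Schur-[]-pos ℓ γ a e
Schur-leading (suc ℓ) γ (suc i , s≤s l , h , a , e) =
  trans (Schur-[]-tail ℓ γ (h 0 (s≤s z≤n))) (Schur-leading ℓ (λ r → γ (suc r)) (i , l , (λ r q → h (suc r) (s≤s q)) , a , e))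

Schur-zero : ∀ ℓ γ → (∀ r → r < ℓ → γ r ≡ + 0) → Schur ℓ γ [] ≡ + 1
Schur-zero zero    γ h = refl
Schur-zero (suc ℓ) γ h = trans (Schur-[]-tail ℓ γ (h 0 (s≤s z≤n))) (Schur-zero ℓ (λ r → γ (suc r)) (λ r l → h (suc r) (s≤s l)))

shift-root-at : ∀ {i j} γ → i < j → shift (root i j) γ i ≡ γ i ℤ.+ + 1
shift-root-at {i} {j} γ l rewrite δ-same i | δ-diff {j} {i} (<⇒≢ l) = refl

shift-root-before : ∀ {i j r} γ → i < j → r < i → shift (root i j) γ r ≡ γ r
shift-root-before {i} {j} {r} γ l q rewrite δ-diff {i} {r} (<⇒≢ q) | δ-diff {j} {r} (<⇒≢ (<-trans q l)) = ℤP.+-identityʳ _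

-- A root adds to a row above the one from which it subtracts, so the first nonzero entry stays
-- positive, or a new positive one appears before it.
leading-shift : ∀ {ℓ i j} → i < j → j < ℓ → ∀ γ → Leading ℓ γ → Leading ℓ (shift (root i j) γ)
leading-shift {ℓ} {i} {j} l u γ (p , pl , h , a , e) with <-cmp i p
... | tri< q _ _ = i , <-trans l u , (λ r s → trans (shift-root-before γ l s) (h r (<-trans s q))) , 0 , trans (shift-root-at γ l) (cong (ℤ._+ + 1) (h i q))
... | tri≈ _ refl _ = i , pl , (λ r s → trans (shift-root-before γ l s) (h r s)) , a + 1 , trans (shift-root-at γ l) (cong (ℤ._+ + 1) e)
... | tri> _ _ q = p , pl , (λ r s → trans (shift-root-before γ l (<-trans s q)) (h r s)) , a , trans (shift-root-before γ l q) e

roots-∈ : ∀ {ℓ fs f} → Roots ℓ fs → f ∈ fs → ∃[ i ] ∃[ j ] f ≡ root i j × i < j × j < ℓ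
roots-∈ (r ∷ rs) (here refl) = _ , _ , refl , r
roots-∈ (r ∷ rs) (there m)   = roots-∈ rs m

K-leading : ∀ ℓ {fs} → Roots ℓ fs → ∀ γ → Leading ℓ γ → ∀ e n → K-at ℓ [] fs γ e n ≡ + 0
K-leading ℓ {fs} rs = KAt.K-zero ℓ [] (Leading ℓ) (Schur-leading ℓ) fs stable
  where
  stable : ∀ f → f ∈ fs → ∀ γ → Leading ℓ γ → Leading ℓ (shift f γ)
  stable f m γ h with roots-∈ rs m
  ... | i , j , refl , l , u = leading-shift l u γ h

K-zero-weight : ∀ ℓ {fs} → Roots ℓ fs → ∀ γ → (∀ r → r < ℓ → γ r ≡ + 0) → ∀ n → K-at ℓ [] fs γ 0 n ≡ (if n ≡ᵇ 0 then + 1 else + 0)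
K-zero-weight ℓ []                    γ h zero    = Schur-zero ℓ γ h
K-zero-weight ℓ []                    γ h (suc n) = refl
K-zero-weight ℓ (r ∷ rs)              γ h zero    = K-zero-weight ℓ rs γ h zero
K-zero-weight ℓ ((l , u) ∷ rs) γ h (suc n) = cong₂ ℤ._+_ (K-zero-weight ℓ rs γ h (suc n))
  (K-leading ℓ ((l , u) ∷ rs) _ (_ , <-trans l u , (λ r s → trans (shift-root-before γ l s) (h r (<-trans s (<-trans l u)))) , 0 ,
    trans (shift-root-at γ l) (cong (ℤ._+ + 1) (h _ (<-trans l u)))) 0 n)

-- The hypothesis says that part r of the bounded partition is 0. It gives κ r = κ (n + r) and d (n
-- + r) = n + (n + r), so the argument repeats at row n + r until it passes N.
part-zero : ∀ {n κ d} (C : IsCore n κ d) N → κ N ≡ 0 → ∀ fuel r → N ≤ r + fuel → d r ≡ n + r → κ r ≡ 0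
part-zero C N e zero r l _ = n≤0⇒n≡0 (≤-trans (IsCore.mono-≤ C (≤-trans l (≤-reflexive (+-identityʳ r)))) (≤-reflexive e))
part-zero {n} {κ} {d} C N e (suc fuel) r l dr = trans eq (part-zero C N e fuel (n + r) (lin≤ (N ∷ r ∷ fuel ∷ n ∷ []) 1 ($ 0) ($ 3 ⊹ $ 1 ⊹ $ 2) ($ 0 ⊴ $ 1 ⊹ (# 1 ⊹ $ 2) ∋ l ∷ # 1 ⊴ $ 3 ∋ pos ∷ [])) dnr)
  where
  open IsCore C
  eq : κ r ≡ κ (n + r)
  eq = ≤-antisym (lin≤ (κ r ∷ d r ∷ κ (d r) ∷ n ∷ r ∷ κ (n + r) ∷ []) 1 ($ 0) ($ 5) ($ 0 ⊹ $ 1 ≐ $ 2 ⊹ ($ 3 ⊹ $ 4) ∋ eqn r ∷ $ 3 ⊹ $ 4 ≐ $ 1 ∋ sym dr ∷ $ 2 ≐ $ 5 ∋ cong κ dr ∷ [])) (lin≤ (κ r ∷ d r ∷ κ (d r) ∷ n ∷ r ∷ κ (n + r) ∷ []) 1 ($ 5) ($ 0) ($ 2 ⊹ ($ 3 ⊹ $ 4) ≐ $ 0 ⊹ $ 1 ∋ sym (eqn r) ∷ $ 1 ≐ $ 3 ⊹ $ 4 ∋ dr ∷ $ 5 ≐ $ 2 ∋ sym (cong κ dr) ∷ []))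
  dnr : d (n + r) ≡ n + (n + r)
  dnr = ≤-antisym (d-≤ (n + r)) (lin≤ (d r ∷ n ∷ d (r + n) ∷ r ∷ d (n + r) ∷ []) 1 ($ 1 ⊹ ($ 1 ⊹ $ 3)) ($ 4) ($ 0 ⊹ $ 1 ⊴ $ 2 ∋ d-grow r n ∷ $ 1 ⊹ $ 3 ≐ $ 0 ∋ sym dr ∷ $ 2 ≐ $ 4 ∋ cong d (+-comm r n) ∷ []))

-- The generating function of tableaux is the Catalan function.

module Tableaux (k ℓ : ℕ) where
  open Count k

  record CoreList (m : ℕ) (κ : List ℕ) (d : ℕ → ℕ) : Set where
    field
      partition : T (isPartition κ)
      isCore′   : IsCore (suc k) (at κ) d
      rows      : length κ ≤ suc ℓ
      size      : sum (𝔭 k κ) ≡ m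

  Agrees : List ℕ → Set
  Agrees η = ∀ {m κ d} → CoreList m κ d → ∀ n → tableaux m κ η n ≡ K-at (suc ℓ) η (Ψ (suc ℓ) d) (weightOf (suc k) d) 0 n

  agrees-[] : Agrees []
  agrees-[] {zero} {κ} {d} cl n = trans (start n) (sym (K-zero-weight (suc ℓ) (Ψ-roots (suc ℓ) d) (weightOf (suc k) d) zeros n))
    where
    open CoreList cl
    open IsCore isCore′
    start : ∀ n → tableaux 0 κ [] n ≡ (if n ≡ᵇ 0 then + 1 else + 0)
    start zero    = refl
    start (suc n) = refl
    parts : ∀ xs → sum xs ≡ 0 → ∀ r → at xs r ≡ 0
    parts []       e r       = refl
    parts (x ∷ xs) e zero    = ≤-antisym (lin≤ (x ∷ foldr _+_ 0 xs ∷ []) 1 ($ 0) (# 0) ($ 0 ⊹ $ 1 ≐ # 0 ∋ e ∷ [])) (lin≤ (x ∷ foldr _+_ 0 xs ∷ []) 1 (# 0) ($ 0) [])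
    parts (x ∷ xs) e (suc r) = parts xs (≤-antisym (lin≤ (x ∷ foldr _+_ 0 xs ∷ []) 1 ($ 1) (# 0) ($ 0 ⊹ $ 1 ≐ # 0 ∋ e ∷ [])) (lin≤ (x ∷ foldr _+_ 0 xs ∷ []) 1 (# 0) ($ 1) [])) r
    zeros : ∀ r → r < suc ℓ → weightOf (suc k) d r ≡ + 0
    zeros r _ = trans (cong (λ z → + (suc k + r) ℤ.- + z) (trans (cong (_+ d r) (sym (parts (𝔭 k κ) size r))) (FromCore.at-𝔭 k {κ} isCore′ r))) (ℤP.+-inverseʳ (+ (suc k + r)))
  agrees-[] {suc m} {κ} {d} cl n = trans (cong +_ none) (sym (K-leading (suc ℓ) (Ψ-roots (suc ℓ) d) (weightOf (suc k) d) lead 0 n))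
    where
    open CoreList cl
    open IsCore isCore′
    none : countB (λ { (rs , s) → weightOK [] rs ∧ (s ≡ᵇ n) }) (chains k (suc m) κ) ≡ 0
    none = ℤP.+-injective (trans (countB-concatMap _ (λ p → map (λ x → proj₁ x ++ (proj₁ (proj₂ p) ∷ []) , proj₂ x + proj₂ (proj₂ p)) (chains k m (proj₁ p))) (coversInto k κ))
      (trans (sumℤ-cong-∈ {g = λ _ → + 0} (coversInto k κ) (λ {p} _ → cong +_ (trans (countB-map _ _ (chains k m (proj₁ p)))
        (trans (countB-cong (λ x → cong (_∧ (proj₂ x + proj₂ (proj₂ p) ≡ᵇ n)) (nonempty (proj₁ x) _)) (chains k m (proj₁ p))) (countB-false (chains k m (proj₁ p)))))))
        (zero-sum (coversInto k κ))))
      where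
      nonempty : ∀ (rs : List ℕ) r → null (rs ++ r ∷ []) ≡ false
      nonempty []       r = refl
      nonempty (x ∷ rs) r = refl
      zero-sum : ∀ {A : Set} (xs : List A) → sumℤ (map (λ _ → + 0) xs) ≡ + 0
      zero-sum []       = refl
      zero-sum (x ∷ xs) = trans (ℤP.+-identityˡ _) (zero-sum xs)
    nonzero : d 0 ≢ suc k + 0
    nonzero e = 0≢1+n (trans (sym (empty κ (partition-pos {κ} partition) (part-zero isCore′ (length κ) (at-length κ _ ≤-refl) (length κ) 0 ≤-refl e))) size)
      where
      empty : ∀ κ → (∀ r → r < length κ → 1 ≤ at κ r) → at κ 0 ≡ 0 → sum (𝔭 k κ) ≡ 0
      empty []      p z = refl
      empty (x ∷ κ) p z = ⊥-elim (lin⊥ (at (x ∷ κ) 0 ∷ []) (# 1 ⊴ $ 0 ∋ p 0 (s≤s z≤n) ∷ $ 0 ≐ # 0 ∋ z ∷ []))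
    lead : Leading (suc ℓ) (weightOf (suc k) d)
    lead with m≤n⇒∃[o]m+o≡n (≤∧≢⇒< (d-≤ 0) nonzero)
    ... | a , e = 0 , s≤s z≤n , (λ r ()) , a , trans (cong (λ z → + z ℤ.- + d 0) (trans (sym e) (sym (+-suc (d 0) a)))) (trans (cong (ℤ._- + d 0) (ℤP.pos-+ (d 0) (suc a))) (lem (+ d 0) (+ suc a)))
      where
      lem = ring27

  module Snoc′ (ζ : List ℕ) (ih : Agrees ζ) where
    open Catalan (suc ℓ) (suc k) ζ

    split-≤ᵇ : ∀ z r (a : ℤ) → (if suc z ≤ᵇ r then a else + 0) ≡ (if suc (suc z) ≤ᵇ r then a else + 0) ℤ.+ (if r ≡ᵇ suc z then a else + 0)
    split-≤ᵇ z r a with <-cmp r (suc z)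
    ... | tri< l ne _ rewrite ≤ᵇ-false l | ≤ᵇ-false {suc (suc z)} (m<n⇒m<1+n l) | ≡ᵇ-≢ ne = refl
    ... | tri≈ _ refl _ rewrite ≡ᵇ-refl z | <ᵇ-true {z} {suc z} ≤-refl | <ᵇ-false {suc z} {suc z} ≤-refl = sym (ℤP.+-identityˡ a)
    ... | tri> _ ne l rewrite <ᵇ-true {suc z} {r} l | <ᵇ-true {z} {r} (<⇒≤ l) | ≡ᵇ-≢ ne = sym (ℤP.+-identityʳ a)

    F-end : ∀ d e n → F (suc ℓ) d (suc e) n ≡ + 0
    F-end d e n rewrite n∸n≡0 ℓ = roots-no-e (suc ℓ) ζ (Ψ-roots (suc ℓ) d) (weightOf (suc k) d) e n

    F-step : ∀ z d → z ≤ ℓ → ∀ e n → F z d (suc e) n ≡ F (suc z) d (suc e) n ℤ.+ A z d z e n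
    F-step z d l e n rewrite +-∸-assoc 1 l = refl

    -- Marks count rows from 1, so the bound `suc z` belongs to row z. Marks larger than it
    -- correspond to z + 1 in place of z; marks equal to it match the use of `low z`, and `A-covers`
    -- identifies the two. The induction is on the number e of marks left and, for fixed e, on the
    -- rows from z on.
    peel-F : ∀ e fuel z → z + fuel ≡ suc ℓ → ∀ {m κ d} → CoreList m κ d → ∀ n → peel ζ e (suc z) m κ n ≡ F z d e n
    peel-F zero fuel z eq {m} {κ} {d} cl n = trans (ih cl n) (sym (lows-no-e (suc ℓ) ζ (suc ℓ ∸ z) z (Ψ (suc ℓ) d) (weightOf (suc k) d) n))
    peel-F (suc e) zero z eq {m} {κ} {d} cl n rewrite trans (sym (+-identityʳ z)) eq =
      trans (coversInto-sum (λ τ r s → if suc (suc ℓ) ≤ᵇ r then delayBy s (λ _ → peel ζ e r (pred m) τ) 0 n else + 0))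
        (trans (Σ<-zero (suc ℓ) (λ j l → none j l)) (sym (F-end d e n)))
      where
      open CoreList cl
      open CoverSum k ℓ {κ} partition isCore′ rows
      none : ∀ j → j < suc ℓ → perCover (λ τ r s → if suc (suc ℓ) ≤ᵇ r then delayBy s (λ _ → peel ζ e r (pred m) τ) 0 n else + 0) j ≡ + 0
      none j l with cover? j
      ... | inj₂ _ = refl
      ... | inj₁ cv = vanish (Below.xs isCore′ cv) (λ m → ≤-trans (Below.tops-≤ isCore′ cv (Cover.tower cv) m) (≤-pred l))
        where
        vanish : ∀ xs → (∀ {x} → x ∈ xs → x ≤ ℓ) → sumℤ (map (λ x → if suc (suc ℓ) ≤ᵇ suc x
          then delayBy (Cover.c cv * Cover.w cv + countB (λ v → x <ᵇ v) (Below.xs isCore′ cv)) (λ _ → peel ζ e (suc x) (pred m) (moveList cv)) 0 n else + 0) xs) ≡ + 0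
        vanish []       h = refl
        vanish (x ∷ xs) h rewrite <ᵇ-false {suc ℓ} {suc x} (s≤s (h (here refl))) = trans (ℤP.+-identityˡ _) (vanish xs (λ m → h (there m)))
    peel-F (suc e) (suc fuel) z eq {m} {κ} {d} cl n =
      trans (sumℤ-cong-∈ (coversInto k κ) (λ {p} _ → trans (split-≤ᵇ z (proj₁ (proj₂ p)) (term p)) (cong (λ w → (if suc (suc z) ≤ᵇ proj₁ (proj₂ p) then term p else + 0) ℤ.+ w) (marked p))))
        (trans (sumℤ-+ (λ p → if suc (suc z) ≤ᵇ proj₁ (proj₂ p) then term p else + 0) (λ p → if proj₁ (proj₂ p) ≡ᵇ suc z then G (proj₁ p) (proj₂ (proj₂ p)) else + 0) (coversInto k κ))
          (trans (cong₂ ℤ._+_ (peel-F (suc e) fuel (suc z) (trans (sym (+-suc z fuel)) eq) cl n) (sym (Marked.A-covers ζ z (m≤n⇒m≤1+n zl) zl G e n below′)))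
            (sym (F-step z d zl e n))))
      where
      open CoreList cl
      open CoverSum k ℓ {κ} partition isCore′ rows
      zl : z ≤ ℓ
      zl = lin≤ (z ∷ fuel ∷ ℓ ∷ []) 1 ($ 0) ($ 2) ($ 0 ⊹ (# 1 ⊹ $ 1) ≐ # 1 ⊹ $ 2 ∋ eq ∷ [])
      G : List ℕ → ℕ → ℤ
      G τ s = delayBy s (λ _ → peel ζ e (suc z) (pred m) τ) 0 n
      term : List ℕ × ℕ × ℕ → ℤ
      term p = delayBy (proj₂ (proj₂ p)) (λ _ → peel ζ e (proj₁ (proj₂ p)) (pred m) (proj₁ p)) 0 n
      marked : ∀ p → (if proj₁ (proj₂ p) ≡ᵇ suc z then term p else + 0) ≡ (if proj₁ (proj₂ p) ≡ᵇ suc z then G (proj₁ p) (proj₂ (proj₂ p)) else + 0)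
      marked (τ , r , s) with r ≡ᵇ suc z in q
      ... | false = refl
      ... | true  = cong (λ r → delayBy s (λ _ → peel ζ e r (pred m) τ) 0 n) (≡ᵇ⇒≡ r (suc z) (Equivalence.from T-≡ q))
      below′ : ∀ {j} (cv : Cover d j) s → G (moveList cv) s ≡ delayBy s (F z (Below.dτ isCore′ cv)) e n
      below′ cv s = delayBy-const s e (peel-F e (suc fuel) z eq record
        { partition = move-partition cv ; isCore′ = move-core cv ; rows = move-length cv
        ; size = cong pred (trans (proj₂ (proj₂ (proj₂ (covered⁻ (move∈ cv))))) size) }) n

    peel-0 : ∀ e {m κ d} → CoreList m κ d → ∀ n → peel ζ e 0 m κ n ≡ peel ζ e 1 m κ n
    peel-0 zero    cl n = refl
    peel-0 (suc e) {m} {κ} cl n = trans (coversInto-sum (g 0)) (sym (coversInto-sum (g 1)))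
      where
      open CoreList cl
      open CoverSum k ℓ {κ} partition isCore′ rows
      g : ℕ → List ℕ → ℕ → ℕ → ℤ
      g z τ r s = if z ≤ᵇ r then delayBy s (λ _ → peel ζ e r (pred m) τ) 0 n else + 0

    agrees-snoc : ∀ e → Agrees (ζ ++ e ∷ [])
    agrees-snoc e {m} {κ} {d} cl n =
      trans (cong +_ (countB-cong (λ x → cong (_∧ (proj₂ x ≡ᵇ n)) (weightOK-snoc ζ e (proj₁ x))) (chains k m κ)))
        (trans (count-peel ζ e 0 m κ n (CoreList.size cl))
          (trans (peel-0 e cl n) (trans (peel-F e (suc ℓ) 0 refl cl n) (sym (K-snoc (suc ℓ) ζ e (Ψ-roots (suc ℓ) d) (weightOf (suc k) d) n)))))

  agrees : ∀ {η} → Reverse η → Agrees η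
  agrees []            = agrees-[]
  agrees (ζ ∶ rs ∶ʳ e) = Snoc′.agrees-snoc ζ (agrees rs) e

-- Hall-Littlewood series as Catalan functions with all roots.

-- The local function of `raise` is recovered by unification, after the literal
-- row index and the list have been generalised.
mutual
  raiseFrom : ℕ → ℕ → ℕ → List ℤ → ℕ → List ℤ → List ℤ
  raiseFrom = _

  raise-tail : ∀ i j m x xs → drop 1 (raise (i , j) m (x ∷ xs)) ≡ raiseFrom i j m (x ∷ xs) 1 xs
  raise-tail i j m x xs with x ∷ xs | 1
  ... | γ | r = refl

shiftN : ℕ → Factor → Weight → Weight
shiftN zero    f γ = γ
shiftN (suc a) f γ = shiftN a f (shift f γ)

shiftN-at : ∀ a f γ r → shiftN a f γ r ≡ γ r ℤ.+ + a ℤ.* wt f r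
shiftN-at zero    f γ r = lem (γ r) (wt f r)
  where
  lem = ring28
shiftN-at (suc a) f γ r = trans (shiftN-at a f (shift f γ) r)
  (trans (lem (γ r) (wt f r) (+ a)) (cong (λ z → γ r ℤ.+ z ℤ.* wt f r) (sym (ℤP.pos-+ 1 a))))
  where
  lem = ring29

raiseFrom-at : ∀ {i j} m γ r xs q → i < j → q < length xs → atℤ (raiseFrom i j m γ r xs) q ≡ atℤ xs q ℤ.+ + m ℤ.* wt (root i j) (r + q)
raiseFrom-at {i} {j} m γ r (x ∷ xs) zero l u rewrite +-identityʳ r = row
  where
  up = ring30
  dn = ring31
  no′ = ring32
  row : (if r ≡ᵇ i then x ℤ.+ + m else (if r ≡ᵇ j then x ℤ.- + m else x)) ≡ x ℤ.+ + m ℤ.* (δ i r ℤ.- δ j r)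
  row with r ≟ i | r ≟ j
  ... | yes refl | _ rewrite ≡ᵇ-refl r | ≡ᵇ-≢ {r} {j} (<⇒≢ l) = up x (+ m)
  ... | no ne | yes refl rewrite ≡ᵇ-≢ ne | ≡ᵇ-refl r = dn x (+ m)
  ... | no ne | no ne' rewrite ≡ᵇ-≢ ne | ≡ᵇ-≢ ne' = no′ x (+ m)
raiseFrom-at {i} {j} m γ r (x ∷ xs) (suc q) l (s≤s u) = trans (raiseFrom-at m γ (suc r) xs q l u) (cong (λ s → atℤ xs q ℤ.+ + m ℤ.* wt (root i j) s) (sym (+-suc r q)))

raiseFrom-length : ∀ i j m γ r xs → length (raiseFrom i j m γ r xs) ≡ length xs
raiseFrom-length i j m γ r []       = refl
raiseFrom-length i j m γ r (x ∷ xs) = cong suc (raiseFrom-length i j m γ (suc r) xs)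

module _ (ℓ : ℕ) (η : List ℕ) where
  open KAt ℓ η

  K-cong-< : ∀ fs {γ γ'} → (∀ r → r < ℓ → γ r ≡ γ' r) → ∀ e n → K fs γ e n ≡ K fs γ' e n
  K-cong-< []              h zero    zero    = Schur-cong ℓ η h
  K-cong-< []              h zero    (suc n) = refl
  K-cong-< []              h (suc e) n       = refl
  K-cong-< (root a b ∷ fs) h e       zero    = K-cong-< fs h e zero
  K-cong-< (root a b ∷ fs) h e       (suc n) =
    cong₂ ℤ._+_ (K-cong-< fs h e (suc n)) (K-cong-< (root a b ∷ fs) (λ r l → cong (ℤ._+ wt (root a b) r) (h r l)) e n)
  K-cong-< (low a ∷ fs)    h zero    n       = K-cong-< fs h zero n
  K-cong-< (low a ∷ fs)    h (suc e) n       =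
    cong₂ ℤ._+_ (K-cong-< fs h (suc e) n) (K-cong-< (low a ∷ fs) (λ r l → cong (ℤ._+ wt (low a) r) (h r l)) e n)

  K-root-sum : ∀ i j fs γ n → K (root i j ∷ fs) γ 0 n ≡ Σ< (suc n) (λ a → K fs (shiftN a (root i j) γ) 0 (n ∸ a))
  K-root-sum i j fs γ zero    = sym (ℤP.+-identityˡ _)
  K-root-sum i j fs γ (suc n) = trans (cong (λ s → K fs γ 0 (suc n) ℤ.+ s) (K-root-sum i j fs (shift (root i j) γ) n))
    (sym (Σ<-front (suc n) (λ a → K fs (shiftN a (root i j) γ) 0 (suc n ∸ a))))

  -- A composition of n indexed by the pairs chooses one term from each geometric series; its first
  -- part is the power taken from the first root.
  raised-sum : ∀ ps γ n → length γ ≡ ℓ → (∀ {p} → p ∈ ps → proj₁ p < proj₂ p × proj₂ p < ℓ) →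
    sumℤ (map (λ m → sγ ℓ (raiseAll ps m γ) η) (comps n (length ps))) ≡ K (map toRoot ps) (atℤ γ) 0 n
  raised-sum []             γ zero    l h = ℤP.+-identityʳ _
  raised-sum []             γ (suc n) l h = refl
  raised-sum ((i , j) ∷ ps) γ n       l h =
    trans (sumℤ-concatMap (λ m → sγ ℓ (raiseAll ((i , j) ∷ ps) m γ) η) (λ a → map (a ∷_) (comps (n ∸ a) (length ps))) (upTo (suc n)))
      (trans (sumℤ-upTo (suc n) (λ a → sumℤ (map (λ m → sγ ℓ (raiseAll ((i , j) ∷ ps) m γ) η) (map (a ∷_) (comps (n ∸ a) (length ps))))))
        (trans (Σ<-cong (suc n) (λ a _ → trans (cong sumℤ (sym (map-∘ (comps (n ∸ a) (length ps)))))
                 (trans (raised-sum ps (raise (i , j) a γ) (n ∸ a) (trans (raiseFrom-length i j a γ 0 γ) l) (λ m → h (there m)))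
                   (K-cong-< (map toRoot ps) (λ r q → trans (raiseFrom-at a γ 0 γ r (proj₁ (h (here refl))) (≤-trans q (≤-reflexive (sym l)))) (sym (shiftN-at a (root i j) (atℤ γ) r))) 0 (n ∸ a)))))
          (sym (K-root-sum i j (map toRoot ps) (atℤ γ) n))))

-- The Hall–Littlewood series of an arbitrary integral weight.
HLw : ℕ → Weight → Ser
HLw ℓ γ η n = K-at ℓ η (map toRoot (pairsLt ℓ)) γ 0 n

HL-weight : ∀ μ η n → HL μ η n ≡ HLw (length μ) (λ r → + at μ r) η n
HL-weight μ η n = trans (raised-sum (length μ) η (pairsLt (length μ)) (map +_ μ) n (length-map +_ μ) (∈-pairsLt⁻ (length μ)))
  (K-cong-< (length μ) η (map toRoot (pairsLt (length μ))) (λ r _ → atℤ-map μ r) 0 n)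
  where
  atℤ-map : ∀ μ r → atℤ (map +_ μ) r ≡ + at μ r
  atℤ-map []      r       = refl
  atℤ-map (x ∷ μ) zero    = refl
  atℤ-map (x ∷ μ) (suc r) = atℤ-map μ r

-- Combinations with polynomial coefficients.

tmul : Ser → Ser
tmul f η zero    = + 0
tmul f η (suc n) = f η n

-- Combinations over ℤ[t], generated by sums, negatives and multiplication by t. The constructor
-- `ext` is there because series are functions, compared pointwise.
data Span (Q : List ℕ → Set) (F : List ℕ → Ser) : Ser → Set where
  gen   : ∀ {μ} → Q μ → Span Q F (F μ)
  zero′ : Span Q F (λ _ _ → + 0)
  add   : ∀ {f g} → Span Q F f → Span Q F g → Span Q F (λ η n → f η n ℤ.+ g η n)
  neg   : ∀ {f} → Span Q F f → Span Q F (λ η n → ℤ.- f η n)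
  times : ∀ {f} → Span Q F f → Span Q F (tmul f)
  ext   : ∀ {f g} → (∀ η n → f η n ≡ g η n) → Span Q F f → Span Q F g

span-bind : ∀ {Q Q' F G f} → Span Q F f → (∀ {μ} → Q μ → Span Q' G (F μ)) → Span Q' G f
span-bind (gen q)   h = h q
span-bind zero′     h = zero′
span-bind (add a b) h = add (span-bind a h) (span-bind b h)
span-bind (neg a)   h = neg (span-bind a h)
span-bind (times a) h = times (span-bind a h)
span-bind (ext e a) h = ext e (span-bind a h)

span-weaken : ∀ {Q Q' F f} → (∀ {μ} → Q μ → Q' μ) → Span Q F f → Span Q' F f
span-weaken h s = span-bind s (λ q → gen (h q))

addP : Poly → Poly → Poly
addP []      q       = q
addP (a ∷ p) []      = a ∷ p
addP (a ∷ p) (b ∷ q) = (a ℤ.+ b) ∷ addP p q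

addP-at : ∀ p q i → atℤ (addP p q) i ≡ atℤ p i ℤ.+ atℤ q i
addP-at []      q       i       = sym (ℤP.+-identityˡ _)
addP-at (a ∷ p) []      i       = sym (ℤP.+-identityʳ _)
addP-at (a ∷ p) (b ∷ q) zero    = refl
addP-at (a ∷ p) (b ∷ q) (suc i) = addP-at p q i

negP-at : ∀ p i → atℤ (map ℤ.-_ p) i ≡ ℤ.- atℤ p i
negP-at []      i       = refl
negP-at (a ∷ p) zero    = refl
negP-at (a ∷ p) (suc i) = negP-at p i

·-Σ : ∀ p F η n → (p · F) η n ≡ Σ< (suc n) (λ i → atℤ p i ℤ.* F η (n ∸ i))
·-Σ p F η n = sumℤ-upTo (suc n) (λ i → atℤ p i ℤ.* F η (n ∸ i))

addP-· : ∀ p q F η n → (addP p q · F) η n ≡ (p · F) η n ℤ.+ (q · F) η n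
addP-· p q F η n = trans (·-Σ (addP p q) F η n)
  (trans (Σ<-cong (suc n) (λ i _ → trans (cong (ℤ._* F η (n ∸ i)) (addP-at p q i)) (ℤP.*-distribʳ-+ (F η (n ∸ i)) (atℤ p i) (atℤ q i))))
    (trans (Σ<-+ (suc n) _ _) (sym (cong₂ ℤ._+_ (·-Σ p F η n) (·-Σ q F η n)))))

negP-· : ∀ p F η n → (map ℤ.-_ p · F) η n ≡ ℤ.- (p · F) η n
negP-· p F η n = trans (·-Σ (map ℤ.-_ p) F η n)
  (trans (Σ<-cong (suc n) (λ i _ → trans (cong (ℤ._* F η (n ∸ i)) (negP-at p i)) (sym (ℤP.neg-distribˡ-* (atℤ p i) (F η (n ∸ i))))))
    (trans (Σ<-neg (suc n) _) (cong ℤ.-_ (sym (·-Σ p F η n)))))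

tP-· : ∀ p F η n → ((+ 0 ∷ p) · F) η n ≡ tmul (p · F) η n
tP-· p F η zero    = trans (·-Σ (+ 0 ∷ p) F η 0) (trans (ℤP.+-identityˡ _) (ℤP.*-zeroˡ (F η 0)))
tP-· p F η (suc n) = trans (·-Σ (+ 0 ∷ p) F η (suc n)) (trans (Σ<-front (suc n) _)
  (trans (cong (λ z → z ℤ.+ Σ< (suc n) (λ i → atℤ p i ℤ.* F η (n ∸ i))) (ℤP.*-zeroˡ (F η (suc n)))) (trans (ℤP.+-identityˡ (Σ< (suc n) (λ i → atℤ p i ℤ.* F η (n ∸ i)))) (sym (·-Σ p F η n)))))

[]-· : ∀ F η n → ([] · F) η n ≡ + 0
[]-· F η n = trans (·-Σ [] F η n) (Σ<-zero (suc n) (λ i _ → ℤP.*-zeroˡ (F η (n ∸ i))))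

1-· : ∀ F η n → ((+ 1 ∷ []) · F) η n ≡ F η n
1-· F η n = trans (·-Σ (+ 1 ∷ []) F η n) (trans (Σ<-front n _)
  (trans (cong₂ ℤ._+_ (ℤP.*-identityˡ (F η n)) (Σ<-zero n (λ i _ → ℤP.*-zeroˡ (F η (n ∸ suc i))))) (ℤP.+-identityʳ _)))

module Coefficients (P : List (List ℕ)) (uniq : Unique P) (F : List ℕ → Ser) where
  open import Data.List.Properties using (≡-dec)

  Combination : Ser → Set
  Combination f = Σ (List ℕ → Poly) λ c → ∀ η n → f η n ≡ linComb P c F η n

  single : List ℕ → List ℕ → Poly
  single μ ν with ≡-dec _≟_ ν μ
  ... | yes _ = + 1 ∷ []
  ... | no _  = []

  single-sum : ∀ {μ P} → Unique P → μ ∈ P → ∀ η n → sumℤ (map (λ ν → (single μ ν · F ν) η n) P) ≡ F μ η n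
  single-sum {μ} {ν ∷ P} (u ∷ us) m η n with ≡-dec _≟_ ν μ
  ... | yes refl = trans (cong₂ ℤ._+_ (1-· (F ν) η n) (rest P u)) (ℤP.+-identityʳ _)
    where
    rest : ∀ P → All (ν ≢_) P → sumℤ (map (λ ρ → (single ν ρ · F ρ) η n) P) ≡ + 0
    rest []      []       = refl
    rest (ρ ∷ P) (a ∷ as) with ≡-dec _≟_ ρ ν
    ... | yes e = ⊥-elim (a (sym e))
    ... | no _  = cong₂ ℤ._+_ ([]-· (F ρ) η n) (rest P as)
  single-sum {μ} {ν ∷ P} (u ∷ us) (here e)  η n | no ne = ⊥-elim (ne (sym e))
  single-sum {μ} {ν ∷ P} (u ∷ us) (there m) η n | no ne = trans (cong₂ ℤ._+_ ([]-· (F ν) η n) (single-sum us m η n)) (ℤP.+-identityˡ _)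

  tmul-sum : ∀ (c : List ℕ → Poly) P η n → tmul (λ η n → sumℤ (map (λ μ → (c μ · F μ) η n) P)) η n ≡ sumℤ (map (λ μ → tmul (c μ · F μ) η n) P)
  tmul-sum c []      η zero    = refl
  tmul-sum c (μ ∷ P) η zero    = trans (tmul-sum c P η zero) (sym (ℤP.+-identityˡ _))
  tmul-sum c P       η (suc n) = refl

  neg-sum : ∀ {A : Set} (f : A → ℤ) xs → sumℤ (map (λ x → ℤ.- f x) xs) ≡ ℤ.- sumℤ (map f xs)
  neg-sum f []       = refl
  neg-sum f (x ∷ xs) = trans (cong (λ s → ℤ.- f x ℤ.+ s) (neg-sum f xs)) (sym (ℤP.neg-distrib-+ (f x) _))

  zero-sum : ∀ P η n → sumℤ (map (λ μ → ([] · F μ) η n) P) ≡ + 0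
  zero-sum []      η n = refl
  zero-sum (μ ∷ P) η n = cong₂ ℤ._+_ ([]-· (F μ) η n) (zero-sum P η n)

  combination : ∀ {f} → Span (_∈ P) F f → Combination f
  combination (gen {μ} m) = single μ , λ η n → sym (single-sum uniq m η n)
  combination zero′ = (λ _ → []) , λ η n → sym (zero-sum P η n)
  combination (add a b) with combination a | combination b
  ... | c , p | c' , q = (λ μ → addP (c μ) (c' μ)) , λ η n → trans (cong₂ ℤ._+_ (p η n) (q η n))
    (trans (sym (sumℤ-+ (λ μ → (c μ · F μ) η n) (λ μ → (c' μ · F μ) η n) P)) (sumℤ-map-cong (λ μ → sym (addP-· (c μ) (c' μ) (F μ) η n)) P))
  combination (neg a) with combination a
  ... | c , p = (λ μ → map ℤ.-_ (c μ)) , λ η n → trans (cong ℤ.-_ (p η n))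
    (trans (sym (neg-sum (λ μ → (c μ · F μ) η n) P)) (sumℤ-map-cong (λ μ → sym (negP-· (c μ) (F μ) η n)) P))
  combination (times {f} a) with combination a
  ... | c , p = (λ μ → + 0 ∷ c μ) , λ η n → trans (shifted η n) (trans (tmul-sum c P η n) (sumℤ-map-cong (λ μ → sym (tP-· (c μ) (F μ) η n)) P))
    where
    shifted : ∀ η n → tmul f η n ≡ tmul (linComb P c F) η n
    shifted η zero    = refl
    shifted η (suc n) = p η n
  combination (ext e a) with combination a
  ... | c , p = c , λ η n → trans (sym (e η n)) (p η n)

  -- The elements of `Span` have coefficients in ℤ[t], so the denominator can be the constant 1.
  inSpan : ∀ {f} → Span (_∈ P) F f → InSpan P F f
  inSpan {f} s with combination s
  ... | c , p = (+ 1 ∷ []) , here (λ ()) , c , λ η n → trans (1-· f η n) (p η n)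

-- Straightening Hall-Littlewood series.

-- Integral weights are written g − lo with g natural, so that the statistic Φ below is natural.
offset : ℕ → (ℕ → ℕ) → Weight
offset lo g r = + g r ℤ.- + lo

transfer : ℕ → ℕ → ℕ → (ℕ → ℕ) → ℕ → ℕ
transfer i j u g r = if r ≡ᵇ i then g i + u else (if r ≡ᵇ j then g j ∸ u else g r)

transfer-i : ∀ {i j u} g → transfer i j u g i ≡ g i + u
transfer-i {i} g rewrite ≡ᵇ-refl i = refl

transfer-j : ∀ {i j u} g → i < j → transfer i j u g j ≡ g j ∸ u
transfer-j {i} {j} g l rewrite ≡ᵇ-≢ {j} {i} (>⇒≢ l) | ≡ᵇ-refl j = refl

transfer-else : ∀ {i j u r} g → r ≢ i → r ≢ j → transfer i j u g r ≡ g r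
transfer-else g p q rewrite ≡ᵇ-≢ p | ≡ᵇ-≢ q = refl

-- Raising operators lower Φ.
Φ : ℕ → (ℕ → ℕ) → ℕ
Φ L g = Σℕ L (λ r → r * g r)

Σℕ-change : ∀ m i (f f' : ℕ → ℕ) → i < m → (∀ r → r ≢ i → f r ≡ f' r) → Σℕ m f + f' i ≡ Σℕ m f' + f i
Σℕ-change (suc m) i f f' l h with i ≟ m
... | yes refl = same (Σℕ-below i ≤-refl)
  where
  Σℕ-below : ∀ q → q ≤ i → Σℕ q f ≡ Σℕ q f'
  Σℕ-below zero    l = refl
  Σℕ-below (suc q) l = cong₂ _+_ (Σℕ-below q (<⇒≤ l)) (h q (<⇒≢ l))
  same : Σℕ i f ≡ Σℕ i f' → Σℕ i f + f i + f' i ≡ Σℕ i f' + f' i + f i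
  same e = ≤-antisym (lin≤ (Σℕ m f ∷ Σℕ m f' ∷ f m ∷ f' m ∷ []) 1 ($ 0 ⊹ $ 2 ⊹ $ 3) ($ 1 ⊹ $ 3 ⊹ $ 2) ($ 0 ≐ $ 1 ∋ e ∷ [])) (lin≤ (Σℕ m f ∷ Σℕ m f' ∷ f m ∷ f' m ∷ []) 1 ($ 1 ⊹ $ 3 ⊹ $ 2) ($ 0 ⊹ $ 2 ⊹ $ 3) ($ 1 ≐ $ 0 ∋ sym e ∷ []))
... | no ne = ≤-antisym (lin≤ (Σℕ m f ∷ f' i ∷ Σℕ m f' ∷ f i ∷ f m ∷ f' m ∷ []) 1 ($ 0 ⊹ $ 4 ⊹ $ 1) ($ 2 ⊹ $ 5 ⊹ $ 3) ($ 0 ⊹ $ 1 ≐ $ 2 ⊹ $ 3 ∋ Σℕ-change m i f f' (≤∧≢⇒< (≤-pred l) ne) h ∷ $ 4 ≐ $ 5 ∋ h m (λ e → ne (sym e)) ∷ [])) (lin≤ (Σℕ m f ∷ f' i ∷ Σℕ m f' ∷ f i ∷ f m ∷ f' m ∷ []) 1 ($ 2 ⊹ $ 5 ⊹ $ 3) ($ 0 ⊹ $ 4 ⊹ $ 1) ($ 2 ⊹ $ 3 ≐ $ 0 ⊹ $ 1 ∋ sym (Σℕ-change m i f f' (≤∧≢⇒< (≤-pred l) ne) h) ∷ $ 5 ≐ $ 4 ∋ sym (h m (λ e → ne (sym e))) ∷ []))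

-- Moving u units from row j up to row i lowers the row-weighted sum by (j - i) u; the equation is
-- arranged to avoid subtraction.
Φ-transfer : ∀ L i j u g → i < j → j < L → u ≤ g j → Φ L (transfer i j u g) + j * u ≡ Φ L g + i * u
Φ-transfer L i j u g l jl ul = ≤-antisym (lin≤ (Φ L g ∷ (i * mid i) ∷ Φ L mid ∷ (i * g i) ∷ (j * transfer i j u g j) ∷ Φ L (transfer i j u g) ∷ (j * mid j) ∷ (j * (g j ∸ u)) ∷ (j * u) ∷ (j * g j) ∷ (i * (g i + u)) ∷ (i * u) ∷ (i * transfer i j u g i) ∷ []) 1 ($ 5 ⊹ $ 8) ($ 0 ⊹ $ 11) ($ 2 ⊹ $ 3 ≐ $ 0 ⊹ $ 1 ∋ sym first ∷ $ 5 ⊹ $ 6 ≐ $ 2 ⊹ $ 4 ∋ sym second ∷ $ 7 ⊹ $ 8 ≐ $ 9 ∋ rowⱼ ∷ $ 10 ≐ $ 3 ⊹ $ 11 ∋ rowᵢ ∷ $ 4 ≐ $ 7 ∋ cong (j *_) (transfer-j {i} {j} {u} g l) ∷ $ 1 ≐ $ 10 ∋ midᵢ ∷ $ 9 ≐ $ 6 ∋ sym midⱼ ∷ [])) (lin≤ (Φ L g ∷ (i * mid i) ∷ Φ L mid ∷ (i * g i) ∷ (j * transfer i j u g j) ∷ Φ L (transfer i j u g) ∷ (j * mid j) ∷ (j * (g j ∸ u)) ∷ (j * u) ∷ (j * g j) ∷ (i * (g i + u)) ∷ (i * u) ∷ (i * transfer i j u g i) ∷ []) 1 ($ 0 ⊹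 $ 11) ($ 5 ⊹ $ 8) ($ 0 ⊹ $ 1 ≐ $ 2 ⊹ $ 3 ∋ first ∷ $ 2 ⊹ $ 4 ≐ $ 5 ⊹ $ 6 ∋ second ∷ $ 9 ≐ $ 7 ⊹ $ 8 ∋ sym rowⱼ ∷ $ 3 ⊹ $ 11 ≐ $ 10 ∋ sym rowᵢ ∷ $ 7 ≐ $ 4 ∋ sym (cong (j *_) (transfer-j {i} {j} {u} g l)) ∷ $ 10 ≐ $ 1 ∋ sym midᵢ ∷ $ 6 ≐ $ 9 ∋ midⱼ ∷ []))
  where
  mid : ℕ → ℕ
  mid r = if r ≡ᵇ i then g i + u else g r
  midᵢ : i * mid i ≡ i * (g i + u)
  midᵢ rewrite ≡ᵇ-refl i = refl
  midⱼ : j * mid j ≡ j * g j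
  midⱼ rewrite ≡ᵇ-≢ {j} {i} (>⇒≢ l) = refl
  first : Φ L g + i * mid i ≡ Φ L mid + i * g i
  first = Σℕ-change L i (λ r → r * g r) (λ r → r * mid r) (<-trans l jl) (λ r ne → cong (r *_) (same r ne))
    where
    same : ∀ r → r ≢ i → g r ≡ mid r
    same r ne rewrite ≡ᵇ-≢ ne = refl
  second : Φ L mid + j * transfer i j u g j ≡ Φ L (transfer i j u g) + j * mid j
  second = Σℕ-change L j (λ r → r * mid r) (λ r → r * transfer i j u g r) jl (λ r ne → cong (r *_) (same r ne))
    where
    same : ∀ r → r ≢ j → mid r ≡ transfer i j u g r
    same r ne rewrite ≡ᵇ-≢ ne = refl
  rowⱼ : j * (g j ∸ u) + j * u ≡ j * g j
  rowⱼ = trans (sym (*-distribˡ-+ j (g j ∸ u) u)) (cong (j *_) (m∸n+n≡m ul))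
  rowᵢ : i * (g i + u) ≡ i * g i + i * u
  rowᵢ = *-distribˡ-+ i (g i) u

Φ-transfer-< : ∀ L i j u g → i < j → j < L → 1 ≤ u → u ≤ g j → Φ L (transfer i j u g) < Φ L g
Φ-transfer-< L i j u g l jl u1 ul = lin≤ (Φ L (transfer i j u g) ∷ (j * u) ∷ Φ L g ∷ (i * u) ∷ u ∷ []) 1 (# 1 ⊹ $ 0) ($ 2) ($ 0 ⊹ $ 1 ≐ $ 2 ⊹ $ 3 ∋ Φ-transfer L i j u g l jl ul ∷ $ 4 ⊹ $ 3 ⊴ $ 1 ∋ *-monoˡ-≤ u l ∷ # 1 ⊴ $ 4 ∋ u1 ∷ [])

offset-transfer : ∀ lo i j g → i < j → 1 ≤ g j → shift (root i j) (offset lo g) ≗ offset lo (transfer i j 1 g)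
offset-transfer lo i j g l g1 r with r ≟ i | r ≟ j
... | yes refl | _ rewrite δ-same r | δ-diff {j} {r} (<⇒≢ l) | transfer-i {r} {j} {1} g =
  trans (lem (+ g r) (+ lo)) (cong (ℤ._- + lo) (sym (ℤP.pos-+ (g r) 1)))
  where
  lem = ring33
... | no ne | yes refl rewrite δ-diff {i} {r} ne | δ-same r | transfer-j {i} {r} {1} g l =
  trans (cong (λ z → + z ℤ.- + lo ℤ.+ (+ 0 ℤ.- + 1)) (sym (m∸n+n≡m g1))) (trans (cong (λ z → z ℤ.- + lo ℤ.+ (+ 0 ℤ.- + 1)) (ℤP.pos-+ (g r ∸ 1) 1)) (lem (+ (g r ∸ 1)) (+ lo)))
  where
  lem = ring34
... | no ne | no ne' rewrite δ-diff {i} {r} ne | δ-diff {j} {r} ne' | transfer-else {i} {j} {1} {r} g ne ne' = ℤP.+-identityʳ _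

dot-offset : ∀ lo x g u → g (suc x) ≡ g x + suc u → dot x (offset lo g) ≗ offset lo (transfer x (suc x) u g)
dot-offset lo x g u e r with cmp x r
... | is-x refl rewrite dot-x x (offset lo g) | transfer-i {x} {suc x} {u} g | e =
  trans (cong (λ z → z ℤ.- + lo ℤ.- + 1) (trans (cong +_ (+-suc (g x) u)) (ℤP.pos-+ 1 (g x + u)))) (lem (+ (g x + u)) (+ lo))
  where
  lem = ring35
... | is-sx refl rewrite dot-sx x (offset lo g) | transfer-j {x} {suc x} {u} g ≤-refl | e =
  trans (lem (+ g x) (+ lo)) (cong (ℤ._- + lo) (trans (sym (ℤP.pos-+ (g x) 1)) (cong +_ (trans (sym (m+n∸n≡m (g x + 1) u)) (cong (_∸ u) (swap′ (g x) u))))))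
  where
  lem = ring36
  swap′ = ring37
... | other p q rewrite dot-else (offset lo g) p q | transfer-else {x} {suc x} {u} {r} g p q = refl

module Straighten (k ℓ : ℕ) where
  private L = suc ℓ

  full : List Factor
  full = map toRoot (pairsLt L)

  full-unique : Unique full
  full-unique = UniqueP.map⁺ toRoot-injective (pairsLt-unique L)

  full-∈⁺ : ∀ {i j} → i < j → j < L → root i j ∈ full
  full-∈⁺ l u = ∈-map⁺ toRoot (∈-pairsLt⁺ L l u)

  full-∈⁻ : ∀ {f} → f ∈ full → ∃[ i ] ∃[ j ] f ≡ root i j × i < j × j < L
  full-∈⁻ m with ∈-map⁻ toRoot m
  ... | (i , j) , q , refl = i , j , refl , ∈-pairsLt⁻ L q

  module Adjacent (x : ℕ) (xl : suc x < L) where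
    -- The transposition of x and x + 1 permutes all pairs i < j other than (x, x + 1) itself.
    others : List Factor
    others = map toRoot (filter (λ p → ¬? (≡-dec′ p (x , suc x))) (pairsLt L))
      where
      open import Relation.Nullary using (¬?)
      open import Data.Product.Properties using () renaming (≡-dec to ×-≡-dec)
      ≡-dec′ = ×-≡-dec _≟_ _≟_

    others-∈⁻ : ∀ {f} → f ∈ others → ∃[ i ] ∃[ j ] f ≡ root i j × i < j × j < L × (i , j) ≢ (x , suc x)
    others-∈⁻ m with ∈-map⁻ toRoot m
    ... | (i , j) , q , refl with ∈-filter⁻ _ {xs = pairsLt L} q
    ... | a , b = i , j , refl , proj₁ (∈-pairsLt⁻ L a) , proj₂ (∈-pairsLt⁻ L a) , b

    others-∈⁺ : ∀ {i j} → i < j → j < L → (i , j) ≢ (x , suc x) → root i j ∈ others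
    others-∈⁺ l u ne = ∈-map⁺ toRoot (∈-filter⁺ _ (∈-pairsLt⁺ L l u) ne)

    others-unique : Unique others
    others-unique = UniqueP.map⁺ toRoot-injective (UniqueP.filter⁺ _ (pairsLt-unique L))

    full-↭ : full ↭ root x (suc x) ∷ others
    full-↭ = set-↭ full-unique (All.tabulate fresh ∷ others-unique) to from
      where
      open import Data.Product.Properties using () renaming (≡-dec to ×-≡-dec)
      fresh : ∀ {f} → f ∈ others → root x (suc x) ≢ f
      fresh m refl with others-∈⁻ m
      ... | _ , _ , refl , _ , _ , ne = ne refl
      to : ∀ {f} → f ∈ full → f ∈ root x (suc x) ∷ others
      to m with full-∈⁻ m
      ... | i , j , refl , l , u with ×-≡-dec _≟_ _≟_ (i , j) (x , suc x)
      ...   | yes refl = here refl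
      ...   | no ne    = there (others-∈⁺ l u ne)
      from : ∀ {f} → f ∈ root x (suc x) ∷ others → f ∈ full
      from (here refl) = full-∈⁺ ≤-refl xl
      from (there m) with others-∈⁻ m
      ... | i , j , refl , l , u , _ = full-∈⁺ l u

    others-swap : map (swapF x) others ↭ others
    others-swap = swap-↭ x others-unique closed
      where
      closed : ∀ {f} → f ∈ others → swapF x f ∈ others
      closed m with others-∈⁻ m
      ... | i , j , refl , l , u , ne with cmp x i | cmp x j
      ... | is-x refl  | is-x refl  = ⊥-elim (lin⊥ (i ∷ []) (# 1 ⊹ $ 0 ⊴ $ 0 ∋ l ∷ []))
      ... | is-x refl  | is-sx refl = ⊥-elim (ne refl)
      ... | is-x refl  | other a b rewrite swapIdx-x x | swapIdx-else a b = others-∈⁺ (≤∧≢⇒< l (λ e → b (sym e))) u (λ e → 1+n≢n (cong proj₁ e))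
      ... | is-sx refl | is-x refl  = ⊥-elim (lin⊥ (j ∷ []) (# 1 ⊹ (# 1 ⊹ $ 0) ⊴ $ 0 ∋ l ∷ []))
      ... | is-sx refl | is-sx refl = ⊥-elim (lin⊥ (x ∷ []) (# 1 ⊹ (# 1 ⊹ $ 0) ⊴ # 1 ⊹ $ 0 ∋ l ∷ []))
      ... | is-sx refl | other a b rewrite swapIdx-sx x | swapIdx-else a b = others-∈⁺ (<⇒≤ l) u (λ e → b (cong proj₂ e))
      ... | other a b  | is-x refl rewrite swapIdx-x x | swapIdx-else a b = others-∈⁺ (m<n⇒m<1+n l) xl (λ e → a (cong proj₁ e))
      ... | other a b  | is-sx refl rewrite swapIdx-sx x | swapIdx-else a b = others-∈⁺ (≤∧≢⇒< (≤-pred l) a) (<⇒≤ u) (λ e → a (cong proj₁ e))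
      ... | other a b  | other a' b' rewrite swapIdx-else a b | swapIdx-else a' b' = others-∈⁺ l u ne

    module _ (η : List ℕ) where
      open KAt L η
      open Mirror x (Schur-anti L x xl η)

      full-0 : ∀ γ → K full γ 0 0 ≡ K others γ 0 0
      full-0 γ = K-perm full-↭ γ 0 0

      full-suc : ∀ γ n → K full γ 0 (suc n) ≡ K others γ 0 (suc n) ℤ.+ K full (shift (root x (suc x)) γ) 0 n
      full-suc γ n = trans (K-perm full-↭ γ 0 (suc n)) (cong (λ s → K others γ 0 (suc n) ℤ.+ s) (sym (K-perm full-↭ _ 0 n)))

      -- With R the raising operator of (x, x + 1), this series is H_γ - t H_(Rγ). Its change of
      -- sign under `dot x` is the source of both straightening relations below.
      others-anti : ∀ γ n → K others (dot x γ) 0 n ≡ ℤ.- K others γ 0 n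
      others-anti γ n = K-mirror others-swap γ 0 n

      others-vanish : ∀ γ n → γ (suc x) ≡ γ x ℤ.+ + 1 → K others γ 0 n ≡ + 0
      others-vanish γ n h = K-vanish others-swap γ h 0 n

  -- H_{…,a,a+1,…} = t H_{…,a+1,a,…}
    equal-step : ∀ γ → γ (suc x) ≡ γ x ℤ.+ + 1 → ∀ η n → tmul (HLw L (shift (root x (suc x)) γ)) η n ≡ HLw L γ η n
    equal-step γ h η zero    = sym (trans (full-0 η γ) (others-vanish η γ 0 h))
    equal-step γ h η (suc n) = sym (trans (full-suc η γ n) (trans (cong (ℤ._+ HLw L (shift (root x (suc x)) γ) η n) (others-vanish η γ (suc n) h)) (ℤP.+-identityˡ _)))

    -- H_{a,b} = t H_{a+1,b−1} + t H_{b,a} − H_{b−1,a+1}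
    general-step : ∀ γ η n → tmul (HLw L (shift (root x (suc x)) γ)) η n ℤ.+ (tmul (HLw L (shift (root x (suc x)) (dot x γ))) η n ℤ.+ ℤ.- HLw L (dot x γ) η n) ≡ HLw L γ η n
    general-step γ η zero    = trans (ℤP.+-identityˡ _) (trans (ℤP.+-identityˡ _) (trans (cong ℤ.-_ (trans (full-0 η (dot x γ)) (others-anti η γ 0)))
      (trans (ℤP.neg-involutive _) (sym (full-0 η γ)))))
    general-step γ η (suc n) = trans (cong (λ s → HLw L (shift (root x (suc x)) γ) η n ℤ.+ (HLw L (shift (root x (suc x)) (dot x γ)) η n ℤ.+ ℤ.- s))
        (trans (full-suc η (dot x γ) n) (cong (ℤ._+ HLw L (shift (root x (suc x)) (dot x γ)) η n) (others-anti η γ (suc n)))))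
      (trans (lem (HLw L (shift (root x (suc x)) γ) η n) (HLw L (shift (root x (suc x)) (dot x γ)) η n) (K-at L η others γ 0 (suc n))) (sym (full-suc η γ n)))
      where
      lem = ring38

  HLw-cong : ∀ {γ γ'} → (∀ r → r < L → γ r ≡ γ' r) → ∀ η n → HLw L γ η n ≡ HLw L γ' η n
  HLw-cong h η n = K-cong-< L η full h 0 n

  HLw-lastNeg : ∀ γ → isNeg (γ ℓ) → ∀ η n → HLw L γ η n ≡ + 0
  HLw-lastNeg γ h η n = KAt.K-zero L η (λ γ → isNeg (γ ℓ)) (λ γ h → Schur-lastNeg ℓ γ h η) full stable γ h 0 n
    where
    stable : ∀ f → f ∈ full → ∀ γ → isNeg (γ ℓ) → isNeg (shift f γ ℓ)
    stable f m γ h with full-∈⁻ m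
    ... | i , j , refl , l , u rewrite δ-diff {i} {ℓ} (λ e → (lin⊥ (ℓ ∷ i ∷ j ∷ []) ($ 0 ≐ $ 1 ∋ e ∷ # 1 ⊹ $ 1 ⊴ $ 2 ∋ l ∷ # 1 ⊹ $ 2 ⊴ # 1 ⊹ $ 0 ∋ u ∷ []))) = dropδ (γ ℓ) h
      where
      dropδ : ∀ z → isNeg z → isNeg (z ℤ.+ (+ 0 ℤ.- δ j ℓ))
      dropδ z (a , refl) with ℓ ≡ᵇ j
      ... | true  = suc (a + 0) , refl
      ... | false = a , refl

  -- The summand for `lo` puts μ on the same footing as weights g whose entries carry the offset.
  Target : ℕ → ℕ → List ℕ → Set
  Target lo b μ = μ ∈ Par k L × Φ L (at μ) + Φ L (λ _ → lo) ≤ b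

  par-∈ : ∀ b n (f : ℕ → ℕ) → (0 < n → f 0 ≤ b) → (∀ r → suc r < n → f (suc r) ≤ f r) → map f (upTo n) ∈ parBounded b n
  par-∈ b n f h m = go b n (λ r → r) f h m
    where
    go : ∀ b n (h : ℕ → ℕ) (f : ℕ → ℕ) → (0 < n → f (h 0) ≤ b) → (∀ r → suc r < n → f (h (suc r)) ≤ f (h r)) → map f (applyUpTo h n) ∈ parBounded b n
    go b zero    h f z m = here refl
    go b (suc n) h f z m = ∈-concatMap-intro (λ a → map (a ∷_) (parBounded a n)) (∈-upTo⁺ (s≤s (z (s≤s z≤n))))
      (∈-map⁺ (f (h 0) ∷_) (go (f (h 0)) n (λ r → h (suc r)) f (λ l → m 0 (s≤s l)) (λ r l → m (suc r) (s≤s l))))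

  par-length : ∀ b n {μ} → μ ∈ parBounded b n → length μ ≡ n
  par-length b zero    (here refl) = refl
  par-length b (suc n) m with ∈-concatMap-elim (λ a → map (a ∷_) (parBounded a n)) (upTo (suc b)) m
  ... | a , _ , q with ∈-map⁻ (a ∷_) q
  ... | μ , r , refl = cong suc (par-length a n r)

  HL-HLw : ∀ {μ} → μ ∈ Par k L → ∀ η n → HL μ η n ≡ HLw L (λ r → + at μ r) η n
  HL-HLw {μ} m η n = trans (HL-weight μ η n) (cong (λ l → HLw l (λ r → + at μ r) η n) (par-length k L m))

  Φ-cong : ∀ m {f g : ℕ → ℕ} → (∀ r → r < m → f r ≡ g r) → Φ m f ≡ Φ m g
  Φ-cong zero    h = refl
  Φ-cong (suc m) h = cong₂ _+_ (Φ-cong m (λ r l → h r (m<n⇒m<1+n l))) (cong (m *_) (h m ≤-refl))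

  Φ-+ : ∀ m (f : ℕ → ℕ) lo → Φ m f + Φ m (λ _ → lo) ≡ Φ m (λ r → f r + lo)
  Φ-+ m f lo = trans (sym (Σℕ-+ m (λ r → r * f r) (λ r → r * lo))) (Σℕ-cong m (λ r → sym (*-distribˡ-+ r (f r) lo)))

  -- Induction on Φ. At an ascent g x < g (x + 1) the weight is replaced by weights with units moved
  -- from row x + 1 to row x, whose new entries do not exceed g (x + 1), so the bound k persists. A
  -- weight without ascents is a partition, or its last entry is negative and the series is 0.
  straighten : ∀ N lo g → Φ L g ≤ N → (∀ r → r < L → g r ≤ k + lo) → Span (Target lo (Φ L g)) HL (HLw L (offset lo g))
  straighten N lo g fl bd = decide (search (λ x → descent? x) ℓ)
    where
    descent? : ∀ x → Dec (x < ℓ × g x < g (suc x))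
    descent? x with x <? ℓ | g x <? g (suc x)
    ... | yes p | yes q = yes (p , q)
    ... | no p  | _     = no (λ r → p (proj₁ r))
    ... | _     | no q  = no (λ r → q (proj₂ r))
    sorted : (∀ x → x < ℓ → ¬ (x < ℓ × g x < g (suc x))) → Span (Target lo (Φ L g)) HL (HLw L (offset lo g))
    sorted h with g ℓ <? lo
    ... | yes p = ext (λ η n → sym (HLw-lastNeg (offset lo g) (negative p) η n)) zero′
      where
      negative : g ℓ < lo → isNeg (offset lo g ℓ)
      negative p with m≤n⇒∃[o]m+o≡n p
      ... | o , e = o , trans (cong (λ z → + g ℓ ℤ.- + z) (trans (sym e) (sym (+-suc (g ℓ) o)))) (trans (cong (λ z → + g ℓ ℤ.- z) (ℤP.pos-+ (g ℓ) (suc o))) (lem (+ g ℓ) (+ suc o)))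
        where
        lem = ring39
    ... | no p = ext same (gen (μ∈ , Φ≤))
      where
      down-to : ∀ r → r < L → g ℓ ≤ g r
      down-to r l with m≤n⇒∃[o]m+o≡n (≤-pred l)
      ... | o , e = go o r e
        where
        go : ∀ o r → r + o ≡ ℓ → g ℓ ≤ g r
        go zero    r e = ≤-reflexive (cong g (trans (sym e) (+-identityʳ r)))
        go (suc o) r e = ≤-trans (go o (suc r) (trans (sym (+-suc r o)) e)) (≮⇒≥ (λ q → h r r<ℓ (r<ℓ , q)))
          where
          r<ℓ : r < ℓ
          r<ℓ = lin≤ (r ∷ o ∷ ℓ ∷ []) 1 (# 1 ⊹ $ 0) ($ 2) ($ 0 ⊹ (# 1 ⊹ $ 1) ≐ $ 2 ∋ e ∷ [])
      lo≤ : ∀ r → r < L → lo ≤ g r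
      lo≤ r l = ≤-trans (≮⇒≥ p) (down-to r l)
      f : ℕ → ℕ
      f r = g r ∸ lo
      μ : List ℕ
      μ = map f (upTo L)
      at-μ : ∀ r → r < L → at μ r ≡ f r
      at-μ r l = at-applyUpTo f (λ r → r) L r l
      μ∈ : μ ∈ Par k L
      μ∈ = par-∈ k L f (λ _ → m≤n+o⇒m∸n≤o _ lo (≤-trans (bd 0 (s≤s z≤n)) (≤-reflexive (+-comm k lo)))) (λ r l → ∸-monoˡ-≤ lo (≮⇒≥ (λ q → h r (≤-pred l) (≤-pred l , q))))
      Φ≤ : Φ L (at μ) + Φ L (λ _ → lo) ≤ Φ L g
      Φ≤ = ≤-reflexive (trans (Φ-+ L (at μ) lo) (Φ-cong L (λ r l → trans (cong (_+ lo) (at-μ r l)) (m∸n+n≡m (lo≤ r l)))))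
      same : ∀ η n → HL μ η n ≡ HLw L (offset lo g) η n
      same η n = trans (HL-HLw μ∈ η n) (HLw-cong (λ r l → trans (cong +_ (at-μ r l)) (sub (g r) (lo≤ r l))) η n)
        where
        sub : ∀ a → lo ≤ a → + (a ∸ lo) ≡ + a ℤ.- + lo
        sub a l = trans (lem (+ (a ∸ lo)) (+ lo)) (cong (ℤ._- + lo) (trans (sym (ℤP.pos-+ (a ∸ lo) lo)) (cong +_ (m∸n+n≡m l))))
          where
          lem = ring40
    moved′ : ∀ N x u → Φ L g ≤ N → suc x < L → 1 ≤ u → g x + u ≤ g (suc x) → Span (Target lo (Φ L g)) HL (HLw L (offset lo (transfer x (suc x) u g)))
    moved′ zero x u fl xl u1 le = ⊥-elim (n≮0 (≤-trans (Φ-transfer-< L x (suc x) u g ≤-refl xl u1 (≤-trans (m≤n+m u (g x)) le)) fl))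
    moved′ (suc N) x u fl xl u1 le = span-weaken (λ (a , b) → a , ≤-trans b (<⇒≤ small)) (straighten N lo (transfer x (suc x) u g) (≤-pred (≤-trans small fl)) bounds)
      where
      small : Φ L (transfer x (suc x) u g) < Φ L g
      small = Φ-transfer-< L x (suc x) u g ≤-refl xl u1 (≤-trans (m≤n+m u (g x)) le)
      bounds : ∀ r → r < L → transfer x (suc x) u g r ≤ k + lo
      bounds r l with cmp x r
      ... | is-x refl  = ≤-trans (≤-reflexive (transfer-i {x} {suc x} {u} g)) (≤-trans le (bd (suc x) xl))
      ... | is-sx refl = ≤-trans (≤-reflexive (transfer-j {x} {suc x} {u} g ≤-refl)) (≤-trans (m∸n≤m _ u) (bd (suc x) xl))
      ... | other p q  = ≤-trans (≤-reflexive (transfer-else {x} {suc x} {u} g p q)) (bd r l)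
    decide : (∃[ x ] x < ℓ × g x < g (suc x)) ⊎ (∀ x → x < ℓ → ¬ (x < ℓ × g x < g (suc x))) → Span (Target lo (Φ L g)) HL (HLw L (offset lo g))
    decide (inj₂ h) = sorted h
    decide (inj₁ (x , xℓ , lt)) with m≤n⇒∃[o]m+o≡n lt
    ... | zero , e = ext (equal-step (offset lo g) step₁) (times (ext (λ η n → HLw-cong (λ r _ → sym (offset-transfer lo x (suc x) g ≤-refl g1 r)) η n) (moved′ N x 1 fl (s≤s xℓ) ≤-refl (≤-trans (≤-reflexive (+-comm (g x) 1)) lt))))
      where
      open Adjacent x (s≤s xℓ)
      g1 : 1 ≤ g (suc x)
      g1 = ≤-trans (s≤s z≤n) lt
      step₁ : offset lo g (suc x) ≡ offset lo g x ℤ.+ + 1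
      step₁ = trans (cong (λ z → + z ℤ.- + lo) (trans (sym e) (trans (+-identityʳ _) (+-comm 1 (g x))))) (trans (cong (ℤ._- + lo) (ℤP.pos-+ (g x) 1)) (lem (+ g x) (+ lo)))
        where
        lem = ring41
    -- Here g (x + 1) = g x + u + 2, and the three weights of the relation have 1, u + 2 and u + 1
    -- units moved up.
    ... | suc u , e = ext (general-step (offset lo g))
      (add (times (ext (λ η n → HLw-cong (λ r _ → sym (offset-transfer lo x (suc x) g ≤-refl g1 r)) η n) (moved′ N x 1 fl (s≤s xℓ) ≤-refl (≤-trans (≤-reflexive (+-comm (g x) 1)) lt))))
        (add (times (ext (λ η n → HLw-cong (λ r _ → sym (trans (shift-cong (root x (suc x)) (dot-offset lo x g (suc u) e′) r) (both r))) η n) (moved′ N x (suc (suc u)) fl (s≤s xℓ) (s≤s z≤n) (≤-reflexive (sym e′)))))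
          (neg (ext (λ η n → HLw-cong (λ r _ → sym (dot-offset lo x g (suc u) e′ r)) η n) (moved′ N x (suc u) fl (s≤s xℓ) (s≤s z≤n) (lin≤ (g (suc x) ∷ g x ∷ u ∷ []) 1 ($ 1 ⊹ (# 1 ⊹ $ 2)) ($ 0) ($ 1 ⊹ (# 1 ⊹ (# 1 ⊹ $ 2)) ≐ $ 0 ∋ sym e′ ∷ [])))))))
      where
      open Adjacent x (s≤s xℓ)
      g1 : 1 ≤ g (suc x)
      g1 = ≤-trans (s≤s z≤n) lt
      e′ : g (suc x) ≡ g x + suc (suc u)
      e′ = ≤-antisym (lin≤ (g x ∷ u ∷ g (suc x) ∷ []) 1 ($ 2) ($ 0 ⊹ (# 1 ⊹ (# 1 ⊹ $ 1))) ($ 2 ≐ # 1 ⊹ ($ 0 ⊹ (# 1 ⊹ $ 1)) ∋ sym e ∷ [])) (lin≤ (g x ∷ u ∷ g (suc x) ∷ []) 1 ($ 0 ⊹ (# 1 ⊹ (# 1 ⊹ $ 1))) ($ 2) (# 1 ⊹ ($ 0 ⊹ (# 1 ⊹ $ 1)) ≐ $ 2 ∋ e ∷ []))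
      mid : ℕ → ℕ
      mid = transfer x (suc x) (suc u) g
      mid1 : 1 ≤ mid (suc x)
      mid1 = ≤-trans (m<n⇒0<n∸m {suc u} {g (suc x)} (lin≤ (g (suc x) ∷ g x ∷ u ∷ []) 1 (# 1 ⊹ (# 1 ⊹ $ 2)) ($ 0) ($ 1 ⊹ (# 1 ⊹ (# 1 ⊹ $ 2)) ≐ $ 0 ∋ sym e′ ∷ []))) (≤-reflexive (sym (transfer-j {x} {suc x} {suc u} g ≤-refl)))
      twice : ∀ r → transfer x (suc x) 1 mid r ≡ transfer x (suc x) (suc (suc u)) g r
      twice r with cmp x r
      ... | is-x refl  = trans (transfer-i {x} {suc x} {1} mid) (trans (cong (_+ 1) (transfer-i {x} {suc x} {suc u} g)) (trans (lem (g x) u) (sym (transfer-i {x} {suc x} {suc (suc u)} g))))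
        where
        lem = ring42
      ... | is-sx refl = trans (transfer-j {x} {suc x} {1} mid ≤-refl) (trans (cong (_∸ 1) (transfer-j {x} {suc x} {suc u} g ≤-refl)) (trans (∸-+-assoc (g (suc x)) (suc u) 1) (trans (cong (g (suc x) ∸_) (+-comm (suc u) 1)) (sym (transfer-j {x} {suc x} {suc (suc u)} g ≤-refl)))))
      ... | other p q  = trans (transfer-else {x} {suc x} {1} mid p q) (trans (transfer-else {x} {suc x} {suc u} g p q) (sym (transfer-else {x} {suc x} {suc (suc u)} g p q)))
      both : ∀ r → shift (root x (suc x)) (offset lo mid) r ≡ offset lo (transfer x (suc x) (suc (suc u)) g) r
      both r = trans (offset-transfer lo x (suc x) mid ≤-refl mid1 r) (cong (λ z → + z ℤ.- + lo) (twice r))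

-- Catalan functions are unitriangular over Hall-Littlewood series.

module Triangular (k ℓ : ℕ) where
  private L = suc ℓ
  open Straighten k ℓ

  Ψ-perm : ∀ d j → j < d j → d j < L → Ψ L d ↭ root j (d j) ∷ Ψ L (raiseAt j d)
  Ψ-perm d j l u = subst (λ m → lows m L ++ Ψ L d ↭ root j (d j) ∷ (lows m L ++ Ψ L (raiseAt j d))) (n∸n≡0 L) (Catalan.raise-perm L 0 [] L d j l u)

  Ψ-same : ∀ {d d'} → (∀ i j → i < j → j < L → d i ≤ j → d' i ≤ j) → (∀ i j → i < j → j < L → d' i ≤ j → d i ≤ j) → Ψ L d ↭ Ψ L d'
  Ψ-same {d} {d'} f g = set-↭ (Ψ-unique L d) (Ψ-unique L d') (tr f) (tr g)
    where
    tr : ∀ {d d'} → (∀ i j → i < j → j < L → d i ≤ j → d' i ≤ j) → ∀ {x} → x ∈ Ψ L d → x ∈ Ψ L d'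
    tr {d} {d'} f p with ∈-Ψ⁻ L d p
    ... | inΨ {i} {j} l u r = ∈-Ψ⁺ L d' l u (f i j l u r)

  E : (ℕ → ℕ) → Weight → Ser
  E d γ η n = K-at L η (Ψ L d) γ 0 n

  -- Removing a root multiplies the series by 1 - t R, with R the raising operator of that root.
  E-raise : ∀ d j → j < d j → d j < L → ∀ γ η n → E (raiseAt j d) γ η n ≡ E d γ η n ℤ.+ ℤ.- tmul (E d (shift (root j (d j)) γ)) η n
  E-raise d j l u γ η zero    = trans (sym (KAt.K-perm L η (Ψ-perm d j l u) γ 0 0)) (sym (ℤP.+-identityʳ _))
  E-raise d j l u γ η (suc n) = trans (lem (E (raiseAt j d) γ η (suc n)) (E d (shift (root j (d j)) γ) η n))
    (cong (ℤ._- E d (shift (root j (d j)) γ) η n)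
      (trans (cong (λ s → E (raiseAt j d) γ η (suc n) ℤ.+ s) (KAt.K-perm L η (Ψ-perm d j l u) _ 0 n)) (sym (KAt.K-perm L η (Ψ-perm d j l u) γ 0 (suc n)))))
    where
    lem = ring43

  Strict : ℕ → ℕ → List ℕ → Set
  Strict lo b μ = μ ∈ Par k L × Φ L (at μ) + Φ L (λ _ → lo) < b

  Expands : ℕ → (ℕ → ℕ) → (ℕ → ℕ) → Set
  Expands lo d g = Σ Ser λ R → Span (Strict lo (Φ L g)) HL R × (∀ η n → E d (offset lo g) η n ≡ HLw L (offset lo g) η n ℤ.+ R η n)

  -- Missing roots are added one at a time, each producing a correction with a unit moved up. The
  -- bound on `g i + d i` leaves row i one unit of room below k for every root it still lacks; the
  -- lower bound by the sum of d keeps entries natural, although each step may lower one of them.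
  expand : ∀ fuel lo d g → Σℕ L d ≤ fuel → (∀ i → i < L → i < d i × d i ≤ L) →
    (∀ i → i < L → g i + d i ≤ k + lo + suc i) → (∀ i → i < L → Σℕ L d ≤ g i) → Expands lo d g
  expand fuel lo d g fl dl gu gl = decide fuel fl (search (λ i → short? i) L)
    where
    short? : ∀ i → Dec (i < L × suc i < d i)
    short? i with i <? L | suc i <? d i
    ... | yes p | yes q = yes (p , q)
    ... | no p  | _     = no (λ r → p (proj₁ r))
    ... | _     | no q  = no (λ r → q (proj₂ r))
    decide : ∀ fuel → Σℕ L d ≤ fuel → (∃[ i ] i < L × suc i < d i) ⊎ (∀ i → i < L → ¬ (i < L × suc i < d i)) → Expands lo d g
    decide fuel fl (inj₂ h) = _ , zero′ , λ η n → trans (KAt.K-perm L η toFull (offset lo g) 0 n) (sym (ℤP.+-identityʳ _))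
      where
      toFull : Ψ L d ↭ full
      toFull = set-↭ (Ψ-unique L d) full-unique to from
        where
        to : ∀ {f} → f ∈ Ψ L d → f ∈ full
        to p with ∈-Ψ⁻ L d p
        ... | inΨ l u _ = full-∈⁺ l u
        from : ∀ {f} → f ∈ full → f ∈ Ψ L d
        from p with full-∈⁻ p
        ... | i , j , refl , l , u = ∈-Ψ⁺ L d l u (≤-trans (≮⇒≥ (λ q → h i (<-trans l u) (<-trans l u , q))) l)
    decide zero fl (inj₁ (i , iL , si)) = ⊥-elim (1+n≢0 (trans (Σℕ-lower L i d iL (≤-trans (s≤s z≤n) si)) (n≤0⇒n≡0 fl)))
    decide (suc fuel) fl (inj₁ (i , iL , si)) = R , add s₁ (neg (times (add s₃ (span-weaken (λ (a , b) → a , <-trans b lower) s₂)))) , result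
      where
      d' = lowerAt i d
      j  = d' i
      1≤di : 1 ≤ d i
      1≤di = ≤-trans (s≤s z≤n) si
      sj : suc j ≡ d i
      sj = trans (cong suc (lowerAt-same i d)) (suc-pred′ 1≤di)
        where
        suc-pred′ : ∀ {a} → 1 ≤ a → suc (pred a) ≡ a
        suc-pred′ (s≤s _) = refl
      Σd' : suc (Σℕ L d') ≡ Σℕ L d
      Σd' = Σℕ-lower L i d iL 1≤di
      fl' : Σℕ L d' ≤ fuel
      fl' = ≤-pred (≤-trans (≤-reflexive Σd') fl)
      dl' : ∀ r → r < L → r < d' r × d' r ≤ L
      dl' r l with r ≟ i
      ... | yes refl = ≤-pred (≤-trans si (≤-reflexive (sym sj))) , ≤-trans (n≤1+n _) (≤-trans (≤-reflexive sj) (proj₂ (dl r l)))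
      ... | no ne = subst (λ z → r < z × z ≤ L) (sym (lowerAt-diff d ne)) (dl r l)
      d'≤ : ∀ r → d' r ≤ d r
      d'≤ r with r ≟ i
      ... | yes refl = ≤-trans (n≤1+n _) (≤-reflexive sj)
      ... | no ne    = ≤-reflexive (lowerAt-diff d ne)
      g' = transfer i j 1 g
      ij : i < j
      ij = ≤-pred (≤-trans si (≤-reflexive (sym sj)))
      gu₁ : ∀ r → r < L → g r + d' r ≤ k + lo + suc r
      gu₁ r l = ≤-trans (+-monoʳ-≤ (g r) (d'≤ r)) (gu r l)
      gl₁ : ∀ r → r < L → Σℕ L d' ≤ g r
      gl₁ r l = ≤-trans (≤-trans (n≤1+n _) (≤-reflexive Σd')) (gl r l)
      gu₂ : ∀ r → r < L → g' r + d' r ≤ k + lo + suc r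
      gu₂ r l with r ≟ i | r ≟ j
      ... | yes refl | _ = ≤-trans (≤-reflexive (trans (cong (_+ d' r) (transfer-i {r} {j} {1} g)) (trans (+-assoc (g r) 1 (d' r)) (cong (λ z → g r + z) sj)))) (gu r l)
      ... | no ne | yes e = ≤-trans (+-monoˡ-≤ (d' r) (≤-trans (≤-reflexive (trans (cong g' e) (transfer-j {i} {j} {1} g ij))) (≤-trans (m∸n≤m _ 1) (≤-reflexive (cong g (sym e)))))) (gu₁ r l)
      ... | no ne | no ne' = ≤-trans (≤-reflexive (cong (_+ d' r) (transfer-else {i} {j} {1} g ne ne'))) (gu₁ r l)
      gl₂ : ∀ r → r < L → Σℕ L d' ≤ g' r
      gl₂ r l with r ≟ i | r ≟ j
      ... | yes refl | _ = ≤-trans (gl₁ r l) (≤-trans (m≤m+n (g r) 1) (≤-reflexive (sym (transfer-i {r} {j} {1} g))))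
      ... | no ne | yes e = ≤-trans (∸-monoˡ-≤ 1 (≤-trans (≤-reflexive Σd') (gl r l))) (≤-reflexive (trans (cong (λ z → g z ∸ 1) e) (trans (sym (transfer-j {i} {j} {1} g ij)) (cong g' (sym e)))))
      ... | no ne | no ne' = ≤-trans (gl₁ r l) (≤-reflexive (sym (transfer-else {i} {j} {1} g ne ne')))
      rec₁ : Expands lo d' g
      rec₁ = expand fuel lo d' g fl' dl' gu₁ gl₁
      rec₂ : Expands lo d' g'
      rec₂ = expand fuel lo d' g' fl' dl' gu₂ gl₂
      R₁ R₂ R : Ser
      R₁ = proj₁ rec₁
      R₂ = proj₁ rec₂
      R η n = R₁ η n ℤ.+ ℤ.- tmul (λ η n → HLw L (offset lo g') η n ℤ.+ R₂ η n) η n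
      s₁ = proj₁ (proj₂ rec₁)
      s₂ = proj₁ (proj₂ rec₂)
      e₁ = proj₂ (proj₂ rec₁)
      e₂ = proj₂ (proj₂ rec₂)
      jL : j < L
      jL = ≤-trans (≤-reflexive sj) (proj₂ (dl i iL))
      g1 : 1 ≤ g j
      g1 = ≤-trans (≤-trans (s≤s z≤n) (≤-reflexive (Σℕ-lower L i d iL 1≤di))) (gl j jL)
      lower : Φ L g' < Φ L g
      lower = Φ-transfer-< L i j 1 g ij jL ≤-refl g1
      bound : ∀ r → r < L → g' r ≤ k + lo
      bound r l with r ≟ i | r ≟ j
      ... | yes refl | _ = ≤-trans (≤-reflexive (transfer-i {r} {j} {1} g)) (room (g r) (gu r l) si)
        where
        room : ∀ a → a + d r ≤ k + lo + suc r → suc r < d r → a + 1 ≤ k + lo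
        room a p q = lin≤ (a ∷ d r ∷ k ∷ lo ∷ r ∷ []) 1 ($ 0 ⊹ # 1) ($ 2 ⊹ $ 3) ($ 0 ⊹ $ 1 ⊴ $ 2 ⊹ $ 3 ⊹ (# 1 ⊹ $ 4) ∋ p ∷ # 1 ⊹ (# 1 ⊹ $ 4) ⊴ $ 1 ∋ q ∷ [])
      ... | no ne | yes e = ≤-trans (≤-reflexive (trans (cong g' e) (transfer-j {i} {j} {1} g ij))) (≤-trans (m∸n≤m _ 1) (≤-trans (≤-reflexive (cong g (sym e))) (room (g r) (gu r l) (proj₁ (dl r l)))))
        where
        room : ∀ a → a + d r ≤ k + lo + suc r → r < d r → a ≤ k + lo
        room a p q = lin≤ (a ∷ d r ∷ k ∷ lo ∷ r ∷ []) 1 ($ 0) ($ 2 ⊹ $ 3) ($ 0 ⊹ $ 1 ⊴ $ 2 ⊹ $ 3 ⊹ (# 1 ⊹ $ 4) ∋ p ∷ # 1 ⊹ $ 4 ⊴ $ 1 ∋ q ∷ [])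
      ... | no ne | no ne' = ≤-trans (≤-reflexive (transfer-else {i} {j} {1} g ne ne')) (room (g r) (gu r l) (proj₁ (dl r l)))
        where
        room : ∀ a → a + d r ≤ k + lo + suc r → r < d r → a ≤ k + lo
        room a p q = lin≤ (a ∷ d r ∷ k ∷ lo ∷ r ∷ []) 1 ($ 0) ($ 2 ⊹ $ 3) ($ 0 ⊹ $ 1 ⊴ $ 2 ⊹ $ 3 ⊹ (# 1 ⊹ $ 4) ∋ p ∷ # 1 ⊹ $ 4 ⊴ $ 1 ∋ q ∷ [])
      s₃ : Span (Strict lo (Φ L g)) HL (HLw L (offset lo g'))
      s₃ = span-weaken (λ (a , b) → a , ≤-trans (s≤s b) lower) (straighten (Φ L g') lo g' ≤-refl bound)
      same : ∀ r → raiseAt i d' r ≡ d r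
      same r with r ≟ i
      ... | yes refl = trans (raiseAt-same r d') sj
      ... | no ne    = trans (raiseAt-diff d' ne) (lowerAt-diff d ne)
      result : ∀ η n → E d (offset lo g) η n ≡ HLw L (offset lo g) η n ℤ.+ R η n
      result η n = trans (KAt.K-perm L η (Ψ-same (λ a b _ _ q → ≤-trans (≤-reflexive (same a)) q) (λ a b _ _ q → ≤-trans (≤-reflexive (sym (same a))) q)) (offset lo g) 0 n)
        (trans (E-raise d' i ij jL (offset lo g) η n)
          (trans (cong₂ ℤ._+_ (e₁ η n) (cong ℤ.-_ (tail n))) (ℤP.+-assoc (HLw L (offset lo g) η n) (R₁ η n) _)))
        where
        tail : ∀ n → tmul (E d' (shift (root i j) (offset lo g))) η n ≡ tmul (λ η n → HLw L (offset lo g') η n ℤ.+ R₂ η n) η n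
        tail zero    = refl
        tail (suc n) = trans (KAt.K-cong L η (Ψ L d') (offset-transfer lo i j g ij g1) 0 n) (e₂ η n)

-- Independence of Schur functions.

-- Schur functions are separated by the last variable: its degree in s_μ is μ₁.
module Leading′ (ℓ : ℕ) (η : List ℕ) where
  private L = suc ℓ
  open KAt L η

  delete : ℕ → (ℕ → ℕ) → ℕ → ℕ
  delete z g r = if r <ᵇ z then g r else g (suc r)

  +W : (ℕ → ℕ) → Weight
  +W g r = + g r

  decr-at : ℕ → (ℕ → ℕ) → ℕ → ℕ
  decr-at z g r = if r ≡ᵇ z then pred (g r) else g r

  shift-low : ∀ z g {a} → g z ≡ suc a → shift (low z) (+W g) ≗ +W (decr-at z g)
  shift-low z g {a} e r with r ≟ z
  ... | yes refl rewrite δ-same r | ≡ᵇ-refl r | e = refl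
  ... | no ne rewrite δ-diff {z} {r} ne | ≡ᵇ-≢ ne = ℤP.+-identityʳ (+ g r)

  delete-decr : ∀ z g r → delete z (decr-at z g) r ≡ delete z g r
  delete-decr z g r with r <? z
  ... | yes p rewrite <ᵇ-true p | ≡ᵇ-≢ {r} {z} (<⇒≢ p) = refl
  ... | no p rewrite <ᵇ-false {r} {z} (≮⇒≥ p) | ≡ᵇ-≢ {suc r} {z} (λ e → p (≤-reflexive e)) = refl

  decr-val : ∀ z g {a} → g z ≡ suc a → decr-at z g z ≡ a
  decr-val z g e rewrite ≡ᵇ-refl z | e = refl

  decr-off : ∀ z g r → r ≢ z → decr-at z g r ≡ g r
  decr-off z g r ne rewrite ≡ᵇ-≢ ne = refl

  -- The last variable removes a horizontal strip from rows z, z + 1, .... The largest strip has g z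
  -- boxes and moves every lower row up by one place, which amounts to deleting row z; the predicate
  -- is meant for a = g z.
  TopDegree : ℕ → ℕ → (ℕ → ℕ) → ℕ → Set
  TopDegree m z g a = (∀ e → a < e → K (lows (suc m) z) (+W g) e 0 ≡ + 0) × (K (lows (suc m) z) (+W g) a 0 ≡ Schur L (+W (delete z g)) η)

  lastRow : ∀ a g → g ℓ ≡ a → g L ≡ 0 → TopDegree 0 ℓ g a
  lastRow zero g e gL = high , Schur-cong L η (λ r l → cong +_ (drop-last r l))
    where
    below0 : isNeg (shift (low ℓ) (+W g) ℓ)
    below0 rewrite δ-same ℓ | e = 0 , refl
    stable : ∀ f → f ∈ lows 1 ℓ → ∀ γ → isNeg (γ ℓ) → isNeg (shift f γ ℓ)
    stable f (here refl) γ (a , q) rewrite q | δ-same ℓ = suc (a + 0) , refl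
    high : ∀ e → 0 < e → K (lows 1 ℓ) (+W g) e 0 ≡ + 0
    high (suc e) _ = trans (ℤP.+-identityˡ _) (K-zero (λ γ → isNeg (γ ℓ)) (λ γ h → Schur-lastNeg ℓ γ h η) (lows 1 ℓ) stable _ below0 e 0)
    drop-last : ∀ r → r < L → g r ≡ delete ℓ g r
    drop-last r l with r <? ℓ
    ... | yes p rewrite <ᵇ-true p = refl
    ... | no p rewrite <ᵇ-false {r} {ℓ} (≮⇒≥ p) = trans (trans (cong g (≤-antisym (≤-pred l) (≮⇒≥ p))) e) (sym (trans (cong (λ z → g (suc z)) (≤-antisym (≤-pred l) (≮⇒≥ p))) gL))
  lastRow (suc a) g e gL = high , trans (ℤP.+-identityˡ _) (trans (K-cong (lows 1 ℓ) (shift-low ℓ g e) a 0) (trans (proj₂ rec) (Schur-cong L η (λ r _ → cong +_ (delete-decr ℓ g r)))))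
    where
    rec : TopDegree 0 ℓ (decr-at ℓ g) a
    rec = lastRow a (decr-at ℓ g) (decr-val ℓ g e) (trans (decr-off ℓ g L 1+n≢n) gL)
    high : ∀ e′ → suc a < e′ → K (lows 1 ℓ) (+W g) e′ 0 ≡ + 0
    high (suc e′) (s≤s l) = trans (ℤP.+-identityˡ _) (trans (K-cong (lows 1 ℓ) (shift-low ℓ g e) e′ 0) (proj₁ rec e′ l))

  -- Rows z and z + 1 of equal length: lowering row z once more gives 0 by the mirror symmetry.
  equalRows : ∀ m z g a → z + suc (suc m) ≡ L → g z ≡ a → g (suc z) ≡ a → TopDegree m (suc z) g a → TopDegree (suc m) z g a
  equalRows m z g a eq e e′ (hi , tp) = (λ c l → trans (skip-z c) (hi c l)) , trans (skip-z a) (trans tp (Schur-cong L η (λ r _ → cong +_ (merge r))))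
    where
    xl : suc z < L
    xl = lin≤ (z ∷ m ∷ ℓ ∷ []) 1 (# 1 ⊹ (# 1 ⊹ $ 0)) (# 1 ⊹ $ 2) ($ 0 ⊹ (# 1 ⊹ (# 1 ⊹ $ 1)) ≐ # 1 ⊹ $ 2 ∋ eq ∷ [])
    open Mirror z (Schur-anti L z xl η)
    flat : shift (low z) (+W g) (suc z) ≡ shift (low z) (+W g) z ℤ.+ + 1
    flat rewrite δ-same z | δ-diff {z} {suc z} 1+n≢n | e | e′ = lem (+ a)
      where
      lem = ring44
    lowered : ∀ c → K (lows (suc (suc m)) z) (shift (low z) (+W g)) c 0 ≡ + 0
    lowered c = K-vanish (swap-↭ z (lows-unique (suc (suc m)) z) (lows-swap z (suc (suc m)) z (inj₂ (≤-refl , (lin≤ (z ∷ m ∷ ℓ ∷ []) 1 (# 1 ⊹ (# 1 ⊹ $ 0)) ($ 0 ⊹ (# 1 ⊹ (# 1 ⊹ $ 1))) []))))) (shift (low z) (+W g)) flat c 0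
    skip-z : ∀ c → K (lows (suc (suc m)) z) (+W g) c 0 ≡ K (lows (suc m) (suc z)) (+W g) c 0
    skip-z zero    = refl
    skip-z (suc c) = trans (cong (λ s → K (lows (suc m) (suc z)) (+W g) (suc c) 0 ℤ.+ s) (lowered c)) (ℤP.+-identityʳ _)
    merge : ∀ r → delete (suc z) g r ≡ delete z g r
    merge r with <-cmp r z
    ... | tri< l _ _ rewrite <ᵇ-true l | <ᵇ-true {r} {suc z} (m<n⇒m<1+n l) = refl
    ... | tri≈ _ refl _ rewrite <ᵇ-true {r} {suc r} ≤-refl | <ᵇ-false {r} {r} ≤-refl = trans e (sym e′)
    ... | tri> _ _ l rewrite <ᵇ-false {r} {z} (<⇒≤ l) | <ᵇ-false {r} {suc z} l = refl

  -- As row z + 1 is shorter than row z, the terms that leave row z alone have degree at most b < a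
  -- + 1, and the top degree comes from lowering row z.
  longerRow : ∀ m z g a b → g z ≡ suc a → b < suc a → TopDegree m (suc z) g b → TopDegree (suc m) z (decr-at z g) a → TopDegree (suc m) z g (suc a)
  longerRow m z g a b e lt (hi , _) (hi′ , tp′) = high ,
    trans (cong₂ ℤ._+_ (hi (suc a) lt) (trans (K-cong (lows (suc (suc m)) z) (shift-low z g e) a 0) tp′))
      (trans (ℤP.+-identityˡ _) (Schur-cong L η (λ r _ → cong +_ (delete-decr z g r))))
    where
    high : ∀ c → suc a < c → K (lows (suc (suc m)) z) (+W g) c 0 ≡ + 0
    high (suc c) (s≤s l) = cong₂ ℤ._+_ (hi (suc c) (≤-trans lt (≤-trans l (n≤1+n c)))) (trans (K-cong (lows (suc (suc m)) z) (shift-low z g e) c 0) (hi′ c l))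

  decr-gL : ∀ m z g → z + suc m ≡ L → g L ≡ 0 → decr-at z g L ≡ 0
  decr-gL m z g eq gL = trans (decr-off z g L (λ q → m+1+n≢m z (trans eq q))) gL

  decr-dec : ∀ z g {a} → g z ≡ suc a → g (suc z) < suc a → (∀ r → z ≤ r → g (suc r) ≤ g r) → ∀ r → z ≤ r → decr-at z g (suc r) ≤ decr-at z g r
  decr-dec z g e lt dec r l with r ≟ z
  ... | yes refl = ≤-trans (≤-reflexive (decr-off r g (suc r) 1+n≢n)) (≤-trans (≤-pred lt) (≤-reflexive (sym (decr-val r g e))))
  ... | no ne = ≤-trans (≤-reflexive (decr-off z g (suc r) (λ q → <-irrefl refl (≤-trans (s≤s l) (≤-reflexive q))))) (≤-trans (dec r l) (≤-reflexive (sym (decr-off z g r ne))))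

  rowStep : ∀ m a z g → z + suc (suc m) ≡ L → g z ≡ suc a → g (suc z) ≤ suc a → TopDegree m (suc z) g (g (suc z)) →
    (g (suc z) < suc a → TopDegree (suc m) z (decr-at z g) a) → TopDegree (suc m) z g (suc a)
  rowStep m a z g eq e le next shorter with g (suc z) ≟ suc a
  ... | yes e′ = equalRows m z g (suc a) eq e e′ (subst (TopDegree m (suc z) g) e′ next)
  ... | no ne  = longerRow m z g a (g (suc z)) e (≤∧≢⇒< le ne) next (shorter (≤∧≢⇒< le ne))

  -- Induction on the number of rows and, within a row, on its length: equal neighbours are merged,
  -- otherwise row z is shortened by one.
  top-degree : ∀ m a z g → z + suc m ≡ L → g z ≡ a → g L ≡ 0 → (∀ r → z ≤ r → g (suc r) ≤ g r) → TopDegree m z g a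
  top-degree zero a z g eq e gL dec = subst (λ z → g z ≡ a → TopDegree 0 z g a) (suc-injective (trans (sym eq) (+-comm z 1))) (λ e → lastRow a g e gL) e
  top-degree (suc m) zero z g eq e gL dec = equalRows m z g 0 eq e e′
    (subst (TopDegree m (suc z) g) e′ (top-degree m (g (suc z)) (suc z) g (trans (sym (+-suc z (suc m))) eq) refl gL (λ r l → dec r (<⇒≤ l))))
    where
    e′ : g (suc z) ≡ 0
    e′ = n≤0⇒n≡0 (≤-trans (dec z ≤-refl) (≤-reflexive e))
  top-degree (suc m) (suc a) z g eq e gL dec = rowStep m a z g eq e (≤-trans (dec z ≤-refl) (≤-reflexive e))
    (top-degree m (g (suc z)) (suc z) g (trans (sym (+-suc z (suc m))) eq) refl gL (λ r l → dec r (<⇒≤ l)))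
    (λ lt → top-degree (suc m) a z (decr-at z g) eq (decr-val z g e) (decr-gL (suc m) z g eq gL) (decr-dec z g e lt dec))

schur : ℕ → List ℕ → List ℕ → ℤ
schur ℓ μ η = Schur (suc ℓ) (λ r → + at μ r) η

module _ (ℓ : ℕ) where
  private L = suc ℓ

  schur-top : ∀ a μ η → length μ ≤ ℓ → Decr (at (a ∷ μ)) → (∀ e → a < e → schur ℓ (a ∷ μ) (η ++ e ∷ []) ≡ + 0) × (schur ℓ (a ∷ μ) (η ++ a ∷ []) ≡ schur ℓ μ η)
  schur-top a μ η l dec = (λ e q → trans (Schur-snoc L η e (λ r → + at (a ∷ μ) r)) (proj₁ deg e q)) , trans (Schur-snoc L η a (λ r → + at (a ∷ μ) r)) (proj₂ deg)
    where
    deg = Leading′.top-degree ℓ η ℓ a 0 (at (a ∷ μ)) refl refl (at-length (a ∷ μ) L (s≤s l)) (λ r _ → dec r)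

  par-decr : ∀ b n {μ} → μ ∈ parBounded b n → Decr (at μ) × at μ 0 ≤ b
  par-decr b zero    (here refl) = (λ _ → z≤n) , z≤n
  par-decr b (suc n) m with ∈-concatMap-elim (λ a → map (a ∷_) (parBounded a n)) (upTo (suc b)) m
  ... | a , p , q with ∈-map⁻ (a ∷_) q
  ... | μ , r , refl with par-decr a n r
  ... | dec , z = (λ { zero → z ; (suc i) → dec i }) , ≤-pred (∈-upTo⁻ p)

  par-len : ∀ b n {μ} → μ ∈ parBounded b n → length μ ≡ n
  par-len b zero    (here refl) = refl
  par-len b (suc n) m with ∈-concatMap-elim (λ a → map (a ∷_) (parBounded a n)) (upTo (suc b)) m
  ... | a , _ , q with ∈-map⁻ (a ∷_) q
  ... | μ , r , refl = cong suc (par-len a n r)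

  -- Taking the coefficient of the b-th power of an additional variable annihilates the partitions
  -- with first part below b and strips the first part from the others. Induction on the number of
  -- rows then disposes of first part b, and the bound decreases.
  schur-independent : ∀ n b → n ≤ L → (c : List ℕ → ℤ) → (∀ η → sumℤ (map (λ μ → c μ ℤ.* schur ℓ μ η) (parBounded b n)) ≡ + 0) →
    ∀ μ → μ ∈ parBounded b n → c μ ≡ + 0
  schur-independent zero b nl c h .[] (here refl) =
    trans (sym (ℤP.*-identityʳ (c []))) (trans (cong (c [] ℤ.*_) (sym (Schur-zero L (λ r → + 0) (λ r _ → refl)))) (trans (sym (ℤP.+-identityʳ _)) (h [])))
  schur-independent (suc n) b nl c h μ m = byBound (suc b) (λ η → trans (sym (trans (sumℤ-concatMap (λ μ → c μ ℤ.* schur ℓ μ η) (λ a → map (a ∷_) (parBounded a n)) (upTo (suc b)))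
      (trans (sumℤ-upTo (suc b) _) (Σ<-cong (suc b) (λ a _ → cong sumℤ (sym (map-∘ (parBounded a n)))))))) (h η)) μ (split m)
    where
    row : ℕ → List ℕ → ℤ
    row a η = sumℤ (map (λ ν → c (a ∷ ν) ℤ.* schur ℓ (a ∷ ν) η) (parBounded a n))
    split : μ ∈ parBounded b (suc n) → ∃[ a ] ∃[ ν ] a < suc b × ν ∈ parBounded a n × μ ≡ a ∷ ν
    split m with ∈-concatMap-elim (λ a → map (a ∷_) (parBounded a n)) (upTo (suc b)) m
    ... | a , p , q with ∈-map⁻ (a ∷_) q
    ... | ν , r , e = a , ν , ∈-upTo⁻ p , r , e
    tops-of : ∀ a {ν} → ν ∈ parBounded a n → ∀ η → (∀ e → a < e → schur ℓ (a ∷ ν) (η ++ e ∷ []) ≡ + 0) × (schur ℓ (a ∷ ν) (η ++ a ∷ []) ≡ schur ℓ ν η)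
    tops-of a {ν} q η = schur-top a ν η (≤-trans (≤-reflexive (par-len a n q)) (≤-pred nl)) (λ { zero → proj₂ (par-decr a n q) ; (suc i) → proj₁ (par-decr a n q) i })
    zeros : ∀ {A : Set} (f : A → ℤ) xs → (∀ {x} → x ∈ xs → f x ≡ + 0) → sumℤ (map f xs) ≡ + 0
    zeros f []       h = refl
    zeros f (x ∷ xs) h = cong₂ ℤ._+_ (h (here refl)) (zeros f xs (λ m → h (there m)))
    topCoefficients : ∀ b → (∀ η → Σ< (suc b) (λ a → row a η) ≡ + 0) → ∀ ν → ν ∈ parBounded b n → c (b ∷ ν) ≡ + 0
    topCoefficients b h = schur-independent n b (<⇒≤ nl) (λ ν → c (b ∷ ν)) λ η → begin
      sumℤ (map (λ ν → c (b ∷ ν) ℤ.* schur ℓ ν η) (parBounded b n))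
        ≡⟨ sumℤ-cong-∈ (parBounded b n) (λ {ν} q → cong (c (b ∷ ν) ℤ.*_) (sym (proj₂ (tops-of b q η)))) ⟩
      row b (η ++ b ∷ [])
        ≡⟨ ℤP.+-identityˡ _ ⟨
      + 0 ℤ.+ row b (η ++ b ∷ [])
        ≡⟨ cong (ℤ._+ row b (η ++ b ∷ [])) (Σ<-zero b (λ a l → zeros _ (parBounded a n) (λ {ν} q →
             trans (cong (c (a ∷ ν) ℤ.*_) (proj₁ (tops-of a q η) b l)) (ℤP.*-zeroʳ (c (a ∷ ν)))))) ⟨
      Σ< (suc b) (λ a → row a (η ++ b ∷ []))
        ≡⟨ h (η ++ b ∷ []) ⟩
      + 0 ∎
      where open ≡-Reasoning
    byBound : ∀ b → (∀ η → Σ< b (λ a → row a η) ≡ + 0) → ∀ μ → (∃[ a ] ∃[ ν ] a < b × ν ∈ parBounded a n × μ ≡ a ∷ ν) → c μ ≡ + 0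
    byBound (suc b) h μ (a , ν , l , q , e) with a ≟ b
    ... | yes refl = trans (cong c e) (topCoefficients b h ν q)
    ... | no ne = byBound b lowerRows μ (a , ν , ≤∧≢⇒< (≤-pred l) ne , q , e)
      where
      vanish : ∀ η → row b η ≡ + 0
      vanish η = zeros _ (parBounded b n) (λ {ν} q → trans (cong (ℤ._* schur ℓ (b ∷ ν) η) (topCoefficients b h ν q)) (ℤP.*-zeroˡ (schur ℓ (b ∷ ν) η)))
      lowerRows : ∀ η → Σ< b (λ a → row a η) ≡ + 0
      lowerRows η = trans (sym (trans (cong (λ s → Σ< b (λ a → row a η) ℤ.+ s) (vanish η)) (ℤP.+-identityʳ _))) (h η)

-- Both families span the same space.

eqPad-at : ∀ xs ys → T (eqPad xs ys) → ∀ r → at xs r ≡ at ys r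
eqPad-at []       []       t r       = refl
eqPad-at []       (y ∷ ys) t zero    = sym (≡ᵇ⇒≡ y 0 (proj₁ (∧-T {y ≡ᵇ 0} t)))
eqPad-at []       (y ∷ ys) t (suc r) = eqPad-at [] ys (proj₂ (∧-T {y ≡ᵇ 0} t)) r
eqPad-at (x ∷ xs) []       t zero    = ≡ᵇ⇒≡ x 0 (proj₁ (∧-T {x ≡ᵇ 0} t))
eqPad-at (x ∷ xs) []       t (suc r) = eqPad-at xs [] (proj₂ (∧-T {x ≡ᵇ 0} t)) r
eqPad-at (x ∷ xs) (y ∷ ys) t zero    = ≡ᵇ⇒≡ x y (proj₁ (∧-T {x ≡ᵇ y} t))
eqPad-at (x ∷ xs) (y ∷ ys) t (suc r) = eqPad-at xs ys (proj₂ (∧-T {x ≡ᵇ y} t)) r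

all-zero : ∀ (p : Poly) → (∀ i → atℤ p i ≡ + 0) → ZeroPoly p
all-zero []      h = []
all-zero (a ∷ p) h = h 0 ∷ all-zero p (λ i → h (suc i))

module Basis (ℓ k : ℕ) (core : List ℕ → List ℕ) (isCoreOf : ∀ μ → μ ∈ Par k (suc ℓ) → IsCoreOf k (core μ) μ) where
  private L = suc ℓ
  open Straighten k ℓ
  open Triangular k ℓ
  open Tableaux k ℓ

  S : List ℕ → Ser
  S μ = kSchur k μ (core μ)

  par-unique : ∀ b n → Unique (parBounded b n)
  par-unique b zero    = [] ∷ []
  par-unique b (suc n) = unique-concatMap (λ a → map (a ∷_) (parBounded a n)) (UniqueP.upTo⁺ (suc b)) (λ a → UniqueP.map⁺ (λ { refl → refl }) (par-unique a n)) same
    where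
    same : ∀ {x y μ} → μ ∈ map (x ∷_) (parBounded x n) → μ ∈ map (y ∷_) (parBounded y n) → x ≡ y
    same {x} {y} p q with ∈-map⁻ (x ∷_) p | ∈-map⁻ (y ∷_) q
    ... | _ , _ , refl | _ , _ , refl = refl

  module Element {μ : List ℕ} (m : μ ∈ Par k L) where
    κ = core μ

    private
      facts : T (isPartition κ) × T (isCore k κ) × T (eqPad (𝔭 k κ) μ)
      facts with ∧-T {isPartition κ} (isCoreOf μ m)
      ... | p , q = p , ∧-T {isCore k κ} q

    pt : T (isPartition κ)
    pt = proj₁ facts

    has-d : ∃[ d ] IsCore (suc k) (at κ) d
    has-d = core-d k {κ} (partition-decr {κ} pt) (proj₁ (proj₂ facts))

    d : ℕ → ℕ
    d = proj₁ has-d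

    C : IsCore (suc k) (at κ) d
    C = proj₂ has-d

    𝔭≡μ : ∀ r → at (𝔭 k κ) r ≡ at μ r
    𝔭≡μ = eqPad-at (𝔭 k κ) μ (proj₂ (proj₂ facts))

    at-μ-d : ∀ r → at μ r + d r ≡ suc k + r
    at-μ-d r = trans (cong (_+ d r) (sym (𝔭≡μ r))) (FromCore.at-𝔭 k {κ} C r)

    -- μ has L entries, so the part of index L of the bounded partition is 0, and `part-zero` shows
    -- that κ has no row of that index.
    rows : length κ ≤ L
    rows with length κ ≤? L
    ... | yes p = p
    ... | no p  = ⊥-elim (n≮0 (≤-trans (partition-pos {κ} pt L (≰⇒> p)) (≤-reflexive (part-zero C (length κ) (at-length κ _ ≤-refl) (length κ) L (m≤n+m _ L) dL))))
      where
      dL : d L ≡ suc k + L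
      dL = trans (sym (cong (_+ d L) (at-length μ L (≤-reflexive (par-length k L m))))) (at-μ-d L)

    size : sum (𝔭 k κ) ≡ sum μ
    size = trans (sum-at (𝔭 k κ) L (≤-trans (≤-reflexive (FromCore.length-𝔭 k {κ} C)) rows))
      (trans (Σℕ-cong L 𝔭≡μ) (sym (sum-at μ L (≤-reflexive (par-length k L m)))))

    weight : ∀ r → weightOf (suc k) d r ≡ + at μ r
    weight r = trans (cong (λ z → + z ℤ.- + d r) (sym (at-μ-d r))) (trans (cong (ℤ._- + d r) (ℤP.pos-+ (at μ r) (d r))) (lem (+ at μ r) (+ d r)))
      where
      lem = ring45

    catalan : ∀ η n → S μ η n ≡ E d (λ r → + at μ r) η n
    catalan η n = trans (agrees (reverseView η) (record { partition = pt ; isCore′ = C ; rows = rows ; size = size }) n)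
      (KAt.K-cong L η (Ψ L d) weight 0 n)

    -- There are no columns from L on, so cutting d off at L leaves the root ideal unchanged and
    -- meets the bound required by `expand`.
    d̂ : ℕ → ℕ
    d̂ r = d r ⊓ L

    -- The sum of d̂ bounds the number of roots that `expand` can add, hence how often an entry can
    -- be lowered.
    lo : ℕ
    lo = Σℕ L d̂

    g : ℕ → ℕ
    g r = at μ r + lo

    expanded : Expands lo d̂ g
    expanded = expand (Σℕ L d̂) lo d̂ g ≤-refl (λ i l → ⊓-glb (IsCore.d-> C i) l , m⊓n≤n (d i) L)
      (λ i l → ≤-trans (+-monoʳ-≤ (g i) (m⊓n≤m (d i) L)) (≤-reflexive (rearrange (at μ i) (d i) lo i (at-μ-d i)))) (λ i l → m≤n+m lo (at μ i))
      where
      rearrange : ∀ a b c i → a + b ≡ suc k + i → a + c + b ≡ k + c + suc i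
      rearrange a b c i e = ≤-antisym (lin≤ (a ∷ b ∷ k ∷ i ∷ c ∷ []) 1 ($ 0 ⊹ $ 4 ⊹ $ 1) ($ 2 ⊹ $ 4 ⊹ (# 1 ⊹ $ 3)) ($ 0 ⊹ $ 1 ≐ # 1 ⊹ $ 2 ⊹ $ 3 ∋ e ∷ [])) (lin≤ (a ∷ b ∷ k ∷ i ∷ c ∷ []) 1 ($ 2 ⊹ $ 4 ⊹ (# 1 ⊹ $ 3)) ($ 0 ⊹ $ 4 ⊹ $ 1) (# 1 ⊹ $ 2 ⊹ $ 3 ≐ $ 0 ⊹ $ 1 ∋ sym e ∷ []))

    R : Ser
    R = proj₁ expanded

    Smaller : List ℕ → Set
    Smaller λ′ = λ′ ∈ Par k L × Φ L (at λ′) < Φ L (at μ)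

    R-span : Span Smaller HL R
    R-span = span-weaken (λ (a , b) → a , +-cancelʳ-< (Φ L (λ _ → lo)) _ _ (≤-trans b (≤-reflexive (sym (Φ-+ L (at μ) lo))))) (proj₁ (proj₂ expanded))

    offset-μ : ∀ r → + at μ r ≡ offset lo g r
    offset-μ r = trans (lem (+ at μ r) (+ lo)) (cong (ℤ._- + lo) (sym (ℤP.pos-+ (at μ r) lo)))
      where
      lem = ring46

    unitriangular : ∀ η n → S μ η n ≡ HL μ η n ℤ.+ R η n
    unitriangular η n = trans (catalan η n)
      (trans (KAt.K-perm L η (Ψ-same (λ i j _ _ q → ≤-trans (m⊓n≤m (d i) L) q) (λ i j _ u q → clamp (d i) q u)) (λ r → + at μ r) 0 n)
        (trans (KAt.K-cong L η (Ψ L d̂) offset-μ 0 n)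
          (trans (proj₂ (proj₂ expanded) η n) (cong (ℤ._+ R η n) (trans (HLw-cong (λ r _ → sym (offset-μ r)) η n) (sym (HL-HLw m η n)))))))
      where
      clamp : ∀ a {j} → a ⊓ L ≤ j → j < L → a ≤ j
      clamp a {j} q u with ≤-total a L
      ... | inj₁ p = ≤-trans (≤-reflexive (sym (m≤n⇒m⊓n≡m p))) q
      ... | inj₂ p = ⊥-elim (<⇒≱ u (≤-trans (≤-reflexive (sym (m≥n⇒m⊓n≡n p))) q))

    leading : ∀ η → S μ η 0 ≡ schur ℓ μ η
    leading η = trans (catalan η 0) (no-t (Ψ-roots L d) (λ r → + at μ r))
      where
      no-t : ∀ {fs} → Roots L fs → ∀ γ → K-at L η fs γ 0 0 ≡ Schur L γ η
      no-t []       γ = refl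
      no-t (r ∷ rs) γ = no-t rs γ

  S-in-HL : ∀ {μ} → μ ∈ Par k L → Span (_∈ Par k L) HL (S μ)
  S-in-HL m = ext (λ η n → sym (Element.unitriangular m η n)) (add (gen m) (span-weaken proj₁ (Element.R-span m)))

  -- The unitriangular relation is solved for the Hall-Littlewood series of ν; the correction
  -- involves only partitions of smaller Φ, to which the induction applies.
  HL-in-S : ∀ N {ν} → ν ∈ Par k L → Φ L (at ν) ≤ N → Span (_∈ Par k L) S (HL ν)
  HL-in-S N {ν} m fl = ext isolate (add (gen m) (neg (span-bind (Element.R-span m) (λ (a , b) → smaller N a b fl))))
    where
    lem = ring47
    isolate : ∀ η n → S ν η n ℤ.- Element.R m η n ≡ HL ν η n
    isolate η n = trans (cong (ℤ._- Element.R m η n) (Element.unitriangular m η n)) (lem (HL ν η n) (Element.R m η n))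
    smaller : ∀ N {λ′} → λ′ ∈ Par k L → Φ L (at λ′) < Φ L (at ν) → Φ L (at ν) ≤ N → Span (_∈ Par k L) S (HL λ′)
    smaller zero    a b fl = ⊥-elim (n≮0 (≤-trans b fl))
    smaller (suc N) a b fl = HL-in-S N a (≤-pred (≤-trans b fl))

  -- At t = 0 the series S μ is the Schur function, so the coefficients of a relation vanish degree by degree in t.
  S-independent : LinIndep (Par k L) S
  S-independent c h μ m = all-zero (c μ) (λ i → coefficients (suc i) i ≤-refl m)
    where
    coefficients : ∀ N i → i < N → ∀ {μ} → μ ∈ Par k L → atℤ (c μ) i ≡ + 0
    coefficients (suc N) i l {μ} m with i ≟ N
    ... | no ne = coefficients N i (≤∧≢⇒< (≤-pred l) ne) m
    ... | yes refl = schur-independent ℓ L k ≤-refl (λ μ → atℤ (c μ) i) (λ η → trans (sumℤ-cong-∈ (Par k L) (λ {ν} q → sym (term q η))) (h η i)) μ m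
      where
      term : ∀ {ν} → ν ∈ Par k L → ∀ η → (c ν · S ν) η i ≡ atℤ (c ν) i ℤ.* schur ℓ ν η
      term {ν} q η = trans (·-Σ (c ν) (S ν) η i)
        (trans (cong₂ ℤ._+_ (Σ<-zero i (λ j jl → trans (cong (ℤ._* S ν η (i ∸ j)) (coefficients N j jl q)) (ℤP.*-zeroˡ (S ν η (i ∸ j)))))
                 (cong (atℤ (c ν) i ℤ.*_) (trans (cong (S ν η) (n∸n≡0 i)) (Element.leading q η))))
          (ℤP.+-identityˡ _))

  basis : IsBasisOfSpan (Par k L) S HL
  basis = (λ μ m → Coefficients.inSpan (Par k L) (par-unique k L) HL (S-in-HL m))
        , (λ ν m → Coefficients.inSpan (Par k L) (par-unique k L) S (HL-in-S (Φ L (at ν)) m ≤-refl))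
        , S-independent

theorem2p8 : (ℓ k : ℕ) → 1 ≤ ℓ → 1 ≤ k →
    (core : List ℕ → List ℕ) → (∀ μ → μ ∈ Par k ℓ → IsCoreOf k (core μ) μ) →
    IsBasisOfSpan (Par k ℓ) (λ μ → kSchur k μ (core μ)) HL
-- From here on ℓ is the index of the last of ℓ + 1 rows.
theorem2p8 (suc ℓ) k _ _ core h = Basis.basis ℓ k core h
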